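{- For an odd positive integer $n$, let $s_n$ denote the number of ordered pairs $(\pi_1,\pi_2)$ of bijections $\pi_1,\pi_2\colon\{1,\dots,n\}\to\mathbb{Z}/n\mathbb{Z}$ such that the pointwise sum $\pi_1+\pi_2\colon\{1,\dots,n\}\to\mathbb{Z}/n\mathbb{Z}$, $i\mapsto\pi_1(i)+\pi_2(i)$, is also a bijection. Then, as $n\to\infty$ through odd integers, \[ s_n=\bigl(e^{ -1/2}+o(1)\bigr)\frac{n!^3}{n^{n-1}}. \] -}

module Defs where

open import Data.Bool using (Bool; true; false; _∧_; _∨_; if_then_else_; not)
open import Data.Nat using (ℕ; zero; suc; _+_; _*_; _∸_; _^_; _%_; _<_; _!)
open import Data.Nat.DivMod using (m%n<n)
open import Data.Nat.Properties using (_!≢0; m*n≢0; m^n≢0)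
open import Data.Fin using (Fin; toℕ; fromℕ<)
open import Data.Fin.Properties using () renaming (_≟_ to _≟ᶠ_)
open import Data.List using (List; []; _∷_; [_]; map; concatMap; allFin)
open import Data.Bool.ListAction using (and; or)
open import Data.Nat.ListAction using (sum)
open import Data.Vec using (Vec; []; _∷_; lookup; zipWith)
open import Data.Integer using (ℤ; +_; -[1+_])
open import Data.Rational using (ℚ; _/_; _+_; 0ℚ)
open import Relation.Nullary.Decidable using (⌊_⌋)

_+ₙ_ : {n : ℕ} → Fin n → Fin n → Fin n
_+ₙ_ {suc m} i j = fromℕ< (m%n<n (toℕ i Data.Nat.+ toℕ j) (suc m))

-- A map {1,…,n} → ℤ/nℤ is represented by the vector of its values
-- (index k : Fin n stands for k+1 ∈ {1,…,n}).
Map : ℕ → Set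
Map n = Vec (Fin n) n

isInjectiveᵇ : {n : ℕ} → Map n → Bool
isInjectiveᵇ {n} f =
  and (map (λ i → and (map (λ j → not ⌊ lookup f i ≟ᶠ lookup f j ⌋ ∨ ⌊ i ≟ᶠ j ⌋)
                            (allFin n)))
           (allFin n))

isSurjectiveᵇ : {n : ℕ} → Map n → Bool
isSurjectiveᵇ {n} f =
  and (map (λ y → or (map (λ x → ⌊ lookup f x ≟ᶠ y ⌋) (allFin n))) (allFin n))

isBijectionᵇ : {n : ℕ} → Map n → Bool
isBijectionᵇ f = isInjectiveᵇ f ∧ isSurjectiveᵇ f

allVecs : (m n : ℕ) → List (Vec (Fin n) m)
allVecs zero    n = [ [] ]
allVecs (suc m) n = concatMap (λ x → map (x ∷_) (allVecs m n)) (allFin n)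

_⊕_ : {n : ℕ} → Map n → Map n → Map n
π₁ ⊕ π₂ = zipWith _+ₙ_ π₁ π₂

s : ℕ → ℕ
s n = sum (map (λ π₁ → sum (map (λ π₂ →
          if isBijectionᵇ π₁ ∧ isBijectionᵇ π₂ ∧ isBijectionᵇ (π₁ ⊕ π₂)
          then 1 else 0) (allVecs n n))) (allVecs n n))

ratio : ℕ → ℚ
ratio n = (+ (s n * n ^ (n ∸ 1))) / ((n !) ^ 3)
  where instance _ = m^n≢0 (n !) 3 {{n !≢0}}

-- k-th term of the exponential series for e^{-1/2}: (-1/2)^k / k!
expTerm : ℕ → ℚ
expTerm k = sign k / (2 ^ k * k !)
  where
    instance _ = m*n≢0 (2 ^ k) (k !) {{m^n≢0 2 k}} {{k !≢0}}
    sign : ℕ → ℤ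
    sign zero = + 1
    sign (suc zero) = -[1+ 0 ]
    sign (suc (suc j)) = sign j

-- Partial sums T m = Σ_{k=0}^{m} (-1/2)^k / k!, which converge to e^{-1/2}.
expPartial : ℕ → ℚ
expPartial zero    = expTerm 0
expPartial (suc m) = expPartial m Data.Rational.+ expTerm (suc m)

{-# OPTIONS --safe #-}

-- Let F(χ) = Σ ω^(χ·x), over the bijections x : {1,…,n} → ℤ/n, with ω a primitive n-th root of unity. Counting
-- solutions of x + x′ = x″ by characters gives ratio n = (n · n!³)⁻¹ Σ F(χ)³. The F(χ) are integers satisfying a
-- recursion, and in place of ω any n-periodic y with y(0) = 1 that sums to 0 over the cosets of nontrivial
-- subgroups serves, so everything takes place in ℚ.
--
-- For n odd, Σ x = 0, so F(χ) is unchanged when a constant is added to χ; this removes the factor n and makes the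
-- most frequent value of χ equal to 0. Let T m be the contribution of the χ with m nonzero entries.
-- For m ≤ n/100 the second moment Σ F², known exactly from a recursion, and a sup bound for F give geometric decay
-- of T m, while the recursion for the third moment gives T (m + 2) = − T m / (m + 2) + O(1/√n). As T 0 = 1 and
-- T 1 = 0, the T (2k) tend to (−1/2)^k / k! and the odd ones to 0.
--
-- For the other χ, with a_r the number of entries equal to r, consider the operators f ↦ Σ_r q_r f(· + t_i + r x_i)
-- on functions on ℤ/n. Their product over i has norm at most (Σ q_r²)^(n/2) on average over bijections x (an
-- inequality of Maclaurin type for the commuting operators L*L), and averaging over the phases t extracts F(χ), so
-- |F(χ)| ≤ (Σ q_r²)^(n/2) ∏ a_r! / q_r^(a_r). For q_r close to √a_r, the sum of the cubes over all χ is the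
-- coefficient of an exponential generating function and is exponentially small compared with n!³.

module Submission where

-- For few nonzero entries neither factor suffices alone: relative to the normalisation, the bounds
-- used are about √(m!) for the second moment and √(m!/2^m) for the sup of F, against m! in T m. The
-- factor 2^(-m/2) makes Σ T m converge uniformly in n; it comes from r ≠ -r, hence from the oddness
-- of n. With rates 1.3 and 0.6 instead of 1 and 1/2 the recursions close for m ≤ n/100.
--
-- For the other χ the weights q_r = √a_r give |F(χ)| ≤ n^(n/2) ∏ a_r!/a_r^(a_r/2), and the sum of
-- the cubes is at most n^(3n/2) n! times the coefficient of x^n in (Σ a!² x^a / a^(3a/2))^n. At x ≈
-- e²/√n this only gives back n!³, up to subexponential factors. Dropping the counts a > 99n/100,
-- which belong to the sparse part, keeps the series near 1 even at η e²/√n with a constant η > 1,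
-- and η^(-n) is the gain. Square roots and e are replaced by rational numbers whose losses stay
-- below η.

module Proof where

  open import Data.Bool using (Bool; true; false; _∧_; _∨_; not; if_then_else_)
  open import Data.Bool.ListAction using (and; or)
  open import Data.Empty using (⊥; ⊥-elim)
  open import Data.Fin using (Fin; zero; suc; toℕ; fromℕ<)
  import Data.Fin.Properties as FinP
  import Data.Integer as ℤ
  import Data.Integer.Properties as ℤP
  open import Data.List using (List; []; _∷_; map; concatMap; allFin; tabulate; _++_; length)
  open import Data.List.Membership.Propositional using (_∈_)
  open import Data.List.Membership.Propositional.Properties using (∈-allFin)
  import Data.List.Relation.Unary.All as All
  open import Data.List.Relation.Unary.Any using (here; there)
  open import Data.Nat as ℕ using (ℕ; zero; suc; z≤n; s≤s; _!)
  open import Data.Nat.Divisibility using (_∣_; _∣?_; divides)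
  import Data.Nat.Divisibility as ∣P
  open import Data.Nat.DivMod using (_%_; m%n<n)
  import Data.Nat.DivMod as DM
  open import Data.Nat.GCD using (module GCD; module Bézout)
  open import Data.Nat.ListAction using (product) renaming (sum to sumℕ)
  open import Data.Nat.Primality using (Prime; prime?; euclidsLemma; ¬prime[0]; ¬prime[1])
  open import Data.Nat.Primality.Factorisation using (factorise)
  import Data.Nat.Properties as ℕP
  open import Data.Nat.Solver using () renaming (module +-*-Solver to ℕSolver)
  open ℕSolver using () renaming (solve to solveℕ; con to conℕ; _:+_ to _∔_; _:*_ to _⨯_; _:=_ to _≐_)
  open import Data.Product using (_×_; _,_; proj₁; proj₂; ∃-syntax)
  open import Data.Rational using (ℚ; 0ℚ; 1ℚ; ½; _+_; _*_; _-_; -_; _≤_; _<_; ∣_∣; _/_; 1/_; NonNegative; nonNegative; positive)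
  import Data.Rational as ℚ
  import Data.Rational.Properties as ℚP
  open import Data.Rational.Solver using (module +-*-Solver)
  open +-*-Solver using (solve; _:=_; con; _:+_; _:*_; _:-_; :-_)
  import Data.Rational.Unnormalised as ℚᵘ
  import Data.Rational.Unnormalised.Properties as ℚᵘP
  open import Data.Sum as Sum using (_⊎_; inj₁; inj₂)
  open import Data.Unit using (⊤; tt)
  open import Data.Vec using (Vec; []; _∷_; lookup)
  import Data.Vec as Vec
  open import Defs using (_+ₙ_; Map; isInjectiveᵇ; isBijectionᵇ; allVecs; _⊕_; s; ratio; expTerm; expPartial)
  open import Function using (_∘_)
  open import Relation.Binary.PropositionalEquality using (_≡_; _≢_; refl; sym; trans; cong; cong₂; subst; subst₂; module ≡-Reasoning)
  open import Relation.Nullary using (¬_; yes; no; Dec)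
  open import Relation.Nullary.Decidable using (⌊_⌋)

  -- Sums and powers of rational numbers

  ≤-by : ∀ {a b d} → 0ℚ ≤ d → b ≡ a + d → a ≤ b
  ≤-by {a} {b} {d} p refl = subst (_≤ a + d) (ℚP.+-identityʳ a) (ℚP.+-monoʳ-≤ a p)

  *-mono : ∀ {a b c} → 0ℚ ≤ c → a ≤ b → c * a ≤ c * b
  *-mono {c = c} p q = ℚP.*-monoˡ-≤-nonNeg c {{nonNegative p}} q

  *-monoʳ : ∀ {a b c} → 0ℚ ≤ c → a ≤ b → a * c ≤ b * c
  *-monoʳ {c = c} p q = ℚP.*-monoʳ-≤-nonNeg c {{nonNegative p}} q

  0≤* : ∀ {a b} → 0ℚ ≤ a → 0ℚ ≤ b → 0ℚ ≤ a * b
  0≤* {a} {b} p q = subst (_≤ a * b) (ℚP.*-zeroʳ a) (*-mono p q)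

  0≤+ : ∀ {a b} → 0ℚ ≤ a → 0ℚ ≤ b → 0ℚ ≤ a + b
  0≤+ {a} {b} p q = subst (_≤ a + b) (ℚP.+-identityʳ 0ℚ) (ℚP.+-mono-≤ p q)

  *-mono₂ : ∀ {a b c d} → 0ℚ ≤ a → 0ℚ ≤ d → a ≤ b → c ≤ d → a * c ≤ b * d
  *-mono₂ pa pd p q = ℚP.≤-trans (*-mono pa q) (*-monoʳ pd p)

  ≤-diff : ∀ {a b} → a ≤ b → 0ℚ ≤ b - a
  ≤-diff {a} {b} p = subst (_≤ b - a) (ℚP.+-inverseʳ a) (ℚP.+-monoˡ-≤ (- a) p)

  diff-≤ : ∀ {a b} → 0ℚ ≤ b - a → a ≤ b
  diff-≤ {a} {b} p = ≤-by p (solve 2 (λ a b → b := a :+ (b :- a)) refl a b)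

  neg-≤ : ∀ {a} → a ≤ 0ℚ → 0ℚ ≤ - a
  neg-≤ p = ℚP.neg-antimono-≤ p

  sq≥0 : ∀ a → 0ℚ ≤ a * a
  sq≥0 a with ℚP.≤-total 0ℚ a
  ... | inj₁ p = 0≤* p p
  ... | inj₂ q = subst (0ℚ ≤_) (solve 1 (λ a → (:- a) :* (:- a) := a :* a) refl a) (0≤* (neg-≤ q) (neg-≤ q))

  0<* : ∀ {a b} → 0ℚ < a → 0ℚ < b → 0ℚ < a * b
  0<* {a} {b} p q = subst (_< a * b) (ℚP.*-zeroʳ a) (ℚP.*-monoʳ-<-pos a {{positive p}} q)

  0<+ : ∀ {a b} → 0ℚ < a → 0ℚ ≤ b → 0ℚ < a + b
  0<+ {a} {b} p q = subst (_< a + b) (ℚP.+-identityʳ 0ℚ) (ℚP.+-mono-<-≤ p q)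

  cancel-≤ : ∀ {a b c} → 0ℚ < c → c * a ≤ c * b → a ≤ b
  cancel-≤ {c = c} p q = ℚP.*-cancelˡ-≤-pos c {{positive p}} q

  cancel-≡ : ∀ {a b c} → 0ℚ < c → c * a ≡ c * b → a ≡ b
  cancel-≡ p q = ℚP.≤-antisym (cancel-≤ p (ℚP.≤-reflexive q)) (cancel-≤ p (ℚP.≤-reflexive (sym q)))

  ≤≢⇒< : ∀ {a b} → a ≤ b → a ≢ b → a < b
  ≤≢⇒< p ne = ℚP.≰⇒> λ q → ne (ℚP.≤-antisym p q)

  -- The value 0 at 0 makes the inverse total, so quotients can be written before their denominators
  -- are known to be positive.
  inv : ℚ → ℚ
  inv x with x ℚP.≟ 0ℚ
  ... | yes _ = 0ℚ
  ... | no p = (1/ x) {{ℚ.≢-nonZero p}}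

  inv-r : ∀ {x} → 0ℚ < x → x * inv x ≡ 1ℚ
  inv-r {x} p with x ℚP.≟ 0ℚ
  ... | yes e = ⊥-elim (ℚP.<-irrefl (sym e) p)
  ... | no q = ℚP.*-inverseʳ x {{ℚ.≢-nonZero q}}

  0<1 : 0ℚ < 1ℚ
  0<1 = ℚP.positive⁻¹ 1ℚ

  0≤1 : 0ℚ ≤ 1ℚ
  0≤1 = ℚP.<⇒≤ 0<1

  inv≥0 : ∀ {x} → 0ℚ < x → 0ℚ ≤ inv x
  inv≥0 {x} p with ℚP.≤-total 0ℚ (inv x)
  ... | inj₁ q = q
  ... | inj₂ q = ⊥-elim (ℚP.<-irrefl refl (ℚP.<-≤-trans 0<1
        (subst₂ _≤_ (inv-r p) (ℚP.*-zeroʳ x) (*-mono (ℚP.<⇒≤ p) q))))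

  inv>0 : ∀ {x} → 0ℚ < x → 0ℚ < inv x
  inv>0 {x} p = ≤≢⇒< (inv≥0 p) λ e → ℚP.<-irrefl (trans (sym (ℚP.*-zeroʳ x)) (trans (cong (x *_) e) (inv-r p))) 0<1

  sq-≤ : ∀ {a b} → 0ℚ ≤ b → a * a ≤ b * b → a ≤ b
  sq-≤ {a} {b} pb p with ℚP.≤-total a b
  ... | inj₁ q = q
  ... | inj₂ q with a ℚP.≟ b
  ...   | yes e = ℚP.≤-reflexive e
  ...   | no ne = ⊥-elim (ℚP.<-irrefl refl (ℚP.<-≤-trans lt p))
    where
    b<a : b < a
    b<a = ≤≢⇒< q (ne ∘ sym)
    lt : b * b < a * a
    lt = ℚP.≤-<-trans (*-mono pb q) (ℚP.*-monoˡ-<-pos a {{positive (ℚP.≤-<-trans pb b<a)}} b<a)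

  ∣∣≤ : ∀ {a b} → a ≤ b → - a ≤ b → ∣ a ∣ ≤ b
  ∣∣≤ {a} p q with ℚP.∣p∣≡p∨∣p∣≡-p a
  ... | inj₁ e = subst (_≤ _) (sym e) p
  ... | inj₂ e = subst (_≤ _) (sym e) q

  ∣∣-sq : ∀ a → ∣ a ∣ * ∣ a ∣ ≡ a * a
  ∣∣-sq a with ℚP.∣p∣≡p∨∣p∣≡-p a
  ... | inj₁ e = cong₂ _*_ e e
  ... | inj₂ e = trans (cong₂ _*_ e e) (solve 1 (λ a → (:- a) :* (:- a) := a :* a) refl a)

  ∣∣≤-sq : ∀ {a b} → 0ℚ ≤ b → a * a ≤ b * b → ∣ a ∣ ≤ b
  ∣∣≤-sq {a} pb p = sq-≤ pb (subst (_≤ _) (sym (∣∣-sq a)) p)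

  sq-∣∣≤ : ∀ {a b} → ∣ a ∣ ≤ b → a * a ≤ b * b
  sq-∣∣≤ {a} {b} p = subst (_≤ b * b) (∣∣-sq a) (*-mono₂ (ℚP.0≤∣p∣ a) (ℚP.≤-trans (ℚP.0≤∣p∣ a) p) p p)

  ∣∣-* : ∀ a b → ∣ a * b ∣ ≡ ∣ a ∣ * ∣ b ∣
  ∣∣-* = ℚP.∣p*q∣≡∣p∣*∣q∣

  ∣∣-*-nonNegˡ : ∀ {a} b → 0ℚ ≤ a → ∣ a * b ∣ ≡ a * ∣ b ∣
  ∣∣-*-nonNegˡ {a} b p = trans (∣∣-* a b) (cong (_* ∣ b ∣) (ℚP.0≤p⇒∣p∣≡p p))

  infixr 8 _^_
  _^_ : ℚ → ℕ → ℚ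
  x ^ zero = 1ℚ
  x ^ suc k = x * x ^ k

  ^-+ : ∀ x a b → x ^ (a ℕ.+ b) ≡ x ^ a * x ^ b
  ^-+ x zero b = sym (ℚP.*-identityˡ _)
  ^-+ x (suc a) b = trans (cong (x *_) (^-+ x a b)) (sym (ℚP.*-assoc x (x ^ a) (x ^ b)))

  ^-* : ∀ x y a → (x * y) ^ a ≡ x ^ a * y ^ a
  ^-* x y zero = refl
  ^-* x y (suc a) = trans (cong (x * y *_) (^-* x y a)) (solve 4 (λ x y s t → x :* y :* (s :* t) := (x :* s) :* (y :* t)) refl x y (x ^ a)
      (y ^ a))

  1^ : ∀ a → 1ℚ ^ a ≡ 1ℚ
  1^ zero = refl
  1^ (suc a) = trans (ℚP.*-identityˡ _) (1^ a)

  ^≥0 : ∀ {x} a → 0ℚ ≤ x → 0ℚ ≤ x ^ a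
  ^≥0 zero p = 0≤1
  ^≥0 (suc a) p = 0≤* p (^≥0 a p)

  ^>0 : ∀ {x} a → 0ℚ < x → 0ℚ < x ^ a
  ^>0 zero p = 0<1
  ^>0 (suc a) p = 0<* p (^>0 a p)

  ^-mono : ∀ {x y} a → 0ℚ ≤ x → x ≤ y → x ^ a ≤ y ^ a
  ^-mono zero p q = ℚP.≤-refl
  ^-mono (suc a) p q = *-mono₂ p (^≥0 a (ℚP.≤-trans p q)) q (^-mono a p q)

  ^≥1 : ∀ {x} a → 1ℚ ≤ x → 1ℚ ≤ x ^ a
  ^≥1 {x} a p = subst (_≤ x ^ a) (1^ a) (^-mono a 0≤1 p)

  ^≤1 : ∀ {x} a → 0ℚ ≤ x → x ≤ 1ℚ → x ^ a ≤ 1ℚ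
  ^≤1 {x} a p q = subst (x ^ a ≤_) (1^ a) (^-mono a p q)

  -- Unary, so that `ι (suc k)` unfolds to `1ℚ + ι k` and successors become polynomials in `ι k` for
  -- the ring solver.
  ι : ℕ → ℚ
  ι zero = 0ℚ
  ι (suc k) = 1ℚ + ι k

  ι-+ : ∀ a b → ι (a ℕ.+ b) ≡ ι a + ι b
  ι-+ zero b = sym (ℚP.+-identityˡ _)
  ι-+ (suc a) b = trans (cong (1ℚ +_) (ι-+ a b)) (sym (ℚP.+-assoc 1ℚ (ι a) (ι b)))

  ι-* : ∀ a b → ι (a ℕ.* b) ≡ ι a * ι b
  ι-* zero b = sym (ℚP.*-zeroˡ (ι b))
  ι-* (suc a) b = trans (ι-+ b (a ℕ.* b)) (trans (cong (ι b +_) (ι-* a b))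
      (solve 2 (λ a b → b :+ a :* b := (con 1ℚ :+ a) :* b) refl (ι a) (ι b)))

  ι-^ : ∀ a k → ι (a ℕ.^ k) ≡ ι a ^ k
  ι-^ a zero = ℚP.+-identityʳ 1ℚ
  ι-^ a (suc k) = trans (ι-* a (a ℕ.^ k)) (cong (ι a *_) (ι-^ a k))

  ι≥0 : ∀ k → 0ℚ ≤ ι k
  ι≥0 zero = ℚP.≤-refl
  ι≥0 (suc k) = 0≤+ 0≤1 (ι≥0 k)

  ι>0 : ∀ k → 0ℚ < ι (suc k)
  ι>0 k = 0<+ 0<1 (ι≥0 k)

  ι-mono : ∀ {a b} → a ℕ.≤ b → ι a ≤ ι b
  ι-mono {b = b} z≤n = ι≥0 b
  ι-mono (s≤s p) = ℚP.+-monoʳ-≤ 1ℚ (ι-mono p)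

  ι-< : ∀ {a b} → a ℕ.< b → ι a < ι b
  ι-< {zero} {suc b} (s≤s p) = ι>0 b
  ι-< {suc a} {suc b} (s≤s p) = ℚP.+-monoʳ-< 1ℚ (ι-< p)

  ι-cancel-≤ : ∀ {a b} → ι a ≤ ι b → a ℕ.≤ b
  ι-cancel-≤ {a} {b} p with a ℕP.≤? b
  ... | yes q = q
  ... | no q = ⊥-elim (ℚP.<-irrefl refl (ℚP.<-≤-trans (ι-< (ℕP.≰⇒> q)) p))

  ι-∸ : ∀ {a b} → b ℕ.≤ a → ι (a ℕ.∸ b) ≡ ι a - ι b
  ι-∸ {a} {b} p = trans (solve 2 (λ x y → x := (y :+ x) :- y) refl (ι (a ℕ.∸ b)) (ι b))
      (cong (_- ι b) (trans (sym (ι-+ b _)) (cong ι (ℕP.m+[n∸m]≡n p))))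

  ι≥1 : ∀ {k} → 1 ℕ.≤ k → 1ℚ ≤ ι k
  ι≥1 {k} p = subst (_≤ ι k) (ℚP.+-identityʳ 1ℚ) (ι-mono p)

  bernoulli : ∀ x k → 0ℚ ≤ x → 1ℚ + ι k * x ≤ (1ℚ + x) ^ k
  bernoulli x zero p = ℚP.≤-reflexive (solve 1 (λ x → con 1ℚ :+ con 0ℚ :* x := con 1ℚ) refl x)
  bernoulli x (suc k) p = ℚP.≤-trans (≤-by (0≤* (ι≥0 k) (sq≥0 x))
     (solve 2 (λ x k → (con 1ℚ :+ x) :* (con 1ℚ :+ k :* x) := (con 1ℚ :+ (con 1ℚ :+ k) :* x) :+ k :* (x :* x)) refl x (ι k)))
     (*-mono (0≤+ 0≤1 p) (bernoulli x k p))

  ∑ : {A : Set} → List A → (A → ℚ) → ℚ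
  ∑ [] f = 0ℚ
  ∑ (x ∷ xs) f = f x + ∑ xs f

  module _ {A : Set} where

    ∑-cong : (xs : List A) {f g : A → ℚ} → (∀ x → f x ≡ g x) → ∑ xs f ≡ ∑ xs g
    ∑-cong [] e = refl
    ∑-cong (x ∷ xs) e = cong₂ _+_ (e x) (∑-cong xs e)

    ∑-+ : (xs : List A) (f g : A → ℚ) → ∑ xs (λ x → f x + g x) ≡ ∑ xs f + ∑ xs g
    ∑-+ [] f g = refl
    ∑-+ (x ∷ xs) f g = trans (cong (f x + g x +_) (∑-+ xs f g))
      (solve 4 (λ a b c d → (a :+ b) :+ (c :+ d) := (a :+ c) :+ (b :+ d)) refl (f x) (g x) (∑ xs f) (∑ xs g))

    ∑-*ˡ : (xs : List A) (c : ℚ) (f : A → ℚ) → ∑ xs (λ x → c * f x) ≡ c * ∑ xs f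
    ∑-*ˡ [] c f = sym (ℚP.*-zeroʳ c)
    ∑-*ˡ (x ∷ xs) c f = trans (cong (c * f x +_) (∑-*ˡ xs c f)) (sym (ℚP.*-distribˡ-+ c (f x) (∑ xs f)))

    ∑-*ʳ : (xs : List A) (c : ℚ) (f : A → ℚ) → ∑ xs (λ x → f x * c) ≡ ∑ xs f * c
    ∑-*ʳ xs c f = trans (∑-cong xs λ x → ℚP.*-comm (f x) c) (trans (∑-*ˡ xs c f) (ℚP.*-comm c _))

    ∑-neg : (xs : List A) (f : A → ℚ) → ∑ xs (λ x → - f x) ≡ - ∑ xs f
    ∑-neg [] f = refl
    ∑-neg (x ∷ xs) f = trans (cong (- f x +_) (∑-neg xs f)) (sym (ℚP.neg-distrib-+ (f x) (∑ xs f)))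

    ∑-− : (xs : List A) (f g : A → ℚ) → ∑ xs (λ x → f x - g x) ≡ ∑ xs f - ∑ xs g
    ∑-− xs f g = trans (∑-+ xs f (λ x → - g x)) (cong (∑ xs f +_) (∑-neg xs g))

    ∑-0 : (xs : List A) → ∑ xs (λ _ → 0ℚ) ≡ 0ℚ
    ∑-0 [] = refl
    ∑-0 (x ∷ xs) = trans (ℚP.+-identityˡ _) (∑-0 xs)

    ∑-≡0 : (xs : List A) {f : A → ℚ} → (∀ x → f x ≡ 0ℚ) → ∑ xs f ≡ 0ℚ
    ∑-≡0 xs e = trans (∑-cong xs e) (∑-0 xs)

    ∑-const : (xs : List A) (c : ℚ) → ∑ xs (λ _ → c) ≡ ι (length xs) * c
    ∑-const [] c = sym (ℚP.*-zeroˡ c)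
    ∑-const (x ∷ xs) c = trans (cong (c +_) (∑-const xs c)) (solve 2 (λ c k → c :+ k :* c := (con 1ℚ :+ k) :* c) refl c (ι (length xs)))

    ∑-mono : (xs : List A) {f g : A → ℚ} → (∀ x → f x ≤ g x) → ∑ xs f ≤ ∑ xs g
    ∑-mono [] p = ℚP.≤-refl
    ∑-mono (x ∷ xs) p = ℚP.+-mono-≤ (p x) (∑-mono xs p)

    ∑≥0 : (xs : List A) {f : A → ℚ} → (∀ x → 0ℚ ≤ f x) → 0ℚ ≤ ∑ xs f
    ∑≥0 [] p = ℚP.≤-refl
    ∑≥0 (x ∷ xs) p = 0≤+ (p x) (∑≥0 xs p)

    ∑-abs : (xs : List A) (f : A → ℚ) → ∣ ∑ xs f ∣ ≤ ∑ xs (λ x → ∣ f x ∣)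
    ∑-abs [] f = ℚP.≤-refl
    ∑-abs (x ∷ xs) f = ℚP.≤-trans (ℚP.∣p+q∣≤∣p∣+∣q∣ (f x) (∑ xs f)) (ℚP.+-monoʳ-≤ ∣ f x ∣ (∑-abs xs f))

    ∑-++ : (xs ys : List A) (f : A → ℚ) → ∑ (xs ++ ys) f ≡ ∑ xs f + ∑ ys f
    ∑-++ [] ys f = sym (ℚP.+-identityˡ _)
    ∑-++ (x ∷ xs) ys f = trans (cong (f x +_) (∑-++ xs ys f)) (sym (ℚP.+-assoc (f x) _ _))

  ∑-map : {A B : Set} (xs : List A) (h : A → B) (f : B → ℚ) → ∑ (map h xs) f ≡ ∑ xs (f ∘ h)
  ∑-map [] h f = refl
  ∑-map (x ∷ xs) h f = cong (f (h x) +_) (∑-map xs h f)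

  ∑-concatMap : {A B : Set} (xs : List A) (h : A → List B) (f : B → ℚ) → ∑ (concatMap h xs) f ≡ ∑ xs (λ x → ∑ (h x) f)
  ∑-concatMap [] h f = refl
  ∑-concatMap (x ∷ xs) h f = trans (∑-++ (h x) _ f) (cong (∑ (h x) f +_) (∑-concatMap xs h f))

  ∑-swap : {A B : Set} (xs : List A) (ys : List B) (f : A → B → ℚ) →
    ∑ xs (λ x → ∑ ys (f x)) ≡ ∑ ys (λ y → ∑ xs (λ x → f x y))
  ∑-swap [] ys f = sym (∑-0 ys)
  ∑-swap (x ∷ xs) ys f = trans (cong (∑ ys (f x) +_) (∑-swap xs ys f)) (sym (∑-+ ys (f x) _))

  ∑-tabulate : {A : Set} {n : ℕ} (h : Fin n → A) (f : A → ℚ) → ∑ (tabulate h) f ≡ ∑ (allFin n) (f ∘ h)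
  ∑-tabulate {n = zero} h f = refl
  ∑-tabulate {n = suc n} h f = cong (f (h zero) +_) (trans (∑-tabulate (h ∘ suc) f) (sym (∑-tabulate {n = n} suc (f ∘ h))))

  -- Lagrange's identity: twice the difference of the sides is the double sum of w x · w y · (f x -
  -- f y)².
  ∑-cauchy : {A : Set} (xs : List A) (w f : A → ℚ) → (∀ x → 0ℚ ≤ w x) →
    ∑ xs (λ x → w x * f x) * ∑ xs (λ x → w x * f x) ≤ ∑ xs w * ∑ xs (λ x → w x * (f x * f x))
  ∑-cauchy xs w f w≥0 = diff-≤ (cancel-≤ {c = ℤ.+ 2 / 1} (ℚP.positive⁻¹ (ℤ.+ 2 / 1))
      (subst₂ _≤_ (sym (ℚP.*-zeroʳ (ℤ.+ 2 / 1))) eq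
      (∑≥0 xs λ x → ∑≥0 xs λ y → 0≤* (0≤* (w≥0 x) (w≥0 y)) (sq≥0 (f x - f y)))))
    where
    open ≡-Reasoning
    A B W : ℚ
    A = ∑ xs (λ x → w x * f x)
    B = ∑ xs (λ x → w x * (f x * f x))
    W = ∑ xs w
    inner : ∀ x → ∑ xs (λ y → w x * w y * ((f x - f y) * (f x - f y))) ≡ (w x * (f x * f x)) * W + (w x * f x) * (- (ℤ.+ 2 / 1) * A) + w x * B
    inner x = begin
      ∑ xs (λ y → w x * w y * ((f x - f y) * (f x - f y)))
        ≡⟨ ∑-cong xs (λ y → (solve 4 (λ a b p q → a :* b :* ((p :- q) :* (p :- q)) :=
            ((a :* (p :* p)) :* b :+ (a :* p :* (:- (con (ℤ.+ 2 / 1)))) :* (b :* q)) :+ a :* (b :* (q :* q))) refl (w x) (w y) (f x) (f y))) ⟩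
      ∑ xs (λ y → ((w x * (f x * f x)) * w y + (w x * f x * (- (ℤ.+ 2 / 1))) * (w y * f y)) + w x * (w y * (f y * f y)))
        ≡⟨ trans (∑-+ xs _ _) (cong₂ _+_ (∑-+ xs _ _) (∑-*ˡ xs (w x) _)) ⟩
      (∑ xs (λ y → (w x * (f x * f x)) * w y) + ∑ xs (λ y → (w x * f x * (- (ℤ.+ 2 / 1))) * (w y * f y))) + w x * B
        ≡⟨ cong (_+ w x * B) (cong₂ _+_ (∑-*ˡ xs (w x * (f x * f x)) w) (trans (∑-*ˡ xs (w x * f x * (- (ℤ.+ 2 / 1))) _)
            (ℚP.*-assoc (w x * f x) (- (ℤ.+ 2 / 1)) A))) ⟩
      (w x * (f x * f x)) * W + (w x * f x) * (- (ℤ.+ 2 / 1) * A) + w x * B ∎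
    eq : ∑ xs (λ x → ∑ xs (λ y → w x * w y * ((f x - f y) * (f x - f y)))) ≡ (ℤ.+ 2 / 1) * (W * B - A * A)
    eq = begin
      ∑ xs (λ x → ∑ xs (λ y → w x * w y * ((f x - f y) * (f x - f y)))) ≡⟨ ∑-cong xs inner ⟩
      ∑ xs (λ x → (w x * (f x * f x)) * W + (w x * f x) * (- (ℤ.+ 2 / 1) * A) + w x * B)
        ≡⟨ trans (∑-+ xs _ _) (cong₂ _+_ (trans (∑-+ xs _ _) (cong₂ _+_ (∑-*ʳ xs W _) (∑-*ʳ xs _ _))) (∑-*ʳ xs B w)) ⟩
      B * W + A * (- (ℤ.+ 2 / 1) * A) + W * B ≡⟨ (solve 3 (λ A B W → B :* W :+ A :* (:- (con (ℤ.+ 2 / 1)) :* A) :+ W :* B := (con (ℤ.+ 2 / 1))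
          :* (W :* B :- A :* A)) refl A B W) ⟩
      (ℤ.+ 2 / 1) * (W * B - A * A) ∎

  vecs : {A : Set} → List A → (m : ℕ) → List (Vec A m)
  vecs xs zero = [] ∷ []
  vecs xs (suc m) = concatMap (λ x → map (x ∷_) (vecs xs m)) xs

  ∑-vecs : {A : Set} (xs : List A) (m : ℕ) (f : Vec A (suc m) → ℚ) →
    ∑ (vecs xs (suc m)) f ≡ ∑ xs (λ x → ∑ (vecs xs m) (λ v → f (x ∷ v)))
  ∑-vecs xs m f = trans (∑-concatMap xs _ f) (∑-cong xs λ x → ∑-map (vecs xs m) (x ∷_) f)

  ∑< : ℕ → (ℕ → ℚ) → ℚ
  ∑< zero f = 0ℚ
  ∑< (suc n) f = ∑< n f + f n

  ∑<-cong : ∀ n {f g : ℕ → ℚ} → (∀ i → i ℕ.< n → f i ≡ g i) → ∑< n f ≡ ∑< n g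
  ∑<-cong zero e = refl
  ∑<-cong (suc n) e = cong₂ _+_ (∑<-cong n λ i l → e i (ℕP.m<n⇒m<1+n l)) (e n ℕP.≤-refl)

  ∑<-mono : ∀ n {f g : ℕ → ℚ} → (∀ i → i ℕ.< n → f i ≤ g i) → ∑< n f ≤ ∑< n g
  ∑<-mono zero e = ℚP.≤-refl
  ∑<-mono (suc n) e = ℚP.+-mono-≤ (∑<-mono n λ i l → e i (ℕP.m<n⇒m<1+n l)) (e n ℕP.≤-refl)

  ∑<≥0 : ∀ n {f : ℕ → ℚ} → (∀ i → 0ℚ ≤ f i) → 0ℚ ≤ ∑< n f
  ∑<≥0 zero e = ℚP.≤-refl
  ∑<≥0 (suc n) e = 0≤+ (∑<≥0 n e) (e n)

  ∑<-+ : ∀ n (f g : ℕ → ℚ) → ∑< n (λ i → f i + g i) ≡ ∑< n f + ∑< n g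
  ∑<-+ zero f g = refl
  ∑<-+ (suc n) f g = trans (cong (_+ (f n + g n)) (∑<-+ n f g))
    (solve 4 (λ a b c d → (a :+ b) :+ (c :+ d) := (a :+ c) :+ (b :+ d)) refl (∑< n f) (∑< n g) (f n) (g n))

  ∑<-*ˡ : ∀ n c (f : ℕ → ℚ) → ∑< n (λ i → c * f i) ≡ c * ∑< n f
  ∑<-*ˡ zero c f = sym (ℚP.*-zeroʳ c)
  ∑<-*ˡ (suc n) c f = trans (cong (_+ c * f n) (∑<-*ˡ n c f)) (sym (ℚP.*-distribˡ-+ c _ (f n)))

  ∑<-*ʳ : ∀ n c (f : ℕ → ℚ) → ∑< n (λ i → f i * c) ≡ ∑< n f * c
  ∑<-*ʳ n c f = trans (∑<-cong n λ i _ → ℚP.*-comm (f i) c) (trans (∑<-*ˡ n c f) (ℚP.*-comm c _))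

  ∑<-≡0 : ∀ n {f : ℕ → ℚ} → (∀ i → i ℕ.< n → f i ≡ 0ℚ) → ∑< n f ≡ 0ℚ
  ∑<-≡0 zero e = refl
  ∑<-≡0 (suc n) e = cong₂ _+_ (∑<-≡0 n λ i l → e i (ℕP.m<n⇒m<1+n l)) (e n ℕP.≤-refl)

  ∑<-abs : ∀ n (f : ℕ → ℚ) → ∣ ∑< n f ∣ ≤ ∑< n (λ i → ∣ f i ∣)
  ∑<-abs zero f = ℚP.≤-refl
  ∑<-abs (suc n) f = ℚP.≤-trans (ℚP.∣p+q∣≤∣p∣+∣q∣ (∑< n f) (f n)) (ℚP.+-monoˡ-≤ ∣ f n ∣ (∑<-abs n f))

  ∑<-left : ∀ n (f : ℕ → ℚ) → ∑< (suc n) f ≡ f 0 + ∑< n (f ∘ suc)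
  ∑<-left zero f = (solve 1 (λ x → con 0ℚ :+ x := x :+ con 0ℚ) refl (f 0))
  ∑<-left (suc n) f = trans (cong (_+ f (suc n)) (∑<-left n f)) (ℚP.+-assoc (f 0) _ _)

  ∑<-split : ∀ a b (f : ℕ → ℚ) → ∑< (a ℕ.+ b) f ≡ ∑< a f + ∑< b (λ i → f (a ℕ.+ i))
  ∑<-split zero b f = sym (ℚP.+-identityˡ _)
  ∑<-split (suc a) b f = trans (∑<-left (a ℕ.+ b) f) (trans (cong (f 0 +_) (∑<-split a b (f ∘ suc)))
     (trans (sym (ℚP.+-assoc (f 0) _ _)) (cong (_+ ∑< b (λ i → f (suc (a ℕ.+ i)))) (sym (∑<-left a f)))))

  ∑<-swap : {A : Set} (xs : List A) (n : ℕ) (f : A → ℕ → ℚ) → ∑ xs (λ x → ∑< n (f x)) ≡ ∑< n (λ i → ∑ xs (λ x → f x i))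
  ∑<-swap xs zero f = ∑-0 xs
  ∑<-swap xs (suc n) f = trans (∑-+ xs _ _) (cong (_+ ∑ xs (λ x → f x n)) (∑<-swap xs n f))

  opaque
    fins : ∀ n → List (Fin n)
    fins = allFin

    fins-allFin : ∀ n → fins n ≡ allFin n
    fins-allFin n = refl

  ∑-fins : ∀ n (f : Fin (suc n) → ℚ) → ∑ (fins (suc n)) f ≡ f zero + ∑ (fins n) (f ∘ suc)
  ∑-fins n f = trans (cong (λ l → ∑ l f) (fins-allFin (suc n)))
    (cong (f zero +_) (trans (∑-tabulate {n = n} suc f) (cong (λ l → ∑ l (f ∘ suc)) (sym (fins-allFin n)))))

  ∑-fins0 : (f : Fin 0 → ℚ) → ∑ (fins 0) f ≡ 0ℚ
  ∑-fins0 f = cong (λ l → ∑ l f) (fins-allFin 0)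

  ∑-fins-toℕ : ∀ n (f : ℕ → ℚ) → ∑ (fins n) (f ∘ toℕ) ≡ ∑< n f
  ∑-fins-toℕ zero f = ∑-fins0 (f ∘ toℕ)
  ∑-fins-toℕ (suc n) f = trans (∑-fins n (f ∘ toℕ)) (trans (cong (f 0 +_) (∑-fins-toℕ n (f ∘ suc))) (sym (∑<-left n f)))

  ∑<-const : ∀ n c → ∑< n (λ _ → c) ≡ ι n * c
  ∑<-const zero c = sym (ℚP.*-zeroˡ c)
  ∑<-const (suc n) c = trans (cong (_+ c) (∑<-const n c)) (solve 2 (λ k c → k :* c :+ c := (con 1ℚ :+ k) :* c) refl (ι n) c)

  ∑-fins-const : ∀ n c → ∑ (fins n) (λ _ → c) ≡ ι n * c
  ∑-fins-const n c = trans (∑-fins-toℕ n (λ _ → c)) (∑<-const n c)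

  -- Fourier coefficients

  δ : ∀ {n} → Fin n → Fin n → ℚ
  δ zero zero = 1ℚ
  δ zero (suc _) = 0ℚ
  δ (suc _) zero = 0ℚ
  δ (suc i) (suc j) = δ i j

  δ-refl : ∀ {n} (i : Fin n) → δ i i ≡ 1ℚ
  δ-refl zero = refl
  δ-refl (suc i) = δ-refl i

  δ-≢ : ∀ {n} {i j : Fin n} → i ≢ j → δ i j ≡ 0ℚ
  δ-≢ {i = zero} {zero} ne = ⊥-elim (ne refl)
  δ-≢ {i = zero} {suc j} ne = refl
  δ-≢ {i = suc i} {zero} ne = refl
  δ-≢ {i = suc i} {suc j} ne = δ-≢ {i = i} {j} (ne ∘ cong suc)

  δ-comm : ∀ {n} (i j : Fin n) → δ i j ≡ δ j i
  δ-comm zero zero = refl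
  δ-comm zero (suc j) = refl
  δ-comm (suc i) zero = refl
  δ-comm (suc i) (suc j) = δ-comm i j

  ∑-δ : ∀ {n} (a : Fin n) (f : Fin n → ℚ) → ∑ (fins n) (λ x → δ a x * f x) ≡ f a
  ∑-δ {suc n} zero f = trans (∑-fins n _) (trans (cong (1ℚ * f zero +_) (∑-≡0 (fins n) λ x → ℚP.*-zeroˡ (f (suc x))))
    (solve 1 (λ x → con 1ℚ :* x :+ con 0ℚ := x) refl (f zero)))
  ∑-δ {suc n} (suc a) f = trans (∑-fins n _) (trans (cong (0ℚ * f zero +_) (∑-δ a (f ∘ suc)))
    (solve 2 (λ x y → con 0ℚ :* x :+ y := y) refl (f zero) (f (suc a))))

  ∑-δ1 : ∀ {n} (a : Fin n) → ∑ (fins n) (δ a) ≡ 1ℚ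
  ∑-δ1 {n} a = trans (∑-cong (fins n) λ x → sym (ℚP.*-identityʳ (δ a x))) (∑-δ a (λ _ → 1ℚ))

  δ-bij : ∀ {n} (φ ψ : Fin n → Fin n) → (∀ x → ψ (φ x) ≡ x) → (∀ x → φ (ψ x) ≡ x) → ∀ x y → δ (φ x) y ≡ δ (ψ y) x
  δ-bij φ ψ ψφ φψ x y with φ x FinP.≟ y
  ... | yes refl = trans (δ-refl (φ x)) (sym (trans (cong (λ z → δ z x) (ψφ x)) (δ-refl x)))
  ... | no ne = trans (δ-≢ ne) (sym (δ-≢ λ e → ne (trans (cong φ (sym e)) (φψ y))))

  -- Writing f (φ x) as a sum against δ (φ x) turns the reindexing into an exchange of two sums,
  -- with no permutation of lists.
  ∑-reindex : ∀ {n} (φ ψ : Fin n → Fin n) → (∀ x → ψ (φ x) ≡ x) → (∀ x → φ (ψ x) ≡ x) → (f : Fin n → ℚ) →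
    ∑ (fins n) (f ∘ φ) ≡ ∑ (fins n) f
  ∑-reindex {n} φ ψ ψφ φψ f = begin
    ∑ (fins n) (f ∘ φ) ≡⟨ ∑-cong (fins n) (λ x → sym (∑-δ (φ x) f)) ⟩
    ∑ (fins n) (λ x → ∑ (fins n) (λ y → δ (φ x) y * f y)) ≡⟨ ∑-swap (fins n) (fins n) _ ⟩
    ∑ (fins n) (λ y → ∑ (fins n) (λ x → δ (φ x) y * f y)) ≡⟨ ∑-cong (fins n) (λ y → trans (∑-*ʳ (fins n) (f y) _)
       (trans (cong (_* f y) (trans (∑-cong (fins n) (λ x → δ-bij φ ψ ψφ φψ x y)) (∑-δ1 (ψ y)))) (ℚP.*-identityˡ (f y)))) ⟩
    ∑ (fins n) f ∎
    where open ≡-Reasoning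

  infix 4 _~_
  data _~_ {A : Set} : ∀ {m} → Vec A m → Vec A m → Set where
    ~refl : ∀ {m} {u : Vec A m} → u ~ u
    ~cons : ∀ {m} x {u v : Vec A m} → u ~ v → x ∷ u ~ x ∷ v
    ~swap : ∀ {m} x y {u : Vec A m} → x ∷ y ∷ u ~ y ∷ x ∷ u
    ~trans : ∀ {m} {u v w : Vec A m} → u ~ v → v ~ w → u ~ w

  ~sym : ∀ {A : Set} {m} {u v : Vec A m} → u ~ v → v ~ u
  ~sym ~refl = ~refl
  ~sym (~cons x p) = ~cons x (~sym p)
  ~sym (~swap x y) = ~swap y x
  ~sym (~trans p q) = ~trans (~sym q) (~sym p)

  Symm : {A : Set} {m : ℕ} → (Vec A m → ℚ) → Set
  Symm f = ∀ {u v} → u ~ v → f u ≡ f v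

  module Group (p : ℕ) where

    n : ℕ
    n = suc p

    G : Set
    G = Fin n

    opaque
      -- Opaque, so that n remains a single variable in polynomial identities and does not unfold to
      -- `1ℚ + ι p`; `nQ-ι` links the two where p matters.
      nQ : ℚ
      nQ = ι n

      nQ-ι : nQ ≡ ι n
      nQ-ι = refl

    infixl 6 _⊞_
    _⊞_ : G → G → G
    _⊞_ = _+ₙ_

    ⊟_ : G → G
    ⊟ i = fromℕ< (m%n<n (n ℕ.∸ toℕ i) n)

    gs ns : List G
    gs = fins n
    ns = map suc (fins p)

    ∑-gs : (f : G → ℚ) → ∑ gs f ≡ f zero + ∑ ns f
    ∑-gs f = trans (∑-fins p f) (cong (f zero +_) (sym (∑-map (fins p) suc f)))

    toℕ-⊞ : ∀ a b → toℕ (a ⊞ b) ≡ (toℕ a ℕ.+ toℕ b) % n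
    toℕ-⊞ a b = FinP.toℕ-fromℕ< (m%n<n (toℕ a ℕ.+ toℕ b) n)

    toℕ-⊟ : ∀ a → toℕ (⊟ a) ≡ (n ℕ.∸ toℕ a) % n
    toℕ-⊟ a = FinP.toℕ-fromℕ< (m%n<n (n ℕ.∸ toℕ a) n)

    toℕ% : ∀ (a : G) → toℕ a % n ≡ toℕ a
    toℕ% a = DM.m<n⇒m%n≡m (FinP.toℕ<n a)

    ⊞-comm : ∀ a b → a ⊞ b ≡ b ⊞ a
    ⊞-comm a b = FinP.toℕ-injective (trans (toℕ-⊞ a b) (trans (cong (_% n) (ℕP.+-comm (toℕ a) (toℕ b))) (sym (toℕ-⊞ b a))))

    private
      %-absorbʳ : ∀ a b → (a ℕ.+ b % n) % n ≡ (a ℕ.+ b) % n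
      %-absorbʳ a b = trans (DM.%-distribˡ-+ a (b % n) n) (trans (cong (λ t → (a % n ℕ.+ t) % n) (DM.m%n%n≡m%n b n))
          (sym (DM.%-distribˡ-+ a b n)))

      %-absorbˡ : ∀ a b → (a % n ℕ.+ b) % n ≡ (a ℕ.+ b) % n
      %-absorbˡ a b = trans (cong (_% n) (ℕP.+-comm (a % n) b)) (trans (%-absorbʳ b a) (cong (_% n) (ℕP.+-comm b a)))

    ⊞-assoc : ∀ a b c → (a ⊞ b) ⊞ c ≡ a ⊞ (b ⊞ c)
    ⊞-assoc a b c = FinP.toℕ-injective (begin
      toℕ ((a ⊞ b) ⊞ c) ≡⟨ toℕ-⊞ (a ⊞ b) c ⟩
      (toℕ (a ⊞ b) ℕ.+ toℕ c) % n ≡⟨ cong (λ t → (t ℕ.+ toℕ c) % n) (toℕ-⊞ a b) ⟩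
      ((toℕ a ℕ.+ toℕ b) % n ℕ.+ toℕ c) % n ≡⟨ %-absorbˡ (toℕ a ℕ.+ toℕ b) (toℕ c) ⟩
      (toℕ a ℕ.+ toℕ b ℕ.+ toℕ c) % n ≡⟨ cong (_% n) (ℕP.+-assoc (toℕ a) (toℕ b) (toℕ c)) ⟩
      (toℕ a ℕ.+ (toℕ b ℕ.+ toℕ c)) % n ≡⟨ sym (%-absorbʳ (toℕ a) (toℕ b ℕ.+ toℕ c)) ⟩
      (toℕ a ℕ.+ (toℕ b ℕ.+ toℕ c) % n) % n ≡⟨ cong (λ t → (toℕ a ℕ.+ t) % n) (sym (toℕ-⊞ b c)) ⟩
      (toℕ a ℕ.+ toℕ (b ⊞ c)) % n ≡⟨ sym (toℕ-⊞ a (b ⊞ c)) ⟩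
      toℕ (a ⊞ (b ⊞ c)) ∎)
      where open ≡-Reasoning

    ⊞-idˡ : ∀ a → zero ⊞ a ≡ a
    ⊞-idˡ a = FinP.toℕ-injective (trans (toℕ-⊞ zero a) (toℕ% a))

    ⊞-idʳ : ∀ a → a ⊞ zero ≡ a
    ⊞-idʳ a = trans (⊞-comm a zero) (⊞-idˡ a)

    ⊞-invʳ : ∀ a → a ⊞ ⊟ a ≡ zero
    ⊞-invʳ a = FinP.toℕ-injective (begin
      toℕ (a ⊞ ⊟ a) ≡⟨ toℕ-⊞ a (⊟ a) ⟩
      (toℕ a ℕ.+ toℕ (⊟ a)) % n ≡⟨ cong (λ t → (toℕ a ℕ.+ t) % n) (toℕ-⊟ a) ⟩
      (toℕ a ℕ.+ (n ℕ.∸ toℕ a) % n) % n ≡⟨ %-absorbʳ (toℕ a) (n ℕ.∸ toℕ a) ⟩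
      (toℕ a ℕ.+ (n ℕ.∸ toℕ a)) % n ≡⟨ cong (_% n) (ℕP.m+[n∸m]≡n (ℕP.<⇒≤ (FinP.toℕ<n a))) ⟩
      n % n ≡⟨ DM.n%n≡0 n ⟩
      0 ∎)
      where open ≡-Reasoning

    ⊞-invˡ : ∀ a → ⊟ a ⊞ a ≡ zero
    ⊞-invˡ a = trans (⊞-comm (⊟ a) a) (⊞-invʳ a)

    ⊞-cancel : ∀ a b → (a ⊞ b) ⊞ ⊟ b ≡ a
    ⊞-cancel a b = trans (⊞-assoc a b (⊟ b)) (trans (cong (a ⊞_) (⊞-invʳ b)) (⊞-idʳ a))

    ⊞-cancel′ : ∀ a b → (a ⊞ ⊟ b) ⊞ b ≡ a
    ⊞-cancel′ a b = trans (⊞-assoc a (⊟ b) b) (trans (cong (a ⊞_) (⊞-invˡ b)) (⊞-idʳ a))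

    ⊟-unique : ∀ {a b} → a ⊞ b ≡ zero → a ≡ ⊟ b
    ⊟-unique {a} {b} e = trans (sym (⊞-cancel a b)) (trans (cong (_⊞ ⊟ b) e) (⊞-idˡ (⊟ b)))

    ⊟-invol : ∀ a → ⊟ (⊟ a) ≡ a
    ⊟-invol a = sym (⊟-unique (⊞-invʳ a))

    ⊟-zero : ⊟ zero ≡ zero
    ⊟-zero = sym (⊟-unique {zero} {zero} (⊞-idˡ zero))

    ⊞-⊟ : ∀ r s → r ⊞ (s ⊞ ⊟ r) ≡ s
    ⊞-⊟ r s = trans (⊞-comm r (s ⊞ ⊟ r)) (⊞-cancel′ s r)

    ⊟-⊞ : ∀ s z r → (s ⊞ z) ⊞ ⊟ (r ⊞ z) ≡ s ⊞ ⊟ r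
    ⊟-⊞ s z r = trans (⊞-assoc s z (⊟ (r ⊞ z))) (cong (s ⊞_) (⊟-unique
      (trans (⊞-assoc z (⊟ (r ⊞ z)) r) (trans (cong (z ⊞_) (⊞-comm (⊟ (r ⊞ z)) r))
        (trans (sym (⊞-assoc z r (⊟ (r ⊞ z)))) (trans (cong (_⊞ ⊟ (r ⊞ z)) (⊞-comm z r)) (⊞-invʳ (r ⊞ z))))))))

    ∑-translate : ∀ z (f : G → ℚ) → ∑ gs (λ r → f (r ⊞ z)) ≡ ∑ gs f
    ∑-translate z = ∑-reindex (_⊞ z) (_⊞ ⊟ z) (λ x → ⊞-cancel x z) (λ x → ⊞-cancel′ x z)

    ∑-⊟ : ∀ (f : G → ℚ) → ∑ gs (λ r → f (⊟ r)) ≡ ∑ gs f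
    ∑-⊟ = ∑-reindex ⊟_ ⊟_ ⊟-invol ⊟-invol

    ∑ns-⊟ : ∀ (f : G → ℚ) → ∑ ns (λ r → f (⊟ r)) ≡ ∑ ns f
    ∑ns-⊟ f = begin
      ∑ ns (λ r → f (⊟ r)) ≡⟨ (solve 2 (λ a b → b := (a :+ b) :- a) refl (f (⊟ zero)) (∑ ns (λ r → f (⊟ r)))) ⟩
      (f (⊟ zero) + ∑ ns (λ r → f (⊟ r))) - f (⊟ zero) ≡⟨ cong₂ _-_ (trans (sym (∑-gs (λ r → f (⊟ r)))) (trans (∑-⊟ f) (∑-gs f)))
          (cong f ⊟-zero) ⟩
      (f zero + ∑ ns f) - f zero ≡⟨ (solve 2 (λ a b → (a :+ b) :- a := b) refl (f zero) (∑ ns f)) ⟩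
      ∑ ns f ∎
      where open ≡-Reasoning

    -- S r v f is the sum of f over the vectors obtained from v by adding r to one entry.
    S : ∀ {m} → G → Vec G m → (Vec G m → ℚ) → ℚ
    S r [] f = 0ℚ
    S r (y ∷ ys) f = f ((r ⊞ y) ∷ ys) + S r ys (λ w → f (y ∷ w))

    -- F m χ is the Fourier coefficient Σ ω^(χ·x) over injective x : Fin m → ℤ/n: it is an integer
    -- given by this recursion, obtained by summing over the first value of x.
    F : (m : ℕ) → Vec G m → ℚ
    F zero [] = 1ℚ
    F (suc m) (r ∷ v) = δ zero r * (nQ * F m v) - S r v (F m)

    S-cong : ∀ {m} r (v : Vec G m) {f g : Vec G m → ℚ} → (∀ w → f w ≡ g w) → S r v f ≡ S r v g
    S-cong r [] e = refl
    S-cong r (y ∷ ys) e = cong₂ _+_ (e ((r ⊞ y) ∷ ys)) (S-cong r ys λ w → e (y ∷ w))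

    S-+ : ∀ {m} r (v : Vec G m) (f g : Vec G m → ℚ) → S r v (λ w → f w + g w) ≡ S r v f + S r v g
    S-+ r [] f g = refl
    S-+ r (y ∷ ys) f g = trans (cong (f ((r ⊞ y) ∷ ys) + g ((r ⊞ y) ∷ ys) +_) (S-+ r ys _ _))
      (solve 4 (λ a b c d → (a :+ b) :+ (c :+ d) := (a :+ c) :+ (b :+ d)) refl (f ((r ⊞ y) ∷ ys)) (g ((r ⊞ y) ∷ ys))
          (S r ys (λ w → f (y ∷ w))) (S r ys (λ w → g (y ∷ w))))

    S-*ˡ : ∀ {m} r (v : Vec G m) c (f : Vec G m → ℚ) → S r v (λ w → c * f w) ≡ c * S r v f
    S-*ˡ r [] c f = sym (ℚP.*-zeroʳ c)
    S-*ˡ r (y ∷ ys) c f = trans (cong (c * f ((r ⊞ y) ∷ ys) +_) (S-*ˡ r ys c _)) (sym (ℚP.*-distribˡ-+ c _ _))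

    S-neg : ∀ {m} r (v : Vec G m) (f : Vec G m → ℚ) → S r v (λ w → - f w) ≡ - S r v f
    S-neg r [] f = refl
    S-neg r (y ∷ ys) f = trans (cong (- f ((r ⊞ y) ∷ ys) +_) (S-neg r ys _)) (sym (ℚP.neg-distrib-+ (f ((r ⊞ y) ∷ ys)) _))

    S-symm : ∀ {m} r {f : Vec G m → ℚ} → Symm f → Symm (λ v → S r v f)
    S-symm r sf ~refl = refl
    S-symm r sf (~cons x q) = cong₂ _+_ (sf (~cons (r ⊞ x) q)) (S-symm r (λ q′ → sf (~cons x q′)) q)
    S-symm r {f} sf (~swap x y {u}) = begin
      f ((r ⊞ x) ∷ y ∷ u) + (f (x ∷ (r ⊞ y) ∷ u) + S r u (λ w → f (x ∷ y ∷ w)))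
        ≡⟨ cong₂ _+_ (sf (~swap (r ⊞ x) y)) (cong₂ _+_ (sf (~swap x (r ⊞ y))) (S-cong r u λ w → sf (~swap x y))) ⟩
      f (y ∷ (r ⊞ x) ∷ u) + (f ((r ⊞ y) ∷ x ∷ u) + S r u (λ w → f (y ∷ x ∷ w)))
        ≡⟨ (solve 3 (λ a b c → a :+ (b :+ c) := b :+ (a :+ c)) refl (f (y ∷ (r ⊞ x) ∷ u)) (f ((r ⊞ y) ∷ x ∷ u)) (S r u (λ w → f (y ∷ x ∷ w)))) ⟩
      f ((r ⊞ y) ∷ x ∷ u) + (f (y ∷ (r ⊞ x) ∷ u) + S r u (λ w → f (y ∷ x ∷ w))) ∎
      where open ≡-Reasoning
    S-symm r sf (~trans a b) = trans (S-symm r sf a) (S-symm r sf b)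

    S-swap : ∀ {m} r r′ (v : Vec G m) (f : Vec G m → ℚ) → S r v (λ w → S r′ w f) ≡ S r′ v (λ w → S r w f)
    S-swap r r′ [] f = refl
    S-swap r r′ (y ∷ ys) f = begin
      (f ((r′ ⊞ (r ⊞ y)) ∷ ys) + S r′ ys (λ w → f ((r ⊞ y) ∷ w))) + S r ys (λ w → f ((r′ ⊞ y) ∷ w) + S r′ w (λ w′ → f (y ∷ w′)))
        ≡⟨ cong₂ _+_ (cong (λ t → f (t ∷ ys) + S r′ ys (λ w → f ((r ⊞ y) ∷ w))) e)
            (trans (S-+ r ys _ _) (cong (S r ys (λ w → f ((r′ ⊞ y) ∷ w)) +_) (S-swap r r′ ys _))) ⟩
      (f ((r ⊞ (r′ ⊞ y)) ∷ ys) + S r′ ys (λ w → f ((r ⊞ y) ∷ w))) + (S r ys (λ w → f ((r′ ⊞ y) ∷ w)) + S r′ ys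
          (λ w → S r w (λ w′ → f (y ∷ w′))))
        ≡⟨ (solve 4 (λ a b c d → (a :+ b) :+ (c :+ d) := (a :+ c) :+ (b :+ d)) refl (f ((r ⊞ (r′ ⊞ y)) ∷ ys))
            (S r′ ys (λ w → f ((r ⊞ y) ∷ w))) (S r ys (λ w → f ((r′ ⊞ y) ∷ w))) (S r′ ys (λ w → S r w (λ w′ → f (y ∷ w′))))) ⟩
      (f ((r ⊞ (r′ ⊞ y)) ∷ ys) + S r ys (λ w → f ((r′ ⊞ y) ∷ w))) + (S r′ ys (λ w → f ((r ⊞ y) ∷ w)) + S r′ ys
          (λ w → S r w (λ w′ → f (y ∷ w′))))
        ≡⟨ cong (f ((r ⊞ (r′ ⊞ y)) ∷ ys) + S r ys (λ w → f ((r′ ⊞ y) ∷ w)) +_) (sym (S-+ r′ ys _ _)) ⟩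
      (f ((r ⊞ (r′ ⊞ y)) ∷ ys) + S r ys (λ w → f ((r′ ⊞ y) ∷ w))) + S r′ ys (λ w → f ((r ⊞ y) ∷ w) + S r w (λ w′ → f (y ∷ w′))) ∎
      where
      open ≡-Reasoning
      e : r′ ⊞ (r ⊞ y) ≡ r ⊞ (r′ ⊞ y)
      e = trans (sym (⊞-assoc r′ r y)) (trans (cong (_⊞ y) (⊞-comm r′ r)) (⊞-assoc r r′ y))

    -- Symmetry is evident for the character sum but has to be derived from the recursion. Two steps
    -- of it give an expression symmetric in a and b, because `S a` and `S b` commute and the merged
    -- entry is a ⊞ b.
    F-swap : ∀ m a b (v : Vec G m) → F (2 ℕ.+ m) (a ∷ b ∷ v) ≡ F (2 ℕ.+ m) (b ∷ a ∷ v)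
    F-swap m a b v = trans (expand a b) (trans mid (sym (expand b a)))
      where
      open ≡-Reasoning
      expand : ∀ a b → F (2 ℕ.+ m) (a ∷ b ∷ v) ≡ δ zero a * (nQ * (δ zero b * (nQ * F m v) - S b v (F m)))
        - (F (suc m) ((a ⊞ b) ∷ v) + (δ zero b * nQ * S a v (F m) - S a v (λ w → S b w (F m))))
      expand a b = cong (λ t → δ zero a * (nQ * (δ zero b * (nQ * F m v) - S b v (F m))) - (F (suc m) ((a ⊞ b) ∷ v) + t)) (begin
        S a v (λ w → δ zero b * (nQ * F m w) - S b w (F m)) ≡⟨ S-+ a v _ _ ⟩
        S a v (λ w → δ zero b * (nQ * F m w)) + S a v (λ w → - S b w (F m))
          ≡⟨ cong₂ _+_ (trans (S-cong a v λ w → sym (ℚP.*-assoc (δ zero b) nQ (F m w))) (S-*ˡ a v (δ zero b * nQ) (F m))) (S-neg a v _) ⟩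
        δ zero b * nQ * S a v (F m) - S a v (λ w → S b w (F m)) ∎)
      mid : δ zero a * (nQ * (δ zero b * (nQ * F m v) - S b v (F m))) - (F (suc m) ((a ⊞ b) ∷ v) +
          (δ zero b * nQ * S a v (F m) - S a v (λ w → S b w (F m))))
          ≡ δ zero b * (nQ * (δ zero a * (nQ * F m v) - S a v (F m))) - (F (suc m) ((b ⊞ a) ∷ v) +
              (δ zero a * nQ * S b v (F m) - S b v (λ w → S a w (F m))))
      mid = begin
        _ ≡⟨ cong₂ (λ t u → δ zero a * (nQ * (δ zero b * (nQ * F m v) - S b v (F m))) -
            (F (suc m) (t ∷ v) + (δ zero b * nQ * S a v (F m) - u))) (⊞-comm a b) (S-swap a b v (F m)) ⟩
        _ ≡⟨ (solve 8 (λ da db n f sa sb g u → da :* (n :* (db :* (n :* f) :- sb)) :- (g :+ (db :* n :* sa :- u)) := db :*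
            (n :* (da :* (n :* f) :- sa)) :- (g :+ (da :* n :* sb :- u))) refl (δ zero a) (δ zero b) (nQ) (F m v) (S a v (F m)) (S b v (F m))
            (F (suc m) ((b ⊞ a) ∷ v)) (S b v (λ w → S a w (F m)))) ⟩
        _ ∎

    F-symm : ∀ m → Symm (F m)
    F-symm m ~refl = refl
    F-symm (suc m) (~cons x q) = cong₂ (λ a b → δ zero x * (nQ * a) - b) (F-symm m q) (S-symm x (F-symm m) q)
    F-symm (suc (suc m)) (~swap x y {u}) = F-swap m x y u
    F-symm m (~trans a b) = trans (F-symm m a) (F-symm m b)

    S-zero : ∀ {m} (v : Vec G m) (f : Vec G m → ℚ) → S zero v f ≡ ι m * f v
    S-zero [] f = sym (ℚP.*-zeroˡ (f []))
    S-zero {suc m} (y ∷ ys) f = trans (cong₂ _+_ (cong (λ t → f (t ∷ ys)) (⊞-idˡ y)) (S-zero ys _))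
        (solve 2 (λ a k → a :+ k :* a := (con 1ℚ :+ k) :* a) refl (f (y ∷ ys)) (ι m))

    -- The value at an entry 0 does not affect the character; it can be any of the n - m values left
    -- free by the others.
    F-zero : ∀ m (v : Vec G m) → F (suc m) (zero ∷ v) ≡ (nQ - ι m) * F m v
    F-zero m v = trans (cong (λ t → 1ℚ * (nQ * F m v) - t) (S-zero v (F m)))
        (solve 3 (λ n f k → con 1ℚ :* (n :* f) :- k :* f := (n :- k) :* f) refl (nQ) (F m v) (ι m))

    -- Merging r into an entry z of v leaves the entries s - r and r + z, whose sum does not depend
    -- on r; `h` says that such pairs average to 0. The equation `suc j ≡ k` records that v has an
    -- entry to merge into.
    ∑-S-pair : ∀ k (f : Vec G (suc k) → ℚ) → Symm f →
      (∀ s z → (j : ℕ) → (e : suc j ≡ k) → (w : Vec G j) → ∑ gs (λ r → f (subst (λ t → Vec G (suc t)) e ((s ⊞ ⊟ r) ∷ (r ⊞ z) ∷ w))) ≡ 0ℚ) →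
      ∀ s v → ∑ gs (λ r → S r v (λ w → f ((s ⊞ ⊟ r) ∷ w))) ≡ 0ℚ
    ∑-S-pair zero f sf h s [] = ∑-0 gs
    ∑-S-pair (suc k) f sf h s (y ∷ ys) = trans (∑-+ gs _ _) (cong₂ _+_ (h s y k refl ys)
      (trans (∑-cong gs λ r → S-cong r ys λ w → sf (~swap (s ⊞ ⊟ r) y))
        (∑-S-pair k (λ w → f (y ∷ w)) (λ q → sf (~cons y q))
          (λ { s z j refl w → trans (∑-cong gs λ r → sf (~trans (~swap y (s ⊞ ⊟ r)) (~cons (s ⊞ ⊟ r) (~swap y (r ⊞ z)))))
              (h s z (suc j) refl (y ∷ w)) })
          s ys)))

    -- The pair of entries r, s − r gives ω^(s x₂ + r (x₁ − x₂)) with x₁ ≠ x₂, which averages to 0 over r.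
    ∑-pair : ∀ m s (v : Vec G m) → ∑ gs (λ r → F (2 ℕ.+ m) (r ∷ (s ⊞ ⊟ r) ∷ v)) ≡ 0ℚ
    ∑-pair m s v = begin
      ∑ gs (λ r → δ zero r * (nQ * F (suc m) ((s ⊞ ⊟ r) ∷ v)) - (F (suc m) ((r ⊞ (s ⊞ ⊟ r)) ∷ v) + S r v (λ w → F (suc m) ((s ⊞ ⊟ r) ∷ w))))
        ≡⟨ ∑-− gs _ _ ⟩
      ∑ gs (λ r → δ zero r * (nQ * F (suc m) ((s ⊞ ⊟ r) ∷ v))) - ∑ gs (λ r → F (suc m) ((r ⊞ (s ⊞ ⊟ r)) ∷ v) + S r v
          (λ w → F (suc m) ((s ⊞ ⊟ r) ∷ w)))
        ≡⟨ cong₂ _-_ (∑-δ zero _) (∑-+ gs _ _) ⟩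
      nQ * F (suc m) ((s ⊞ ⊟ zero) ∷ v) - (∑ gs (λ r → F (suc m) ((r ⊞ (s ⊞ ⊟ r)) ∷ v)) + ∑ gs
          (λ r → S r v (λ w → F (suc m) ((s ⊞ ⊟ r) ∷ w))))
        ≡⟨ cong₂ (λ a b → nQ * F (suc m) (a ∷ v) - b) (trans (cong (s ⊞_) ⊟-zero) (⊞-idʳ s))
            (cong₂ _+_ (trans (∑-cong gs λ r → cong (λ t → F (suc m) (t ∷ v)) (⊞-⊟ r s))
                (trans (∑-fins-const n (F (suc m) (s ∷ v))) (cong (_* F (suc m) (s ∷ v)) (sym nQ-ι))))
              (∑-S-pair m (F (suc m)) (F-symm (suc m)) ih s v)) ⟩
      nQ * F (suc m) (s ∷ v) - (nQ * F (suc m) (s ∷ v) + 0ℚ) ≡⟨ (solve 1 (λ x → x :- (x :+ con 0ℚ) := con 0ℚ) refl (nQ * F (suc m) (s ∷ v))) ⟩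
      0ℚ ∎
      where
      open ≡-Reasoning
      ih : ∀ s z → (j : ℕ) → (e : suc j ≡ m) → (w : Vec G j) → ∑ gs (λ r → F (suc m)
          (subst (λ t → Vec G (suc t)) e ((s ⊞ ⊟ r) ∷ (r ⊞ z) ∷ w))) ≡ 0ℚ
      ih s z j refl w = begin
        ∑ gs (λ r → F (2 ℕ.+ j) ((s ⊞ ⊟ r) ∷ (r ⊞ z) ∷ w))
          ≡⟨ ∑-cong gs (λ r → trans (F-swap j (s ⊞ ⊟ r) (r ⊞ z) w) (cong (λ t → F (2 ℕ.+ j) ((r ⊞ z) ∷ t ∷ w)) (sym (⊟-⊞ s z r)))) ⟩
        ∑ gs (λ r → F (2 ℕ.+ j) ((r ⊞ z) ∷ ((s ⊞ z) ⊞ ⊟ (r ⊞ z)) ∷ w)) ≡⟨ ∑-translate z (λ r → F (2 ℕ.+ j) (r ∷ ((s ⊞ z) ⊞ ⊟ r) ∷ w)) ⟩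
        ∑ gs (λ r → F (2 ℕ.+ j) (r ∷ ((s ⊞ z) ⊞ ⊟ r) ∷ w)) ≡⟨ ∑-pair j (s ⊞ z) w ⟩
        0ℚ ∎

  -- Second and third moments

  module Moments (p : ℕ) where
    open Group p

    V : (m : ℕ) → (Vec G m → ℚ) → ℚ
    V m = ∑ (vecs ns m)

    NZ : ∀ {m} → Vec G m → Set
    NZ [] = ⊤
    NZ (x ∷ v) = (x ≢ zero) × NZ v

    ∑ns-mono : {f g : G → ℚ} → (∀ x → x ≢ zero → f x ≤ g x) → ∑ ns f ≤ ∑ ns g
    ∑ns-mono {f} {g} h = subst₂ _≤_ (sym (∑-map (fins p) suc f)) (sym (∑-map (fins p) suc g)) (∑-mono (fins p) λ x → h (suc x) λ ())

    ∑ns-cong : {f g : G → ℚ} → (∀ x → x ≢ zero → f x ≡ g x) → ∑ ns f ≡ ∑ ns g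
    ∑ns-cong h = ℚP.≤-antisym (∑ns-mono λ x q → ℚP.≤-reflexive (h x q)) (∑ns-mono λ x q → ℚP.≤-reflexive (sym (h x q)))

    V-suc : ∀ m (f : Vec G (suc m) → ℚ) → V (suc m) f ≡ ∑ ns (λ y → V m (λ w → f (y ∷ w)))
    V-suc m f = ∑-vecs ns m f

    V-mono : ∀ m {f g : Vec G m → ℚ} → (∀ v → NZ v → f v ≤ g v) → V m f ≤ V m g
    V-mono zero h = ℚP.+-monoˡ-≤ 0ℚ (h [] tt)
    V-mono (suc m) {f} {g} h = subst₂ _≤_ (sym (V-suc m f)) (sym (V-suc m g)) (∑ns-mono λ x q → V-mono m λ v q′ → h (x ∷ v) (q , q′))

    -- By symmetry of f and g, every entry that r is merged into contributes as much as the first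
    -- one.
    V-S : ∀ m r (f g : Vec G (suc m) → ℚ) → Symm f → Symm g →
      V (suc m) (λ v → g v * S r v f) ≡ ι (suc m) * ∑ ns (λ y → V m (λ w → g (y ∷ w) * f ((r ⊞ y) ∷ w)))
    V-S zero r f g sf sg = trans (V-suc 0 _) (trans (∑-cong ns λ y → cong (λ t → g (y ∷ []) * t + 0ℚ) (ℚP.+-identityʳ _))
      (sym (trans (cong (_* ∑ ns (λ y → V 0 (λ w → g (y ∷ w) * f ((r ⊞ y) ∷ w)))) (ℚP.+-identityʳ 1ℚ)) (ℚP.*-identityˡ _))))
    V-S (suc m) r f g sf sg = begin
      V (2 ℕ.+ m) (λ v → g v * S r v f) ≡⟨ V-suc (suc m) _ ⟩
      ∑ ns (λ y → V (suc m) (λ v → g (y ∷ v) * (f ((r ⊞ y) ∷ v) + S r v (λ w → f (y ∷ w)))))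
        ≡⟨ ∑-cong ns (λ y → trans (∑-cong (vecs ns (suc m)) λ v → ℚP.*-distribˡ-+ (g (y ∷ v)) _ _) (∑-+ (vecs ns (suc m)) _ _)) ⟩
      ∑ ns (λ y → V (suc m) (λ v → g (y ∷ v) * f ((r ⊞ y) ∷ v)) + V (suc m) (λ v → g (y ∷ v) * S r v (λ w → f (y ∷ w))))
        ≡⟨ ∑-+ ns _ _ ⟩
      A + ∑ ns (λ y → V (suc m) (λ v → g (y ∷ v) * S r v (λ w → f (y ∷ w))))
        ≡⟨ cong (A +_) (∑-cong ns λ y → V-S m r (λ w → f (y ∷ w)) (λ w → g (y ∷ w)) (λ q → sf (~cons y q)) (λ q → sg (~cons y q))) ⟩
      A + ∑ ns (λ y → ι (suc m) * ∑ ns (λ z → V m (λ w → g (y ∷ z ∷ w) * f (y ∷ (r ⊞ z) ∷ w))))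
        ≡⟨ cong (A +_) (trans (∑-*ˡ ns (ι (suc m)) _) (cong (ι (suc m) *_) (begin
           ∑ ns (λ y → ∑ ns (λ z → V m (λ w → g (y ∷ z ∷ w) * f (y ∷ (r ⊞ z) ∷ w)))) ≡⟨ ∑-swap ns ns _ ⟩
           ∑ ns (λ z → ∑ ns (λ y → V m (λ w → g (y ∷ z ∷ w) * f (y ∷ (r ⊞ z) ∷ w))))
             ≡⟨ ∑-cong ns (λ z → trans (∑-cong ns λ y → ∑-cong (vecs ns m) λ w → cong₂ _*_ (sg (~swap y z)) (sf (~swap y (r ⊞ z))))
                 (sym (V-suc m _))) ⟩
           A ∎))) ⟩
      A + ι (suc m) * A ≡⟨ (solve 2 (λ A k → A :+ k :* A := (con 1ℚ :+ k) :* A) refl A (ι (suc m))) ⟩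
      ι (2 ℕ.+ m) * A ∎
      where
      open ≡-Reasoning
      A = ∑ ns (λ y → V (suc m) (λ v → g (y ∷ v) * f ((r ⊞ y) ∷ v)))

    F-nz : ∀ m {r} (v : Vec G m) → r ≢ zero → F (suc m) (r ∷ v) ≡ - S r v (F m)
    F-nz m {r} v q = trans (cong (λ t → t * (nQ * F m v) - S r v (F m)) (δ-≢ (q ∘ sym)))
        (solve 2 (λ a b → con 0ℚ :* a :- b := :- b) refl (nQ * F m v) (S r v (F m)))

    -- One factor F is opened at its first entry r. As r is nonzero only the merging term survives,
    -- and the pair r, y becomes free for summation. The choice g = F gives the second moment, g =
    -- F² the third.
    V-expand : ∀ m (g : Vec G (2 ℕ.+ m) → ℚ) → Symm g →
      V (2 ℕ.+ m) (λ v → g v * F (2 ℕ.+ m) v) ≡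
      - ι (suc m) * V m (λ w → ∑ ns (λ r → ∑ ns (λ y → g (r ∷ y ∷ w) * F (suc m) ((r ⊞ y) ∷ w))))
    V-expand m g sg = begin
      V (2 ℕ.+ m) (λ v → g v * F (2 ℕ.+ m) v) ≡⟨ V-suc (suc m) _ ⟩
      ∑ ns (λ r → V (suc m) (λ v → g (r ∷ v) * F (2 ℕ.+ m) (r ∷ v)))
        ≡⟨ ∑ns-cong (λ r q → trans (∑-cong (vecs ns (suc m)) λ v → trans (cong (g (r ∷ v) *_) (F-nz (suc m) v q))
            (sym (ℚP.neg-distribʳ-* (g (r ∷ v)) _)))
             (trans (∑-neg (vecs ns (suc m)) _) (cong -_ (V-S m r (F (suc m)) (λ w → g (r ∷ w)) (F-symm (suc m)) (λ e → sg (~cons r e)))))) ⟩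
      ∑ ns (λ r → - (ι (suc m) * ∑ ns (λ y → V m (λ w → g (r ∷ y ∷ w) * F (suc m) ((r ⊞ y) ∷ w)))))
        ≡⟨ trans (∑-cong ns λ r → ℚP.neg-distribˡ-* (ι (suc m)) _) (∑-*ˡ ns (- ι (suc m)) _) ⟩
      - ι (suc m) * ∑ ns (λ r → ∑ ns (λ y → V m (λ w → g (r ∷ y ∷ w) * F (suc m) ((r ⊞ y) ∷ w))))
        ≡⟨ cong (- ι (suc m) *_) (trans (∑-cong ns λ r → ∑-swap ns (vecs ns m) _) (∑-swap ns (vecs ns m) _)) ⟩
      - ι (suc m) * V m (λ w → ∑ ns (λ r → ∑ ns (λ y → g (r ∷ y ∷ w) * F (suc m) ((r ⊞ y) ∷ w)))) ∎
      where open ≡-Reasoning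

    ∑ns-gs : (f : G → ℚ) → ∑ ns f ≡ ∑ gs f - f zero
    ∑ns-gs f = trans (solve 2 (λ a b → b := (a :+ b) :- a) refl (f zero) (∑ ns f)) (cong (λ t → t - f zero) (sym (∑-gs f)))

    ∑∑ns : (T : G → G → ℚ) → ∑ ns (λ r → ∑ ns (T r)) ≡
      ((∑ gs (λ r → ∑ gs (T r)) - ∑ gs (T zero)) - ∑ gs (λ r → T r zero)) + T zero zero
    ∑∑ns T = trans (∑-cong ns λ r → ∑ns-gs (T r)) (trans (∑-− ns (λ r → ∑ gs (T r)) (λ r → T r zero))
      (trans (cong₂ _-_ (∑ns-gs (λ r → ∑ gs (T r))) (∑ns-gs (λ r → T r zero)))
      (solve 4 (λ a b c d → (a :- b) :- (c :- d) := ((a :- b) :- c) :+ d) refl (∑ gs (λ r → ∑ gs (T r))) (∑ gs (T zero))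
          (∑ gs (λ r → T r zero)) (T zero zero))))

    -- The substitution s = r + y isolates an inner sum over pairs of fixed sum, the one that
    -- `∑-pair` evaluates when K is F.
    ∑-conv : (K : G → G → ℚ) (B : G → ℚ) →
      ∑ gs (λ r → ∑ gs (λ y → K r y * B (r ⊞ y))) ≡ ∑ gs (λ s → ∑ gs (λ r → K r (s ⊞ ⊟ r)) * B s)
    ∑-conv K B = begin
      ∑ gs (λ r → ∑ gs (λ y → K r y * B (r ⊞ y))) ≡⟨ ∑-cong gs (λ r → trans (sym (∑-translate (⊟ r) (λ y → K r y * B (r ⊞ y))))
          (∑-cong gs λ s → cong (λ t → K r (s ⊞ ⊟ r) * B t) (⊞-⊟ r s))) ⟩
      ∑ gs (λ r → ∑ gs (λ s → K r (s ⊞ ⊟ r) * B s)) ≡⟨ ∑-swap gs gs _ ⟩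
      ∑ gs (λ s → ∑ gs (λ r → K r (s ⊞ ⊟ r) * B s)) ≡⟨ ∑-cong gs (λ s → ∑-*ʳ gs (B s) _) ⟩
      ∑ gs (λ s → ∑ gs (λ r → K r (s ⊞ ⊟ r)) * B s) ∎
      where open ≡-Reasoning

    Y Z : ℕ → ℚ
    Y m = V m (λ v → F m v * F m v)
    Z m = V m (λ v → F m v * F m v * F m v)

    F²-symm : ∀ m → Symm (λ v → F m v * F m v)
    F²-symm m q = cong₂ _*_ (F-symm m q) (F-symm m q)

    F-zero₂ : ∀ m y (w : Vec G m) → F (2 ℕ.+ m) (y ∷ zero ∷ w) ≡ (nQ - ι (suc m)) * F (suc m) (y ∷ w)
    F-zero₂ m y w = trans (F-swap m y zero w) (F-zero (suc m) (y ∷ w))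

    -- Over all r and y in ℤ/n the double sum would vanish by `∑-pair`. Restricting to nonzero r and
    -- y leaves the terms with r = 0 or y = 0, where `F-zero` lowers the length; hence a closed
    -- recursion without error term.
    Y-rec : ∀ m → Y (2 ℕ.+ m) ≡ ι (suc m) * ((nQ - ι (suc m)) * ((ℤ.+ 2 / 1) * Y (suc m) + (nQ - ι m) * (nQ - ι m) * Y m))
    Y-rec m = begin
      Y (2 ℕ.+ m) ≡⟨ V-expand m (F (2 ℕ.+ m)) (F-symm (2 ℕ.+ m)) ⟩
      - ι (suc m) * V m (λ w → ∑ ns (λ r → ∑ ns (λ y → F (2 ℕ.+ m) (r ∷ y ∷ w) * F (suc m) ((r ⊞ y) ∷ w))))
        ≡⟨ cong (- ι (suc m) *_) (trans (∑-cong (vecs ns m) inner) (trans (∑-+ (vecs ns m) _ _)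
            (cong₂ _+_ (trans (∑-*ˡ (vecs ns m) (- (ℤ.+ 2 / 1) * c) _) (cong (- (ℤ.+ 2 / 1) * c *_)
            (trans (∑-swap (vecs ns m) ns _) (sym (V-suc m _)))))
            (∑-*ˡ (vecs ns m) (- (c * (N′ * N′))) _)))) ⟩
      - ι (suc m) * (- (ℤ.+ 2 / 1) * c * Y (suc m) + - (c * (N′ * N′)) * Y m)
        ≡⟨ (solve 5 (λ k c N′ a b → (:- k) :* ((:- con (ℤ.+ 2 / 1)) :* c :* a :+ (:- (c :* (N′ :* N′))) :* b) := k :*
            (c :* (con (ℤ.+ 2 / 1) :* a :+ N′ :* N′ :* b))) refl (ι (suc m)) c N′ (Y (suc m)) (Y m)) ⟩
      ι (suc m) * (c * ((ℤ.+ 2 / 1) * Y (suc m) + N′ * N′ * Y m)) ∎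
      where
      open ≡-Reasoning
      c N′ : ℚ
      c = nQ - ι (suc m)
      N′ = nQ - ι m
      inner : ∀ w → ∑ ns (λ r → ∑ ns (λ y → F (2 ℕ.+ m) (r ∷ y ∷ w) * F (suc m) ((r ⊞ y) ∷ w)))
        ≡ - (ℤ.+ 2 / 1) * c * ∑ ns (λ y → F (suc m) (y ∷ w) * F (suc m) (y ∷ w)) + - (c * (N′ * N′)) * (F m w * F m w)
      inner w = begin
        ∑ ns (λ r → ∑ ns (T r)) ≡⟨ ∑∑ns T ⟩
        ((∑ gs (λ r → ∑ gs (T r)) - ∑ gs (T zero)) - ∑ gs (λ r → T r zero)) + T zero zero
          ≡⟨ cong₂ _+_ (cong₂ _-_ (cong₂ _-_
               (trans (∑-conv (λ r y → F (2 ℕ.+ m) (r ∷ y ∷ w)) (λ s → F (suc m) (s ∷ w)))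
                   (∑-≡0 gs λ s → trans (cong (_* F (suc m) (s ∷ w)) (∑-pair m s w)) (ℚP.*-zeroˡ (F (suc m) (s ∷ w)))))
               (trans (∑-cong gs λ y → trans (cong₂ (λ a b → a * F (suc m) (b ∷ w)) (F-zero (suc m) (y ∷ w)) (⊞-idˡ y)) (ℚP.*-assoc c _ _))
                   (∑-*ˡ gs c _)))
               (trans (∑-cong gs λ r → trans (cong₂ (λ a b → a * F (suc m) (b ∷ w)) (F-zero₂ m r w) (⊞-idʳ r)) (ℚP.*-assoc c _ _))
                   (∑-*ˡ gs c _)))
               (cong₂ (λ a b → a * F (suc m) (b ∷ w)) (F-zero (suc m) (zero ∷ w)) (⊞-idˡ zero)) ⟩
        ((0ℚ - c * Q) - c * Q) + c * F (suc m) (zero ∷ w) * F (suc m) (zero ∷ w)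
          ≡⟨ cong (λ t → ((0ℚ - c * t) - c * t) + c * F (suc m) (zero ∷ w) * F (suc m) (zero ∷ w)) (∑-gs _) ⟩
        ((0ℚ - c * (F (suc m) (zero ∷ w) * F (suc m) (zero ∷ w) + Q′)) - c * (F (suc m) (zero ∷ w) * F (suc m) (zero ∷ w) + Q′)) + c * F
            (suc m) (zero ∷ w) * F (suc m) (zero ∷ w)
          ≡⟨ cong (λ t → ((0ℚ - c * (t * t + Q′)) - c * (t * t + Q′)) + c * t * t) (F-zero m w) ⟩
        ((0ℚ - c * (N′ * F m w * (N′ * F m w) + Q′)) - c * (N′ * F m w * (N′ * F m w) + Q′)) + c * (N′ * F m w) * (N′ * F m w)
          ≡⟨ (solve 4 (λ c N′ f Q′ → ((con 0ℚ :- c :* (N′ :* f :* (N′ :* f) :+ Q′)) :- c :* (N′ :* f :* (N′ :* f) :+ Q′)) :+ c :* (N′ :* f) :*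
              (N′ :* f) := (:- con (ℤ.+ 2 / 1)) :* c :* Q′ :+ (:- (c :* (N′ :* N′))) :* (f :* f)) refl c N′ (F m w) Q′) ⟩
        - (ℤ.+ 2 / 1) * c * Q′ + - (c * (N′ * N′)) * (F m w * F m w) ∎
        where
        T : G → G → ℚ
        T r y = F (2 ℕ.+ m) (r ∷ y ∷ w) * F (suc m) ((r ⊞ y) ∷ w)
        Q Q′ : ℚ
        Q = ∑ gs (λ y → F (suc m) (y ∷ w) * F (suc m) (y ∷ w))
        Q′ = ∑ ns (λ y → F (suc m) (y ∷ w) * F (suc m) (y ∷ w))

    merges : ∀ {m} → G → Vec G m → List (Vec G m)
    merges r [] = []
    merges r (y ∷ ys) = ((r ⊞ y) ∷ ys) ∷ map (y ∷_) (merges r ys)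

    S-merges : ∀ {m} r (v : Vec G m) f → S r v f ≡ ∑ (merges r v) f
    S-merges r [] f = refl
    S-merges r (y ∷ ys) f = cong (f ((r ⊞ y) ∷ ys) +_) (trans (S-merges r ys _) (sym (∑-map (merges r ys) (y ∷_) f)))

    S-1 : ∀ {m} r (v : Vec G m) → S r v (λ _ → 1ℚ) ≡ ι m
    S-1 r [] = refl
    S-1 r (y ∷ ys) = cong (1ℚ +_) (S-1 r ys)

    S-cauchy : ∀ {m} r (v : Vec G m) f → S r v f * S r v f ≤ ι m * S r v (λ w → f w * f w)
    S-cauchy {m} r v f = subst₂ _≤_ (cong₂ _*_ e e) (cong₂ _*_ (trans (sym (S-merges r v _)) (S-1 r v))
        (trans (∑-cong (merges r v) λ w → ℚP.*-identityˡ (f w * f w)) (sym (S-merges r v _))))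
        (∑-cauchy (merges r v) (λ _ → 1ℚ) f (λ _ → 0≤1))
      where
      e : ∑ (merges r v) (λ w → 1ℚ * f w) ≡ S r v f
      e = trans (∑-cong (merges r v) λ w → ℚP.*-identityˡ (f w)) (sym (S-merges r v f))

    -- `A` is F at a pair of opposite entries r, -r, the pairs that carry the main term of the third
    -- moment; `X` is the part of its recursion in which r is merged into the remaining entries.
    X A : ∀ m → G → Vec G m → ℚ
    X m r w = S r w (λ w′ → F (suc m) ((⊟ r) ∷ w′))
    A m r w = F (2 ℕ.+ m) (r ∷ (⊟ r) ∷ w)

    A-X : ∀ m {r} w → r ≢ zero → A m r w ≡ - ((nQ - ι m) * F m w + X m r w)
    A-X m {r} w q = trans (F-nz (suc m) ((⊟ r) ∷ w) q) (cong (λ t → - (t + X m r w))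
        (trans (cong (λ t → F (suc m) (t ∷ w)) (⊞-invʳ r)) (F-zero m w)))

    ∑-A : ∀ m w → ∑ ns (λ r → A m r w) ≡ - ((nQ - ι (suc m)) * ((nQ - ι m) * F m w))
    ∑-A m w = trans (∑ns-gs _) (trans (cong₂ _-_
       (trans (∑-cong gs λ r → cong (λ t → F (2 ℕ.+ m) (r ∷ t ∷ w)) (sym (⊞-idˡ (⊟ r)))) (∑-pair m zero w))
       (trans (F-zero (suc m) ((⊟ zero) ∷ w)) (cong ((nQ - ι (suc m)) *_) (trans (cong (λ t → F (suc m) (t ∷ w)) ⊟-zero) (F-zero m w)))))
       (ℚP.+-identityˡ _))

    ∑ns-const : ∀ c → ∑ ns (λ _ → c) ≡ ι p * c
    ∑ns-const c = trans (∑-map (fins p) suc (λ _ → c)) (∑-fins-const p c)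

    -- With K = (n - m) F w, A = -(K + X), so the square has the cross term 2KX = -2K(A + K), whose
    -- sum is known exactly by `∑-A`. Only the sum of X² remains to be estimated.
    ∑-A² : ∀ m w → ∑ ns (λ r → A m r w * A m r w) ≡
      (ι p - (ℤ.+ 2 / 1) * ι m) * ((nQ - ι m) * (nQ - ι m)) * (F m w * F m w) + ∑ ns (λ r → X m r w * X m r w)
    ∑-A² m w = begin
      ∑ ns (λ r → A m r w * A m r w) ≡⟨ ∑ns-cong (λ r q → trans (cong₂ _*_ (A-X m w q) (A-X m w q))
          (trans (solve 2 (λ a x → (:- (a :+ x)) :* (:- (a :+ x)) := (a :* a :+ con (ℤ.+ 2 / 1) :* a :* x) :+ x :* x) refl (K) (X m r w))
            (cong (λ t → (K * K + t) + X m r w * X m r w) (trans (solve 2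
                (λ a x → con (ℤ.+ 2 / 1) :* a :* x := (:- con (ℤ.+ 2 / 1)) :* a :* (:- (a :+ x) :+ a)) refl (K) (X m r w))
                (cong (λ t → - (ℤ.+ 2 / 1) * K * (t + K)) (sym (A-X m w q))))))) ⟩
      ∑ ns (λ r → (K * K + - (ℤ.+ 2 / 1) * K * (A m r w + K)) + X m r w * X m r w)
        ≡⟨ trans (∑-+ ns _ _) (cong (_+ ∑ ns (λ r → X m r w * X m r w)) (trans (∑-+ ns _ _)
            (cong₂ _+_ (∑ns-const (K * K)) (trans (∑-*ˡ ns (- (ℤ.+ 2 / 1) * K) _)
             (cong (- (ℤ.+ 2 / 1) * K *_) (trans (∑-+ ns _ _) (cong₂ _+_ (∑-A m w) (∑ns-const K)))))))) ⟩
      (ι p * (K * K) + - (ℤ.+ 2 / 1) * K * (- ((nQ - ι (suc m)) * K) + ι p * K)) + ∑ ns (λ r → X m r w * X m r w)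
        ≡⟨ cong (λ t → (ι p * (K * K) + - (ℤ.+ 2 / 1) * K * (- ((t - ι (suc m)) * K) + ι p * K)) + ∑ ns (λ r → X m r w * X m r w)) nQ-ι ⟩
      (ι p * (K * K) + - (ℤ.+ 2 / 1) * K * (- ((1ℚ + ι p - (1ℚ + ι m)) * K) + ι p * K)) + ∑ ns (λ r → X m r w * X m r w)
        ≡⟨ (solve 5 (λ q k N′ f x → (q :* (N′ :* f :* (N′ :* f)) :+ (:- con (ℤ.+ 2 / 1)) :* (N′ :* f) :*
            (:- ((con 1ℚ :+ q :- (con 1ℚ :+ k)) :* (N′ :* f)) :+ q :* (N′ :* f))) :+ x := (q :- con (ℤ.+ 2 / 1) :* k) :* (N′ :* N′) :*
            (f :* f) :+ x) refl (ι p) (ι m) (nQ - ι m) (F m w) (∑ ns (λ r → X m r w * X m r w))) ⟩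
      (ι p - (ℤ.+ 2 / 1) * ι m) * ((nQ - ι m) * (nQ - ι m)) * (F m w * F m w) + ∑ ns (λ r → X m r w * X m r w) ∎
      where
      open ≡-Reasoning
      K : ℚ
      K = (nQ - ι m) * F m w

    -- Cauchy-Schwarz over the m merges reduces to squares of F at the entries -r, r + y. Letting y
    -- run over all of ℤ/n only adds squares and makes the second entry free; its value 0 gives the
    -- multiple of `Y m`, the others give `Y (suc m)`.
    ∑-X² : ∀ m → V m (λ w → ∑ ns (λ r → X m r w * X m r w)) ≤ ι m * ι m * ((nQ - ι m) * (nQ - ι m) * Y m + Y (suc m))
    ∑-X² zero = ℚP.≤-reflexive (trans (cong (_+ 0ℚ) (∑-≡0 ns λ r → refl)) (sym (ℚP.*-zeroˡ ((nQ - ι 0) * (nQ - ι 0) * Y 0 + Y 1))))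
    ∑-X² (suc m) = begin
      V (suc m) (λ w → ∑ ns (λ r → X (suc m) r w * X (suc m) r w)) ≤⟨ ∑-mono (vecs ns (suc m)) (λ w → ∑-mono ns λ r → S-cauchy r w _) ⟩
      V (suc m) (λ w → ∑ ns (λ r → ι (suc m) * S r w (f r))) ≡⟨ trans (∑-cong (vecs ns (suc m)) λ w → ∑-*ˡ ns (ι (suc m)) _)
          (∑-*ˡ (vecs ns (suc m)) (ι (suc m)) _) ⟩
      ι (suc m) * V (suc m) (λ w → ∑ ns (λ r → S r w (f r))) ≡⟨ cong (ι (suc m) *_) (∑-swap (vecs ns (suc m)) ns _) ⟩
      ι (suc m) * ∑ ns (λ r → V (suc m) (λ w → S r w (f r)))
        ≡⟨ cong (ι (suc m) *_) (∑-cong ns λ r → trans (∑-cong (vecs ns (suc m)) λ w → sym (ℚP.*-identityˡ _))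
             (trans (V-S m r (f r) (λ _ → 1ℚ) (λ q → F²-symm (2 ℕ.+ m) (~cons (⊟ r) q)) (λ _ → refl))
                 (cong (ι (suc m) *_) (∑-cong ns λ y → ∑-cong (vecs ns m) λ w → ℚP.*-identityˡ _)))) ⟩
      ι (suc m) * ∑ ns (λ r → ι (suc m) * ∑ ns (λ y → V m (λ w → f r ((r ⊞ y) ∷ w))))
        ≡⟨ trans (cong (ι (suc m) *_) (∑-*ˡ ns (ι (suc m)) _)) (sym (ℚP.*-assoc (ι (suc m)) (ι (suc m)) _)) ⟩
      ι (suc m) * ι (suc m) * ∑ ns (λ r → ∑ ns (λ y → V m (λ w → f r ((r ⊞ y) ∷ w))))
        ≡⟨ cong (ι (suc m) * ι (suc m) *_) (trans (∑-cong ns λ r → ∑-swap ns (vecs ns m) _) (∑-swap ns (vecs ns m) _)) ⟩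
      ι (suc m) * ι (suc m) * V m (λ w → ∑ ns (λ r → ∑ ns (λ y → f r ((r ⊞ y) ∷ w))))
        ≤⟨ *-mono (0≤* (ι≥0 (suc m)) (ι≥0 (suc m))) (∑-mono (vecs ns m) inner) ⟩
      ι (suc m) * ι (suc m) * V m (λ w → N′ * N′ * ∑ ns (λ r → F (suc m) (r ∷ w) * F (suc m) (r ∷ w)) + ∑ ns (λ r → ∑ ns (λ y → h r y w)))
        ≡⟨ cong (ι (suc m) * ι (suc m) *_) (trans (∑-+ (vecs ns m) _ _) (cong₂ _+_
            (trans (∑-*ˡ (vecs ns m) (N′ * N′) _) (cong (N′ * N′ *_) (trans (∑-swap (vecs ns m) ns _) (sym (V-suc m _)))))
             (trans (∑-swap (vecs ns m) ns _) (trans (∑-cong ns λ r → trans (∑-swap (vecs ns m) ns _) (sym (V-suc m _)))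
                 (sym (V-suc (suc m) _)))))) ⟩
      ι (suc m) * ι (suc m) * (N′ * N′ * Y (suc m) + Y (2 ℕ.+ m)) ∎
      where
      open ℚP.≤-Reasoning
      N′ : ℚ
      N′ = nQ - ι (suc m)
      f : G → Vec G (suc m) → ℚ
      f r w = F (2 ℕ.+ m) ((⊟ r) ∷ w) * F (2 ℕ.+ m) ((⊟ r) ∷ w)
      h : G → G → Vec G m → ℚ
      h r y w = F (2 ℕ.+ m) (r ∷ y ∷ w) * F (2 ℕ.+ m) (r ∷ y ∷ w)
      inner : ∀ w → ∑ ns (λ r → ∑ ns (λ y → f r ((r ⊞ y) ∷ w))) ≤ N′ * N′ * ∑ ns (λ r → F (suc m) (r ∷ w) * F (suc m) (r ∷ w)) + ∑ ns
          (λ r → ∑ ns (λ y → h r y w))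
      inner w = begin
        ∑ ns (λ r → ∑ ns (λ y → f r ((r ⊞ y) ∷ w))) ≤⟨ ∑-mono ns (λ r → ≤-by (sq≥0 (F (2 ℕ.+ m) ((⊟ r) ∷ (r ⊞ zero) ∷ w)))
            (trans (∑-gs (λ y → f r ((r ⊞ y) ∷ w))) (ℚP.+-comm (f r ((r ⊞ zero) ∷ w)) (∑ ns (λ y → f r ((r ⊞ y) ∷ w)))))) ⟩
        ∑ ns (λ r → ∑ gs (λ y → f r ((r ⊞ y) ∷ w))) ≡⟨ ∑-cong ns (λ r → trans (∑-cong gs λ y → cong (λ t → f r (t ∷ w)) (⊞-comm r y))
            (∑-translate r (λ y → f r (y ∷ w)))) ⟩
        ∑ ns (λ r → ∑ gs (λ y → f r (y ∷ w))) ≡⟨ ∑ns-⊟ (λ r → ∑ gs (λ y → h r y w)) ⟩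
        ∑ ns (λ r → ∑ gs (λ y → h r y w)) ≡⟨ ∑-cong ns (λ r → ∑-gs (λ y → h r y w)) ⟩
        ∑ ns (λ r → h r zero w + ∑ ns (λ y → h r y w)) ≡⟨ ∑-+ ns _ _ ⟩
        ∑ ns (λ r → h r zero w) + ∑ ns (λ r → ∑ ns (λ y → h r y w))
          ≡⟨ cong (_+ ∑ ns (λ r → ∑ ns (λ y → h r y w))) (trans (∑-cong ns λ r → trans (cong₂ _*_ (F-zero₂ m r w) (F-zero₂ m r w))
              (solve 2 (λ N′ f → N′ :* f :* (N′ :* f) := N′ :* N′ :* (f :* f)) refl N′ (F (suc m) (r ∷ w)))) (∑-*ˡ ns (N′ * N′) _)) ⟩
        N′ * N′ * ∑ ns (λ r → F (suc m) (r ∷ w) * F (suc m) (r ∷ w)) + ∑ ns (λ r → ∑ ns (λ y → h r y w)) ∎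

    Bounded : ℕ → ℚ → Set
    Bounded m B = ∀ v → NZ v → ∣ F m v ∣ ≤ B

    ∑ns-δ : ∀ {r} (h : G → ℚ) → r ≢ zero → ∑ ns (λ y → δ zero (r ⊞ y) * h y) ≡ h (⊟ r)
    ∑ns-δ {r} h q = trans (∑ns-gs _) (trans (cong₂ _-_ (trans (∑-cong gs λ y → cong (_* h y) (e y)) (∑-δ (⊟ r) h))
        (trans (cong (λ t → δ zero t * h zero) (⊞-idʳ r)) (trans (cong (_* h zero) (δ-≢ (q ∘ sym))) (ℚP.*-zeroˡ (h zero)))))
            (solve 1 (λ x → x :- con 0ℚ := x) refl (h (⊟ r))))
      where
      e : ∀ y → δ zero (r ⊞ y) ≡ δ (⊟ r) y
      e y with y FinP.≟ (⊟ r)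
      ... | yes refl = trans (cong (δ zero) (⊞-invʳ r)) (sym (δ-refl (⊟ r)))
      ... | no ne = trans (δ-≢ (λ eq → ne (⊟-unique (trans (⊞-comm y r) (sym eq))))) (sym (δ-≢ (ne ∘ sym)))

    1-δ : ∀ {k} (a b : Fin k) → (δ a b ≡ 1ℚ) ⊎ (δ a b ≡ 0ℚ × a ≢ b)
    1-δ a b with a FinP.≟ b
    ... | yes refl = inj₁ (δ-refl a)
    ... | no ne = inj₂ (δ-≢ ne , ne)

    -- In the expansion with g = F² the pairs with y = -r merge to 0 and contribute the sum of A²
    -- times (n - m) F: the main term and, from the sum of X², the error E₁. All other pairs form
    -- E₂, bounded by the sup of F at length m + 1 times the second moment.
    Z-rec : ∀ m {B₀ B₁} → ι m ≤ nQ → 0ℚ ≤ B₀ → 0ℚ ≤ B₁ → Bounded m B₀ → Bounded (suc m) B₁ →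
      ∣ Z (2 ℕ.+ m) + ι (suc m) * ((ι p - (ℤ.+ 2 / 1) * ι m) * ((nQ - ι m) ^ 3) * Z m) ∣ ≤
      ι (suc m) * ((nQ - ι m) * (B₀ * (ι m * ι m * ((nQ - ι m) * (nQ - ι m) * Y m + Y (suc m)))) + B₁ * Y (2 ℕ.+ m))
    Z-rec m {B₀} {B₁} m≤n B₀≥0 B₁≥0 bd₀ bd₁ = begin
      ∣ Z (2 ℕ.+ m) + ι (suc m) * (C * N′ ^ 3 * Z m) ∣ ≡⟨ cong (λ t → ∣ t + ι (suc m) * (C * N′ ^ 3 * Z m) ∣) eqZ ⟩
      ∣ - ι (suc m) * ((C * N′ ^ 3 * Z m + N′ * E₁) + E₂) + ι (suc m) * (C * N′ ^ 3 * Z m) ∣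
        ≡⟨ cong ∣_∣ (solve 4 (λ k z e E₂ → (:- k) :* ((z :+ e) :+ E₂) :+ k :* z := :- (k :* (e :+ E₂))) refl (ι (suc m)) (C * N′ ^ 3 * Z m)
            (N′ * E₁) E₂) ⟩
      ∣ - (ι (suc m) * (N′ * E₁ + E₂)) ∣ ≡⟨ trans (ℚP.∣-p∣≡∣p∣ (ι (suc m) * (N′ * E₁ + E₂))) (∣∣-*-nonNegˡ (N′ * E₁ + E₂) (ι≥0 (suc m))) ⟩
      ι (suc m) * ∣ N′ * E₁ + E₂ ∣ ≤⟨ *-mono (ι≥0 (suc m)) (ℚP.≤-trans (ℚP.∣p+q∣≤∣p∣+∣q∣ (N′ * E₁) E₂) (ℚP.+-mono-≤
          (ℚP.≤-trans (ℚP.≤-reflexive (∣∣-*-nonNegˡ E₁ N′≥0)) (*-mono N′≥0 b₁)) b₂)) ⟩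
      ι (suc m) * (N′ * (B₀ * (ι m * ι m * (N′ * N′ * Y m + Y (suc m)))) + B₁ * Y (2 ℕ.+ m)) ∎
      where
      open ℚP.≤-Reasoning
      N′ C E₁ E₂ : ℚ
      N′ = nQ - ι m
      C = ι p - (ℤ.+ 2 / 1) * ι m
      N′≥0 : 0ℚ ≤ N′
      N′≥0 = ≤-diff m≤n
      T : G → G → Vec G m → ℚ
      T r y w = F (2 ℕ.+ m) (r ∷ y ∷ w) * F (2 ℕ.+ m) (r ∷ y ∷ w) * F (suc m) ((r ⊞ y) ∷ w)
      T′ : G → G → Vec G m → ℚ
      T′ r y w = (1ℚ - δ zero (r ⊞ y)) * T r y w
      E₁ = V m (λ w → F m w * ∑ ns (λ r → X m r w * X m r w))
      E₂ = V m (λ w → ∑ ns (λ r → ∑ ns (λ y → T′ r y w)))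
      inner : ∀ w → ∑ ns (λ r → ∑ ns (λ y → T r y w)) ≡
        (C * N′ ^ 3 * (F m w * F m w * F m w) + N′ * (F m w * ∑ ns (λ r → X m r w * X m r w))) + ∑ ns (λ r → ∑ ns (λ y → T′ r y w))
      inner w = begin-equality
        ∑ ns (λ r → ∑ ns (λ y → T r y w)) ≡⟨ ∑-cong ns (λ r → trans (∑-cong ns λ y →
            (solve 2 (λ d t → t := d :* t :+ (con 1ℚ :- d) :* t) refl (δ zero (r ⊞ y)) (T r y w))) (∑-+ ns _ _)) ⟩
        ∑ ns (λ r → ∑ ns (λ y → δ zero (r ⊞ y) * T r y w) + ∑ ns (λ y → T′ r y w)) ≡⟨ ∑-+ ns _ _ ⟩
        ∑ ns (λ r → ∑ ns (λ y → δ zero (r ⊞ y) * T r y w)) + E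
          ≡⟨ cong (_+ E) (∑ns-cong λ r q → trans (∑ns-δ (λ y → T r y w) q)
              (cong (A m r w * A m r w *_) (trans (cong (λ t → F (suc m) (t ∷ w)) (⊞-invʳ r)) (F-zero m w)))) ⟩
        ∑ ns (λ r → A m r w * A m r w * (N′ * F m w)) + E ≡⟨ cong (_+ E)
            (trans (∑-*ʳ ns (N′ * F m w) _) (cong (_* (N′ * F m w)) (∑-A² m w))) ⟩
        (C * (N′ * N′) * (F m w * F m w) + ∑ ns (λ r → X m r w * X m r w)) * (N′ * F m w) + E
          ≡⟨ (solve 5 (λ C N′ f x E → (C :* (N′ :* N′) :* (f :* f) :+ x) :* (N′ :* f) :+ E :=
              (C :* (N′ :* (N′ :* (N′ :* con 1ℚ))) :* (f :* f :* f) :+ N′ :* (f :* x)) :+ E) refl C N′ (F m w)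
              (∑ ns (λ r → X m r w * X m r w)) E) ⟩
        (C * N′ ^ 3 * (F m w * F m w * F m w) + N′ * (F m w * ∑ ns (λ r → X m r w * X m r w))) + E ∎
        where
        E : ℚ
        E = ∑ ns (λ r → ∑ ns (λ y → T′ r y w))
      eqZ : Z (2 ℕ.+ m) ≡ - ι (suc m) * ((C * N′ ^ 3 * Z m + N′ * E₁) + E₂)
      eqZ = trans (V-expand m (λ v → F (2 ℕ.+ m) v * F (2 ℕ.+ m) v) (F²-symm (2 ℕ.+ m)))
          (cong (- ι (suc m) *_) (trans (∑-cong (vecs ns m) inner)
         (trans (∑-+ (vecs ns m) _ _) (cong (_+ E₂) (trans (∑-+ (vecs ns m) _ _)
             (cong₂ _+_ (∑-*ˡ (vecs ns m) (C * N′ ^ 3) _) (∑-*ˡ (vecs ns m) N′ _)))))))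
      X²≥0 : ∀ w → 0ℚ ≤ ∑ ns (λ r → X m r w * X m r w)
      X²≥0 w = ∑≥0 ns λ r → sq≥0 (X m r w)
      b₁ : ∣ E₁ ∣ ≤ B₀ * (ι m * ι m * (N′ * N′ * Y m + Y (suc m)))
      b₁ = begin
        ∣ E₁ ∣ ≤⟨ ∑-abs (vecs ns m) _ ⟩
        V m (λ w → ∣ F m w * ∑ ns (λ r → X m r w * X m r w) ∣) ≤⟨ V-mono m
            (λ w q → ℚP.≤-trans (ℚP.≤-reflexive (trans (∣∣-* (F m w) _) (cong (∣ F m w ∣ *_) (ℚP.0≤p⇒∣p∣≡p (X²≥0 w)))))
            (*-monoʳ (X²≥0 w) (bd₀ w q))) ⟩
        V m (λ w → B₀ * ∑ ns (λ r → X m r w * X m r w)) ≡⟨ ∑-*ˡ (vecs ns m) B₀ _ ⟩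
        B₀ * V m (λ w → ∑ ns (λ r → X m r w * X m r w)) ≤⟨ *-mono B₀≥0 (∑-X² m) ⟩
        B₀ * (ι m * ι m * (N′ * N′ * Y m + Y (suc m))) ∎
      T′-bound : ∀ w → NZ w → ∀ r y → ∣ T′ r y w ∣ ≤ B₁ * (F (2 ℕ.+ m) (r ∷ y ∷ w) * F (2 ℕ.+ m) (r ∷ y ∷ w))
      T′-bound w nz r y with 1-δ zero (r ⊞ y)
      ... | inj₁ e = ℚP.≤-trans (ℚP.≤-reflexive (cong ∣_∣ (trans (cong (λ t → (1ℚ - t) * T r y w) e)
          (solve 1 (λ t → (con 1ℚ :- con 1ℚ) :* t := con 0ℚ) refl (T r y w))))) (0≤* B₁≥0 (sq≥0 (F (2 ℕ.+ m) (r ∷ y ∷ w))))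
      ... | inj₂ (e , ne) = begin
        ∣ T′ r y w ∣ ≡⟨ cong ∣_∣ (trans (cong (λ t → (1ℚ - t) * T r y w) e) (solve 1 (λ t → (con 1ℚ :- con 0ℚ) :* t := t) refl (T r y w))) ⟩
        ∣ T r y w ∣ ≡⟨ ∣∣-*-nonNegˡ (F (suc m) ((r ⊞ y) ∷ w)) (sq≥0 (F (2 ℕ.+ m) (r ∷ y ∷ w))) ⟩
        f² * ∣ F (suc m) ((r ⊞ y) ∷ w) ∣ ≤⟨ *-mono (sq≥0 (F (2 ℕ.+ m) (r ∷ y ∷ w))) (bd₁ _ ((ne ∘ sym) , nz)) ⟩
        f² * B₁ ≡⟨ ℚP.*-comm f² B₁ ⟩
        B₁ * f² ∎
        where
        f² = F (2 ℕ.+ m) (r ∷ y ∷ w) * F (2 ℕ.+ m) (r ∷ y ∷ w)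
      b₂ : ∣ E₂ ∣ ≤ B₁ * Y (2 ℕ.+ m)
      b₂ = begin
        ∣ E₂ ∣ ≤⟨ ∑-abs (vecs ns m) _ ⟩
        V m (λ w → ∣ ∑ ns (λ r → ∑ ns (λ y → T′ r y w)) ∣) ≤⟨ V-mono m (λ w nz → ℚP.≤-trans (∑-abs ns _)
            (∑-mono ns λ r → ℚP.≤-trans (∑-abs ns _) (∑-mono ns λ y → T′-bound w nz r y))) ⟩
        V m (λ w → ∑ ns (λ r → ∑ ns (λ y → B₁ * g r y w))) ≡⟨ trans (∑-cong (vecs ns m) λ w → trans (∑-cong ns λ r → ∑-*ˡ ns B₁ _)
            (∑-*ˡ ns B₁ _)) (∑-*ˡ (vecs ns m) B₁ _) ⟩
        B₁ * V m (λ w → ∑ ns (λ r → ∑ ns (λ y → g r y w)))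
          ≡⟨ cong (B₁ *_) (trans (∑-swap (vecs ns m) ns _) (trans (∑-cong ns λ r → trans (∑-swap (vecs ns m) ns _) (sym (V-suc m _)))
              (sym (V-suc (suc m) _)))) ⟩
        B₁ * Y (2 ℕ.+ m) ∎
        where
        g : G → G → Vec G m → ℚ
        g r y w = F (2 ℕ.+ m) (r ∷ y ∷ w) * F (2 ℕ.+ m) (r ∷ y ∷ w)

  -- The sup bound

  eqℕ : ∀ {k} → Fin k → Fin k → ℕ
  eqℕ zero zero = 1
  eqℕ zero (suc _) = 0
  eqℕ (suc _) zero = 0
  eqℕ (suc i) (suc j) = eqℕ i j

  eqℕ-refl : ∀ {k} (i : Fin k) → eqℕ i i ≡ 1
  eqℕ-refl zero = refl
  eqℕ-refl (suc i) = eqℕ-refl i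

  eqℕ-≢ : ∀ {k} {i j : Fin k} → i ≢ j → eqℕ i j ≡ 0
  eqℕ-≢ {i = zero} {zero} ne = ⊥-elim (ne refl)
  eqℕ-≢ {i = zero} {suc j} ne = refl
  eqℕ-≢ {i = suc i} {zero} ne = refl
  eqℕ-≢ {i = suc i} {suc j} ne = eqℕ-≢ {i = i} {j} (ne ∘ cong suc)

  count : ∀ {k m} → Fin k → Vec (Fin k) m → ℕ
  count a [] = 0
  count a (x ∷ v) = eqℕ a x ℕ.+ count a v

  count-~ : ∀ {k m} (a : Fin k) {u v : Vec (Fin k) m} → u ~ v → count a u ≡ count a v
  count-~ a ~refl = refl
  count-~ a (~cons x q) = cong (eqℕ a x ℕ.+_) (count-~ a q)
  count-~ a (~swap x y {u}) = trans (sym (ℕP.+-assoc (eqℕ a x) (eqℕ a y) (count a u)))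
    (trans (cong (ℕ._+ count a u) (ℕP.+-comm (eqℕ a x) (eqℕ a y))) (ℕP.+-assoc (eqℕ a y) (eqℕ a x) (count a u)))
  count-~ a (~trans q q′) = trans (count-~ a q) (count-~ a q′)

  count-extract : ∀ {k m} (a : Fin k) (v : Vec (Fin k) (suc m)) → 0 ℕ.< count a v → ∃[ w ] (v ~ a ∷ w)
  count-extract {m = m} a (x ∷ v) l with a FinP.≟ x
  ... | yes refl = v , ~refl
  count-extract {m = zero} a (x ∷ []) l | no ne = ⊥-elim (ℕP.<-irrefl refl (subst (0 ℕ.<_) (cong (ℕ._+ 0) (eqℕ-≢ ne)) l))
  count-extract {m = suc m} a (x ∷ v) l | no ne with count-extract a v (subst (0 ℕ.<_) (cong (ℕ._+ count a v) (eqℕ-≢ ne)) l)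
  ... | w , q = x ∷ w , ~trans (~cons x q) (~swap x a)

  count-sum≤ : ∀ {k m} {a b : Fin k} → a ≢ b → (v : Vec (Fin k) m) → count a v ℕ.+ count b v ℕ.≤ m
  count-sum≤ ne [] = z≤n
  count-sum≤ {a = a} {b} ne (x ∷ v) = ℕP.≤-trans (ℕP.≤-reflexive (re (eqℕ a x) (count a v) (eqℕ b x) (count b v)))
      (ℕP.+-mono-≤ h (count-sum≤ ne v))
    where
    re : ∀ p q r s → (p ℕ.+ q) ℕ.+ (r ℕ.+ s) ≡ (p ℕ.+ r) ℕ.+ (q ℕ.+ s)
    re p q r s = trans (ℕP.+-assoc p q (r ℕ.+ s)) (trans (cong (p ℕ.+_) (trans (sym (ℕP.+-assoc q r s))
        (trans (cong (ℕ._+ s) (ℕP.+-comm q r)) (ℕP.+-assoc r q s)))) (sym (ℕP.+-assoc p r (q ℕ.+ s))))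
    h : eqℕ a x ℕ.+ eqℕ b x ℕ.≤ 1
    h with a FinP.≟ x
    ... | yes refl = ℕP.≤-reflexive (cong₂ ℕ._+_ (eqℕ-refl a) (eqℕ-≢ (ne ∘ sym)))
    ... | no ne₁ with b FinP.≟ x
    ...   | yes refl = ℕP.≤-reflexive (cong₂ ℕ._+_ (eqℕ-≢ ne₁) (eqℕ-refl b))
    ...   | no ne₂ = subst (ℕ._≤ 1) (sym (cong₂ ℕ._+_ (eqℕ-≢ ne₁) (eqℕ-≢ ne₂))) z≤n

  module Sup (p : ℕ) where
    open Group p
    open Moments p

    -- The shape that arises when r is merged into an entry -r of a vector of nonzero entries:
    -- exactly one zero.
    OneZero : ∀ {m} → Vec G m → Set
    OneZero [] = ⊥
    OneZero (x ∷ v) = (x ≡ zero × NZ v) ⊎ (x ≢ zero × OneZero v)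

    OneZero-extract : ∀ {m} (v : Vec G (suc m)) → OneZero v → ∃[ w ] (NZ w × v ~ zero ∷ w)
    OneZero-extract (x ∷ v) (inj₁ (refl , nz)) = v , nz , ~refl
    OneZero-extract {zero} (x ∷ []) (inj₂ (_ , ()))
    OneZero-extract {suc m} (x ∷ v) (inj₂ (ne , oz)) with OneZero-extract v oz
    ... | w , nz , q = x ∷ w , (ne , nz) , ~trans (~cons x q) (~swap x zero)

    NZ-~ : ∀ {m} {u v : Vec G m} → u ~ v → NZ u → NZ v
    NZ-~ ~refl q = q
    NZ-~ (~cons x e) (a , b) = a , NZ-~ e b
    NZ-~ (~swap x y) (a , b , c) = b , a , c
    NZ-~ (~trans e e′) q = NZ-~ e′ (NZ-~ e q)

    -- Only entries equal to -r turn into 0 when r is merged into them; these are charged to A₁, and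
    -- B covers the merges that stay nonzero.
    S-bound : ∀ {m} r (v : Vec G m) (f : Vec G m → ℚ) {A₁ B : ℚ} → NZ v → 0ℚ ≤ A₁ → 0ℚ ≤ B →
      (∀ w → OneZero w → ∣ f w ∣ ≤ A₁) → (∀ w → NZ w → ∣ f w ∣ ≤ B) →
      ∣ S r v f ∣ ≤ ι (count (⊟ r) v) * A₁ + ι m * B
    S-bound r [] f {A₁} {B} nz a b hA hB = ℚP.≤-reflexive (solve 2 (λ A₁ B → con 0ℚ := con 0ℚ :* A₁ :+ con 0ℚ :* B) refl A₁ B)
    S-bound {suc m} r (y ∷ ys) f {A₁} {B} (y≢0 , nz) a b hA hB = ℚP.≤-trans (ℚP.∣p+q∣≤∣p∣+∣q∣ (f ((r ⊞ y) ∷ ys)) (S r ys (λ w → f (y ∷ w))))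
      (ℚP.≤-trans (ℚP.+-mono-≤ head (S-bound r ys (λ w → f (y ∷ w)) nz a b (λ w q → hA (y ∷ w) (inj₂ (y≢0 , q)))
          (λ w q → hB (y ∷ w) (y≢0 , q))))
        (ℚP.≤-reflexive (trans (solve 5 (λ e A₁ B c k → (e :* A₁ :+ B) :+ (c :* A₁ :+ k :* B) := (e :+ c) :* A₁ :+ (con 1ℚ :+ k) :* B) refl
            (ι (eqℕ (⊟ r) y)) A₁ B (ι (count (⊟ r) ys)) (ι m))
           (cong (λ t → t * A₁ + ι (suc m) * B) (sym (ι-+ (eqℕ (⊟ r) y) (count (⊟ r) ys)))))))
      where
      head : ∣ f ((r ⊞ y) ∷ ys) ∣ ≤ ι (eqℕ (⊟ r) y) * A₁ + B
      head with (r ⊞ y) FinP.≟ zero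
      ... | yes e = ℚP.≤-trans (hA _ (inj₁ (e , nz))) (≤-by b (trans (cong (λ t → ι t * A₁ + B)
          (trans (cong (eqℕ (⊟ r)) (⊟-unique (trans (⊞-comm y r) e))) (eqℕ-refl (⊟ r))))
          (solve 2 (λ A₁ B → (con 1ℚ :+ con 0ℚ) :* A₁ :+ B := A₁ :+ B) refl A₁ B)))
      ... | no ne = ℚP.≤-trans (hB _ (ne , nz)) (≤-by (0≤* (ι≥0 (eqℕ (⊟ r) y)) a) (ℚP.+-comm (ι (eqℕ (⊟ r) y) * A₁) B))

    F-few : ∀ m {B₀ B₁} → ι m ≤ nQ → 0ℚ ≤ B₀ → 0ℚ ≤ B₁ → Bounded m B₀ → Bounded (suc m) B₁ → ∀ r v → r ≢ zero → NZ v → 2 ℕ.* count (⊟ r) v ℕ.≤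
        2 ℕ.+ m → ∣ F (2 ℕ.+ m) (r ∷ v) ∣ ≤ ½ * ι (2 ℕ.+ m) * ((nQ - ι m) * B₀) + ι (suc m) * B₁
    F-few m {B₀} {B₁} m≤n B₀≥0 B₁≥0 bd₀ bd₁ r v r≢0 nz le = ℚP.≤-trans (ℚP.≤-reflexive
        (trans (cong ∣_∣ (F-nz (suc m) v r≢0)) (ℚP.∣-p∣≡∣p∣ (S r v (F (suc m))))))
        (ℚP.≤-trans (S-bound r v (F (suc m)) nz (0≤* (≤-diff m≤n) B₀≥0) B₁≥0
          (λ w oz → let (w′ , nz′ , q) = OneZero-extract w oz in
             ℚP.≤-trans (ℚP.≤-reflexive (trans (cong ∣_∣ (trans (F-symm (suc m) q) (F-zero m w′))) (∣∣-*-nonNegˡ (F m w′) (≤-diff m≤n))))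
                 (*-mono (≤-diff m≤n) (bd₀ w′ nz′)))
          bd₁)
          (ℚP.+-monoˡ-≤ (ι (suc m) * B₁) (*-monoʳ (0≤* (≤-diff m≤n) B₀≥0) half)))
        where
        half : ι (count (⊟ r) v) ≤ ½ * ι (2 ℕ.+ m)
        half = ℚP.≤-trans (ℚP.≤-reflexive (trans (solve 1 (λ x → x := con (ℤ.+ 1 / 2) :* ((con 1ℚ :+ (con 1ℚ :+ con 0ℚ)) :* x)) refl
            (ι (count (⊟ r) v))) (cong (½ *_) (sym (ι-* 2 (count (⊟ r) v)))))) (*-mono {c = ½} (ℚP.nonNegative⁻¹ ½) (ι-mono le))

    -- The entries r and −r are distinct, so one of them occurs at most (m + 2)/2 times.
    F-bound : (∀ r → r ⊞ r ≡ zero → r ≡ zero) → ∀ m {B₀ B₁} → ι m ≤ nQ → 0ℚ ≤ B₀ → 0ℚ ≤ B₁ → Bounded m B₀ → Bounded (suc m) B₁ →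
      Bounded (2 ℕ.+ m) (½ * ι (2 ℕ.+ m) * ((nQ - ι m) * B₀) + ι (suc m) * B₁)
    F-bound odd m {B₀} {B₁} m≤n B₀≥0 B₁≥0 bd₀ bd₁ (r ∷ v) (r≢0 , nz) with 2 ℕ.* count (⊟ r) v ℕP.≤? 2 ℕ.+ m
    ... | yes le = F-few m m≤n B₀≥0 B₁≥0 bd₀ bd₁ r v r≢0 nz le
    ... | no gt with count-extract (⊟ r) v (ℕP.≰⇒> λ l → gt (ℕP.≤-trans (ℕP.*-monoʳ-≤ 2 l) z≤n))
    -- Here -r is frequent, so it is moved to the front by symmetry; the entries that it turns into
    -- 0 are then those equal to r, which are rare.
    ...   | w , q = subst (λ t → ∣ t ∣ ≤ ½ * ι (2 ℕ.+ m) * ((nQ - ι m) * B₀) + ι (suc m) * B₁) (F-symm (2 ℕ.+ m) (~sym e))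
                      (F-few m m≤n B₀≥0 B₁≥0 bd₀ bd₁ (⊟ r) (r ∷ w) (proj₁ nz′) (proj₂ nz′) le′)
      where
      e : r ∷ v ~ (⊟ r) ∷ r ∷ w
      e = ~trans (~cons r q) (~swap r (⊟ r))
      nz′ : NZ ((⊟ r) ∷ r ∷ w)
      nz′ = NZ-~ e (r≢0 , nz)
      r≢⊟r : r ≢ ⊟ r
      r≢⊟r eq = r≢0 (odd r (trans (cong (r ⊞_) eq) (⊞-invʳ r)))
      cnt : count r (r ∷ w) ℕ.+ count (⊟ r) v ℕ.≤ 2 ℕ.+ m
      cnt = ℕP.≤-trans (ℕP.≤-reflexive (trans (cong₂ (λ a b → a ℕ.+ b) (cong (ℕ._+ count r w) (eqℕ-refl r)) refl)
          (cong (λ t → suc (t ℕ.+ count (⊟ r) v)) (sym (trans (count-~ r q) (cong (ℕ._+ count r w) (eqℕ-≢ r≢⊟r)))))))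
              (s≤s (count-sum≤ r≢⊟r v))
      le′ : 2 ℕ.* count (⊟ (⊟ r)) (r ∷ w) ℕ.≤ 2 ℕ.+ m
      le′ = subst (λ t → 2 ℕ.* count t (r ∷ w) ℕ.≤ 2 ℕ.+ m) (sym (⊟-invol r)) (arith (count r (r ∷ w)) (count (⊟ r) v) cnt (ℕP.≰⇒> gt))
        where
        arith : ∀ a b → a ℕ.+ b ℕ.≤ 2 ℕ.+ m → 2 ℕ.+ m ℕ.< 2 ℕ.* b → 2 ℕ.* a ℕ.≤ 2 ℕ.+ m
        arith a b h₁ h₂ = ℕP.+-cancelʳ-≤ (2 ℕ.* b) (2 ℕ.* a) (2 ℕ.+ m) (ℕP.≤-trans (ℕP.≤-reflexive (sym (ℕP.*-distribˡ-+ 2 a b)))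
           (ℕP.≤-trans (ℕP.*-monoʳ-≤ 2 h₁) (ℕP.≤-trans (ℕP.≤-reflexive (cong (2 ℕ.+ m ℕ.+_) (ℕP.+-identityʳ (2 ℕ.+ m))))
               (ℕP.+-monoʳ-≤ (2 ℕ.+ m) (ℕP.<⇒≤ h₂)))))

  fact : ℕ → ℚ
  fact zero = 1ℚ
  fact (suc m) = ι (suc m) * fact m

  fact>0 : ∀ m → 0ℚ < fact m
  fact>0 zero = 0<1
  fact>0 (suc m) = 0<* (ι>0 m) (fact>0 m)

  fact≥0 : ∀ m → 0ℚ ≤ fact m
  fact≥0 m = ℚP.<⇒≤ (fact>0 m)

  nonneg : ∀ {q} → .{{NonNegative q}} → 0ℚ ≤ q
  nonneg {q} = ℚP.nonNegative⁻¹ q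

  -- Normalised bounds for the squares of the second moment and of the sup of F: `α m` is 1.3^m m!
  -- and `β m` is 0.6^m (m + 1)!. The leading terms of the two recursions have rates 1 and 1/2; the
  -- slack absorbs the lower ones, while the product 0.78 has to stay below 1.
  α β : ℕ → ℚ
  α zero = 1ℚ
  α (suc m) = (ℤ.+ 13 / 10) * ι (suc m) * α m
  β zero = 1ℚ
  β (suc m) = (ℤ.+ 3 / 5) * ι (2 ℕ.+ m) * β m

  α≥0 : ∀ m → 0ℚ ≤ α m
  α≥0 zero = 0≤1
  α≥0 (suc m) = 0≤* (0≤* (nonneg {ℤ.+ 13 / 10}) (ι≥0 (suc m))) (α≥0 m)

  β≥0 : ∀ m → 0ℚ ≤ β m
  β≥0 zero = 0≤1
  β≥0 (suc m) = 0≤* (0≤* (nonneg {ℤ.+ 3 / 5}) (ι≥0 (2 ℕ.+ m))) (β≥0 m)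

  Y-step : ∀ {N k c N′ Y Y′ f a P} → 0ℚ ≤ N → 0ℚ ≤ k → 0ℚ ≤ a → (ℤ.+ 100 / 1) * k ≤ N → c ≡ N - k →
    Y * Y * P ≤ a * f ^ 4 → Y′ * Y′ * (N * P) ≤ (ℤ.+ 13 / 10) * k * a * (f * N′) ^ 4 → 0ℚ ≤ P →
    let Y″ = k * (c * ((ℤ.+ 2 / 1) * Y′ + N′ * N′ * Y)) in
    Y″ * Y″ * (N * (N * P)) ≤ (ℤ.+ 13 / 10) * (1ℚ + k) * ((ℤ.+ 13 / 10) * k * a) * (f * N′ * c) ^ 4
  Y-step {N} {k} {c} {N′} {Y} {Y′} {f} {a} {P} N≥0 k≥0 a≥0 kN ec h₀ h₁ P≥0 = begin
    k * (c * ((ℤ.+ 2 / 1) * Y′ + N′ * N′ * Y)) * (k * (c * ((ℤ.+ 2 / 1) * Y′ + N′ * N′ * Y))) * (N * (N * P))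
      ≡⟨ (solve 7 (λ k c Y Y′ N′ N P → k :* (c :* (con (ℤ.+ 2 / 1) :* Y′ :+ N′ :* N′ :* Y)) :*
          (k :* (c :* (con (ℤ.+ 2 / 1) :* Y′ :+ N′ :* N′ :* Y))) :* (N :* (N :* P)) := (k :* k :* (c :* c) :* N) :*
          ((N :* P) :* ((con (ℤ.+ 2 / 1) :* Y′ :+ N′ :* N′ :* Y) :* (con (ℤ.+ 2 / 1) :* Y′ :+ N′ :* N′ :* Y)))) refl k c Y Y′ N′ N P) ⟩
    W * ((N * P) * (((ℤ.+ 2 / 1) * Y′ + N′ * N′ * Y) * ((ℤ.+ 2 / 1) * Y′ + N′ * N′ * Y)))
      -- Weighted square: (u + v)² ≤ 5u² + (5/4)v² with u = 2Y′, the term of lower order, so that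
      -- the main term v loses only the factor 5/4.
      ≤⟨ *-mono W≥0 (*-mono (0≤* N≥0 P≥0) (≤-by {a = ((ℤ.+ 2 / 1) * Y′ + N′ * N′ * Y) * ((ℤ.+ 2 / 1) * Y′ + N′ * N′ * Y)}
          (sq≥0 (½ * (N′ * N′ * Y) - (ℤ.+ 4 / 1) * Y′))
        (solve 3 (λ Y Y′ N′ → (con (ℤ.+ 5 / 4) :* (N′ :* N′ :* (N′ :* N′)) :* (Y :* Y) :+ con (ℤ.+ 20 / 1) :* (Y′ :* Y′)) :=
            (con (ℤ.+ 2 / 1) :* Y′ :+ N′ :* N′ :* Y) :* (con (ℤ.+ 2 / 1) :* Y′ :+ N′ :* N′ :* Y) :+
            (con (ℤ.+ 1 / 2) :* (N′ :* N′ :* Y) :- con (ℤ.+ 4 / 1) :* Y′) :* (con (ℤ.+ 1 / 2) :* (N′ :* N′ :* Y) :- con (ℤ.+ 4 / 1) :* Y′))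
            refl Y Y′ N′))) ⟩
    W * ((N * P) * ((ℤ.+ 5 / 4) * (N′ * N′ * (N′ * N′)) * (Y * Y) + (ℤ.+ 20 / 1) * (Y′ * Y′)))
      ≡⟨ cong (W *_) (solve 5 (λ N P N′ Y Y′ → (N :* P) :* (con (ℤ.+ 5 / 4) :* (N′ :* N′ :* (N′ :* N′)) :* (Y :* Y) :+ con (ℤ.+ 20 / 1) :*
          (Y′ :* Y′)) := con (ℤ.+ 5 / 4) :* (N′ :* N′ :* (N′ :* N′)) :* N :* (Y :* Y :* P) :+ con (ℤ.+ 20 / 1) :* (Y′ :* Y′ :* (N :* P))) refl
          N P N′ Y Y′) ⟩
    W * ((ℤ.+ 5 / 4) * (N′ * N′ * (N′ * N′)) * N * (Y * Y * P) + (ℤ.+ 20 / 1) * (Y′ * Y′ * (N * P)))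
      ≤⟨ *-mono W≥0 (ℚP.+-mono-≤ (*-mono (0≤* (0≤* nonneg (sq≥0 (N′ * N′))) N≥0) h₀) (*-mono {c = ℤ.+ 20 / 1} nonneg h₁)) ⟩
    W * ((ℤ.+ 5 / 4) * (N′ * N′ * (N′ * N′)) * N * (a * f ^ 4) + (ℤ.+ 20 / 1) * ((ℤ.+ 13 / 10) * k * a * (f * N′) ^ 4))
      ≡⟨ (solve 6 (λ k c N N′ f a → (k :* k :* (c :* c) :* N) :* (con (ℤ.+ 5 / 4) :* (N′ :* N′ :* (N′ :* N′)) :* N :*
          (a :* (f :* (f :* (f :* (f :* con 1ℚ))))) :+ con (ℤ.+ 20 / 1) :*
          (con (ℤ.+ 13 / 10) :* k :* a :* (f :* N′ :* (f :* N′ :* (f :* N′ :* (f :* N′ :* con 1ℚ)))))) :=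
          (k :* k :* (c :* c) :* (a :* (f :* f :* (f :* f)) :* (N′ :* N′ :* (N′ :* N′)))) :*
          (N :* (con (ℤ.+ 5 / 4) :* N :+ con (ℤ.+ 26 / 1) :* k))) refl k c N N′ f a) ⟩
    W′ * (N * ((ℤ.+ 5 / 4) * N + (ℤ.+ 26 / 1) * k)) ≤⟨ *-mono W′≥0 key ⟩
    W′ * ((ℤ.+ 169 / 100) * (c * c)) ≤⟨ ≤-by (0≤* (0≤* k≥0 (0≤* (sq≥0 (c * c)) (0≤* (0≤* a≥0 (sq≥0 (f * f))) (sq≥0 (N′ * N′)))))
        (nonneg {ℤ.+ 169 / 100}))
       (solve 5 (λ k c N′ f a → con (ℤ.+ 13 / 10) :* (con 1ℚ :+ k) :* (con (ℤ.+ 13 / 10) :* k :* a) :*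
           (f :* N′ :* c :* (f :* N′ :* c :* (f :* N′ :* c :* (f :* N′ :* c :* con 1ℚ)))) :=
           (k :* k :* (c :* c) :* (a :* (f :* f :* (f :* f)) :* (N′ :* N′ :* (N′ :* N′)))) :* (con (ℤ.+ 169 / 100) :* (c :* c)) :+ k :*
           (c :* c :* (c :* c) :* (a :* (f :* f :* (f :* f)) :* (N′ :* N′ :* (N′ :* N′)))) :* con (ℤ.+ 169 / 100)) refl k c N′ f a) ⟩
    (ℤ.+ 13 / 10) * (1ℚ + k) * ((ℤ.+ 13 / 10) * k * a) * (f * N′ * c) ^ 4 ∎
    where
    open ℚP.≤-Reasoning
    W W′ t : ℚ
    W = k * k * (c * c) * N
    W′ = k * k * (c * c) * (a * (f * f * (f * f)) * (N′ * N′ * (N′ * N′)))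
    W≥0 : 0ℚ ≤ W
    W≥0 = 0≤* (0≤* (sq≥0 k) (sq≥0 c)) N≥0
    W′≥0 : 0ℚ ≤ W′
    W′≥0 = 0≤* (0≤* (sq≥0 k) (sq≥0 c)) (0≤* (0≤* a≥0 (sq≥0 (f * f))) (sq≥0 (N′ * N′)))
    t = N - (ℤ.+ 100 / 1) * k
    t≥0 : 0ℚ ≤ t
    t≥0 = ≤-diff kN
    -- The hypothesis 100k ≤ N enters here: in k and t = N - 100k the difference of the sides has
    -- nonnegative coefficients. The 26 is 20 · 1.3 and 169/100 is 1.3².
    key : N * ((ℤ.+ 5 / 4) * N + (ℤ.+ 26 / 1) * k) ≤ (ℤ.+ 169 / 100) * (c * c)
    key = ≤-by (0≤+ (0≤+ (0≤* (nonneg {ℤ.+ 1463 / 1}) (sq≥0 k)) (0≤* (nonneg {ℤ.+ 58 / 1}) (0≤* k≥0 t≥0)))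
                 (0≤+ (0≤* (nonneg {ℤ.+ 11 / 25}) (sq≥0 t)) (0≤+ (0≤* (nonneg {ℤ.+ 69 / 100}) (sq≥0 k))
                     (0≤* (nonneg {ℤ.+ 31 / 50}) (0≤* k≥0 t≥0)))))
      (trans (cong (λ x → (ℤ.+ 169 / 100) * (x * x)) ec)
       (solve 2 (λ N k → con (ℤ.+ 169 / 100) :* ((N :- k) :* (N :- k)) := N :* (con (ℤ.+ 5 / 4) :* N :+ con (ℤ.+ 26 / 1) :* k) :+
           ((con (ℤ.+ 1463 / 1) :* (k :* k) :+ con (ℤ.+ 58 / 1) :* (k :* (N :- con (ℤ.+ 100 / 1) :* k))) :+
           (con (ℤ.+ 11 / 25) :* ((N :- con (ℤ.+ 100 / 1) :* k) :* (N :- con (ℤ.+ 100 / 1) :* k)) :+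
           (con (ℤ.+ 69 / 100) :* (k :* k) :+ con (ℤ.+ 31 / 50) :* (k :* (N :- con (ℤ.+ 100 / 1) :* k)))))) refl N k))

  -- The weighted square of `Y-step` again. The main term now carries (1/2)², and 5/4 of that, 5/16,
  -- has to stay below 0.6² = 9/25.
  Φ-step : ∀ {N k c N′ X X′ f b P} → 0ℚ ≤ N → 0ℚ ≤ k → 0ℚ ≤ b → (ℤ.+ 100 / 1) * k ≤ N → c ≡ N - k →
    X * X * P ≤ b * f ^ 2 → X′ * X′ * (N * P) ≤ (ℤ.+ 3 / 5) * (1ℚ + k) * b * (f * N′) ^ 2 → 0ℚ ≤ P →
    let X″ = ½ * (1ℚ + k) * (N′ * X) + k * X′ in
    X″ * X″ * (N * (N * P)) ≤ (ℤ.+ 3 / 5) * (1ℚ + (1ℚ + k)) * ((ℤ.+ 3 / 5) * (1ℚ + k) * b) * (f * N′ * c) ^ 2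
  Φ-step {N} {k} {c} {N′} {X} {X′} {f} {b} {P} N≥0 k≥0 b≥0 kN ec h₀ h₁ P≥0 = begin
    (½ * (1ℚ + k) * (N′ * X) + k * X′) * (½ * (1ℚ + k) * (N′ * X) + k * X′) * (N * (N * P))
      ≤⟨ *-monoʳ (0≤* N≥0 (0≤* N≥0 P≥0)) (≤-by {a = (½ * (1ℚ + k) * (N′ * X) + k * X′) * (½ * (1ℚ + k) * (N′ * X) + k * X′)}
          (sq≥0 (½ * (½ * (1ℚ + k) * (N′ * X)) - (ℤ.+ 2 / 1) * (k * X′)))
        (solve 4 (λ k N′ X X′ → con (ℤ.+ 5 / 16) :* ((con 1ℚ :+ k) :* (con 1ℚ :+ k)) :* (N′ :* N′) :* (X :* X) :+ con (ℤ.+ 5 / 1) :* (k :* k)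
            :* (X′ :* X′) := (con (ℤ.+ 1 / 2) :* (con 1ℚ :+ k) :* (N′ :* X) :+ k :* X′) :*
            (con (ℤ.+ 1 / 2) :* (con 1ℚ :+ k) :* (N′ :* X) :+ k :* X′) :+
            (con (ℤ.+ 1 / 2) :* (con (ℤ.+ 1 / 2) :* (con 1ℚ :+ k) :* (N′ :* X)) :- con (ℤ.+ 2 / 1) :* (k :* X′)) :*
            (con (ℤ.+ 1 / 2) :* (con (ℤ.+ 1 / 2) :* (con 1ℚ :+ k) :* (N′ :* X)) :- con (ℤ.+ 2 / 1) :* (k :* X′))) refl k N′ X X′)) ⟩
    ((ℤ.+ 5 / 16) * ((1ℚ + k) * (1ℚ + k)) * (N′ * N′) * (X * X) + (ℤ.+ 5 / 1) * (k * k) * (X′ * X′)) * (N * (N * P))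
      ≡⟨ (solve 6 (λ k N′ X X′ N P → (con (ℤ.+ 5 / 16) :* ((con 1ℚ :+ k) :* (con 1ℚ :+ k)) :* (N′ :* N′) :* (X :* X) :+ con (ℤ.+ 5 / 1) :*
          (k :* k) :* (X′ :* X′)) :* (N :* (N :* P)) := con (ℤ.+ 5 / 16) :* ((con 1ℚ :+ k) :* (con 1ℚ :+ k)) :* (N′ :* N′) :* (N :* N) :*
          (X :* X :* P) :+ con (ℤ.+ 5 / 1) :* (k :* k) :* N :* (X′ :* X′ :* (N :* P))) refl k N′ X X′ N P) ⟩
    (ℤ.+ 5 / 16) * ((1ℚ + k) * (1ℚ + k)) * (N′ * N′) * (N * N) * (X * X * P) + (ℤ.+ 5 / 1) * (k * k) * N * (X′ * X′ * (N * P))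
      ≤⟨ ℚP.+-mono-≤ (*-mono (0≤* (0≤* (0≤* nonneg (sq≥0 (1ℚ + k))) (sq≥0 N′)) (sq≥0 N)) h₀) (*-mono (0≤* (0≤* nonneg (sq≥0 k)) N≥0) h₁) ⟩
    (ℤ.+ 5 / 16) * ((1ℚ + k) * (1ℚ + k)) * (N′ * N′) * (N * N) * (b * f ^ 2) + (ℤ.+ 5 / 1) * (k * k) * N *
        ((ℤ.+ 3 / 5) * (1ℚ + k) * b * (f * N′) ^ 2)
      ≤⟨ ≤-by (0≤* (0≤* (0≤* nonneg (0≤* k≥0 (0≤+ 0≤1 k≥0))) N≥0) (0≤* b≥0 (sq≥0 (f * N′))))
         (solve 5 (λ k N′ N b f → ((con 1ℚ :+ k) :* (con 1ℚ :+ k)) :* (b :* (f :* N′ :* (f :* N′))) :*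
             (N :* (con (ℤ.+ 5 / 16) :* N :+ con (ℤ.+ 3 / 1) :* k)) := (con (ℤ.+ 5 / 16) :* ((con 1ℚ :+ k) :* (con 1ℚ :+ k)) :* (N′ :* N′) :*
             (N :* N) :* (b :* (f :* (f :* con 1ℚ))) :+ con (ℤ.+ 5 / 1) :* (k :* k) :* N :*
             (con (ℤ.+ 3 / 5) :* (con 1ℚ :+ k) :* b :* (f :* N′ :* (f :* N′ :* con 1ℚ)))) :+ con (ℤ.+ 3 / 1) :* (k :* (con 1ℚ :+ k)) :* N :*
             (b :* (f :* N′ :* (f :* N′)))) refl k N′ N b f) ⟩
    ((1ℚ + k) * (1ℚ + k)) * (b * (f * N′ * (f * N′))) * (N * ((ℤ.+ 5 / 16) * N + (ℤ.+ 3 / 1) * k))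
      ≤⟨ *-mono (0≤* (sq≥0 (1ℚ + k)) (0≤* b≥0 (sq≥0 (f * N′)))) key ⟩
    ((1ℚ + k) * (1ℚ + k)) * (b * (f * N′ * (f * N′))) * ((ℤ.+ 9 / 25) * (c * c))
      ≤⟨ ≤-by (0≤* (0≤+ 0≤1 k≥0) (0≤* (0≤* b≥0 (sq≥0 (f * N′))) (0≤* (nonneg {ℤ.+ 9 / 25}) (sq≥0 c))))
        (solve 5 (λ k N′ c b f → con (ℤ.+ 3 / 5) :* (con 1ℚ :+ (con 1ℚ :+ k)) :* (con (ℤ.+ 3 / 5) :* (con 1ℚ :+ k) :* b) :*
            (f :* N′ :* c :* (f :* N′ :* c :* con 1ℚ)) := ((con 1ℚ :+ k) :* (con 1ℚ :+ k)) :* (b :* (f :* N′ :* (f :* N′))) :*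
            (con (ℤ.+ 9 / 25) :* (c :* c)) :+ (con 1ℚ :+ k) :* (b :* (f :* N′ :* (f :* N′)) :* (con (ℤ.+ 9 / 25) :* (c :* c)))) refl k N′ c b
            f) ⟩
    (ℤ.+ 3 / 5) * (1ℚ + (1ℚ + k)) * ((ℤ.+ 3 / 5) * (1ℚ + k) * b) * (f * N′ * c) ^ 2 ∎
    where
    open ℚP.≤-Reasoning
    t : ℚ
    t = N - (ℤ.+ 100 / 1) * k
    t≥0 : 0ℚ ≤ t
    t≥0 = ≤-diff kN
    key : N * ((ℤ.+ 5 / 16) * N + (ℤ.+ 3 / 1) * k) ≤ (ℤ.+ 9 / 25) * (c * c)
    key = ≤-by (0≤+ (0≤* (nonneg {ℤ.+ 2584 / 25}) (sq≥0 k)) (0≤+ (0≤* (nonneg {ℤ.+ 289 / 50}) (0≤* k≥0 t≥0))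
        (0≤* (nonneg {ℤ.+ 19 / 400}) (sq≥0 t))))
      (trans (cong (λ x → (ℤ.+ 9 / 25) * (x * x)) ec)
       (solve 2 (λ N k → con (ℤ.+ 9 / 25) :* ((N :- k) :* (N :- k)) := N :* (con (ℤ.+ 5 / 16) :* N :+ con (ℤ.+ 3 / 1) :* k) :+
           (con (ℤ.+ 2584 / 25) :* (k :* k) :+ (con (ℤ.+ 289 / 50) :* (k :* (N :- con (ℤ.+ 100 / 1) :* k)) :+ con (ℤ.+ 19 / 400) :*
           ((N :- con (ℤ.+ 100 / 1) :* k) :* (N :- con (ℤ.+ 100 / 1) :* k))))) refl N k))

  -- Characters with few nonzero entries

  Odd : ℕ → Set
  Odd p = ∀ r → Group._⊞_ p r r ≡ zero → r ≡ zero

  α-fact : ∀ m → α m ≡ (ℤ.+ 13 / 10) ^ m * fact m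
  α-fact zero = refl
  α-fact (suc m) = trans (cong ((ℤ.+ 13 / 10) * ι (suc m) *_) (α-fact m))
      (solve 4 (λ c k x f → c :* k :* (x :* f) := c :* x :* (k :* f)) refl (ℤ.+ 13 / 10) (ι (suc m)) ((ℤ.+ 13 / 10) ^ m) (fact m))

  β-fact : ∀ m → β m ≡ (ℤ.+ 3 / 5) ^ m * (ι (suc m) * fact m)
  β-fact zero = refl
  β-fact (suc m) = trans (cong ((ℤ.+ 3 / 5) * ι (2 ℕ.+ m) *_) (β-fact m))
      (solve 4 (λ c k x f → c :* k :* (x :* f) := c :* x :* (k :* f)) refl (ℤ.+ 3 / 5) (ι (2 ℕ.+ m)) ((ℤ.+ 3 / 5) ^ m) (ι (suc m) * fact m))

  -- 39/50 is 1.3 · 0.6, and 27/26 is chosen so that 39/50 · 27/26 = (9/10)². By Bernoulli the power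
  -- of 27/26 absorbs m + 1, at the cost of the constant 36.
  linear-exp : ∀ m → (ℤ.+ 39 / 50) ^ m * ι (suc m) ≤ (ℤ.+ 36 / 1) * ((ℤ.+ 9 / 10) ^ m * (ℤ.+ 9 / 10) ^ m)
  linear-exp m = begin
    (ℤ.+ 39 / 50) ^ m * ι (suc m) ≤⟨ *-mono (^≥0 m (nonneg {ℤ.+ 39 / 50}))
        (≤-by (0≤+ (nonneg {ℤ.+ 35 / 1}) (0≤* (nonneg {ℤ.+ 5 / 13}) (ι≥0 m)))
        (solve 1 (λ k → con (ℤ.+ 36 / 1) :* (con 1ℚ :+ k :* con (ℤ.+ 1 / 26)) := (con 1ℚ :+ k) :+ (con (ℤ.+ 35 / 1) :+ con (ℤ.+ 5 / 13) :* k))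
            refl (ι m))) ⟩
    (ℤ.+ 39 / 50) ^ m * ((ℤ.+ 36 / 1) * (1ℚ + ι m * (ℤ.+ 1 / 26))) ≤⟨ *-mono (^≥0 m (nonneg {ℤ.+ 39 / 50}))
        (*-mono {c = ℤ.+ 36 / 1} nonneg (bernoulli (ℤ.+ 1 / 26) m nonneg)) ⟩
    (ℤ.+ 39 / 50) ^ m * ((ℤ.+ 36 / 1) * (ℤ.+ 27 / 26) ^ m) ≡⟨ (solve 2 (λ a b → a :* (con (ℤ.+ 36 / 1) :* b) := con (ℤ.+ 36 / 1) :* (a :* b))
        refl ((ℤ.+ 39 / 50) ^ m) ((ℤ.+ 27 / 26) ^ m)) ⟩
    (ℤ.+ 36 / 1) * ((ℤ.+ 39 / 50) ^ m * (ℤ.+ 27 / 26) ^ m) ≡⟨ cong ((ℤ.+ 36 / 1) *_)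
        (trans (sym (^-* (ℤ.+ 39 / 50) (ℤ.+ 27 / 26) m)) (^-* (ℤ.+ 9 / 10) (ℤ.+ 9 / 10) m)) ⟩
    (ℤ.+ 36 / 1) * ((ℤ.+ 9 / 10) ^ m * (ℤ.+ 9 / 10) ^ m) ∎
    where open ℚP.≤-Reasoning

  module Sparse (p : ℕ) where
    open Group p
    open Moments p
    open Sup p

    -- `ff m` is the falling factorial n(n - 1)...(n - m + 1). `Φ` iterates `F-bound`, and `Φ 1` is
    -- 0 because F vanishes at a single nonzero entry.
    ff Φ : ℕ → ℚ
    ff zero = 1ℚ
    ff (suc m) = ff m * (nQ - ι m)
    Φ zero = 1ℚ
    Φ (suc zero) = 0ℚ
    Φ (suc (suc m)) = ½ * ι (2 ℕ.+ m) * ((nQ - ι m) * Φ m) + ι (suc m) * Φ (suc m)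

    nQ>0 : 0ℚ < nQ
    nQ>0 = subst (0ℚ <_) (sym nQ-ι) (ι>0 p)

    nQ≥0 : 0ℚ ≤ nQ
    nQ≥0 = ℚP.<⇒≤ nQ>0

    ι≤nQ : ∀ {m} → m ℕ.≤ n → ι m ≤ nQ
    ι≤nQ q = subst (_ ≤_) (sym nQ-ι) (ι-mono q)

    ff≥0 : ∀ m → m ℕ.≤ n → 0ℚ ≤ ff m
    ff≥0 zero q = 0≤1
    ff≥0 (suc m) q = 0≤* (ff≥0 m (ℕP.<⇒≤ q)) (≤-diff (ι≤nQ (ℕP.<⇒≤ q)))

    ff>0 : ∀ m → m ℕ.≤ n → 0ℚ < ff m
    ff>0 zero q = 0<1
    ff>0 (suc m) q = 0<* (ff>0 m (ℕP.<⇒≤ q)) (subst (0ℚ <_) (cong (λ t → t - ι m) (sym nQ-ι))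
        (subst (0ℚ <_) (ι-∸ (ℕP.<⇒≤ q)) (ι-< (ℕP.m<n⇒0<n∸m q))))

    ff≤^ : ∀ m → m ℕ.≤ n → ff m ≤ nQ ^ m
    ff≤^ zero q = ℚP.≤-refl
    ff≤^ (suc m) q = ℚP.≤-trans (*-mono₂ (ff≥0 m (ℕP.<⇒≤ q)) nQ≥0 (ff≤^ m (ℕP.<⇒≤ q))
        (≤-by (ι≥0 m) (solve 2 (λ a b → a := (a :- b) :+ b) refl (nQ) (ι m)))) (ℚP.≤-reflexive (ℚP.*-comm (nQ ^ m) nQ))

    Φ≥0 : ∀ m → m ℕ.≤ n → 0ℚ ≤ Φ m
    Φ≥0 zero q = 0≤1
    Φ≥0 (suc zero) q = ℚP.≤-refl
    Φ≥0 (suc (suc m)) q = 0≤+ (0≤* (0≤* (nonneg {½}) (ι≥0 (2 ℕ.+ m))) (0≤* (≤-diff (ι≤nQ (ℕP.<⇒≤ (ℕP.<⇒≤ q)))) (Φ≥0 m (ℕP.<⇒≤ (ℕP.<⇒≤ q)))))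
        (0≤* (ι≥0 (suc m)) (Φ≥0 (suc m) (ℕP.<⇒≤ q)))

    F-single : ∀ {r} → r ≢ zero → F 1 (r ∷ []) ≡ 0ℚ
    F-single q = F-nz 0 [] q

    Φ-bound : Odd p → ∀ m → m ℕ.≤ n → Bounded m (Φ m)
    Φ-bound odd zero q [] nz = ℚP.≤-refl
    Φ-bound odd (suc zero) q (r ∷ []) (ne , _) = ℚP.≤-reflexive (cong ∣_∣ (F-single ne))
    Φ-bound odd (suc (suc m)) q = F-bound odd m (ι≤nQ q₂) (Φ≥0 m q₂) (Φ≥0 (suc m) q₁) (Φ-bound odd m q₂) (Φ-bound odd (suc m) q₁)
      where
      q₁ = ℕP.<⇒≤ q
      q₂ = ℕP.<⇒≤ q₁

    Z≤ : Odd p → ∀ m → m ℕ.≤ n → ∣ Z m ∣ ≤ Φ m * Y m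
    Z≤ odd m q = ℚP.≤-trans (∑-abs (vecs ns m) _) (ℚP.≤-trans (V-mono m λ v nz →
      ℚP.≤-trans (ℚP.≤-reflexive (trans (∣∣-*-nonNegˡ (F m v) (sq≥0 (F m v))) (ℚP.*-comm (F m v * F m v) ∣ F m v ∣)))
          (*-monoʳ (sq≥0 (F m v)) (Φ-bound odd m q v nz)))
      (ℚP.≤-reflexive (∑-*ˡ (vecs ns m) (Φ m) _)))

    Y-one : Y 1 ≡ 0ℚ
    Y-one = trans (V-suc 0 _) (trans (∑ns-cong {g = λ _ → 0ℚ} λ y q → cong (λ t → t * t + 0ℚ) (F-single q)) (∑-0 ns))

    100∣ : ∀ {m} → 100 ℕ.* m ℕ.≤ n → (ℤ.+ 100 / 1) * ι m ≤ nQ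
    100∣ {m} q = subst (_≤ nQ) (ι-* 100 m) (ι≤nQ q)

    Y² Φ² : ℕ → Set
    Y² m = Y m * Y m * nQ ^ m ≤ α m * ff m ^ 4
    Φ² m = Φ m * Φ m * nQ ^ m ≤ β m * ff m ^ 2

    Y²-bounds : ∀ m → 100 ℕ.* m ℕ.≤ n → Y² m × Y² (suc m)
    Y²-bounds zero q = ℚP.≤-refl , ℚP.≤-trans (ℚP.≤-reflexive (trans (cong (λ t → t * t * nQ ^ 1) Y-one) (ℚP.*-zeroˡ (nQ ^ 1))))
        (0≤* (α≥0 1) (^≥0 {ff 1} 4 (ff≥0 1 (s≤s z≤n))))
    Y²-bounds (suc m) q with Y²-bounds m (ℕP.≤-trans (ℕP.*-monoʳ-≤ 100 (ℕP.n≤1+n m)) q)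
    ... | h₀ , h₁ = h₁ , subst (λ t → t * t * nQ ^ (2 ℕ.+ m) ≤ α (2 ℕ.+ m) * ff (2 ℕ.+ m) ^ 4) (sym (Y-rec m))
       (Y-step {N = nQ} {k = ι (suc m)} {Y = Y m} {Y′ = Y (suc m)} {f = ff m} {a = α m} {P = nQ ^ m} nQ≥0 (ι≥0 (suc m)) (α≥0 m)
           (100∣ {suc m} q) refl h₀ h₁ (^≥0 m nQ≥0))

    Φ²-bounds : ∀ m → 100 ℕ.* m ℕ.≤ n → Φ² m × Φ² (suc m)
    Φ²-bounds zero q = ℚP.≤-refl , ℚP.≤-trans (ℚP.≤-reflexive (ℚP.*-zeroˡ (nQ ^ 1))) (0≤* (β≥0 1) (^≥0 {ff 1} 2 (ff≥0 1 (s≤s z≤n))))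
    Φ²-bounds (suc m) q with Φ²-bounds m (ℕP.≤-trans (ℕP.*-monoʳ-≤ 100 (ℕP.n≤1+n m)) q)
    ... | h₀ , h₁ = h₁ , Φ-step {N = nQ} {k = ι (suc m)} {X = Φ m} {X′ = Φ (suc m)} {f = ff m} {b = β m} {P = nQ ^ m} nQ≥0 (ι≥0 (suc m))
        (β≥0 m) (100∣ {suc m} q) refl h₀ h₁ (^≥0 m nQ≥0)

    100→≤ : ∀ {m} → 100 ℕ.* m ℕ.≤ n → m ℕ.≤ n
    100→≤ {m} q = ℕP.≤-trans (ℕP.m≤m+n m (99 ℕ.* m)) q

    ΦY² : ∀ {a b f P x y} → 0ℚ ≤ f → 0ℚ < P → f ≤ P → 0ℚ ≤ a → 0ℚ ≤ b → y * y * P ≤ a * f ^ 4 → x * x * P ≤ b * f ^ 2 →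
      (x * y) * (x * y) ≤ a * b * f ^ 4
    ΦY² {a} {b} {f} {P} {x} {y} f≥0 P>0 fP a≥0 b≥0 hy hx = cancel-≤ (0<* P>0 P>0) (begin
      P * P * (x * y * (x * y)) ≡⟨ (solve 3 (λ P x y → P :* P :* (x :* y :* (x :* y)) := (x :* x :* P) :* (y :* y :* P)) refl P x y) ⟩
      (x * x * P) * (y * y * P) ≤⟨ *-mono₂ (0≤* (sq≥0 x) (ℚP.<⇒≤ P>0)) (0≤* a≥0 (^≥0 4 f≥0)) hx hy ⟩
      b * f ^ 2 * (a * f ^ 4) ≡⟨ (solve 4 (λ a b f g → b :* (f :* (f :* con 1ℚ)) :* (a :* g) := (a :* b :* g) :* (f :* f)) refl a b f (f ^ 4)) ⟩
      (a * b * f ^ 4) * (f * f) ≤⟨ *-mono (0≤* (0≤* a≥0 b≥0) (^≥0 4 f≥0)) (*-mono₂ f≥0 (ℚP.<⇒≤ P>0) fP fP) ⟩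
      (a * b * f ^ 4) * (P * P) ≡⟨ ℚP.*-comm (a * b * f ^ 4) (P * P) ⟩
      P * P * (a * b * f ^ 4) ∎)
      where open ℚP.≤-Reasoning

    -- Sup of |F| times second moment. In the square the factorials of `α` and `β` combine to (m!)²,
    -- and (m + 1) · 0.78^m is left over.
    Z-sparse : Odd p → ∀ m → 100 ℕ.* m ℕ.≤ n → ∣ Z m ∣ ≤ fact m * (ff m * ff m) * ((ℤ.+ 6 / 1) * (ℤ.+ 9 / 10) ^ m)
    Z-sparse odd m q = ℚP.≤-trans (Z≤ odd m m≤n) (sq-≤ (0≤* (0≤* (fact≥0 m) (sq≥0 (ff m)))
        (0≤* (nonneg {ℤ.+ 6 / 1}) (^≥0 m (nonneg {ℤ.+ 9 / 10}))))
      (begin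
        Φ m * Y m * (Φ m * Y m) ≤⟨ ΦY² {x = Φ m} {y = Y m} (ff≥0 m m≤n) (^>0 m nQ>0) (ff≤^ m m≤n) (α≥0 m) (β≥0 m) (proj₁ (Y²-bounds m q))
            (proj₁ (Φ²-bounds m q)) ⟩
        α m * β m * ff m ^ 4 ≡⟨ cong (_* ff m ^ 4) (cong₂ _*_ (α-fact m) (β-fact m)) ⟩
        (ℤ.+ 13 / 10) ^ m * fact m * ((ℤ.+ 3 / 5) ^ m * (ι (suc m) * fact m)) * ff m ^ 4
          ≡⟨ (solve 5 (λ a b k x f → a :* x :* (b :* (k :* x)) :* (f :* (f :* (f :* (f :* con 1ℚ)))) := (x :* (f :* f) :* (x :* (f :* f))) :*
              (a :* b :* k)) refl ((ℤ.+ 13 / 10) ^ m) ((ℤ.+ 3 / 5) ^ m) (ι (suc m)) (fact m) (ff m)) ⟩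
        (fact m * (ff m * ff m) * (fact m * (ff m * ff m))) * ((ℤ.+ 13 / 10) ^ m * (ℤ.+ 3 / 5) ^ m * ι (suc m))
          ≤⟨ *-mono (sq≥0 (fact m * (ff m * ff m))) (ℚP.≤-trans (ℚP.≤-reflexive (cong (_* ι (suc m)) (sym (^-* (ℤ.+ 13 / 10) (ℤ.+ 3 / 5) m))))
              (linear-exp m)) ⟩
        (fact m * (ff m * ff m) * (fact m * (ff m * ff m))) * ((ℤ.+ 36 / 1) * ((ℤ.+ 9 / 10) ^ m * (ℤ.+ 9 / 10) ^ m))
          ≡⟨ (solve 2 (λ x c → (x :* x) :* (con (ℤ.+ 36 / 1) :* (c :* c)) := x :* (con (ℤ.+ 6 / 1) :* c) :* (x :* (con (ℤ.+ 6 / 1) :* c)))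
              refl (fact m * (ff m * ff m)) ((ℤ.+ 9 / 10) ^ m)) ⟩
        fact m * (ff m * ff m) * ((ℤ.+ 6 / 1) * (ℤ.+ 9 / 10) ^ m) * (fact m * (ff m * ff m) * ((ℤ.+ 6 / 1) * (ℤ.+ 9 / 10) ^ m)) ∎))
      where
      open ℚP.≤-Reasoning
      m≤n = 100→≤ q

    -- T m is the normalised contribution of the characters with exactly m nonzero entries.
    T : ℕ → ℚ
    T m = Z m * inv (fact m * (ff m * ff m))

    den>0 : ∀ m → m ℕ.≤ n → 0ℚ < fact m * (ff m * ff m)
    den>0 m q = 0<* (fact>0 m) (0<* (ff>0 m q) (ff>0 m q))

    T-bound : Odd p → ∀ m → 100 ℕ.* m ℕ.≤ n → ∣ T m ∣ ≤ (ℤ.+ 6 / 1) * (ℤ.+ 9 / 10) ^ m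
    T-bound odd m q = begin
      ∣ Z m * i ∣ ≡⟨ trans (∣∣-* (Z m) i) (cong (∣ Z m ∣ *_) (ℚP.0≤p⇒∣p∣≡p (inv≥0 d>0))) ⟩
      ∣ Z m ∣ * i ≤⟨ *-monoʳ (inv≥0 d>0) (Z-sparse odd m q) ⟩
      D * B * i ≡⟨ (solve 3 (λ D B i → D :* B :* i := D :* i :* B) refl D B i) ⟩
      D * i * B ≡⟨ trans (cong (_* B) (inv-r d>0)) (ℚP.*-identityˡ B) ⟩
      B ∎
      where
      open ℚP.≤-Reasoning
      D B i : ℚ
      D = fact m * (ff m * ff m)
      B = (ℤ.+ 6 / 1) * (ℤ.+ 9 / 10) ^ m
      d>0 = den>0 m (100→≤ q)
      i = inv D

  -- Fractions, the Archimedean property and quantities that tend to 0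

  /-ᵘ : ∀ z d .{{_ : ℕ.NonZero d}} → ℚ.toℚᵘ (z / d) ℚᵘ.≃ (z ℚᵘ./ d)
  /-ᵘ z (suc d) = ℚP.toℚᵘ-fromℚᵘ (ℚᵘ.mkℚᵘ z d)

  ι-/1 : ∀ k → ι k ≡ (ℤ.+ k) / 1
  ι-/1 zero = refl
  ι-/1 (suc k) = ℚP.toℚᵘ-injective (ℚᵘP.≃-trans (ℚP.toℚᵘ-homo-+ 1ℚ (ι k))
    (ℚᵘP.≃-trans (ℚᵘP.+-congʳ (ℚ.toℚᵘ 1ℚ) (ℚᵘP.≃-trans (ℚᵘP.≃-reflexive (cong ℚ.toℚᵘ (ι-/1 k))) (/-ᵘ (ℤ.+ k) 1)))
    (ℚᵘP.≃-trans (ℚᵘ.*≡* (trans (ℤP.*-identityʳ _) (trans (cong₂ ℤ._+_ (ℤP.*-identityʳ (ℤ.+ 1)) (ℤP.*-identityʳ (ℤ.+ k)))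
        (sym (ℤP.*-identityʳ (ℤ.+ suc k)))))) (ℚᵘP.≃-sym (/-ᵘ (ℤ.+ suc k) 1)))))

  /-* : ∀ z d .{{_ : ℕ.NonZero d}} → ι d * (z / d) ≡ z / 1
  /-* z (suc d) = ℚP.toℚᵘ-injective (ℚᵘP.≃-trans (ℚP.toℚᵘ-homo-* (ι (suc d)) (z / suc d))
    (ℚᵘP.≃-trans (ℚᵘP.*-cong (ℚᵘP.≃-trans (ℚᵘP.≃-reflexive (cong ℚ.toℚᵘ (ι-/1 (suc d)))) (/-ᵘ (ℤ.+ suc d) 1)) (/-ᵘ z (suc d)))
    (ℚᵘP.≃-trans (ℚᵘ.*≡* (trans (ℤP.*-identityʳ _) (trans (ℤP.*-comm (ℤ.+ suc d) z)
        (cong (z ℤ.*_) (cong ℤ.+_ (sym (ℕP.+-identityʳ (suc d)))))))) (ℚᵘP.≃-sym (/-ᵘ z 1)))))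

  archimedes : ∀ q → ∃[ k ] q ≤ ι k
  archimedes q@(ℚ.mkℚ a d c) = ℤ.∣ a ∣ , subst (q ≤_) (sym (ι-/1 ℤ.∣ a ∣))
      (ℚP.toℚᵘ-cancel-≤ (ℚᵘP.≤-trans (ℚᵘ.*≤* le) (ℚᵘP.≤-reflexive (ℚᵘP.≃-sym (/-ᵘ (ℤ.+ ℤ.∣ a ∣) 1)))))
    where
    le : a ℤ.* ℤ.+ 1 ℤ.≤ ℤ.+ ℤ.∣ a ∣ ℤ.* ℤ.+ (suc d)
    le = ℤP.≤-trans (ℤP.≤-reflexive (ℤP.*-identityʳ a)) (ℤP.≤-trans (le₁ a)
        (subst (ℤ.+ ℤ.∣ a ∣ ℤ.≤_) (ℤP.pos-* ℤ.∣ a ∣ (suc d)) (ℤ.+≤+ (ℕP.m≤m*n ℤ.∣ a ∣ (suc d)))))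
      where
      le₁ : ∀ a → a ℤ.≤ ℤ.+ ℤ.∣ a ∣
      le₁ (ℤ.+ k) = ℤP.≤-refl
      le₁ (ℤ.-[1+ k ]) = ℤ.-≤+

  archimedes′ : ∀ {x} q → 0ℚ < x → ∃[ k ] (∀ j → k ℕ.≤ j → q ≤ x * ι j)
  archimedes′ {x} q x>0 = let (k , h) = archimedes (q * inv x) in k , λ j kj → ℚP.≤-trans (ℚP.≤-reflexive (sym (trans (solve 3 (λ x q i → x :* (q :* i) := q :* (x :* i)) refl x q (inv x)) (trans (cong (q *_) (inv-r x>0)) (ℚP.*-identityʳ q)))))
     (*-mono (ℚP.<⇒≤ x>0) (ℚP.≤-trans h (ι-mono kj)))

  -- By Bernoulli, c^a (1 + a x) ≤ (c (1 + x))^a ≤ 1, so it suffices that C ≤ ε x a.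
  pow-small : ∀ {c x} → 0ℚ ≤ c → 0ℚ < x → c * (1ℚ + x) ≤ 1ℚ → ∀ C ε → 0ℚ < ε → ∃[ N ] (∀ a → N ℕ.≤ a → C * c ^ a ≤ ε)
  pow-small {c} {x} c≥0 x>0 cx C ε ε>0 = let (N , h) = archimedes′ C (0<* ε>0 x>0) in N , λ a Na → begin
    C * c ^ a ≤⟨ *-monoʳ (^≥0 a c≥0) (h a Na) ⟩
    ε * x * ι a * c ^ a ≡⟨ (solve 4 (λ ε x k q → ε :* x :* k :* q := ε :* (q :* (k :* x))) refl ε x (ι a) (c ^ a)) ⟩
    ε * (c ^ a * (ι a * x)) ≤⟨ *-mono (ℚP.<⇒≤ ε>0) (*-mono (^≥0 a c≥0) (≤-by 0≤1 (solve 1 (λ y → con 1ℚ :+ y := y :+ con 1ℚ) refl (ι a * x)))) ⟩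
    ε * (c ^ a * (1ℚ + ι a * x)) ≤⟨ *-mono (ℚP.<⇒≤ ε>0) (*-mono (^≥0 a c≥0) (bernoulli x a (ℚP.<⇒≤ x>0))) ⟩
    ε * (c ^ a * (1ℚ + x) ^ a) ≡⟨ cong (ε *_) (sym (^-* c (1ℚ + x) a)) ⟩
    ε * (c * (1ℚ + x)) ^ a ≤⟨ *-mono (ℚP.<⇒≤ ε>0) (^≤1 a (0≤* c≥0 (0≤+ 0≤1 (ℚP.<⇒≤ x>0))) cx) ⟩
    ε * 1ℚ ≡⟨ ℚP.*-identityʳ ε ⟩
    ε ∎
    where open ℚP.≤-Reasoning

  -- Convergence to 0 along odd n, the argument being p = n - 1.
  Small : (ℕ → ℚ) → Set
  Small g = ∀ ε → 0ℚ < ε → ∃[ N ] (∀ p → N ℕ.≤ p → Odd p → ∣ g p ∣ ≤ ε)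

  half-pos : ∀ {ε} → 0ℚ < ε → 0ℚ < ½ * ε
  half-pos = 0<* (ℚP.positive⁻¹ ½)

  Small-sq : ∀ {g} errorConst N₀ → (∀ p → N₀ ℕ.≤ p → Odd p → g p * g p * ι (suc p) ≤ errorConst) → Small g
  Small-sq {g} errorConst N₀ h ε ε>0 = let (N₁ , h₁) = archimedes′ errorConst (0<* ε>0 ε>0) in N₀ ℕ.+ N₁ , λ p le odd → ∣∣≤-sq (ℚP.<⇒≤ ε>0) (cancel-≤ (ι>0 p) (begin
     ι (suc p) * (g p * g p) ≡⟨ ℚP.*-comm (ι (suc p)) (g p * g p) ⟩
     g p * g p * ι (suc p) ≤⟨ h p (ℕP.≤-trans (ℕP.m≤m+n N₀ N₁) le) odd ⟩
     errorConst ≤⟨ h₁ (suc p) (ℕP.≤-trans (ℕP.≤-trans (ℕP.m≤n+m N₁ N₀) le) (ℕP.n≤1+n p)) ⟩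
     ε * ε * ι (suc p) ≡⟨ ℚP.*-comm (ε * ε) (ι (suc p)) ⟩
     ι (suc p) * (ε * ε) ∎))
    where open ℚP.≤-Reasoning

  Small-cong : ∀ {f g} N₀ → (∀ p → N₀ ℕ.≤ p → Odd p → f p ≡ g p) → Small f → Small g
  Small-cong N₀ e sf ε ε>0 with sf ε ε>0
  ... | N , h = N₀ ℕ.+ N , λ p le odd → subst (λ t → ∣ t ∣ ≤ ε) (e p (ℕP.≤-trans (ℕP.m≤m+n N₀ N) le) odd)
      (h p (ℕP.≤-trans (ℕP.m≤n+m N N₀) le) odd)

  Small-+ : ∀ {f g} → Small f → Small g → Small (λ p → f p + g p)
  Small-+ {f} {g} sf sg ε ε>0 with sf (½ * ε) (half-pos ε>0) | sg (½ * ε) (half-pos ε>0)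
  ... | N , h | N′ , h′ = N ℕ.+ N′ , λ p le odd → ℚP.≤-trans (ℚP.∣p+q∣≤∣p∣+∣q∣ (f p) (g p))
     (ℚP.≤-trans (ℚP.+-mono-≤ (h p (ℕP.≤-trans (ℕP.m≤m+n N N′) le) odd) (h′ p (ℕP.≤-trans (ℕP.m≤n+m N′ N) le) odd))
         (ℚP.≤-reflexive (solve 1 (λ ε → con (ℤ.+ 1 / 2) :* ε :+ con (ℤ.+ 1 / 2) :* ε := ε) refl ε)))

  Small-*ˡ : ∀ {f} c → ∣ c ∣ ≤ 1ℚ → Small f → Small (λ p → c * f p)
  Small-*ˡ {f} c h sf ε ε>0 with sf ε ε>0
  ... | N , k = N , λ p le odd → ℚP.≤-trans (ℚP.≤-reflexive (∣∣-* c (f p)))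
      (ℚP.≤-trans (*-monoʳ (ℚP.0≤∣p∣ (f p)) h) (ℚP.≤-trans (ℚP.≤-reflexive (ℚP.*-identityˡ ∣ f p ∣)) (k p le odd)))

  Small-0 : Small (λ _ → 0ℚ)
  Small-0 ε ε>0 = 0 , λ p le odd → ℚP.<⇒≤ ε>0

  -- The recursion for T with error O(1/√n)

  fact≥1 : ∀ m → 1ℚ ≤ fact m
  fact≥1 zero = ℚP.≤-refl
  fact≥1 (suc m) = ℚP.≤-trans (fact≥1 m) (≤-by (0≤* (ι≥0 m) (fact≥0 m)) (solve 2 (λ k f → (con 1ℚ :+ k) :* f := f :+ k :* f) refl (ι m)
      (fact m)))

  prod-bound : ∀ {N a b f g P x y} → 0ℚ ≤ N → 0ℚ ≤ f → 0ℚ < P → f ≤ P → 0ℚ ≤ a → 0ℚ ≤ b → 0ℚ ≤ g → x * x * P ≤ b * f ^ 2 → y * y * (N * P) ≤ a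
      * g →
    (x * y) * (x * y) * N ≤ a * b * g
  prod-bound {N} {a} {b} {f} {g} {P} {x} {y} N≥0 f≥0 P>0 fP a≥0 b≥0 g≥0 hx hy = cancel-≤ (0<* P>0 P>0) (begin
    P * P * (x * y * (x * y) * N) ≡⟨ (solve 4 (λ P x y N → P :* P :* (x :* y :* (x :* y) :* N) := (x :* x :* P) :* (y :* y :* (N :* P))) refl
        P x y N) ⟩
    (x * x * P) * (y * y * (N * P)) ≤⟨ *-mono₂ (0≤* (sq≥0 x) (ℚP.<⇒≤ P>0)) (0≤* a≥0 g≥0) hx hy ⟩
    b * f ^ 2 * (a * g) ≡⟨ (solve 4 (λ a b f g → b :* (f :* (f :* con 1ℚ)) :* (a :* g) := (a :* b :* g) :* (f :* f)) refl a b f g) ⟩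
    (a * b * g) * (f * f) ≤⟨ *-mono (0≤* (0≤* a≥0 b≥0) g≥0) (*-mono₂ f≥0 (ℚP.<⇒≤ P>0) fP fP) ⟩
    (a * b * g) * (P * P) ≡⟨ ℚP.*-comm (a * b * g) (P * P) ⟩
    P * P * (a * b * g) ∎)
    where open ℚP.≤-Reasoning

  -- The normalisation is (f N′ c)⁴. The bounds for u and v lack powers of N′ and c, and 1 ≤ c, N ≤
  -- 2c turn these gaps into room for the remaining powers of N and N′.
  error-bound : ∀ {N N′ c f q u v w B₁ B₂ B₃} → 0ℚ ≤ N → 1ℚ ≤ c → N ≤ (ℤ.+ 2 / 1) * c → N′ ≡ c + 1ℚ → 0ℚ ≤ B₁ → 0ℚ ≤ B₂ →
    u * u ≤ B₁ * f ^ 4 → v * v * N ≤ B₂ * (f * N′) ^ 4 → w * w * N ≤ B₃ * (f * N′ * c) ^ 4 →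
    (q * (N′ * N′ * N′) * u + q * N′ * v + w) * (q * (N′ * N′ * N′) * u + q * N′ * v + w) * N ≤
    (ℤ.+ 3 / 1) * ((ℤ.+ 8 / 1) * (q * q) * B₁ + (ℤ.+ 4 / 1) * (q * q) * B₂ + B₃) * (f * N′ * c) ^ 4
  error-bound {N} {N′} {c} {f} {q} {u} {v} {w} {B₁} {B₂} {B₃} N≥0 c≥1 N2c eN B₁≥0 B₂≥0 hu hv hw = begin
    (A + B + w) * (A + B + w) * N ≤⟨ *-monoʳ N≥0 (≤-by {a = (A + B + w) * (A + B + w)}
        (0≤+ (0≤+ (sq≥0 (A - B)) (sq≥0 (B - w))) (sq≥0 (A - w)))
        (solve 3 (λ A B w → con (ℤ.+ 3 / 1) :* (A :* A :+ B :* B :+ w :* w) := (A :+ B :+ w) :* (A :+ B :+ w) :+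
            (((A :- B) :* (A :- B) :+ (B :- w) :* (B :- w)) :+ (A :- w) :* (A :- w))) refl A B w)) ⟩
    (ℤ.+ 3 / 1) * (A * A + B * B + w * w) * N ≡⟨ (solve 6 (λ q N′ u v w N → con (ℤ.+ 3 / 1) :*
        (q :* (N′ :* N′ :* N′) :* u :* (q :* (N′ :* N′ :* N′) :* u) :+ q :* N′ :* v :* (q :* N′ :* v) :+ w :* w) :* N := con (ℤ.+ 3 / 1) :*
        (q :* q :* (N′ :* N′ :* (N′ :* N′)) :* (N′ :* N′ :* N) :* (u :* u) :+ q :* q :* (N′ :* N′) :* (v :* v :* N) :+ w :* w :* N)) refl q N′
        u v w N) ⟩
    (ℤ.+ 3 / 1) * (q * q * (N′ * N′ * (N′ * N′)) * (N′ * N′ * N) * (u * u) + q * q * (N′ * N′) * (v * v * N) + w * w * N)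
      ≤⟨ *-mono {c = ℤ.+ 3 / 1} nonneg (ℚP.+-mono-≤ (ℚP.+-mono-≤
          (*-mono₂ (0≤* (0≤* (sq≥0 q) (sq≥0 (N′ * N′))) (0≤* (sq≥0 N′) N≥0)) (0≤* B₁≥0 f4) (*-mono (0≤* (sq≥0 q) (sq≥0 (N′ * N′))) k₁) hu)
          (*-mono₂ (0≤* (sq≥0 q) (sq≥0 N′)) (0≤* B₂≥0 g4) (*-mono (sq≥0 q) k₂) hv)) hw) ⟩
    (ℤ.+ 3 / 1) * (q * q * (N′ * N′ * (N′ * N′)) * ((ℤ.+ 8 / 1) * (c * c * (c * c))) * (B₁ * f ^ 4) + q * q *
        ((ℤ.+ 4 / 1) * (c * c * (c * c))) * (B₂ * (f * N′) ^ 4) + B₃ * (f * N′ * c) ^ 4)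
      ≡⟨ (solve 7 (λ q N′ c f B₁ B₂ B₃ → con (ℤ.+ 3 / 1) :* (q :* q :* (N′ :* N′ :* (N′ :* N′)) :* (con (ℤ.+ 8 / 1) :* (c :* c :* (c :* c)))
          :* (B₁ :* (f :* (f :* (f :* (f :* con 1ℚ))))) :+ q :* q :* (con (ℤ.+ 4 / 1) :* (c :* c :* (c :* c))) :*
          (B₂ :* (f :* N′ :* (f :* N′ :* (f :* N′ :* (f :* N′ :* con 1ℚ))))) :+ B₃ :*
          (f :* N′ :* c :* (f :* N′ :* c :* (f :* N′ :* c :* (f :* N′ :* c :* con 1ℚ))))) := con (ℤ.+ 3 / 1) :*
          (con (ℤ.+ 8 / 1) :* (q :* q) :* B₁ :+ con (ℤ.+ 4 / 1) :* (q :* q) :* B₂ :+ B₃) :*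
          (f :* N′ :* c :* (f :* N′ :* c :* (f :* N′ :* c :* (f :* N′ :* c :* con 1ℚ))))) refl q N′ c f B₁ B₂ B₃) ⟩
    (ℤ.+ 3 / 1) * ((ℤ.+ 8 / 1) * (q * q) * B₁ + (ℤ.+ 4 / 1) * (q * q) * B₂ + B₃) * (f * N′ * c) ^ 4 ∎
    where
    open ℚP.≤-Reasoning
    A B : ℚ
    A = q * (N′ * N′ * N′) * u
    B = q * N′ * v
    f4 : 0ℚ ≤ f ^ 4
    f4 = subst (0ℚ ≤_) (solve 1 (λ f → f :* f :* (f :* f) := f :* (f :* (f :* (f :* con 1ℚ)))) refl f) (sq≥0 (f * f))
    g4 : 0ℚ ≤ (f * N′) ^ 4
    g4 = subst (0ℚ ≤_) (solve 1 (λ f → f :* f :* (f :* f) := f :* (f :* (f :* (f :* con 1ℚ)))) refl (f * N′)) (sq≥0 (f * N′ * (f * N′)))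
    c≥0 : 0ℚ ≤ c
    c≥0 = ℚP.≤-trans 0≤1 c≥1
    N′≤ : N′ ≤ (ℤ.+ 2 / 1) * c
    N′≤ = ℚP.≤-trans (ℚP.≤-reflexive eN) (ℚP.≤-trans (ℚP.+-monoʳ-≤ c c≥1)
        (ℚP.≤-reflexive (solve 1 (λ c → c :+ c := con (ℤ.+ 2 / 1) :* c) refl c)))
    N′≥0 : 0ℚ ≤ N′
    N′≥0 = subst (0ℚ ≤_) (sym eN) (0≤+ c≥0 0≤1)
    c≤c² : c ≤ c * c
    c≤c² = ℚP.≤-trans (ℚP.≤-reflexive (sym (ℚP.*-identityʳ c))) (*-mono c≥0 c≥1)
    k₂ : N′ * N′ ≤ (ℤ.+ 4 / 1) * (c * c * (c * c))
    k₂ = begin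
      N′ * N′ ≤⟨ *-mono₂ N′≥0 (0≤* (nonneg {ℤ.+ 2 / 1}) c≥0) N′≤ N′≤ ⟩
      (ℤ.+ 2 / 1) * c * ((ℤ.+ 2 / 1) * c) ≡⟨ (solve 1 (λ c → con (ℤ.+ 2 / 1) :* c :* (con (ℤ.+ 2 / 1) :* c) := con (ℤ.+ 4 / 1) :* (c :* c))
          refl c) ⟩
      (ℤ.+ 4 / 1) * (c * c) ≤⟨ *-mono {c = ℤ.+ 4 / 1} nonneg (*-mono₂ c≥0 (sq≥0 c) c≤c² c≤c²) ⟩
      (ℤ.+ 4 / 1) * (c * c * (c * c)) ∎
    k₁ : N′ * N′ * N ≤ (ℤ.+ 8 / 1) * (c * c * (c * c))
    k₁ = begin
      N′ * N′ * N ≤⟨ *-mono₂ (sq≥0 N′) (0≤* (nonneg {ℤ.+ 2 / 1}) c≥0) (*-mono₂ N′≥0 (0≤* (nonneg {ℤ.+ 2 / 1}) c≥0) N′≤ N′≤) N2c ⟩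
      (ℤ.+ 2 / 1) * c * ((ℤ.+ 2 / 1) * c) * ((ℤ.+ 2 / 1) * c) ≡⟨ (solve 1
          (λ c → con (ℤ.+ 2 / 1) :* c :* (con (ℤ.+ 2 / 1) :* c) :* (con (ℤ.+ 2 / 1) :* c) := con (ℤ.+ 8 / 1) :* (c :* c :* c)) refl c) ⟩
      (ℤ.+ 8 / 1) * (c * c * c) ≤⟨ *-mono {c = ℤ.+ 8 / 1} nonneg (*-mono (sq≥0 c) c≤c²) ⟩
      (ℤ.+ 8 / 1) * (c * c * (c * c)) ∎

  -- Independent of n. Its growth in m is harmless, as m is fixed while n tends to infinity.
  errorConst : ℕ → ℚ
  errorConst m = (ℤ.+ 3 / 1) * ((ℤ.+ 8 / 1) * (ι m * ι m * (ι m * ι m)) * (α m * β m) + (ℤ.+ 4 / 1) * (ι m * ι m * (ι m * ι m)) *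
      (α (suc m) * β m) + α (2 ℕ.+ m) * β (suc m))

  errorConst≥0 : ∀ m → 0ℚ ≤ errorConst m
  errorConst≥0 m = 0≤* (nonneg {ℤ.+ 3 / 1}) (0≤+ (0≤+ (0≤* (0≤* (nonneg {ℤ.+ 8 / 1}) (sq≥0 (ι m * ι m))) (0≤* (α≥0 m) (β≥0 m)))
     (0≤* (0≤* (nonneg {ℤ.+ 4 / 1}) (sq≥0 (ι m * ι m))) (0≤* (α≥0 (suc m)) (β≥0 m)))) (0≤* (α≥0 (2 ℕ.+ m)) (β≥0 (suc m))))

  -- D R = G + H with G the error of the recursion for Z and H = T (k d N′²) ((m − 1) c + m).
  ratio-bound : ∀ {N c N′ d k j m t G R D Fa B g} → 0ℚ ≤ N → 1ℚ ≤ c → N ≤ (ℤ.+ 2 / 1) * c → 0ℚ ≤ k → 0ℚ ≤ m → 0ℚ ≤ d → j ≡ 1ℚ + k → k ≡ 1ℚ +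
      m → 0ℚ ≤ B → 0ℚ ≤ g →
    D ≡ j * k * d * (N′ * N′ * (c * c)) → D * D ≡ Fa * Fa * g → 0ℚ < D → k ≤ Fa → ∣ t ∣ ≤ (ℤ.+ 6 / 1) → G * G * N ≤ k * k * (B * g) →
    D * R ≡ G + t * (k * d * (N′ * N′)) * ((m - 1ℚ) * c + m) → R * R * N ≤ (ℤ.+ 2 / 1) * B + (ℤ.+ 576 / 1)
  ratio-bound {N} {c} {N′} {d} {k} {j} {m} {t} {G} {R} {D} {Fa} {B} {g} N≥0 c≥1 N2c k≥0 m≥0 d≥0 ej ek B≥0 g≥0 eD eD² D>0 kFa ht hG eR =
      cancel-≤ (0<* D>0 D>0) (begin
    D * D * (R * R * N) ≡⟨ (solve 3 (λ D R N → D :* D :* (R :* R :* N) := D :* R :* (D :* R) :* N) refl D R N) ⟩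
    D * R * (D * R) * N ≡⟨ cong (λ z → z * z * N) eR ⟩
    (G + H) * (G + H) * N ≤⟨ *-monoʳ N≥0 (≤-by {a = (G + H) * (G + H)} (sq≥0 (G - H))
        (solve 2 (λ G H → con (ℤ.+ 2 / 1) :* (G :* G) :+ con (ℤ.+ 2 / 1) :* (H :* H) := (G :+ H) :* (G :+ H) :+ (G :- H) :* (G :- H)) refl G
        H)) ⟩
    ((ℤ.+ 2 / 1) * (G * G) + (ℤ.+ 2 / 1) * (H * H)) * N ≡⟨ (solve 3 (λ G H N → (con (ℤ.+ 2 / 1) :* (G :* G) :+ con (ℤ.+ 2 / 1) :* (H :* H)) :*
        N := con (ℤ.+ 2 / 1) :* (G :* G :* N) :+ con (ℤ.+ 2 / 1) :* (H :* H :* N)) refl G H N) ⟩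
    (ℤ.+ 2 / 1) * (G * G * N) + (ℤ.+ 2 / 1) * (H * H * N) ≤⟨ ℚP.+-mono-≤ (*-mono {c = ℤ.+ 2 / 1} nonneg gG)
        (*-mono {c = ℤ.+ 2 / 1} nonneg gH) ⟩
    (ℤ.+ 2 / 1) * (D * D * B) + (ℤ.+ 2 / 1) * ((ℤ.+ 288 / 1) * (D * D)) ≡⟨
        (solve 2 (λ D B → con (ℤ.+ 2 / 1) :* (D :* D :* B) :+ con (ℤ.+ 2 / 1) :* (con (ℤ.+ 288 / 1) :* (D :* D)) := D :* D :*
        (con (ℤ.+ 2 / 1) :* B :+ con (ℤ.+ 576 / 1))) refl D B) ⟩
    D * D * ((ℤ.+ 2 / 1) * B + (ℤ.+ 576 / 1)) ∎)
    where
    open ℚP.≤-Reasoning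
    e w H : ℚ
    e = (m - 1ℚ) * c + m
    w = k * d * (N′ * N′)
    H = t * w * e
    c≥0 : 0ℚ ≤ c
    c≥0 = ℚP.≤-trans 0≤1 c≥1
    gG : G * G * N ≤ D * D * B
    gG = begin
      G * G * N ≤⟨ hG ⟩
      k * k * (B * g) ≤⟨ *-monoʳ (0≤* B≥0 g≥0) (*-mono₂ k≥0 (ℚP.≤-trans k≥0 kFa) kFa kFa) ⟩
      Fa * Fa * (B * g) ≡⟨ (solve 3 (λ Fa B g → Fa :* Fa :* (B :* g) := Fa :* Fa :* g :* B) refl Fa B g) ⟩
      Fa * Fa * g * B ≡⟨ cong (_* B) (sym eD²) ⟩
      D * D * B ∎
    j2 : j ≡ (ℤ.+ 2 / 1) + m
    j2 = trans ej (trans (cong (1ℚ +_) ek) (solve 1 (λ m → con 1ℚ :+ (con 1ℚ :+ m) := con (ℤ.+ 2 / 1) :+ m) refl m))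
    he : ∣ e ∣ ≤ (ℤ.+ 2 / 1) * (j * c)
    he = ∣∣≤ (≤-by (0≤+ (0≤* (nonneg {ℤ.+ 5 / 1}) c≥0) (0≤* m≥0 (≤-diff c≥1)))
        (trans (cong (λ z → (ℤ.+ 2 / 1) * (z * c)) j2) (solve 2 (λ m c → con (ℤ.+ 2 / 1) :* ((con (ℤ.+ 2 / 1) :+ m) :* c) :=
        ((m :- con 1ℚ) :* c :+ m) :+ (con (ℤ.+ 5 / 1) :* c :+ m :* (c :- con 1ℚ))) refl m c)))
             (≤-by (0≤+ (0≤* (nonneg {ℤ.+ 3 / 1}) c≥0) (0≤+ (0≤* (nonneg {ℤ.+ 3 / 1}) (0≤* m≥0 c≥0)) m≥0))
                 (trans (cong (λ z → (ℤ.+ 2 / 1) * (z * c)) j2) (solve 2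
                 (λ m c → con (ℤ.+ 2 / 1) :* ((con (ℤ.+ 2 / 1) :+ m) :* c) := (:- ((m :- con 1ℚ) :* c :+ m)) :+
                 (con (ℤ.+ 3 / 1) :* c :+ (con (ℤ.+ 3 / 1) :* (m :* c) :+ m))) refl m c)))
    gH : H * H * N ≤ (ℤ.+ 288 / 1) * (D * D)
    gH = begin
      H * H * N ≡⟨ (solve 4 (λ t w e N → t :* w :* e :* (t :* w :* e) :* N := (t :* t) :* ((w :* w) :* (e :* e)) :* N) refl t w e N) ⟩
      (t * t) * ((w * w) * (e * e)) * N ≤⟨ *-mono₂ (0≤* (sq≥0 t) (0≤* (sq≥0 w) (sq≥0 e))) (0≤* (nonneg {ℤ.+ 2 / 1}) c≥0)
          (*-mono₂ (sq≥0 t) (0≤* (sq≥0 w) (sq≥0 ((ℤ.+ 2 / 1) * (j * c)))) (sq-∣∣≤ ht) (*-mono (sq≥0 w) (sq-∣∣≤ he))) N2c ⟩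
      ((ℤ.+ 6 / 1) * (ℤ.+ 6 / 1)) * ((w * w) * ((ℤ.+ 2 / 1) * (j * c) * ((ℤ.+ 2 / 1) * (j * c)))) * ((ℤ.+ 2 / 1) * c)
        ≡⟨ (solve 3 (λ w j c → (con (ℤ.+ 6 / 1) :* con (ℤ.+ 6 / 1)) :* ((w :* w) :*
            (con (ℤ.+ 2 / 1) :* (j :* c) :* (con (ℤ.+ 2 / 1) :* (j :* c)))) :* (con (ℤ.+ 2 / 1) :* c) := con (ℤ.+ 288 / 1) :*
            (w :* w :* (j :* j)) :* (c :* c :* c)) refl w j c) ⟩
      (ℤ.+ 288 / 1) * (w * w * (j * j)) * (c * c * c) ≤⟨ *-mono (0≤* (nonneg {ℤ.+ 288 / 1}) (0≤* (sq≥0 w) (sq≥0 j)))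
          (*-mono (sq≥0 c) (ℚP.≤-trans (ℚP.≤-reflexive (sym (ℚP.*-identityʳ c))) (*-mono c≥0 c≥1))) ⟩
      (ℤ.+ 288 / 1) * (w * w * (j * j)) * (c * c * (c * c)) ≡⟨ (solve 5 (λ k d N′ j c → con (ℤ.+ 288 / 1) :*
          (k :* d :* (N′ :* N′) :* (k :* d :* (N′ :* N′)) :* (j :* j)) :* (c :* c :* (c :* c)) := con (ℤ.+ 288 / 1) :*
          (j :* k :* d :* (N′ :* N′ :* (c :* c)) :* (j :* k :* d :* (N′ :* N′ :* (c :* c))))) refl k d N′ j c) ⟩
      (ℤ.+ 288 / 1) * (j * k * d * (N′ * N′ * (c * c)) * (j * k * d * (N′ * N′ * (c * c)))) ≡⟨ cong (λ z → (ℤ.+ 288 / 1) * (z * z)) (sym eD) ⟩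
      (ℤ.+ 288 / 1) * (D * D) ∎

  module Recurrence (p : ℕ) where
    open Group p
    open Moments p
    open Sup p
    open Sparse p

    -- Normalisation of `Z-rec`. With c = n - m - 1 the coefficient there is (c - m)(c + 1)³ in
    -- place of the expected c²(c + 1)²; since c² - (c - m)(c + 1) = (m - 1)c + m is of lower order,
    -- the factor of T m is 1/(m + 2) up to O(1/n).
    T-recurrence : Odd p → ∀ m → 100 ℕ.* (2 ℕ.+ m) ℕ.≤ n →
      (T (2 ℕ.+ m) + inv (ι (2 ℕ.+ m)) * T m) * (T (2 ℕ.+ m) + inv (ι (2 ℕ.+ m)) * T m) * nQ ≤ (ℤ.+ 2 / 1) * errorConst m + (ℤ.+ 576 / 1)
    T-recurrence odd m q = ratio-bound {N = nQ} {c = c} {N′ = N′} {d = d} {k = k} {j = j} {m = ι m} {t = T m} {G = Gz}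
        {R = T (2 ℕ.+ m) + inv j * T m} {D = D} {Fa = fact (2 ℕ.+ m)} {B = errorConst m} {g = ff (2 ℕ.+ m) ^ 4}
      nQ≥0 c≥1 N≤2c (ι≥0 (suc m)) (ι≥0 m) (ℚP.<⇒≤ d>0) refl refl (errorConst≥0 m) (^≥0 4 (ff≥0 (2 ℕ.+ m) q₂))
      (solve 6 (λ j k x f N′ c → j :* (k :* x) :* (f :* N′ :* c :* (f :* N′ :* c)) := j :* k :* (x :* (f :* f)) :* (N′ :* N′ :* (c :* c)))
          refl j k (fact m) (ff m) N′ c)
      (solve 2 (λ x f → x :* (f :* f) :* (x :* (f :* f)) := x :* x :* (f :* (f :* (f :* (f :* con 1ℚ))))) refl (fact (2 ℕ.+ m))
          (ff (2 ℕ.+ m)))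
      D>0 k≤F (ℚP.≤-trans (T-bound odd m q₀) (ℚP.≤-trans (*-mono {c = ℤ.+ 6 / 1} nonneg
          (^≤1 m (nonneg {ℤ.+ 9 / 10}) (diff-≤ {ℤ.+ 9 / 10} {1ℚ} nonneg))) (ℚP.≤-reflexive refl)))
      G-bound eq
      where
      q₁ : 100 ℕ.* suc m ℕ.≤ n
      q₁ = ℕP.≤-trans (ℕP.*-monoʳ-≤ 100 (ℕP.n≤1+n (suc m))) q
      q₀ : 100 ℕ.* m ℕ.≤ n
      q₀ = ℕP.≤-trans (ℕP.*-monoʳ-≤ 100 (ℕP.n≤1+n m)) q₁
      q₂ : 2 ℕ.+ m ℕ.≤ n
      q₂ = 100→≤ q
      m≤n : m ℕ.≤ n
      m≤n = ℕP.<⇒≤ (ℕP.<⇒≤ q₂)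
      c N′ d k j D Gz E u v w : ℚ
      c = nQ - ι (suc m)
      N′ = nQ - ι m
      k = ι (suc m)
      j = ι (2 ℕ.+ m)
      d = fact m * (ff m * ff m)
      D = fact (2 ℕ.+ m) * (ff (2 ℕ.+ m) * ff (2 ℕ.+ m))
      C₀ = ι p - (ℤ.+ 2 / 1) * ι m
      Gz = Z (2 ℕ.+ m) + k * (C₀ * N′ ^ 3 * Z m)
      d>0 : 0ℚ < d
      d>0 = den>0 m m≤n
      D>0 : 0ℚ < D
      D>0 = den>0 (2 ℕ.+ m) q₂
      big : (ℤ.+ 100 / 1) * j ≤ nQ
      big = 100∣ {2 ℕ.+ m} q
      c≥1 : 1ℚ ≤ c
      c≥1 = diff-≤ (subst (0ℚ ≤_) (solve 2 (λ N m → (N :- con (ℤ.+ 100 / 1) :* (con 1ℚ :+ (con 1ℚ :+ m))) :+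
          (con (ℤ.+ 198 / 1) :+ con (ℤ.+ 99 / 1) :* m) := (N :- (con 1ℚ :+ m)) :- con 1ℚ) refl (nQ) (ι m))
          (0≤+ (≤-diff big) (0≤+ (nonneg {ℤ.+ 198 / 1}) (0≤* (nonneg {ℤ.+ 99 / 1}) (ι≥0 m)))))
      N≤2c : nQ ≤ (ℤ.+ 2 / 1) * c
      N≤2c = diff-≤ (subst (0ℚ ≤_) (solve 2 (λ N m → (N :- con (ℤ.+ 100 / 1) :* (con 1ℚ :+ (con 1ℚ :+ m))) :+
          (con (ℤ.+ 198 / 1) :+ con (ℤ.+ 98 / 1) :* m) := (con (ℤ.+ 2 / 1) :* (N :- (con 1ℚ :+ m))) :- N) refl (nQ) (ι m))
          (0≤+ (≤-diff big) (0≤+ (nonneg {ℤ.+ 198 / 1}) (0≤* (nonneg {ℤ.+ 98 / 1}) (ι≥0 m)))))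
      k≤F : k ≤ fact (2 ℕ.+ m)
      k≤F = begin
        k ≡⟨ (solve 1 (λ k → k := con 1ℚ :* (k :* con 1ℚ)) refl k) ⟩
        1ℚ * (k * 1ℚ) ≤⟨ *-mono₂ 0≤1 (0≤* (ι≥0 (suc m)) (fact≥0 m)) (ι≥1 {2 ℕ.+ m} (s≤s z≤n)) (*-mono (ι≥0 (suc m)) (fact≥1 m)) ⟩
        j * (k * fact m) ∎
        where open ℚP.≤-Reasoning
      u = Φ m * Y m
      v = Φ m * Y (suc m)
      w = Φ (suc m) * Y (2 ℕ.+ m)
      E = N′ * (Φ m * (ι m * ι m * (N′ * N′ * Y m + Y (suc m)))) + w
      E²-bound : E * E * nQ ≤ errorConst m * ff (2 ℕ.+ m) ^ 4
      E²-bound = subst (λ t → t * t * nQ ≤ errorConst m * ff (2 ℕ.+ m) ^ 4)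
        (solve 6 (λ N′ q x y y′ w → q :* (N′ :* N′ :* N′) :* (x :* y) :+ q :* N′ :* (x :* y′) :+ w := N′ :*
            (x :* (q :* (N′ :* N′ :* y :+ y′))) :+ w) refl N′ (ι m * ι m) (Φ m) (Y m) (Y (suc m)) w)
        (error-bound {N = nQ} {N′ = N′} {c = c} {f = ff m} {q = ι m * ι m} {u = u} {v = v} {w = w} {B₁ = α m * β m} {B₂ = α (suc m) * β m}
            {B₃ = α (2 ℕ.+ m) * β (suc m)}
          nQ≥0 c≥1 N≤2c (solve 2 (λ N m → N :- m := (N :- (con 1ℚ :+ m)) :+ con 1ℚ) refl (nQ) (ι m)) (0≤* (α≥0 m) (β≥0 m))
              (0≤* (α≥0 (suc m)) (β≥0 m))
          (ΦY² {x = Φ m} {y = Y m} (ff≥0 m m≤n) (^>0 m nQ>0) (ff≤^ m m≤n) (α≥0 m) (β≥0 m) (proj₁ (Y²-bounds m q₀)) (proj₁ (Φ²-bounds m q₀)))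
          (prod-bound {x = Φ m} {y = Y (suc m)} nQ≥0 (ff≥0 m m≤n) (^>0 m nQ>0) (ff≤^ m m≤n) (α≥0 (suc m)) (β≥0 m)
              (^≥0 {ff (suc m)} 4 (ff≥0 (suc m) (ℕP.<⇒≤ q₂))) (proj₁ (Φ²-bounds m q₀)) (proj₁ (Y²-bounds (suc m) q₁)))
          (prod-bound {x = Φ (suc m)} {y = Y (2 ℕ.+ m)} nQ≥0 (ff≥0 (suc m) (ℕP.<⇒≤ q₂)) (^>0 (suc m) nQ>0) (ff≤^ (suc m) (ℕP.<⇒≤ q₂))
              (α≥0 (2 ℕ.+ m)) (β≥0 (suc m)) (^≥0 {ff (2 ℕ.+ m)} 4 (ff≥0 (2 ℕ.+ m) q₂)) (proj₁ (Φ²-bounds (suc m) q₁))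
              (proj₂ (Y²-bounds (suc m) q₁))))
      G≤ : ∣ Gz ∣ ≤ k * E
      G≤ = Z-rec m (ι≤nQ m≤n) (Φ≥0 m m≤n) (Φ≥0 (suc m) (ℕP.<⇒≤ q₂)) (Φ-bound odd m m≤n) (Φ-bound odd (suc m) (ℕP.<⇒≤ q₂))
      G-bound : Gz * Gz * nQ ≤ k * k * (errorConst m * ff (2 ℕ.+ m) ^ 4)
      G-bound = begin
        Gz * Gz * nQ ≤⟨ *-monoʳ nQ≥0 (sq-∣∣≤ G≤) ⟩
        k * E * (k * E) * nQ ≡⟨ (solve 3 (λ k E N → k :* E :* (k :* E) :* N := k :* k :* (E :* E :* N)) refl k E (nQ)) ⟩
        k * k * (E * E * nQ) ≤⟨ *-mono (sq≥0 k) E²-bound ⟩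
        k * k * (errorConst m * ff (2 ℕ.+ m) ^ 4) ∎
        where open ℚP.≤-Reasoning
      eZ : ∀ m → m ℕ.≤ n → fact m * (ff m * ff m) * T m ≡ Z m
      eZ m q = trans (solve 3 (λ D z i → D :* (z :* i) := z :* (D :* i)) refl (fact m * (ff m * ff m)) (Z m) (inv (fact m * (ff m * ff m))))
          (trans (cong (Z m *_) (inv-r (den>0 m q))) (ℚP.*-identityʳ (Z m)))
      eq : D * (T (2 ℕ.+ m) + inv j * T m) ≡ Gz + T m * (k * d * (N′ * N′)) * ((ι m - 1ℚ) * c + ι m)
      eq = begin
        D * (T (2 ℕ.+ m) + inv j * T m) ≡⟨ (solve 4 (λ D t″ t i → D :* (t″ :+ i :* t) := D :* t″ :+ t :* (D :* i)) refl D (T (2 ℕ.+ m)) (T m)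
            (inv j)) ⟩
        D * T (2 ℕ.+ m) + T m * (D * inv j) ≡⟨ cong₂ (λ a b → a + T m * b) (eZ (2 ℕ.+ m) q₂)
           (trans (solve 7 (λ j k x f N′ c i → j :* (k :* x) :* (f :* N′ :* c :* (f :* N′ :* c)) :* i :=
               (k :* (x :* (f :* f)) :* (N′ :* N′ :* (c :* c))) :* (j :* i)) refl j k (fact m) (ff m) N′ c (inv j))
             (trans (cong (k * d * (N′ * N′ * (c * c)) *_) (inv-r (ι>0 (suc m)))) (ℚP.*-identityʳ _))) ⟩
        Z (2 ℕ.+ m) + T m * (k * d * (N′ * N′ * (c * c)))
          ≡⟨ trans (solve 6 (λ z t k d N m → z :+ t :* (k :* d :* ((N :- m) :* (N :- m) :* ((N :- (con 1ℚ :+ m)) :* (N :- (con 1ℚ :+ m))))) :=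
              (z :+ k :* ((N :- con 1ℚ :- con (ℤ.+ 2 / 1) :* m) :* ((N :- m) :* ((N :- m) :* ((N :- m) :* con 1ℚ))) :* (d :* t))) :+ t :*
              (k :* d :* ((N :- m) :* (N :- m))) :* ((m :- con 1ℚ) :* (N :- (con 1ℚ :+ m)) :+ m)) refl (Z (2 ℕ.+ m)) (T m) k d (nQ) (ι m))
             (cong₂ (λ a b → (Z (2 ℕ.+ m) + k * ((a - (ℤ.+ 2 / 1) * ι m) * N′ ^ 3 * b)) + T m * (k * d * (N′ * N′)) * ((ι m - 1ℚ) * c + ι m))
                 (trans (cong (λ t → t - 1ℚ) nQ-ι) (solve 1 (λ q → (con 1ℚ :+ q) :- con 1ℚ := q) refl (ι p))) (eZ m m≤n)) ⟩
        Gz + T m * (k * d * (N′ * N′)) * ((ι m - 1ℚ) * c + ι m) ∎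
        where open ≡-Reasoning

    T-zero : T 0 ≡ 1ℚ
    T-zero = refl

    T-one : T 1 ≡ 0ℚ
    T-one = trans (cong (_* inv (fact 1 * (ff 1 * ff 1))) (trans (V-suc 0 _)
        (trans (∑ns-cong {g = λ _ → 0ℚ} λ y q → cong (λ t → t * t * t + 0ℚ) (F-single q)) (∑-0 ns))))
        (ℚP.*-zeroˡ (inv (fact 1 * (ff 1 * ff 1))))

  -- Limits of the sparse terms and the exponential series

  Tₙ : ℕ → ℕ → ℚ
  Tₙ m p = Sparse.T p m

  limit : ℕ → ℚ
  limit zero = 1ℚ
  limit (suc zero) = 0ℚ
  limit (suc (suc m)) = - (inv (ι (2 ℕ.+ m)) * limit m)

  inv≤1 : ∀ m → ∣ inv (ι (suc m)) ∣ ≤ 1ℚ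
  inv≤1 m = ℚP.≤-trans (ℚP.≤-reflexive (ℚP.0≤p⇒∣p∣≡p (inv≥0 (ι>0 m)))) (cancel-≤ (ι>0 m) (ℚP.≤-trans (ℚP.≤-reflexive (inv-r (ι>0 m)))
     (ℚP.≤-trans (ι≥1 {suc m} (s≤s z≤n)) (ℚP.≤-reflexive (sym (ℚP.*-identityʳ (ι (suc m))))))))

  -- Induction in steps of two: the recursion errs by O(1/√n) for fixed m, and its coefficient 1/(m
  -- + 2) ≤ 1 does not enlarge the error already present.
  T-limit : ∀ m → Small (λ p → Tₙ m p - limit m)
  T-limit zero = Small-cong {f = λ _ → 0ℚ} 0 (λ p _ _ → sym (trans (cong (λ t → t - 1ℚ) (Recurrence.T-zero p)) refl)) Small-0
  T-limit (suc zero) = Small-cong {f = λ _ → 0ℚ} 0 (λ p _ _ → sym (trans (cong (λ t → t - 0ℚ) (Recurrence.T-one p)) refl)) Small-0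
  T-limit (suc (suc m)) = Small-cong {f = λ p → R p + (- i) * (Tₙ m p - limit m)} 0
    (λ p _ _ → (solve 4 (λ t″ i t l → (t″ :+ i :* t) :+ (:- i) :* (t :- l) := t″ :- (:- (i :* l))) refl (Tₙ (2 ℕ.+ m) p) i (Tₙ m p)
        (limit m)))
    (Small-+ {f = R} {g = λ p → (- i) * (Tₙ m p - limit m)}
      (Small-sq {g = R} ((ℤ.+ 2 / 1) * errorConst m + (ℤ.+ 576 / 1)) (100 ℕ.* (2 ℕ.+ m)) λ p le odd → subst
          (λ t → R p * R p * t ≤ (ℤ.+ 2 / 1) * errorConst m + (ℤ.+ 576 / 1)) (Group.nQ-ι p)
        (Recurrence.T-recurrence p odd m (ℕP.≤-trans le (ℕP.n≤1+n p))))
      (Small-*ˡ {f = λ p → Tₙ m p - limit m} (- i) (subst (_≤ 1ℚ) (sym (ℚP.∣-p∣≡∣p∣ i)) (inv≤1 (suc m))) (T-limit m)))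
    where
    i : ℚ
    i = inv (ι (2 ℕ.+ m))
    R : ℕ → ℚ
    R p = Tₙ (2 ℕ.+ m) p + i * Tₙ m p

  ∑T-limit : ∀ M → Small (λ p → ∑< M (λ m → Tₙ m p) - ∑< M limit)
  ∑T-limit zero = Small-0
  ∑T-limit (suc M) = Small-cong {f = λ p → (∑< M (λ m → Tₙ m p) - ∑< M limit) + (Tₙ M p - limit M)} 0
      (λ p _ _ → (solve 4 (λ a b c d → (a :- b) :+ (c :- d) := (a :+ c) :- (b :+ d)) refl (∑< M (λ m → Tₙ m p)) (∑< M limit) (Tₙ M p)
      (limit M))) (Small-+ {f = λ p → ∑< M (λ m → Tₙ m p) - ∑< M limit} {g = λ p → Tₙ M p - limit M} (∑T-limit M) (T-limit M))

  expDen : ℕ → ℕ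
  expDen k = 2 ℕ.^ k ℕ.* (k !)

  expDen≢0 : ∀ k → ℕ.NonZero (expDen k)
  expDen≢0 k = ℕP.m*n≢0 (2 ℕ.^ k) (k !) {{ℕP.m^n≢0 2 k}} {{k ℕP.!≢0}}

  sgn : ℕ → ℤ.ℤ
  sgn zero = ℤ.+ 1
  sgn (suc zero) = ℤ.-[1+ 0 ]
  sgn (suc (suc j)) = sgn j

  -- The numerator of expTerm k is a function local to the definition of expTerm, with k as a hidden parameter.
  -- Abstracting over that parameter and over _/_ makes it the solution of the metavariable defining num.
  mutual
    num : ℕ → ℕ → ℤ.ℤ
    num = _

    num-def : ∀ j → expTerm (2 ℕ.+ j) ≡ expTerm (2 ℕ.+ j)
    num-def j with suc (suc j) | _/_
    ... | p | f = refl {x = f (num p j) (expDen (2 ℕ.+ j)) {{expDen≢0 (2 ℕ.+ j)}}}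

  num-sgn : ∀ p j → num p j ≡ sgn j
  num-sgn p zero = refl
  num-sgn p (suc zero) = refl
  num-sgn p (suc (suc j)) = num-sgn p j

  expTerm-sgn : ∀ k → ι (expDen k) * expTerm k ≡ sgn k / 1
  expTerm-sgn zero = refl
  expTerm-sgn (suc zero) = refl
  expTerm-sgn (suc (suc j)) = trans (/-* (num (2 ℕ.+ j) j) (expDen (2 ℕ.+ j)) {{expDen≢0 (2 ℕ.+ j)}})
      (cong (λ z → z / 1) (num-sgn (2 ℕ.+ j) j))

  sgn-suc : ∀ k → sgn (suc k) / 1 ≡ - (sgn k / 1)
  sgn-suc zero = refl
  sgn-suc (suc zero) = refl
  sgn-suc (suc (suc k)) = sgn-suc k

  expTerm-sign : ∀ k → ι (expDen (suc k)) * expTerm (suc k) ≡ - (ι (expDen k) * expTerm k)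
  expTerm-sign k = trans (expTerm-sgn (suc k)) (trans (sgn-suc k) (cong -_ (sym (expTerm-sgn k))))

  expDen>0 : ∀ k → 0ℚ < ι (expDen k)
  expDen>0 k = ι-< (ℕ.>-nonZero⁻¹ (expDen k) {{expDen≢0 k}})

  expDen-suc : ∀ k → ι (expDen (suc k)) ≡ ι (2 ℕ.+ (k ℕ.+ k)) * ι (expDen k)
  expDen-suc k = begin
    ι (2 ℕ.* 2 ℕ.^ k ℕ.* (suc k ℕ.* (k !))) ≡⟨ trans (ι-* (2 ℕ.* 2 ℕ.^ k) _) (cong₂ _*_ (ι-* 2 (2 ℕ.^ k)) (ι-* (suc k) (k !))) ⟩
    ι 2 * ι (2 ℕ.^ k) * (ι (suc k) * ι (k !)) ≡⟨ (solve 3 (λ a k f → con (ℤ.+ 2 / 1) :* a :* ((con 1ℚ :+ k) :* f) :=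
        (con 1ℚ :+ (con 1ℚ :+ (k :+ k))) :* (a :* f)) refl (ι (2 ℕ.^ k)) (ι k) (ι (k !))) ⟩
    (1ℚ + (1ℚ + (ι k + ι k))) * (ι (2 ℕ.^ k) * ι (k !)) ≡⟨ cong₂ (λ a b → (1ℚ + (1ℚ + a)) * b) (sym (ι-+ k k)) (sym (ι-* (2 ℕ.^ k) (k !))) ⟩
    ι (2 ℕ.+ (k ℕ.+ k)) * ι (expDen k) ∎
    where open ≡-Reasoning

  expTerm-suc : ∀ k → expTerm (suc k) ≡ - (inv (ι (2 ℕ.+ (k ℕ.+ k))) * expTerm k)
  expTerm-suc k = cancel-≡ (expDen>0 (suc k)) (trans (expTerm-sign k) (sym (trans (cong (_* - (inv j * expTerm k)) (expDen-suc k))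
    (trans (solve 4 (λ j d i e → j :* d :* (:- (i :* e)) := :- ((j :* i) :* (d :* e))) refl j (ι (expDen k)) (inv j) (expTerm k))
      (trans (cong (λ t → - (t * (ι (expDen k) * expTerm k))) (inv-r (ι>0 (suc (k ℕ.+ k)))))
          (cong -_ (ℚP.*-identityˡ (ι (expDen k) * expTerm k))))))))
    where
    j : ℚ
    j = ι (2 ℕ.+ (k ℕ.+ k))

  limit-even : ∀ k → limit (k ℕ.+ k) ≡ expTerm k
  limit-even zero = refl
  limit-even (suc k) = trans (cong (λ t → limit (suc t)) (ℕP.+-suc k k))
      (trans (cong (λ t → - (inv (ι (2 ℕ.+ (k ℕ.+ k))) * t)) (limit-even k)) (sym (expTerm-suc k)))

  limit-odd : ∀ k → limit (suc (k ℕ.+ k)) ≡ 0ℚ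
  limit-odd zero = refl
  limit-odd (suc k) = trans (cong (λ t → limit (suc (suc t))) (ℕP.+-suc k k))
      (trans (cong (λ t → - (inv (ι (3 ℕ.+ (k ℕ.+ k))) * t)) (limit-odd k)) (cong -_ (ℚP.*-zeroʳ (inv (ι (3 ℕ.+ (k ℕ.+ k)))))))

  ∑-limit : ∀ M → ∑< (suc M ℕ.+ suc M) limit ≡ expPartial M
  ∑-limit zero = refl
  ∑-limit (suc M) = trans (cong (λ t → ∑< t limit) (cong suc (ℕP.+-suc (suc M) (suc M)))) (trans
    (cong₂ _+_ (cong₂ _+_ (∑-limit M) (limit-even (suc M))) (limit-odd (suc M))) (ℚP.+-identityʳ (expPartial M + expTerm (suc M))))

  ∣expTerm∣≤ : ∀ k → ∣ expTerm k ∣ ≤ (ℤ.+ 9 / 10) ^ k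
  ∣expTerm∣≤ zero = ℚP.≤-refl
  ∣expTerm∣≤ (suc k) = begin
    ∣ expTerm (suc k) ∣ ≡⟨ trans (cong ∣_∣ (expTerm-suc k)) (trans (ℚP.∣-p∣≡∣p∣ (inv j * expTerm k)) (∣∣-*-nonNegˡ (expTerm k) (inv≥0 j>0))) ⟩
    inv j * ∣ expTerm k ∣ ≤⟨ *-mono₂ (inv≥0 j>0) (^≥0 k (nonneg {ℤ.+ 9 / 10})) inv≤ (∣expTerm∣≤ k) ⟩
    (ℤ.+ 9 / 10) * (ℤ.+ 9 / 10) ^ k ∎
    where
    open ℚP.≤-Reasoning
    j : ℚ
    j = ι (2 ℕ.+ (k ℕ.+ k))
    j>0 = ι>0 (suc (k ℕ.+ k))
    inv≤ : inv j ≤ ℤ.+ 9 / 10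
    inv≤ = cancel-≤ j>0 (ℚP.≤-trans (ℚP.≤-reflexive (inv-r j>0)) (≤-by (0≤+ (nonneg {ℤ.+ 4 / 5}) (0≤* (nonneg {ℤ.+ 9 / 10}) (ι≥0 (k ℕ.+ k))))
       (solve 1 (λ x → (con 1ℚ :+ (con 1ℚ :+ x)) :* con (ℤ.+ 9 / 10) := con 1ℚ :+ (con (ℤ.+ 4 / 5) :+ con (ℤ.+ 9 / 10) :* x)) refl
           (ι (k ℕ.+ k)))))

  geometric : ∀ b → ∑< b (λ i → (ℤ.+ 9 / 10) ^ i) ≤ ℤ.+ 10 / 1
  geometric b = ≤-by (0≤* (nonneg {ℤ.+ 10 / 1}) (^≥0 b (nonneg {ℤ.+ 9 / 10}))) (sym (eq b))
    where
    eq : ∀ b → ∑< b (λ i → (ℤ.+ 9 / 10) ^ i) + (ℤ.+ 10 / 1) * (ℤ.+ 9 / 10) ^ b ≡ ℤ.+ 10 / 1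
    eq zero = refl
    eq (suc b) = trans (solve 2 (λ s x → (s :+ x) :+ con (ℤ.+ 10 / 1) :* (con (ℤ.+ 9 / 10) :* x) := s :+ con (ℤ.+ 10 / 1) :* x) refl
        (∑< b (λ i → (ℤ.+ 9 / 10) ^ i)) ((ℤ.+ 9 / 10) ^ b)) (eq b)

  tail-bound : ∀ (f : ℕ → ℚ) C a b → (∀ i → i ℕ.< b → ∣ f (a ℕ.+ i) ∣ ≤ C * (ℤ.+ 9 / 10) ^ (a ℕ.+ i)) → 0ℚ ≤ C →
    ∣ ∑< (a ℕ.+ b) f - ∑< a f ∣ ≤ (ℤ.+ 10 / 1) * C * (ℤ.+ 9 / 10) ^ a
  tail-bound f C a b h C≥0 = begin
    ∣ ∑< (a ℕ.+ b) f - ∑< a f ∣ ≡⟨ cong ∣_∣ (trans (cong (λ t → t - ∑< a f) (∑<-split a b f))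
        (solve 2 (λ x y → (x :+ y) :- x := y) refl (∑< a f) (∑< b (λ i → f (a ℕ.+ i))))) ⟩
    ∣ ∑< b (λ i → f (a ℕ.+ i)) ∣ ≤⟨ ∑<-abs b _ ⟩
    ∑< b (λ i → ∣ f (a ℕ.+ i) ∣) ≤⟨ ∑<-mono b h ⟩
    ∑< b (λ i → C * (ℤ.+ 9 / 10) ^ (a ℕ.+ i)) ≡⟨ ∑<-cong b (λ i _ → trans (cong (C *_) (^-+ (ℤ.+ 9 / 10) a i))
        (sym (ℚP.*-assoc C ((ℤ.+ 9 / 10) ^ a) ((ℤ.+ 9 / 10) ^ i)))) ⟩
    ∑< b (λ i → C * (ℤ.+ 9 / 10) ^ a * (ℤ.+ 9 / 10) ^ i) ≡⟨ ∑<-*ˡ b (C * (ℤ.+ 9 / 10) ^ a) _ ⟩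
    C * (ℤ.+ 9 / 10) ^ a * ∑< b (λ i → (ℤ.+ 9 / 10) ^ i) ≤⟨ *-mono (0≤* C≥0 (^≥0 a (nonneg {ℤ.+ 9 / 10}))) (geometric b) ⟩
    C * (ℤ.+ 9 / 10) ^ a * (ℤ.+ 10 / 1) ≡⟨ (solve 2 (λ C x → C :* x :* con (ℤ.+ 10 / 1) := con (ℤ.+ 10 / 1) :* C :* x) refl C
        ((ℤ.+ 9 / 10) ^ a)) ⟩
    (ℤ.+ 10 / 1) * C * (ℤ.+ 9 / 10) ^ a ∎
    where open ℚP.≤-Reasoning

  expPartial-∑ : ∀ M → expPartial M ≡ ∑< (suc M) expTerm
  expPartial-∑ zero = sym (ℚP.+-identityˡ (expTerm 0))
  expPartial-∑ (suc M) = cong (_+ expTerm (suc M)) (expPartial-∑ M)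

  -- `T-bound` is uniform in n, so the tail beyond a fixed A is small for all n at once, while the
  -- terms below A converge; the tail of the exponential series is bounded in the same way.
  sparse-limit : ∀ ε → 0ℚ < ε → ∃[ N ] (∀ p m → N ℕ.≤ p → N ℕ.≤ m → Odd p → ∣ ∑< (suc (suc p ℕ./ 100)) (Sparse.T p) - expPartial m ∣ ≤ ε)
  sparse-limit ε ε>0 = N , bound
    where
    ε₃ : ℚ
    ε₃ = (ℤ.+ 1 / 3) * ε
    ε₃>0 : 0ℚ < ε₃
    ε₃>0 = 0<* (ℚP.positive⁻¹ (ℤ.+ 1 / 3)) ε>0
    -- 60 is 10 · 6: the bound for the geometric series times the constant of `T-bound`.
    geo = pow-small {ℤ.+ 9 / 10} {ℤ.+ 1 / 10} (nonneg {ℤ.+ 9 / 10}) (ℚP.positive⁻¹ (ℤ.+ 1 / 10)) (diff-≤ nonneg) (ℤ.+ 60 / 1) ε₃ ε₃>0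
    M A : ℕ
    M = proj₁ geo
    -- The M + 1 terms of `expPartial M` sit at the even indices below A.
    A = suc M ℕ.+ suc M
    lim = ∑T-limit A ε₃ ε₃>0
    N : ℕ
    N = M ℕ.+ (100 ℕ.* A ℕ.+ proj₁ lim)
    bound : ∀ p m → N ℕ.≤ p → N ℕ.≤ m → Odd p → ∣ ∑< (suc (suc p ℕ./ 100)) (Sparse.T p) - expPartial m ∣ ≤ ε
    bound p m Np Nm odd = begin
      ∣ ∑< (suc q) t - expPartial m ∣ ≡⟨ cong ∣_∣ (solve 4 (λ a b c d → a :- d := ((a :- b) :+ (b :- c)) :+ (:- (d :- c))) refl (∑< (suc q) t)
          (∑< A t) (∑< A limit) (expPartial m)) ⟩
      ∣ ((∑< (suc q) t - ∑< A t) + (∑< A t - ∑< A limit)) + (- (expPartial m - ∑< A limit)) ∣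
        ≤⟨ ℚP.≤-trans (ℚP.∣p+q∣≤∣p∣+∣q∣ ((∑< (suc q) t - ∑< A t) + (∑< A t - ∑< A limit)) (- (expPartial m - ∑< A limit)))
            (ℚP.+-mono-≤ (ℚP.≤-trans (ℚP.∣p+q∣≤∣p∣+∣q∣ (∑< (suc q) t - ∑< A t) (∑< A t - ∑< A limit)) (ℚP.+-mono-≤ b₁ b₂))
             (ℚP.≤-trans (ℚP.≤-reflexive (ℚP.∣-p∣≡∣p∣ (expPartial m - ∑< A limit))) b₃)) ⟩
      (ε₃ + ε₃) + ε₃ ≡⟨ (solve 1 (λ ε → (con (ℤ.+ 1 / 3) :* ε :+ con (ℤ.+ 1 / 3) :* ε) :+ con (ℤ.+ 1 / 3) :* ε := ε) refl ε) ⟩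
      ε ∎
      where
      open ℚP.≤-Reasoning
      q : ℕ
      q = suc p ℕ./ 100
      t : ℕ → ℚ
      t = Sparse.T p
      100A≤p : 100 ℕ.* A ℕ.≤ p
      100A≤p = ℕP.≤-trans (ℕP.≤-trans (ℕP.m≤m+n (100 ℕ.* A) (proj₁ lim)) (ℕP.m≤n+m _ M)) Np
      A≤q : A ℕ.≤ suc q
      A≤q = ℕP.≤-trans (ℕP.≤-trans (ℕP.≤-reflexive (sym (trans (cong (ℕ._/ 100) (ℕP.*-comm 100 A)) (DM.m*n/n≡m A 100))))
          (DM./-monoˡ-≤ 100 (ℕP.≤-trans 100A≤p (ℕP.n≤1+n p)))) (ℕP.n≤1+n q)
      small-A : (ℤ.+ 60 / 1) * (ℤ.+ 9 / 10) ^ A ≤ ε₃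
      small-A = proj₂ geo A (ℕP.≤-trans (ℕP.n≤1+n M) (ℕP.m≤m+n (suc M) (suc M)))
      b₁ : ∣ ∑< (suc q) t - ∑< A t ∣ ≤ ε₃
      b₁ = subst (λ z → ∣ ∑< z t - ∑< A t ∣ ≤ ε₃) (ℕP.m+[n∸m]≡n A≤q) (ℚP.≤-trans (tail-bound t (ℤ.+ 6 / 1) A (suc q ℕ.∸ A)
        (λ i l → Sparse.T-bound p odd (A ℕ.+ i) (h i l)) (nonneg {ℤ.+ 6 / 1})) small-A)
        where
        h : ∀ i → i ℕ.< suc q ℕ.∸ A → 100 ℕ.* (A ℕ.+ i) ℕ.≤ suc p
        h i l = ℕP.≤-trans (ℕP.*-monoʳ-≤ 100 (ℕP.≤-pred (subst (ℕ._≤ suc q) (ℕP.+-suc A i)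
            (subst (A ℕ.+ suc i ℕ.≤_) (ℕP.m+[n∸m]≡n A≤q) (ℕP.+-monoʳ-≤ A l)))))
          (ℕP.≤-trans (ℕP.≤-reflexive (ℕP.*-comm 100 q)) (DM.m/n*n≤m (suc p) 100))
      b₂ : ∣ ∑< A t - ∑< A limit ∣ ≤ ε₃
      b₂ = proj₂ lim p (ℕP.≤-trans (ℕP.≤-trans (ℕP.m≤n+m (proj₁ lim) (100 ℕ.* A)) (ℕP.m≤n+m _ M)) Np) odd
      M≤m : suc M ℕ.≤ suc m
      M≤m = s≤s (ℕP.≤-trans (ℕP.m≤m+n M _) Nm)
      b₃ : ∣ expPartial m - ∑< A limit ∣ ≤ ε₃
      b₃ = ℚP.≤-trans (ℚP.≤-reflexive (cong ∣_∣ (cong₂ _-_ (trans (expPartial-∑ m) (cong (λ z → ∑< z expTerm) (sym (ℕP.m+[n∸m]≡n M≤m))))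
          (trans (∑-limit M) (expPartial-∑ M)))))
        (ℚP.≤-trans (tail-bound expTerm 1ℚ (suc M) (suc m ℕ.∸ suc M) (λ i l → ℚP.≤-trans (∣expTerm∣≤ (suc M ℕ.+ i))
            (ℚP.≤-reflexive (sym (ℚP.*-identityˡ ((ℤ.+ 9 / 10) ^ (suc M ℕ.+ i)))))) 0≤1)
        (ℚP.≤-trans (*-monoʳ (^≥0 (suc M) (nonneg {ℤ.+ 9 / 10})) (diff-≤ {(ℤ.+ 10 / 1) * 1ℚ} {ℤ.+ 60 / 1} nonneg))
            (proj₂ geo (suc M) (ℕP.n≤1+n M))))

  -- The trace function and orthogonality

  prime-factor : ∀ e → 1 ℕ.< e → ∃[ r ] (Prime r × r ∣ e)
  prime-factor (suc e) l with factorise (suc e)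
  ... | record { factors = [] ; isFactorisation = eq } = ⊥-elim (ℕP.<-irrefl (sym eq) l)
  ... | record { factors = r ∷ rs ; isFactorisation = eq ; factorsPrime = pr All.∷ _ } = r , pr , divides (product rs)
      (trans eq (ℕP.*-comm r (product rs)))

  prime∣!⇒≤ : ∀ {r} → Prime r → ∀ k → r ∣ (k !) → r ℕ.≤ k
  prime∣!⇒≤ {r} pr zero d = ⊥-elim (¬prime[1] (subst Prime (∣P.∣1⇒≡1 d) pr))
  prime∣!⇒≤ pr (suc k) d with euclidsLemma (suc k) (k !) pr d
  ... | inj₁ h = ∣P.∣⇒≤ h
  ... | inj₂ h = ℕP.m≤n⇒m≤1+n (prime∣!⇒≤ pr k h)

  ∑<-shift : ∀ n (g : ℕ → ℚ) → (∀ j → g (j ℕ.+ n) ≡ g j) → ∀ c → ∑< n (λ j → g (j ℕ.+ c)) ≡ ∑< n g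
  ∑<-shift n g per zero = ∑<-cong n λ j _ → cong g (ℕP.+-identityʳ j)
  ∑<-shift n g per (suc c) = trans (∑<-cong n λ j _ → cong g (ℕP.+-suc j c))
      (trans (one (λ j → g (j ℕ.+ c)) (trans (cong g (ℕP.+-comm n c)) (per c))) (∑<-shift n g per c))
    where
    one : ∀ (h : ℕ → ℚ) → h n ≡ h 0 → ∑< n (h ∘ suc) ≡ ∑< n h
    one h e = trans (solve 2 (λ a b → b := (a :+ b) :- a) refl (h 0) (∑< n (h ∘ suc))) (trans (cong (λ t → t - h 0) (sym (∑<-left n h)))
      (trans (cong (λ t → (∑< n h + t) - h 0) e) (solve 2 (λ a b → (b :+ a) :- a := b) refl (h 0) (∑< n h))))

  -- y is an n-periodic function, y 0 = 1, all of whose sums over cosets of nontrivial subgroups of ℤ/n vanish: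
  -- the product over the primes r dividing n of the operators f ↦ f − f(· + n/r), applied to the indicator of 0.
  module Trace (p : ℕ) where

    n : ℕ
    n = suc p

    private
      z0 : ℕ → ℚ
      z0 zero = 1ℚ
      z0 (suc _) = 0ℚ

      step : ∀ q → Dec (Prime (suc q)) → Dec (suc q ∣ n) → (ℕ → ℚ) → ℕ → ℚ
      step q (yes _) (yes (divides k _)) f i = f i - f (i ℕ.+ k)
      step q (yes _) (no _) f i = f i
      step q (no _) _ f i = f i

      yₛ : ℕ → ℕ → ℚ
      yₛ zero i = z0 (i % n)
      yₛ (suc q) = step q (prime? (suc q)) (suc q ∣? n) (yₛ q)

      step-per : ∀ q d d′ f → (∀ i → f (i ℕ.+ n) ≡ f i) → ∀ i → step q d d′ f (i ℕ.+ n) ≡ step q d d′ f i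
      step-per q (yes _) (yes (divides k _)) f h i = cong₂ _-_ (h i) (trans
          (cong f (trans (ℕP.+-assoc i n k) (trans (cong (i ℕ.+_) (ℕP.+-comm n k)) (sym (ℕP.+-assoc i k n))))) (h (i ℕ.+ k)))
      step-per q (yes _) (no _) f h i = h i
      step-per q (no _) _ f h i = h i

      yₛ-per : ∀ q i → yₛ q (i ℕ.+ n) ≡ yₛ q i
      yₛ-per zero i = cong z0 (DM.[m+n]%n≡m%n i n)
      yₛ-per (suc q) = step-per q (prime? (suc q)) (suc q ∣? n) (yₛ q) (yₛ-per q)

      -- An invariant of the construction: after the primes up to q the function lives on those i
      -- with n ∣ i · q!. A shift by k with k (q + 1) = n respects this once q! becomes (q + 1)!. It
      -- serves to compute the value at 0.
      supp : ∀ q i → ¬ (n ∣ i ℕ.* (q !)) → yₛ q i ≡ 0ℚ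
      supp zero i h with i % n in eq
      ... | zero = ⊥-elim (h (subst (n ∣_) (sym (ℕP.*-identityʳ i)) (∣P.m%n≡0⇒n∣m i n eq)))
      ... | suc _ = refl
      supp (suc q) i h = go (prime? (suc q)) (suc q ∣? n)
        where
        h′ : ¬ (n ∣ i ℕ.* (q !))
        h′ d = h (subst (n ∣_) (trans (sym (ℕP.*-assoc (suc q) i (q !)))
            (trans (cong (ℕ._* (q !)) (ℕP.*-comm (suc q) i)) (ℕP.*-assoc i (suc q) (q !)))) (∣P.∣n⇒∣m*n (suc q) d))
        go : ∀ d d′ → step q d d′ (yₛ q) i ≡ 0ℚ
        go (yes _) (yes (divides k eq)) = trans (cong₂ _-_ (supp q i h′)
            (supp q (i ℕ.+ k) λ d → h (∣P.∣m+n∣m⇒∣n {m = n ℕ.* (q !)} (subst (n ∣_) (re d) (∣P.∣n⇒∣m*n (suc q) d)) (∣P.m∣m*n (q !))))) refl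
          where
          re : n ∣ (i ℕ.+ k) ℕ.* (q !) → suc q ℕ.* ((i ℕ.+ k) ℕ.* (q !)) ≡ n ℕ.* (q !) ℕ.+ i ℕ.* (suc q !)
          re _ = trans (solveℕ 4 (λ s i k f → s ⨯ ((i ∔ k) ⨯ f) ≐ (k ⨯ s) ⨯ f ∔ i ⨯ (s ⨯ f)) refl (suc q) i k (q !))
                   (cong (λ t → t ℕ.* (q !) ℕ.+ i ℕ.* (suc q !)) (sym eq))
        go (yes _) (no _) = supp q i h′
        go (no _) _ = supp q i h′

      -- The subtracted value is taken at k = n/(q + 1), off the support: n ∣ k · q! would give q +
      -- 1 ∣ q!, impossible for a prime q + 1.
      yₛ-0 : ∀ q → yₛ q 0 ≡ 1ℚ
      yₛ-0 zero = refl
      yₛ-0 (suc q) = go (prime? (suc q)) (suc q ∣? n)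
        where
        go : ∀ d d′ → step q d d′ (yₛ q) 0 ≡ 1ℚ
        go (yes pr) (yes (divides k eq)) = trans (cong₂ _-_ (yₛ-0 q) (supp q k λ d → ℕP.<-irrefl refl (prime∣!⇒≤ pr q (cancel k eq d)))) refl
          where
          cancel : ∀ k → n ≡ k ℕ.* suc q → n ∣ k ℕ.* (q !) → suc q ∣ (q !)
          cancel (suc k) eq d = ∣P.*-cancelˡ-∣ (suc k) (subst (_∣ suc k ℕ.* (q !)) eq d)
        go (yes _) (no _) = yₛ-0 q
        go (no _) _ = yₛ-0 q

      per* : ∀ (f : ℕ → ℚ) → (∀ i → f (i ℕ.+ n) ≡ f i) → ∀ a i → f (i ℕ.+ a ℕ.* n) ≡ f i
      per* f h zero i = cong f (ℕP.+-identityʳ i)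
      per* f h (suc a) i = trans (cong f (trans (cong (i ℕ.+_) (ℕP.+-comm n (a ℕ.* n))) (sym (ℕP.+-assoc i (a ℕ.* n) n))))
          (trans (h (i ℕ.+ a ℕ.* n)) (per* f h a i))

      per≈ : ∀ (f : ℕ → ℚ) → (∀ i → f (i ℕ.+ n) ≡ f i) → ∀ {i j} a b → i ℕ.+ a ℕ.* n ≡ j ℕ.+ b ℕ.* n → f i ≡ f j
      per≈ f h {i} {j} a b e = trans (sym (per* f h a i)) (trans (cong f e) (per* f h b j))

      Kill : ℕ → ℕ → Set
      Kill q k = ∀ i → ∑< n (λ j → yₛ q (i ℕ.+ k ℕ.* j)) ≡ 0ℚ

      kill-suc : ∀ q k → Kill q k → Kill (suc q) k
      kill-suc q k h i = go (prime? (suc q)) (suc q ∣? n)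
        where
        go : ∀ d d′ → ∑< n (λ j → step q d d′ (yₛ q) (i ℕ.+ k ℕ.* j)) ≡ 0ℚ
        go (yes _) (yes (divides l _)) = trans (∑<-cong n λ j _ → (solve 2 (λ a b → a :- b := a :+ (:- con 1ℚ) :* b) refl
            (yₛ q (i ℕ.+ k ℕ.* j)) (yₛ q (i ℕ.+ k ℕ.* j ℕ.+ l))))
          (trans (∑<-+ n _ _) (trans (cong₂ _+_ (h i) (trans (∑<-*ˡ n (- 1ℚ) _)
              (cong (- 1ℚ *_) (trans (∑<-cong n λ j _ → cong (yₛ q) (re i (k ℕ.* j) l)) (h (i ℕ.+ l)))))) refl))
          where
          re : ∀ i a l → i ℕ.+ a ℕ.+ l ≡ i ℕ.+ l ℕ.+ a
          re i a l = trans (ℕP.+-assoc i a l) (trans (cong (i ℕ.+_) (ℕP.+-comm a l)) (sym (ℕP.+-assoc i l a)))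
        go (yes _) (no _) = h i
        go (no _) _ = h i

      kill-≤ : ∀ {q q′} k → q ℕ.≤ q′ → Kill q k → Kill q′ k
      kill-≤ {q} k le h with ℕP.≤⇒≤′ le
      ... | le′ = go le′
        where
        go : ∀ {q′} → q ℕ.≤′ q′ → Kill q′ k
        go ℕ.≤′-refl = h
        go (ℕ.≤′-step {n = q″} l) = kill-suc q″ k (go l)

      -- l = n/(q + 1) is congruent to c k modulo n, so along a progression of step k the subtracted
      -- shift by l only moves the index by c. A sum over a full period minus its translate is 0.
      kill-prime : ∀ q k → Prime (suc q) → (l : ℕ) → n ≡ l ℕ.* suc q → (c a b : ℕ) → c ℕ.* k ℕ.+ b ℕ.* n ≡ l ℕ.+ a ℕ.* n → Kill (suc q) k
      kill-prime q k pr l eq c a b e i = go (prime? (suc q)) (suc q ∣? n)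
        where
        go : ∀ d d′ → ∑< n (λ j → step q d d′ (yₛ q) (i ℕ.+ k ℕ.* j)) ≡ 0ℚ
        go (no ¬pr) _ = ⊥-elim (¬pr pr)
        go (yes _) (no ¬d) = ⊥-elim (¬d (divides l eq))
        go (yes _) (yes (divides l′ eq′)) = trans (∑<-cong n λ j _ → (solve 2 (λ x y → x :- y := x :+ (:- con 1ℚ) :* y) refl
            (yₛ q (i ℕ.+ k ℕ.* j)) (yₛ q (i ℕ.+ k ℕ.* j ℕ.+ l′))))
          (trans (∑<-+ n _ _) (trans (cong (∑< n g +_) (trans (∑<-*ˡ n (- 1ℚ) _)
              (cong (- 1ℚ *_) (trans (∑<-cong n λ j _ → sh j) (∑<-shift n g gper c)))))
              (solve 1 (λ x → x :+ (:- con 1ℚ) :* x := con 0ℚ) refl (∑< n g))))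
          where
          g : ℕ → ℚ
          g j = yₛ q (i ℕ.+ k ℕ.* j)
          l′≡l : l′ ≡ l
          l′≡l = ℕP.*-cancelʳ-≡ l′ l (suc q) (trans (sym eq′) eq)
          gper : ∀ j → g (j ℕ.+ n) ≡ g j
          gper j = trans (cong (yₛ q) (trans (cong (i ℕ.+_) (ℕP.*-distribˡ-+ k j n)) (sym (ℕP.+-assoc i (k ℕ.* j) (k ℕ.* n)))))
              (per* (yₛ q) (yₛ-per q) k (i ℕ.+ k ℕ.* j))
          sh : ∀ j → yₛ q (i ℕ.+ k ℕ.* j ℕ.+ l′) ≡ g (j ℕ.+ c)
          sh j = per≈ (yₛ q) (yₛ-per q) a b (trans (cong (λ t → i ℕ.+ k ℕ.* j ℕ.+ t ℕ.+ a ℕ.* n) l′≡l)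
             (trans (ℕP.+-assoc (i ℕ.+ k ℕ.* j) l (a ℕ.* n)) (trans (cong (i ℕ.+ k ℕ.* j ℕ.+_) (sym e))
               (solveℕ 5 (λ i k j c m → i ∔ k ⨯ j ∔ (c ⨯ k ∔ m) ≐ i ∔ k ⨯ (j ∔ c) ∔ m) refl i k j c (b ℕ.* n)))))

    opaque
      y : ℕ → ℚ
      y = yₛ n

      y-0 : y 0 ≡ 1ℚ
      y-0 = yₛ-0 n

      y-≈ : ∀ {i j} a b → i ℕ.+ a ℕ.* n ≡ j ℕ.+ b ℕ.* n → y i ≡ y j
      y-≈ = per≈ (yₛ n) (yₛ-per n)

      -- With d = gcd(k, n) < n, some prime r divides n/d. Then n/r is a multiple of d, hence by
      -- Bézout a multiple of k modulo n, and the operator for r kills the progression; later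
      -- operators preserve this.
      y-kill : ∀ k → ¬ (n ∣ k) → ∀ i → ∑< n (λ j → y (i ℕ.+ k ℕ.* j)) ≡ 0ℚ
      y-kill k n∤k with Bézout.lemma k n
      ... | Bézout.result d g b with GCD.gcd∣m g | GCD.gcd∣n g
      ...   | d∣k | divides e eq with prime-factor e (e>1 e eq)
        where
        e>1 : ∀ e → n ≡ e ℕ.* d → 1 ℕ.< e
        e>1 zero ()
        e>1 (suc zero) eq = ⊥-elim (n∤k (subst (_∣ k) (sym (trans eq (ℕP.+-identityʳ d))) d∣k))
        e>1 (suc (suc e)) eq = s≤s (s≤s z≤n)
      ...     | zero , pr , _ = ⊥-elim (¬prime[0] pr)
      ...     | suc q , pr , divides e′ eq′ = kill-≤ k q<n (bez b)
        where
        eqn : n ≡ (d ℕ.* e′) ℕ.* suc q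
        eqn = trans eq (trans (cong (ℕ._* d) eq′) (solveℕ 3 (λ e s d → e ⨯ s ⨯ d ≐ d ⨯ e ⨯ s) refl e′ (suc q) d))
        q<n : suc q ℕ.≤ n
        q<n = ∣P.∣⇒≤ (divides (d ℕ.* e′) eqn)
        bez : Bézout.Identity d k n → Kill (suc q) k
        bez (Bézout.+- x y eq₁) = kill-prime q k pr (d ℕ.* e′) eqn (x ℕ.* e′) (y ℕ.* e′) 0
          (trans (solveℕ 3 (λ x e k → x ⨯ e ⨯ k ∔ conℕ 0 ≐ x ⨯ k ⨯ e) refl x e′ k) (trans (cong (ℕ._* e′) (sym eq₁))
            (solveℕ 4 (λ d y n e → (d ∔ y ⨯ n) ⨯ e ≐ d ⨯ e ∔ y ⨯ e ⨯ n) refl d y n e′)))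
        -- p is -1 modulo n, so multiplication by p replaces the Bézout coefficient -x by a natural
        -- number.
        bez (Bézout.-+ x y eq₁) = kill-prime q k pr (d ℕ.* e′) eqn (p ℕ.* x ℕ.* e′) (p ℕ.* e′ ℕ.* y) (e′ ℕ.* d)
          (trans (solveℕ 5 (λ p x e k d → p ⨯ x ⨯ e ⨯ k ∔ e ⨯ d ⨯ (conℕ 1 ∔ p) ≐ d ⨯ e ∔ p ⨯ e ⨯ (d ∔ x ⨯ k)) refl p x e′ k d)
            (trans (cong (λ t → d ℕ.* e′ ℕ.+ p ℕ.* e′ ℕ.* t) eq₁) (cong (d ℕ.* e′ ℕ.+_) (sym (ℕP.*-assoc (p ℕ.* e′) y n)))))

  -- Vectors without repetition as bijections

  eqℕ-δ : ∀ {k} (a b : Fin k) → ι (eqℕ a b) ≡ δ a b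
  eqℕ-δ zero zero = refl
  eqℕ-δ zero (suc b) = refl
  eqℕ-δ (suc a) zero = refl
  eqℕ-δ (suc a) (suc b) = eqℕ-δ a b

  sumV : ∀ {A : Set} {m} → Vec A m → (A → ℚ) → ℚ
  sumV [] h = 0ℚ
  sumV (x ∷ xs) h = h x + sumV xs h

  sumV-cong : ∀ {A : Set} {m} (xs : Vec A m) {h h′ : A → ℚ} → (∀ x → h x ≡ h′ x) → sumV xs h ≡ sumV xs h′
  sumV-cong [] e = refl
  sumV-cong (x ∷ xs) e = cong₂ _+_ (e x) (sumV-cong xs e)

  ∑-count : ∀ {k m} (xs : Vec (Fin k) m) (h : Fin k → ℚ) → ∑ (fins k) (λ x → ι (count x xs) * h x) ≡ sumV xs h
  ∑-count {k} [] h = ∑-≡0 (fins k) λ x → ℚP.*-zeroˡ (h x)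
  ∑-count {k} (a ∷ xs) h = trans (∑-cong (fins k) λ x → trans (cong (_* h x)
      (trans (ι-+ (eqℕ x a) (count x xs)) (cong (_+ ι (count x xs)) (trans (eqℕ-δ x a) (δ-comm x a)))))
      (ℚP.*-distribʳ-+ (h x) (δ a x) (ι (count x xs))))
    (trans (∑-+ (fins k) _ _) (cong₂ _+_ (∑-δ a h) (∑-count xs h)))

  sumV-1 : ∀ {A : Set} {m} (xs : Vec A m) → sumV xs (λ _ → 1ℚ) ≡ ι m
  sumV-1 [] = refl
  sumV-1 (x ∷ xs) = cong (1ℚ +_) (sumV-1 xs)

  term≤∑ : ∀ {k} (f : Fin k → ℚ) → (∀ x → 0ℚ ≤ f x) → ∀ a → f a ≤ ∑ (fins k) f
  term≤∑ {k} f h a = ℚP.≤-trans (ℚP.≤-reflexive (sym (∑-δ a f))) (∑-mono (fins k) δ*)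
    where
    δ* : ∀ x → δ a x * f x ≤ f x
    δ* x with a FinP.≟ x
    ... | yes refl = ℚP.≤-reflexive (trans (cong (_* f a) (δ-refl a)) (ℚP.*-identityˡ (f a)))
    ... | no ne = ℚP.≤-trans (ℚP.≤-reflexive (trans (cong (_* f x) (δ-≢ ne)) (ℚP.*-zeroˡ (f x)))) (h x)

  NoDup : ∀ {k m} → Vec (Fin k) m → Set
  NoDup [] = ⊤
  NoDup (x ∷ xs) = count x xs ≡ 0 × NoDup xs

  NoDup? : ∀ {k m} (v : Vec (Fin k) m) → Dec (NoDup v)
  NoDup? [] = yes tt
  NoDup? (x ∷ xs) with count x xs ℕP.≟ 0 | NoDup? xs
  ... | yes a | yes b = yes (a , b)
  ... | no a | _ = no (a ∘ proj₁)
  ... | _ | no b = no (b ∘ proj₂)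

  NoDup-count≤1 : ∀ {k m} (v : Vec (Fin k) m) → NoDup v → ∀ a → count a v ℕ.≤ 1
  NoDup-count≤1 [] nd a = z≤n
  NoDup-count≤1 (x ∷ xs) (c , nd) a with a FinP.≟ x
  ... | yes refl = ℕP.≤-reflexive (cong₂ ℕ._+_ (eqℕ-refl a) c)
  ... | no ne = subst (ℕ._≤ 1) (cong (ℕ._+ count a xs) (sym (eqℕ-≢ ne))) (NoDup-count≤1 xs nd a)

  -- Pigeonhole: the numbers 1 - count are nonnegative and sum to 0, as the counts sum to k.
  NoDup-count≡1 : ∀ {k} (v : Vec (Fin k) k) → NoDup v → ∀ a → count a v ≡ 1
  NoDup-count≡1 {k} v nd a = ℕP.≤-antisym (NoDup-count≤1 v nd a) (ι-cancel-≤ {1} {count a v}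
      (diff-≤ {ι 1} (ℚP.≤-reflexive (sym (zero-diff (ℚP.≤-trans (term≤∑ (λ x → 1ℚ - ι (count x v))
      (λ x → ≤-diff (ι-mono {count x v} {1} (NoDup-count≤1 v nd x))) a) (ℚP.≤-reflexive total)))))))
    where
    total : ∑ (fins k) (λ x → 1ℚ - ι (count x v)) ≡ 0ℚ
    total = trans (∑-− (fins k) _ _) (trans (cong₂ _-_ (trans (∑-fins-const k 1ℚ) (ℚP.*-identityʳ (ι k)))
        (trans (∑-cong (fins k) λ x → sym (ℚP.*-identityʳ (ι (count x v)))) (trans (∑-count v (λ _ → 1ℚ)) (sumV-1 v)))) (ℚP.+-inverseʳ (ι k)))
    zero-diff : 1ℚ - ι (count a v) ≤ 0ℚ → ι (count a v) - ι 1 ≡ 0ℚ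
    zero-diff h = ℚP.≤-antisym (subst (_≤ 0ℚ) refl (ℚP.≤-trans (ℚP.+-monoˡ-≤ (- ι 1) (ι-mono {count a v} {1} (NoDup-count≤1 v nd a)))
        (ℚP.≤-reflexive refl)))
      (subst (0ℚ ≤_) (solve 1 (λ c → :- (con 1ℚ :- c) := c :- con 1ℚ) refl (ι (count a v))) (neg-≤ h))

  sumV-NoDup : ∀ {k} (v : Vec (Fin k) k) → NoDup v → ∀ h → sumV v h ≡ ∑ (fins k) h
  sumV-NoDup {k} v nd h = trans (sym (∑-count v h)) (∑-cong (fins k) λ x → trans (cong (λ c → ι c * h x) (NoDup-count≡1 v nd x))
      (ℚP.*-identityˡ (h x)))

  -- The indicator of `NoDup` as a product. A factor can be negative only if a value repeats further
  -- on, and then a later factor is 0.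
  injw : ∀ {k m} → Vec (Fin k) m → ℚ
  injw [] = 1ℚ
  injw (x ∷ xs) = (1ℚ - ι (count x xs)) * injw xs

  injw-yes : ∀ {k m} (v : Vec (Fin k) m) → NoDup v → injw v ≡ 1ℚ
  injw-yes [] nd = refl
  injw-yes (x ∷ xs) (c , nd) = trans (cong₂ (λ a b → (1ℚ - ι a) * b) c (injw-yes xs nd)) refl

  injw-no : ∀ {k m} (v : Vec (Fin k) m) → ¬ NoDup v → injw v ≡ 0ℚ
  injw-no [] nd = ⊥-elim (nd tt)
  injw-no (x ∷ xs) nd with NoDup? xs
  ... | no nd′ = trans (cong ((1ℚ - ι (count x xs)) *_) (injw-no xs nd′)) (ℚP.*-zeroʳ (1ℚ - ι (count x xs)))
  ... | yes nd′ = trans (cong (λ c → (1ℚ - ι c) * injw xs) (ℕP.≤-antisym (NoDup-count≤1 xs nd′ x) (ℕP.n≢0⇒n>0 λ c → nd (c , nd′))))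
      (ℚP.*-zeroˡ (injw xs))

  injw≥0 : ∀ {k m} (v : Vec (Fin k) m) → 0ℚ ≤ injw v
  injw≥0 v with NoDup? v
  ... | yes nd = subst (0ℚ ≤_) (sym (injw-yes v nd)) 0≤1
  ... | no nd = ℚP.≤-reflexive (sym (injw-no v nd))

  count-lookup : ∀ {k m} (xs : Vec (Fin k) m) j → 0 ℕ.< count (lookup xs j) xs
  count-lookup (x ∷ xs) zero = subst (λ t → 0 ℕ.< t ℕ.+ count x xs) (sym (eqℕ-refl x)) (s≤s z≤n)
  count-lookup (x ∷ xs) (suc j) = ℕP.≤-trans (count-lookup xs j) (ℕP.m≤n+m _ _)

  count-find : ∀ {k m} (a : Fin k) (xs : Vec (Fin k) m) → 0 ℕ.< count a xs → ∃[ j ] lookup xs j ≡ a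
  count-find a (x ∷ xs) l with a FinP.≟ x
  ... | yes e = zero , sym e
  ... | no ne with count-find a xs (subst (λ t → 0 ℕ.< t ℕ.+ count a xs) (eqℕ-≢ ne) l)
  ...   | j , e = suc j , e

  NoDup-lookup : ∀ {k m} (v : Vec (Fin k) m) → NoDup v → ∀ i j → lookup v i ≡ lookup v j → i ≡ j
  NoDup-lookup (x ∷ xs) (c , nd) zero zero e = refl
  NoDup-lookup (x ∷ xs) (c , nd) zero (suc j) e = ⊥-elim (ℕP.<-irrefl (sym (trans (cong (λ t → count t xs) (sym e)) c)) (count-lookup xs j))
  NoDup-lookup (x ∷ xs) (c , nd) (suc i) zero e = ⊥-elim (ℕP.<-irrefl (sym (trans (cong (λ t → count t xs) e) c)) (count-lookup xs i))
  NoDup-lookup (x ∷ xs) (c , nd) (suc i) (suc j) e = cong suc (NoDup-lookup xs nd i j e)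

  lookup-NoDup : ∀ {k m} (v : Vec (Fin k) m) → (∀ i j → lookup v i ≡ lookup v j → i ≡ j) → NoDup v
  lookup-NoDup [] h = tt
  lookup-NoDup (x ∷ xs) h = c , lookup-NoDup xs (λ i j e → FinP.suc-injective (h (suc i) (suc j) e))
    where
    c : count x xs ≡ 0
    c with count x xs ℕP.≟ 0
    ... | yes e = e
    ... | no ne with count-find x xs (ℕP.n≢0⇒n>0 ne)
    ...   | j , e with h (suc j) zero e
    ...     | ()

  and-true : {A : Set} (h : A → Bool) (xs : List A) → (∀ x → h x ≡ true) → and (map h xs) ≡ true
  and-true h [] e = refl
  and-true h (x ∷ xs) e rewrite e x = and-true h xs e

  and-∈ : {A : Set} (h : A → Bool) (xs : List A) → and (map h xs) ≡ true → ∀ {x} → x ∈ xs → h x ≡ true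
  and-∈ h (x ∷ xs) e m with h x in eq
  and-∈ h (x ∷ xs) e (here refl) | true = eq
  and-∈ h (x ∷ xs) e (there m) | true = and-∈ h xs e m
  and-∈ h (x ∷ xs) () m | false

  or-true : {A : Set} (h : A → Bool) {x : A} (xs : List A) → x ∈ xs → h x ≡ true → or (map h xs) ≡ true
  or-true h (x ∷ xs) (here refl) e rewrite e = refl
  or-true h (x ∷ xs) (there m) e with h x
  ... | true = refl
  ... | false = or-true h xs m e

  isInjective-NoDup : ∀ {k} (f : Map k) → isInjectiveᵇ f ≡ true → NoDup f
  isInjective-NoDup {k} f e = lookup-NoDup f λ i j eq → pt i j eq (and-∈ _ (allFin k) (and-∈ _ (allFin k) e (∈-allFin i)) (∈-allFin j))
    where
    pt : ∀ i j → lookup f i ≡ lookup f j → not ⌊ lookup f i FinP.≟ lookup f j ⌋ ∨ ⌊ i FinP.≟ j ⌋ ≡ true → i ≡ j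
    pt i j eq b with lookup f i FinP.≟ lookup f j | i FinP.≟ j
    ... | _ | yes p = p
    ... | no ne | no _ = ⊥-elim (ne eq)
    pt i j eq () | yes _ | no _

  NoDup-isBijection : ∀ {k} (f : Map k) → NoDup f → isBijectionᵇ f ≡ true
  NoDup-isBijection {k} f nd = cong₂ _∧_ (and-true _ (allFin k) λ i → and-true _ (allFin k) λ j → pt i j)
     (and-true _ (allFin k) λ z → let (j , e) = count-find z f (subst (0 ℕ.<_) (sym (NoDup-count≡1 f nd z)) (s≤s z≤n)) in or-true _ (allFin k) (∈-allFin j) (dec j z e))
    where
    pt : ∀ i j → not ⌊ lookup f i FinP.≟ lookup f j ⌋ ∨ ⌊ i FinP.≟ j ⌋ ≡ true
    pt i j with lookup f i FinP.≟ lookup f j | i FinP.≟ j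
    ... | _ | yes p = ∨-true _
      where
      ∨-true : ∀ b → b ∨ true ≡ true
      ∨-true true = refl
      ∨-true false = refl
    ... | no ne | no _ = refl
    ... | yes e | no ne = ⊥-elim (ne (NoDup-lookup f nd i j e))
    dec : ∀ j z → lookup f j ≡ z → ⌊ lookup f j FinP.≟ z ⌋ ≡ true
    dec j z e with lookup f j FinP.≟ z
    ... | yes _ = refl
    ... | no ne = ⊥-elim (ne e)

  b2q : Bool → ℚ
  b2q b = ι (if b then 1 else 0)

  isBijection-injw : ∀ {k} (f : Map k) → b2q (isBijectionᵇ f) ≡ injw f
  isBijection-injw f with NoDup? f
  ... | yes nd = trans (cong b2q (NoDup-isBijection f nd)) (sym (injw-yes f nd))
  ... | no nd = trans (cong b2q (false-if f nd)) (sym (injw-no f nd))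
    where
    false-if : ∀ f → ¬ NoDup f → isBijectionᵇ f ≡ false
    false-if f nd with isInjectiveᵇ f in eq
    ... | true = ⊥-elim (nd (isInjective-NoDup f eq))
    ... | false = refl

  b2q-∧ : ∀ a b → b2q (a ∧ b) ≡ b2q a * b2q b
  b2q-∧ true b = sym (ℚP.*-identityˡ (b2q b))
  b2q-∧ false b = sym (ℚP.*-zeroˡ (b2q b))

  ι-sum : {A : Set} (f : A → ℕ) (xs : List A) → ι (sumℕ (map f xs)) ≡ ∑ xs (λ x → ι (f x))
  ι-sum f [] = refl
  ι-sum f (x ∷ xs) = trans (ι-+ (f x) _) (cong (ι (f x) +_) (ι-sum f xs))

  ∑-allVecs : ∀ m k (f : Vec (Fin k) m → ℚ) → ∑ (allVecs m k) f ≡ ∑ (vecs (fins k) m) f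
  ∑-allVecs zero k f = refl
  ∑-allVecs (suc m) k f = trans (∑-concatMap (allFin k) _ f) (trans (∑-cong (allFin k) λ x → trans (∑-map (allVecs m k) (x ∷_) f)
      (∑-allVecs m k _))
    (trans (cong (λ l → ∑ l (λ x → ∑ (vecs (fins k) m) (λ v → f (x ∷ v)))) (sym (fins-allFin k))) (sym (∑-vecs (fins k) m f))))

  s-injw : ∀ k → ι (s k) ≡ ∑ (vecs (fins k) k) (λ π₁ → ∑ (vecs (fins k) k) (λ π₂ → injw π₁ * (injw π₂ * injw (π₁ ⊕ π₂))))
  s-injw k = trans (ι-sum _ (allVecs k k)) (trans (∑-cong (allVecs k k) λ π₁ → trans (ι-sum _ (allVecs k k))
      (trans (∑-cong (allVecs k k) λ π₂ →
     trans (b2q-∧ (isBijectionᵇ π₁) (isBijectionᵇ π₂ ∧ isBijectionᵇ (π₁ ⊕ π₂)))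
         (cong₂ _*_ (isBijection-injw π₁) (trans (b2q-∧ (isBijectionᵇ π₂) (isBijectionᵇ (π₁ ⊕ π₂)))
         (cong₂ _*_ (isBijection-injw π₂) (isBijection-injw (π₁ ⊕ π₂))))))
     (∑-allVecs k k _))) (∑-allVecs k k _))

  -- Fourier expansion through the trace function

  module Fourier (p : ℕ) where
    open Group p
    open Moments p
    open Trace p using (y; y-0; y-≈; y-kill)

    -- Exponents are natural numbers and are not reduced; only the periodicity of `y` identifies
    -- them modulo n.
    dot : ∀ {m} → Vec G m → Vec ℕ m → ℕ
    dot [] [] = 0
    dot (a ∷ u) (b ∷ v) = toℕ a ℕ.* b ℕ.+ dot u v

    nat : ∀ {m} → Vec G m → Vec ℕ m
    nat [] = []
    nat (x ∷ xs) = toℕ x ∷ nat xs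

    -- Used for c = 1 and for c = p, which is -1 modulo n and plays the part of complex conjugation.
    Faithful : ℕ → Set
    Faithful c = ∀ (r : G) → r ≢ zero → ¬ (n ∣ c ℕ.* toℕ r)

    ∑-y : ∀ c → Faithful c → ∀ (r : G) k → ∑ gs (λ x → y (k ℕ.+ c ℕ.* (toℕ r ℕ.* toℕ x))) ≡ δ zero r * (nQ * y k)
    ∑-y c fa zero k = trans (∑-cong gs λ x → cong y (trans (cong (k ℕ.+_) (ℕP.*-zeroʳ c)) (ℕP.+-identityʳ k)))
        (trans (∑-fins-const n (y k)) (trans (cong (_* y k) (sym nQ-ι)) (sym (ℚP.*-identityˡ (nQ * y k)))))
    ∑-y c fa (suc i) k = trans (trans (∑-cong gs λ x → cong (λ t → y (k ℕ.+ t)) (sym (ℕP.*-assoc c (suc (toℕ i)) (toℕ x))))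
        (∑-fins-toℕ n (λ j → y (k ℕ.+ c ℕ.* suc (toℕ i) ℕ.* j)))) (trans (y-kill (c ℕ.* suc (toℕ i)) (fa (suc i) λ ()) k)
        (sym (ℚP.*-zeroˡ (nQ * y k))))

    toℕ-⊞′ : ∀ a b → ∃[ q ] (toℕ (a ⊞ b) ℕ.+ q ℕ.* n ≡ toℕ a ℕ.+ toℕ b)
    toℕ-⊞′ a b = (toℕ a ℕ.+ toℕ b) ℕ./ n , trans (cong (ℕ._+ (toℕ a ℕ.+ toℕ b) ℕ./ n ℕ.* n) (toℕ-⊞ a b))
        (sym (DM.m≡m%n+[m/n]*n (toℕ a ℕ.+ toℕ b) n))

    S-y : ∀ c {m} r (v : Vec G m) (x : Vec G m) k → S r v (λ w → y (k ℕ.+ c ℕ.* dot w (nat x))) ≡ sumV x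
        (λ z → y (k ℕ.+ c ℕ.* dot v (nat x) ℕ.+ c ℕ.* (toℕ r ℕ.* toℕ z)))
    S-y c r [] [] k = refl
    S-y c r (a ∷ v) (b ∷ x) k = cong₂ _+_ head (trans (S-cong r v λ w → cong y (re₁ (dot w (nat x))))
        (trans (S-y c r v x (k ℕ.+ c ℕ.* (toℕ a ℕ.* toℕ b))) (sumV-cong x λ z → cong (λ t → y (t ℕ.+ c ℕ.* (toℕ r ℕ.* toℕ z)))
        (sym (re₁ (dot v (nat x)))))))
      where
      re₁ : ∀ t → k ℕ.+ c ℕ.* (toℕ a ℕ.* toℕ b ℕ.+ t) ≡ k ℕ.+ c ℕ.* (toℕ a ℕ.* toℕ b) ℕ.+ c ℕ.* t
      re₁ t = trans (cong (k ℕ.+_) (ℕP.*-distribˡ-+ c (toℕ a ℕ.* toℕ b) t)) (sym (ℕP.+-assoc k (c ℕ.* (toℕ a ℕ.* toℕ b)) (c ℕ.* t)))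
      head : y (k ℕ.+ c ℕ.* (toℕ (r ⊞ a) ℕ.* toℕ b ℕ.+ dot v (nat x))) ≡ y
          (k ℕ.+ c ℕ.* (toℕ a ℕ.* toℕ b ℕ.+ dot v (nat x)) ℕ.+ c ℕ.* (toℕ r ℕ.* toℕ b))
      head = let (q , e) = toℕ-⊞′ r a in y-≈ (c ℕ.* q ℕ.* toℕ b) 0 (trans
        (solveℕ 7 (λ k c s b d q n → k ∔ c ⨯ (s ⨯ b ∔ d) ∔ c ⨯ q ⨯ b ⨯ n ≐ k ∔ c ⨯ ((s ∔ q ⨯ n) ⨯ b ∔ d)) refl k c (toℕ (r ⊞ a)) (toℕ b)
            (dot v (nat x)) q n)
        (trans (cong (λ t → k ℕ.+ c ℕ.* (t ℕ.* toℕ b ℕ.+ dot v (nat x))) e)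
        (solveℕ 6 (λ k c r a b d → k ∔ c ⨯ ((r ∔ a) ⨯ b ∔ d) ≐ k ∔ c ⨯ (a ⨯ b ∔ d) ∔ c ⨯ (r ⨯ b) ∔ conℕ 0) refl k c (toℕ r) (toℕ a) (toℕ b)
            (dot v (nat x)))))

    ∑-S : ∀ {A : Set} (xs : List A) {m} r (v : Vec G m) (w : A → ℚ) (f : A → Vec G m → ℚ) → ∑ xs (λ x → w x * S r v (f x)) ≡ S r v
        (λ u → ∑ xs (λ x → w x * f x u))
    ∑-S xs r [] w f = ∑-≡0 xs λ x → ℚP.*-zeroʳ (w x)
    ∑-S xs r (a ∷ v) w f = trans (∑-cong xs λ x → ℚP.*-distribˡ-+ (w x) _ _)
        (trans (∑-+ xs _ _) (cong (∑ xs (λ x → w x * f x ((r ⊞ a) ∷ v)) +_) (∑-S xs r v w (λ x u → f x (a ∷ u)))))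

    -- For fixed `xs` the first value avoids the entries of `xs`: the unrestricted sum gives the δ
    -- term, and each excluded value merges r into an entry, which is the recursion of F. As `y` is
    -- not multiplicative, the offset k is what allows several expansions to share one value of `y`.
    F-fourier : ∀ c → Faithful c → ∀ m (r : Vec G m) k → ∑ (vecs gs m) (λ x → injw x * y (k ℕ.+ c ℕ.* dot r (nat x))) ≡ F m r * y k
    F-fourier c fa zero [] k = trans (ℚP.+-identityʳ _) (cong (λ t → 1ℚ * y t) (trans (cong (k ℕ.+_) (ℕP.*-zeroʳ c)) (ℕP.+-identityʳ k)))
    F-fourier c fa (suc m) (r ∷ rs) k = begin
      ∑ (vecs gs (suc m)) (λ x → injw x * y (k ℕ.+ c ℕ.* dot (r ∷ rs) (nat x))) ≡⟨ ∑-vecs gs m _ ⟩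
      ∑ gs (λ x → ∑ (vecs gs m) (λ xs → (1ℚ - ι (count x xs)) * injw xs * y (k ℕ.+ c ℕ.* (toℕ r ℕ.* toℕ x ℕ.+ dot rs (nat xs))))) ≡⟨ ∑-swap gs
          (vecs gs m) _ ⟩
      ∑ (vecs gs m) (λ xs → ∑ gs (λ x → (1ℚ - ι (count x xs)) * injw xs * y (k ℕ.+ c ℕ.* (toℕ r ℕ.* toℕ x ℕ.+ dot rs (nat xs))))) ≡⟨ ∑-cong
          (vecs gs m) inner ⟩
      ∑ (vecs gs m) (λ xs → δ zero r * nQ * (injw xs * y (k ℕ.+ c ℕ.* dot rs (nat xs))) - injw xs * S r rs
          (λ w → y (k ℕ.+ c ℕ.* dot w (nat xs))))
        ≡⟨ trans (∑-− (vecs gs m) _ _) (cong₂ _-_ (trans (∑-*ˡ (vecs gs m) (δ zero r * nQ) _)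
            (cong (δ zero r * nQ *_) (F-fourier c fa m rs k)))
            (trans (∑-S (vecs gs m) r rs injw _) (trans (S-cong r rs λ w → trans (F-fourier c fa m w k) (ℚP.*-comm (F m w) (y k)))
                (S-*ˡ r rs (y k) (F m))))) ⟩
      δ zero r * nQ * (F m rs * y k) - y k * S r rs (F m) ≡⟨ (solve 5 (λ d n f y s → d :* n :* (f :* y) :- y :* s := (d :* (n :* f) :- s) :*
          y) refl (δ zero r) (nQ) (F m rs) (y k) (S r rs (F m))) ⟩
      F (suc m) (r ∷ rs) * y k ∎
      where
      open ≡-Reasoning
      inner : ∀ xs → ∑ gs (λ x → (1ℚ - ι (count x xs)) * injw xs * y (k ℕ.+ c ℕ.* (toℕ r ℕ.* toℕ x ℕ.+ dot rs (nat xs))))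
        ≡ δ zero r * nQ * (injw xs * y (k ℕ.+ c ℕ.* dot rs (nat xs))) - injw xs * S r rs (λ w → y (k ℕ.+ c ℕ.* dot w (nat xs)))
      inner xs = begin
        ∑ gs (λ x → (1ℚ - ι (count x xs)) * injw xs * y (k ℕ.+ c ℕ.* (toℕ r ℕ.* toℕ x ℕ.+ dot rs (nat xs))))
          ≡⟨ ∑-cong gs (λ x → trans (cong (λ t → (1ℚ - ι (count x xs)) * injw xs * y t)
              (solveℕ 4 (λ k c a d → k ∔ c ⨯ (a ∔ d) ≐ k ∔ c ⨯ d ∔ c ⨯ a) refl k c (toℕ r ℕ.* toℕ x) (dot rs (nat xs))))
               (solve 3 (λ a i y → (con 1ℚ :- a) :* i :* y := i :* y :- i :* (a :* y)) refl (ι (count x xs)) (injw xs)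
                   (y (k ℕ.+ c ℕ.* dot rs (nat xs) ℕ.+ c ℕ.* (toℕ r ℕ.* toℕ x))))) ⟩
        ∑ gs (λ x → injw xs * h x - injw xs * (ι (count x xs) * h x)) ≡⟨ trans (∑-− gs _ _)
            (cong₂ _-_ (∑-*ˡ gs (injw xs) h) (∑-*ˡ gs (injw xs) _)) ⟩
        injw xs * ∑ gs h - injw xs * ∑ gs (λ x → ι (count x xs) * h x) ≡⟨ cong₂ (λ a b → injw xs * a - injw xs * b) (∑-y c fa r k′)
            (trans (∑-count xs h) (sym (S-y c r rs xs k))) ⟩
        injw xs * (δ zero r * (nQ * y k′)) - injw xs * S r rs (λ w → y (k ℕ.+ c ℕ.* dot w (nat xs)))
          ≡⟨ cong (λ t → t - injw xs * S r rs (λ w → y (k ℕ.+ c ℕ.* dot w (nat xs))))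
              (solve 4 (λ i d n y → i :* (d :* (n :* y)) := d :* n :* (i :* y)) refl (injw xs) (δ zero r) (nQ) (y k′)) ⟩
        δ zero r * nQ * (injw xs * y k′) - injw xs * S r rs (λ w → y (k ℕ.+ c ℕ.* dot w (nat xs))) ∎
        where
        k′ : ℕ
        k′ = k ℕ.+ c ℕ.* dot rs (nat xs)
        h : G → ℚ
        h x = y (k′ ℕ.+ c ℕ.* (toℕ r ℕ.* toℕ x))

    faithful-1 : Faithful 1
    faithful-1 zero ne d = ne refl
    faithful-1 (suc i) ne d = ℕP.<-irrefl refl (ℕP.≤-<-trans (∣P.∣⇒≤ (subst (n ∣_) (ℕP.*-identityˡ (suc (toℕ i))) d)) (FinP.toℕ<n (suc i)))

    faithful-p : Faithful p
    faithful-p r ne d = faithful-1 r ne (subst (n ∣_) (sym (ℕP.*-identityˡ (toℕ r)))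
        (∣P.∣m+n∣m⇒∣n {m = p ℕ.* toℕ r} (subst (n ∣_) (ℕP.+-comm (toℕ r) (p ℕ.* toℕ r)) (∣P.m∣m*n (toℕ r))) d))

    div : ℕ → ℚ
    div v with n ∣? v
    ... | yes _ = 1ℚ
    ... | no _ = 0ℚ

    divs : ∀ {m} → Vec ℕ m → ℚ
    divs [] = 1ℚ
    divs (v ∷ vs) = div v * divs vs

    ∑-y-linear : ∀ v k → ∑ gs (λ t → y (k ℕ.+ toℕ t ℕ.* v)) ≡ nQ * div v * y k
    ∑-y-linear v k with n ∣? v
    ... | yes (divides q e) = trans (∑-cong gs λ t → y-≈ 0 (toℕ t ℕ.* q)
        (trans (ℕP.+-identityʳ _) (cong (k ℕ.+_) (trans (cong (toℕ t ℕ.*_) e) (sym (ℕP.*-assoc (toℕ t) q n))))))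
        (trans (∑-fins-const n (y k)) (trans (cong (_* y k) (sym nQ-ι)) (cong (_* y k) (sym (ℚP.*-identityʳ nQ)))))
    ... | no nd = trans (∑-cong gs λ t → cong (λ z → y (k ℕ.+ z)) (ℕP.*-comm (toℕ t) v))
        (trans (∑-fins-toℕ n (λ j → y (k ℕ.+ v ℕ.* j))) (trans (y-kill v nd k)
        (solve 2 (λ n y → con 0ℚ := n :* con 0ℚ :* y) refl (nQ) (y k))))

    ∑-orthogonal : ∀ {m} (v : Vec ℕ m) k → ∑ (vecs gs m) (λ t → y (k ℕ.+ dot t v)) ≡ nQ ^ m * divs v * y k
    ∑-orthogonal [] k = trans (ℚP.+-identityʳ _) (trans (cong y (ℕP.+-identityʳ k)) (solve 1 (λ y → y := con 1ℚ :* con 1ℚ :* y) refl (y k)))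
    ∑-orthogonal {suc m} (v ∷ vs) k = begin
      ∑ (vecs gs (suc m)) (λ t → y (k ℕ.+ dot t (v ∷ vs))) ≡⟨ ∑-vecs gs m _ ⟩
      ∑ gs (λ a → ∑ (vecs gs m) (λ t → y (k ℕ.+ (toℕ a ℕ.* v ℕ.+ dot t vs)))) ≡⟨ ∑-cong gs
          (λ a → trans (∑-cong (vecs gs m) λ t → cong y (sym (ℕP.+-assoc k (toℕ a ℕ.* v) (dot t vs)))) (∑-orthogonal vs (k ℕ.+ toℕ a ℕ.* v))) ⟩
      ∑ gs (λ a → nQ ^ m * divs vs * y (k ℕ.+ toℕ a ℕ.* v)) ≡⟨ trans (∑-*ˡ gs (nQ ^ m * divs vs) _)
          (cong (nQ ^ m * divs vs *_) (∑-y-linear v k)) ⟩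
      nQ ^ m * divs vs * (nQ * div v * y k) ≡⟨ (solve 5 (λ a b n d y → a :* b :* (n :* d :* y) := n :* a :* (d :* b) :* y) refl (nQ ^ m)
          (divs vs) (nQ) (div v) (y k)) ⟩
      nQ ^ suc m * divs (v ∷ vs) * y k ∎
      where open ≡-Reasoning

  -- Translation and splitting by the most frequent value

  binom : ℕ → ℕ → ℚ
  binom N zero = 1ℚ
  binom zero (suc m) = 0ℚ
  binom (suc N) (suc m) = binom N m + binom N (suc m)

  binom-> : ∀ N m → N ℕ.< m → binom N m ≡ 0ℚ
  binom-> zero (suc m) l = refl
  binom-> (suc N) (suc m) (s≤s l) = trans (cong₂ _+_ (binom-> N m l) (binom-> N (suc m) (ℕP.m<n⇒m<1+n l))) refl

  binom-fact : ∀ a b → binom (a ℕ.+ b) a * (fact a * fact b) ≡ fact (a ℕ.+ b)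
  binom-fact zero b = (solve 1 (λ x → con 1ℚ :* (con 1ℚ :* x) := x) refl (fact b))
  binom-fact (suc a) zero = begin
    (binom (a ℕ.+ 0) a + binom (a ℕ.+ 0) (suc a)) * (ι (suc a) * fact a * 1ℚ) ≡⟨ cong
        (λ t → (binom (a ℕ.+ 0) a + t) * (ι (suc a) * fact a * 1ℚ)) (binom-> (a ℕ.+ 0) (suc a) (s≤s (ℕP.≤-reflexive (ℕP.+-identityʳ a)))) ⟩
    (binom (a ℕ.+ 0) a + 0ℚ) * (ι (suc a) * fact a * 1ℚ) ≡⟨ (solve 3 (λ c k f → (c :+ con 0ℚ) :* (k :* f :* con 1ℚ) := k :*
        (c :* (f :* con 1ℚ))) refl (binom (a ℕ.+ 0) a) (ι (suc a)) (fact a)) ⟩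
    ι (suc a) * (binom (a ℕ.+ 0) a * (fact a * 1ℚ)) ≡⟨ cong₂ (λ x y → ι (suc x) * y) (sym (ℕP.+-identityʳ a)) (binom-fact a 0) ⟩
    fact (suc (a ℕ.+ 0)) ∎
    where open ≡-Reasoning
  binom-fact (suc a) (suc b) = begin
    (binom (a ℕ.+ suc b) a + binom (a ℕ.+ suc b) (suc a)) * (ι (suc a) * fact a * (ι (suc b) * fact b))
      ≡⟨ (solve 6 (λ x y k j f g → (x :+ y) :* (k :* f :* (j :* g)) := k :* (x :* (f :* (j :* g))) :+ j :* (y :* (k :* f :* g))) refl
          (binom (a ℕ.+ suc b) a) (binom (a ℕ.+ suc b) (suc a)) (ι (suc a)) (ι (suc b)) (fact a) (fact b)) ⟩
    ι (suc a) * (binom (a ℕ.+ suc b) a * (fact a * fact (suc b))) + ι (suc b) * (binom (a ℕ.+ suc b) (suc a) * (fact (suc a) * fact b))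
      ≡⟨ cong₂ (λ x y → ι (suc a) * x + ι (suc b) * y) (binom-fact a (suc b))
          (trans (cong (λ t → binom t (suc a) * (fact (suc a) * fact b)) (ℕP.+-suc a b))
          (trans (binom-fact (suc a) b) (cong fact (sym (ℕP.+-suc a b))))) ⟩
    ι (suc a) * fact (a ℕ.+ suc b) + ι (suc b) * fact (a ℕ.+ suc b) ≡⟨ trans
        (sym (ℚP.*-distribʳ-+ (fact (a ℕ.+ suc b)) (ι (suc a)) (ι (suc b)))) (cong (_* fact (a ℕ.+ suc b)) (sym (ι-+ (suc a) (suc b)))) ⟩
    fact (suc a ℕ.+ suc b) ∎
    where open ≡-Reasoning

  strip : ∀ {k N} → Vec (Fin (suc k)) N → ∃[ m ] Vec (Fin k) m
  strip [] = 0 , []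
  strip (zero ∷ v) = strip v
  strip (suc i ∷ v) = let (m , w) = strip v in suc m , i ∷ w

  strip-count : ∀ {k N} (v : Vec (Fin (suc k)) N) → count zero v ℕ.+ proj₁ (strip v) ≡ N
  strip-count [] = refl
  strip-count (zero ∷ v) = cong suc (strip-count v)
  strip-count (suc i ∷ v) = trans (ℕP.+-suc (count zero v) _) (cong suc (strip-count v))

  strip-count-suc : ∀ {k N} (v : Vec (Fin (suc k)) N) i → count (suc i) v ≡ count i (proj₂ (strip v))
  strip-count-suc [] i = refl
  strip-count-suc (zero ∷ v) i = strip-count-suc v i
  strip-count-suc (suc j ∷ v) i = cong (eqℕ i j ℕ.+_) (strip-count-suc v i)

  -- The summand sees only the nonzero entries in their order, and m of these can be placed in
  -- `binom N m` ways. The induction is Pascal's rule.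
  ∑-strip : ∀ {k} N (Ψ : ∀ m → Vec (Fin k) m → ℚ) →
    ∑ (vecs (fins (suc k)) N) (λ v → Ψ (proj₁ (strip v)) (proj₂ (strip v))) ≡ ∑< (suc N) (λ m → binom N m * ∑ (vecs (fins k) m) (Ψ m))
  ∑-strip zero Ψ = (solve 1 (λ x → x :+ con 0ℚ := con 0ℚ :+ con 1ℚ :* (x :+ con 0ℚ)) refl (Ψ 0 []))
  ∑-strip {k} (suc N) Ψ = begin
    ∑ (vecs (fins (suc k)) (suc N)) (λ v → Ψ (proj₁ (strip v)) (proj₂ (strip v))) ≡⟨ trans (∑-vecs (fins (suc k)) N _) (∑-fins k _) ⟩
    ∑ (vecs (fins (suc k)) N) (λ v → Ψ (proj₁ (strip v)) (proj₂ (strip v))) + ∑ (fins k)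
        (λ i → ∑ (vecs (fins (suc k)) N) (λ v → Ψ (suc (proj₁ (strip v))) (i ∷ proj₂ (strip v))))
      ≡⟨ cong₂ _+_ (∑-strip N Ψ) (∑-cong (fins k) λ i → ∑-strip N (λ m w → Ψ (suc m) (i ∷ w))) ⟩
    ∑< (suc N) (λ m → binom N m * Q m) + ∑ (fins k) (λ i → ∑< (suc N) (λ m → binom N m * ∑ (vecs (fins k) m) (λ w → Ψ (suc m) (i ∷ w))))
      ≡⟨ cong (∑< (suc N) (λ m → binom N m * Q m) +_) (trans (∑<-swap (fins k) (suc N) _)
          (∑<-cong (suc N) λ m _ → trans (∑-*ˡ (fins k) (binom N m) _) (cong (binom N m *_) (sym (∑-vecs (fins k) m (Ψ (suc m))))))) ⟩
    ∑< (suc N) (λ m → binom N m * Q m) + ∑< (suc N) (λ m → binom N m * Q (suc m))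
      ≡⟨ cong (_+ ∑< (suc N) (λ m → binom N m * Q (suc m))) (trans (∑<-left N _)
          (cong (binom N 0 * Q 0 +_) (trans (solve 2 (λ x q → x := x :+ con 0ℚ :* q) refl (∑< N (λ m → binom N (suc m) * Q (suc m)))
          (Q (suc N)))
           (cong (λ t → ∑< N (λ m → binom N (suc m) * Q (suc m)) + t * Q (suc N)) (sym (binom-> N (suc N) ℕP.≤-refl)))))) ⟩
    (1ℚ * Q 0 + ∑< (suc N) (λ m → binom N (suc m) * Q (suc m))) + ∑< (suc N) (λ m → binom N m * Q (suc m))
      ≡⟨ trans (solve 3 (λ a b c → (a :+ b) :+ c := a :+ (c :+ b)) refl (1ℚ * Q 0) (∑< (suc N) (λ m → binom N (suc m) * Q (suc m)))
          (∑< (suc N) (λ m → binom N m * Q (suc m))))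
          (cong (1ℚ * Q 0 +_) (trans (sym (∑<-+ (suc N) _ _)) (∑<-cong (suc N) λ m _ → sym
              (ℚP.*-distribʳ-+ (Q (suc m)) (binom N m) (binom N (suc m)))))) ⟩
    1ℚ * Q 0 + ∑< (suc N) (λ m → binom (suc N) (suc m) * Q (suc m)) ≡⟨ sym (∑<-left (suc N) (λ m → binom (suc N) m * Q m)) ⟩
    ∑< (suc (suc N)) (λ m → binom (suc N) m * Q m) ∎
    where
    open ≡-Reasoning
    Q : ℕ → ℚ
    Q m = ∑ (vecs (fins k) m) (Ψ m)

  ∑-vecs-map : {A B : Set} (xs : List A) (h : A → B) (m : ℕ) (f : Vec B m → ℚ) → ∑ (vecs (map h xs) m) f ≡ ∑ (vecs xs m)
      (λ v → f (Vec.map h v))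
  ∑-vecs-map xs h zero f = refl
  ∑-vecs-map xs h (suc m) f = trans (∑-vecs (map h xs) m f) (trans (∑-map xs h _)
      (trans (∑-cong xs λ x → ∑-vecs-map xs h m (λ v → f (h x ∷ v))) (sym (∑-vecs xs m _))))

  2ι∑ : ∀ m → (ℤ.+ 2 / 1) * ∑< m ι ≡ ι m * (ι m - 1ℚ)
  2ι∑ zero = refl
  2ι∑ (suc m) = trans (solve 2 (λ s k → con (ℤ.+ 2 / 1) :* (s :+ k) := con (ℤ.+ 2 / 1) :* s :+ con (ℤ.+ 2 / 1) :* k) refl (∑< m ι) (ι m))
      (trans (cong (_+ (ℤ.+ 2 / 1) * ι m) (2ι∑ m)) (solve 1 (λ k → k :* (k :- con 1ℚ) :+ con (ℤ.+ 2 / 1) :* k := (con 1ℚ :+ k) :*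
      ((con 1ℚ :+ k) :- con 1ℚ)) refl (ι m)))

  ι-injective : ∀ {a b} → ι a ≡ ι b → a ≡ b
  ι-injective e = ℕP.≤-antisym (ι-cancel-≤ (ℚP.≤-reflexive e)) (ι-cancel-≤ (ℚP.≤-reflexive (sym e)))

  module Identity (p : ℕ) where
    open Group p
    open Moments p
    open Sparse p
    open Fourier p
    open Trace p using (y; y-0; y-≈)

    δV : ∀ {m} → Vec G m → Vec G m → ℚ
    δV [] [] = 1ℚ
    δV (a ∷ u) (b ∷ v) = δ a b * δV u v

    ∑-δV : ∀ {m} (u : Vec G m) (f : Vec G m → ℚ) → ∑ (vecs gs m) (λ w → δV u w * f w) ≡ f u
    ∑-δV [] f = (solve 1 (λ x → con 1ℚ :* x :+ con 0ℚ := x) refl (f []))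
    ∑-δV {suc m} (a ∷ u) f = trans (∑-vecs gs m _) (trans (∑-cong gs λ b → trans
        (∑-cong (vecs gs m) λ w → ℚP.*-assoc (δ a b) (δV u w) (f (b ∷ w)))
        (trans (∑-*ˡ (vecs gs m) (δ a b) _) (cong (δ a b *_) (∑-δV u (λ w → f (b ∷ w))))))
      (∑-δ a (λ b → f (b ∷ u))))

    div-δ : ∀ (a b c : G) → div (toℕ a ℕ.+ toℕ b ℕ.+ p ℕ.* toℕ c) ≡ δ (a ⊞ b) c
    div-δ a b c with n ∣? (toℕ a ℕ.+ toℕ b ℕ.+ p ℕ.* toℕ c) | (a ⊞ b) FinP.≟ c
    ... | yes _ | yes refl = sym (δ-refl (a ⊞ b))
    ... | no _ | no ne = sym (δ-≢ ne)
    ... | no nd | yes refl = ⊥-elim (nd (let (q , e) = toℕ-⊞′ a b in divides (toℕ (a ⊞ b) ℕ.+ q) (trans (cong (ℕ._+ p ℕ.* toℕ (a ⊞ b)) (sym e))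
          (solveℕ 3 (λ t q p → t ∔ q ⨯ (conℕ 1 ∔ p) ∔ p ⨯ t ≐ (t ∔ q) ⨯ (conℕ 1 ∔ p)) refl (toℕ (a ⊞ b)) q p))))
    ... | yes (divides d e) | no ne = ⊥-elim (ne (FinP.toℕ-injective (trans (toℕ-⊞ a b)
        (trans (sym (DM.[m+kn]%n≡m%n (toℕ a ℕ.+ toℕ b) (toℕ c) n))
          (trans (cong (_% n) (trans (solveℕ 3 (λ t c p → t ∔ c ⨯ (conℕ 1 ∔ p) ≐ c ∔ (t ∔ p ⨯ c)) refl (toℕ a ℕ.+ toℕ b) (toℕ c) p)
              (cong (toℕ c ℕ.+_) e)))
            (trans (DM.[m+kn]%n≡m%n (toℕ c) d n) (toℕ% c)))))))

    -- Encodes u + v - w, with -1 written as p.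
    comb : ∀ {m} → Vec G m → Vec G m → Vec G m → Vec ℕ m
    comb [] [] [] = []
    comb (a ∷ u) (b ∷ v) (c ∷ w) = (toℕ a ℕ.+ toℕ b ℕ.+ p ℕ.* toℕ c) ∷ comb u v w

    divs-comb : ∀ {m} (u v w : Vec G m) → divs (comb u v w) ≡ δV (Vec.zipWith _+ₙ_ u v) w
    divs-comb [] [] [] = refl
    divs-comb (a ∷ u) (b ∷ v) (c ∷ w) = cong₂ _*_ (div-δ a b c) (divs-comb u v w)

    dot-comb : ∀ {m} (χ u v w : Vec G m) → dot χ (comb u v w) ≡ dot χ (nat u) ℕ.+ dot χ (nat v) ℕ.+ p ℕ.* dot χ (nat w)
    dot-comb [] [] [] [] = sym (ℕP.*-zeroʳ p)
    dot-comb (x ∷ χ) (a ∷ u) (b ∷ v) (c ∷ w) = trans (cong (toℕ x ℕ.* (toℕ a ℕ.+ toℕ b ℕ.+ p ℕ.* toℕ c) ℕ.+_) (dot-comb χ u v w))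
      (solveℕ 8 (λ x a b c p d e f → x ⨯ (a ∔ b ∔ p ⨯ c) ∔ (d ∔ e ∔ p ⨯ f) ≐ (x ⨯ a ∔ d) ∔ (x ⨯ b ∔ e) ∔ p ⨯ (x ⨯ c ∔ f)) refl
        (toℕ x) (toℕ a) (toℕ b) (toℕ c) p (dot χ (nat u)) (dot χ (nat v)) (dot χ (nat w)))

    F³ : ∀ {m} → Vec G m → ℚ
    F³ {m} χ = F m χ * F m χ * F m χ

    -- Three uses of `F-fourier`, for w with c = p and for v and u with c = 1, the remaining
    -- exponents being carried in the offset.
    F³-fourier : ∀ {m} (χ : Vec G m) → F³ χ ≡ ∑ (vecs gs m) (λ u → ∑ (vecs gs m)
        (λ v → ∑ (vecs gs m) (λ w → injw w * (injw v * injw u) * y (dot χ (comb u v w)))))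
    F³-fourier {m} χ = sym (begin
      ∑ (vecs gs m) (λ u → ∑ (vecs gs m) (λ v → ∑ (vecs gs m) (λ w → injw w * (injw v * injw u) * y (dot χ (comb u v w)))))
        ≡⟨ ∑-cong (vecs gs m) (λ u → ∑-cong (vecs gs m) λ v → trans (∑-cong (vecs gs m) λ w → trans
            (solve 4 (λ a b c y → a :* (b :* c) :* y := b :* c :* (a :* y)) refl (injw w) (injw v) (injw u) (y (dot χ (comb u v w))))
            (cong (λ t → injw v * injw u * (injw w * y t)) (dot-comb χ u v w)))
            (trans (∑-*ˡ (vecs gs m) (injw v * injw u) _) (cong (injw v * injw u *_)
                (F-fourier p faithful-p m χ (dot χ (nat u) ℕ.+ dot χ (nat v)))))) ⟩
      ∑ (vecs gs m) (λ u → ∑ (vecs gs m) (λ v → injw v * injw u * (F m χ * y (dot χ (nat u) ℕ.+ dot χ (nat v)))))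
        ≡⟨ ∑-cong (vecs gs m) (λ u → trans (∑-cong (vecs gs m) λ v → trans
            (solve 4 (λ b c f y → b :* c :* (f :* y) := c :* f :* (b :* y)) refl (injw v) (injw u) (F m χ)
            (y (dot χ (nat u) ℕ.+ dot χ (nat v)))) (cong (λ t → injw u * F m χ * (injw v * y (dot χ (nat u) ℕ.+ t)))
            (sym (ℕP.*-identityˡ (dot χ (nat v))))))
            (trans (∑-*ˡ (vecs gs m) (injw u * F m χ) _) (cong (injw u * F m χ *_) (F-fourier 1 faithful-1 m χ (dot χ (nat u)))))) ⟩
      ∑ (vecs gs m) (λ u → injw u * F m χ * (F m χ * y (dot χ (nat u))))
        ≡⟨ trans (∑-cong (vecs gs m) λ u → trans (solve 3 (λ c f y → c :* f :* (f :* y) := f :* f :* (c :* y)) refl (injw u) (F m χ)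
            (y (dot χ (nat u)))) (cong (λ t → F m χ * F m χ * (injw u * y t)) (sym (ℕP.*-identityˡ (dot χ (nat u))))))
            (trans (∑-*ˡ (vecs gs m) (F m χ * F m χ) _) (cong (F m χ * F m χ *_) (F-fourier 1 faithful-1 m χ 0))) ⟩
      F m χ * F m χ * (F m χ * y 0) ≡⟨ trans (cong (λ t → F m χ * F m χ * (F m χ * t)) y-0)
          (solve 1 (λ f → f :* f :* (f :* con 1ℚ) := f :* f :* f) refl (F m χ)) ⟩
      F³ χ ∎)
      where open ≡-Reasoning

    -- Orthogonality in χ forces w = u ⊕ v, so each pair counted by `s n` contributes n^n.
    ∑F³ : ∑ (vecs gs n) F³ ≡ nQ ^ n * ι (s n)
    ∑F³ = begin
      ∑ All F³ ≡⟨ ∑-cong All F³-fourier ⟩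
      ∑ All (λ χ → ∑ All (λ u → ∑ All (λ v → ∑ All (λ w → W u v w * y (dot χ (comb u v w)))))) ≡⟨ trans (∑-swap All All _)
          (∑-cong All λ u → trans (∑-swap All All _) (∑-cong All λ v → trans (∑-swap All All _)
          (∑-cong All λ w → trans (∑-*ˡ All (W u v w) _) (cong (W u v w *_) (∑-orthogonal (comb u v w) 0))))) ⟩
      ∑ All (λ u → ∑ All (λ v → ∑ All (λ w → W u v w * (nQ ^ n * divs (comb u v w) * y 0))))
        ≡⟨ ∑-cong All (λ u → ∑-cong All λ v → trans (∑-cong All λ w → trans (cong₂ (λ a b → W u v w * (nQ ^ n * a * b)) (divs-comb u v w) y-0)
              (solve 5 (λ a b c q d → a :* (b :* c) :* (q :* d :* con 1ℚ) := d :* (q :* (c :* (b :* a)))) refl (injw w) (injw v) (injw u)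
                  (nQ ^ n) (δV (u ⊕ v) w))) (∑-δV (u ⊕ v) (λ w → nQ ^ n * (injw u * (injw v * injw w))))) ⟩
      ∑ All (λ u → ∑ All (λ v → nQ ^ n * (injw u * (injw v * injw (u ⊕ v))))) ≡⟨ trans (∑-cong All λ u → ∑-*ˡ All (nQ ^ n) _)
          (∑-*ˡ All (nQ ^ n) _) ⟩
      nQ ^ n * ∑ All (λ u → ∑ All (λ v → injw u * (injw v * injw (u ⊕ v)))) ≡⟨ cong (nQ ^ n *_) (sym (s-injw n)) ⟩
      nQ ^ n * ι (s n) ∎
      where
      open ≡-Reasoning
      All : List (Vec G n)
      All = vecs gs n
      W : Vec G n → Vec G n → Vec G n → ℚ
      W u v w = injw w * (injw v * injw u)

    total : ∀ {m} → Vec G m → ℕ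
    total [] = 0
    total (x ∷ xs) = toℕ x ℕ.+ total xs

    ι-total : ∀ {m} (x : Vec G m) → ι (total x) ≡ sumV x (λ z → ι (toℕ z))
    ι-total [] = refl
    ι-total (x ∷ xs) = trans (ι-+ (toℕ x) (total xs)) (cong (ι (toℕ x) +_) (ι-total xs))

    dot-translate : ∀ r {m} (χ x : Vec G m) → ∃[ q ] (dot (Vec.map (r ⊞_) χ) (nat x) ℕ.+ q ℕ.* n ≡ dot χ (nat x) ℕ.+ toℕ r ℕ.* total x)
    dot-translate r [] [] = 0 , sym (ℕP.*-zeroʳ (toℕ r))
    dot-translate r (a ∷ χ) (b ∷ x) = let (q , e) = dot-translate r χ x; (q′ , e′) = toℕ-⊞′ r a in q′ ℕ.* toℕ b ℕ.+ q , (begin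
      toℕ (r ⊞ a) ℕ.* toℕ b ℕ.+ dot (Vec.map (r ⊞_) χ) (nat x) ℕ.+ (q′ ℕ.* toℕ b ℕ.+ q) ℕ.* n
        ≡⟨ solveℕ 6 (λ t b d q′ q n → t ⨯ b ∔ d ∔ (q′ ⨯ b ∔ q) ⨯ n ≐ (t ∔ q′ ⨯ n) ⨯ b ∔ (d ∔ q ⨯ n)) refl (toℕ (r ⊞ a)) (toℕ b)
            (dot (Vec.map (r ⊞_) χ) (nat x)) q′ q n ⟩
      (toℕ (r ⊞ a) ℕ.+ q′ ℕ.* n) ℕ.* toℕ b ℕ.+ (dot (Vec.map (r ⊞_) χ) (nat x) ℕ.+ q ℕ.* n) ≡⟨ cong₂ (λ s t → s ℕ.* toℕ b ℕ.+ t) e′ e ⟩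
      (toℕ r ℕ.+ toℕ a) ℕ.* toℕ b ℕ.+ (dot χ (nat x) ℕ.+ toℕ r ℕ.* total x)
        ≡⟨ solveℕ 5 (λ r a b d t → (r ∔ a) ⨯ b ∔ (d ∔ r ⨯ t) ≐ a ⨯ b ∔ d ∔ r ⨯ (b ∔ t)) refl (toℕ r) (toℕ a) (toℕ b) (dot χ (nat x))
            (total x) ⟩
      toℕ a ℕ.* toℕ b ℕ.+ dot χ (nat x) ℕ.+ toℕ r ℕ.* (toℕ b ℕ.+ total x) ∎)
      where open ≡-Reasoning

    total-NoDup : ∀ h → n ≡ suc (2 ℕ.* h) → (x : Vec G n) → NoDup x → total x ≡ n ℕ.* h
    total-NoDup h eq x nd = ι-injective (trans (ι-total x) (trans (sumV-NoDup x nd (λ z → ι (toℕ z)))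
        (trans (∑-fins-toℕ n ι) (cancel-≡ {c = ℤ.+ 2 / 1} (ℚP.positive⁻¹ (ℤ.+ 2 / 1)) (begin
      (ℤ.+ 2 / 1) * ∑< n ι ≡⟨ 2ι∑ n ⟩
      ι n * (ι n - 1ℚ) ≡⟨ cong (λ t → ι n * (t - 1ℚ)) (trans (cong ι eq) (cong (1ℚ +_) (ι-* 2 h))) ⟩
      ι n * ((1ℚ + ι 2 * ι h) - 1ℚ) ≡⟨ (solve 2 (λ a b → a :* ((con 1ℚ :+ con (ℤ.+ 2 / 1) :* b) :- con 1ℚ) := con (ℤ.+ 2 / 1) :* (a :* b))
          refl (ι n) (ι h)) ⟩
      (ℤ.+ 2 / 1) * (ι n * ι h) ≡⟨ cong ((ℤ.+ 2 / 1) *_) (sym (ι-* n h)) ⟩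
      (ℤ.+ 2 / 1) * ι (n ℕ.* h) ∎)))))
      where open ≡-Reasoning

    -- Translating χ by the constant r multiplies ω^(χ·π) by ω^(r Σπ) = 1.
    F-translate : ∀ h → n ≡ suc (2 ℕ.* h) → ∀ r (χ : Vec G n) → F n (Vec.map (r ⊞_) χ) ≡ F n χ
    F-translate h eq r χ = begin
      F n (Vec.map (r ⊞_) χ) ≡⟨ sym (one (Vec.map (r ⊞_) χ)) ⟩
      ∑ (vecs gs n) (λ x → injw x * y (0 ℕ.+ 1 ℕ.* dot (Vec.map (r ⊞_) χ) (nat x))) ≡⟨ ∑-cong (vecs gs n) pt ⟩
      ∑ (vecs gs n) (λ x → injw x * y (0 ℕ.+ 1 ℕ.* dot χ (nat x))) ≡⟨ one χ ⟩
      F n χ ∎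
      where
      open ≡-Reasoning
      one : ∀ χ → ∑ (vecs gs n) (λ x → injw x * y (0 ℕ.+ 1 ℕ.* dot χ (nat x))) ≡ F n χ
      one χ = trans (F-fourier 1 faithful-1 n χ 0) (trans (cong (F n χ *_) y-0) (ℚP.*-identityʳ (F n χ)))
      pt : ∀ x → injw x * y (0 ℕ.+ 1 ℕ.* dot (Vec.map (r ⊞_) χ) (nat x)) ≡ injw x * y (0 ℕ.+ 1 ℕ.* dot χ (nat x))
      pt x with NoDup? x
      ... | no nd = trans (cong (_* y (0 ℕ.+ 1 ℕ.* dot (Vec.map (r ⊞_) χ) (nat x))) (injw-no x nd))
          (trans (solve 2 (λ a b → con 0ℚ :* a := con 0ℚ :* b) refl (y (0 ℕ.+ 1 ℕ.* dot (Vec.map (r ⊞_) χ) (nat x)))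
          (y (0 ℕ.+ 1 ℕ.* dot χ (nat x)))) (cong (_* y (0 ℕ.+ 1 ℕ.* dot χ (nat x))) (sym (injw-no x nd))))
      ... | yes nd = cong (injw x *_) (let (q , e) = dot-translate r χ x in y-≈ q (toℕ r ℕ.* h) (trans (cong (ℕ._+ q ℕ.* n) (ℕP.*-identityˡ (dot (Vec.map (r ⊞_) χ) (nat x))))
          (trans e (trans (cong (λ t → dot χ (nat x) ℕ.+ toℕ r ℕ.* t) (total-NoDup h eq x nd))
            (solveℕ 4 (λ d r n h → d ∔ r ⨯ (n ⨯ h) ≐ conℕ 1 ⨯ d ∔ r ⨯ h ⨯ n) refl (dot χ (nat x)) (toℕ r) n h)))))

    ∑-translateV : ∀ r m (f : Vec G m → ℚ) → ∑ (vecs gs m) (λ χ → f (Vec.map (r ⊞_) χ)) ≡ ∑ (vecs gs m) f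
    ∑-translateV r zero f = refl
    ∑-translateV r (suc m) f = trans (∑-vecs gs m _) (trans (∑-cong gs λ x → ∑-translateV r m (λ v → f ((r ⊞ x) ∷ v)))
      (trans (∑-cong gs λ x → cong (λ t → ∑ (vecs gs m) (λ v → f (t ∷ v))) (⊞-comm r x))
          (trans (∑-translate r (λ x → ∑ (vecs gs m) (λ v → f (x ∷ v)))) (sym (∑-vecs gs m f)))))

    count-translate : ∀ r {m} (χ : Vec G m) → count r (Vec.map (r ⊞_) χ) ≡ count zero χ
    count-translate r [] = refl
    count-translate r (a ∷ χ) = cong₂ ℕ._+_ e (count-translate r χ)
      where
      e : eqℕ r (r ⊞ a) ≡ eqℕ zero a
      e with a FinP.≟ zero
      ... | yes refl = trans (cong (eqℕ r) (⊞-idʳ r)) (eqℕ-refl r)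
      ... | no ne = trans (eqℕ-≢ {i = r} λ eq → ne (trans (sym (⊞-cancel a r))
          (trans (cong (_⊞ ⊟ r) (trans (⊞-comm a r) (sym eq))) (⊞-invʳ r)))) (sym (eqℕ-≢ (ne ∘ sym)))

    -- Generalised from F so that the induction can pass a nonzero entry: a entries are frozen in
    -- front, and `law` is `F-zero` in their presence. The falling factorials collect the factors of
    -- the removed zeros without division.
    strip-family : ∀ a (f : ∀ N → Vec G N → ℚ) → (∀ N → Symm (f N)) → (∀ N v → f (suc N) (zero ∷ v) ≡ (nQ - ι (a ℕ.+ N)) * f N v) →
      ∀ {N} (v : Vec G N) → ff (a ℕ.+ proj₁ (strip v)) * f N v ≡ ff (a ℕ.+ N) * f (proj₁ (strip v)) (Vec.map suc (proj₂ (strip v)))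
    strip-family a f sf law [] = refl
    strip-family a f sf law {suc N} (zero ∷ v) = begin
      ff (a ℕ.+ m) * f (suc N) (zero ∷ v) ≡⟨ cong (ff (a ℕ.+ m) *_) (law N v) ⟩
      ff (a ℕ.+ m) * ((nQ - ι (a ℕ.+ N)) * f N v) ≡⟨ (solve 3 (λ x c g → x :* (c :* g) := c :* (x :* g)) refl (ff (a ℕ.+ m))
          (nQ - ι (a ℕ.+ N)) (f N v)) ⟩
      (nQ - ι (a ℕ.+ N)) * (ff (a ℕ.+ m) * f N v) ≡⟨ cong ((nQ - ι (a ℕ.+ N)) *_) (strip-family a f sf law v) ⟩
      (nQ - ι (a ℕ.+ N)) * (ff (a ℕ.+ N) * f m w) ≡⟨ (solve 3 (λ x c g → c :* (x :* g) := x :* c :* g) refl (ff (a ℕ.+ N)) (nQ - ι (a ℕ.+ N))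
          (f m w)) ⟩
      ff (suc (a ℕ.+ N)) * f m w ≡⟨ cong (λ t → ff t * f m w) (sym (ℕP.+-suc a N)) ⟩
      ff (a ℕ.+ suc N) * f m w ∎
      where
      open ≡-Reasoning
      m = proj₁ (strip v)
      w = Vec.map suc (proj₂ (strip v))
    strip-family a f sf law {suc N} (suc i ∷ v) = subst₂ (λ s t → ff s * f (suc N) (suc i ∷ v) ≡ ff t * f (suc m) (suc i ∷ w))
        (sym (ℕP.+-suc a m)) (sym (ℕP.+-suc a N))
      (strip-family (suc a) (λ N u → f (suc N) (suc i ∷ u)) (λ N q → sf (suc N) (~cons (suc i) q))
          (λ N u → trans (sf (2 ℕ.+ N) (~swap (suc i) zero)) (trans (law (suc N) (suc i ∷ u))
          (cong (λ t → (nQ - ι t) * f (suc N) (suc i ∷ u)) (ℕP.+-suc a N)))) v)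
      where
      m = proj₁ (strip v)
      w = Vec.map suc (proj₂ (strip v))

    F-strip : ∀ (χ : Vec G n) → ff (proj₁ (strip χ)) * F n χ ≡ ff n * F (proj₁ (strip χ)) (Vec.map suc (proj₂ (strip χ)))
    F-strip = strip-family 0 F F-symm F-zero

    ff-fact : ∀ m l → m ℕ.+ l ≡ n → ff m * fact l ≡ fact n
    ff-fact zero l refl = ℚP.*-identityˡ (fact n)
    ff-fact (suc m) l e = trans (cong (λ t → ff m * t * fact l) (trans (cong (λ t → t - ι m) nQ-ι)
        (trans (cong (λ t → ι t - ι m) (trans (sym e) (sym (ℕP.+-suc m l))))
        (trans (cong (λ t → t - ι m) (ι-+ m (suc l))) (solve 2 (λ a b → (a :+ b) :- a := b) refl (ι m) (ι (suc l)))))))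
      (trans (ℚP.*-assoc (ff m) (ι (suc l)) (fact l)) (ff-fact m (suc l) (trans (ℕP.+-suc m l) e)))

    ff-n : ff n ≡ fact n
    ff-n = trans (sym (ℚP.*-identityʳ (ff n))) (ff-fact n 0 (ℕP.+-identityʳ n))

    module Split (h : ℕ) (n-odd : n ≡ suc (2 ℕ.* h)) (m₀ : ℕ) (m₀-small : m₀ ℕ.+ m₀ ℕ.< n) where

      m₀≤n : m₀ ℕ.≤ n
      m₀≤n = ℕP.≤-trans (ℕP.m≤m+n m₀ m₀) (ℕP.<⇒≤ m₀-small)

      -- Indicates that r is dominant: all but at most m₀ entries equal r. As 2m₀ < n there is at
      -- most one such r, so `dense` takes only the values 0 and 1.
      big : G → Vec G n → ℚ
      big r χ with n ℕP.≤? count r χ ℕ.+ m₀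
      ... | yes _ = 1ℚ
      ... | no _ = 0ℚ

      Dense : Vec G n → Set
      Dense χ = ∀ r → count r χ ℕ.+ m₀ ℕ.< n

      dense : Vec G n → ℚ
      dense χ = 1ℚ - ∑ gs (λ r → big r χ)

      big-cong : ∀ r r′ χ χ′ → count r χ ≡ count r′ χ′ → big r χ ≡ big r′ χ′
      big-cong r r′ χ χ′ e with n ℕP.≤? count r χ ℕ.+ m₀ | n ℕP.≤? count r′ χ′ ℕ.+ m₀
      ... | yes _ | yes _ = refl
      ... | no _ | no _ = refl
      ... | yes a | no b = ⊥-elim (b (subst (λ t → n ℕ.≤ t ℕ.+ m₀) e a))
      ... | no a | yes b = ⊥-elim (a (subst (λ t → n ℕ.≤ t ℕ.+ m₀) (sym e) b))

      big-yes : ∀ r χ → n ℕ.≤ count r χ ℕ.+ m₀ → big r χ ≡ 1ℚ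
      big-yes r χ q with n ℕP.≤? count r χ ℕ.+ m₀
      ... | yes _ = refl
      ... | no nq = ⊥-elim (nq q)

      big-no : ∀ r χ → ¬ (n ℕ.≤ count r χ ℕ.+ m₀) → big r χ ≡ 0ℚ
      big-no r χ nq with n ℕP.≤? count r χ ℕ.+ m₀
      ... | yes q = ⊥-elim (nq q)
      ... | no _ = refl

      big-unique : ∀ r χ → n ℕ.≤ count r χ ℕ.+ m₀ → ∀ r′ → big r′ χ ≡ δ r r′
      big-unique r χ q r′ with r FinP.≟ r′
      ... | yes refl = trans (big-yes r χ q) (sym (δ-refl r))
      ... | no ne = trans (big-no r′ χ (λ q′ → ℕP.<-irrefl refl (ℕP.<-≤-trans (ℕP.+-monoʳ-< n m₀-small) (ℕP.≤-trans (ℕP.+-mono-≤ q q′)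
           (ℕP.≤-trans (ℕP.≤-reflexive (re (count r χ) m₀ (count r′ χ))) (ℕP.+-monoˡ-≤ (m₀ ℕ.+ m₀) (count-sum≤ ne χ))))))) (sym (δ-≢ ne))
        where
        re : ∀ a m b → a ℕ.+ m ℕ.+ (b ℕ.+ m) ≡ a ℕ.+ b ℕ.+ (m ℕ.+ m)
        re a m b = solveℕ 3 (λ a m b → a ∔ m ∔ (b ∔ m) ≐ a ∔ b ∔ (m ∔ m)) refl a m b

      dense-cases : ∀ χ → (dense χ ≡ 1ℚ × Dense χ) ⊎ (dense χ ≡ 0ℚ)
      dense-cases χ with FinP.any? (λ r → n ℕP.≤? count r χ ℕ.+ m₀)
      ... | yes (r , q) = inj₂ (trans (cong (λ t → 1ℚ - t) (trans (∑-cong gs (big-unique r χ q)) (∑-δ1 r))) refl)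
      ... | no nq = inj₁ (trans (cong (λ t → 1ℚ - t) (∑-≡0 gs λ r → big-no r χ λ q → nq (r , q))) refl , λ r → ℕP.≰⇒> λ q → nq (r , q))

      -- With m nonzero entries, F χ is n!/`ff m` times F of these entries, and there are `ff m`/m!
      -- choices of their positions. The cubes therefore add up to n!³ Z m/(m! (`ff m`)²).
      sparse-part : ∑ (vecs gs n) (λ χ → big zero χ * F³ χ) ≡ fact n ^ 3 * ∑< (suc m₀) T
      sparse-part = begin
        ∑ (vecs gs n) (λ χ → big zero χ * F³ χ) ≡⟨ ∑-cong (vecs gs n) pt ⟩
        ∑ (vecs gs n) (λ χ → Ψ (proj₁ (strip χ)) (proj₂ (strip χ))) ≡⟨ ∑-strip n Ψ ⟩
        ∑< (suc n) (λ m → binom n m * ∑ (vecs (fins p) m) (Ψ m)) ≡⟨ cong (λ t → ∑< t (λ m → binom n m * ∑ (vecs (fins p) m) (Ψ m)))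
            (sym (ℕP.m+[n∸m]≡n (s≤s m₀≤n))) ⟩
        ∑< (suc m₀ ℕ.+ (suc n ℕ.∸ suc m₀)) (λ m → binom n m * ∑ (vecs (fins p) m) (Ψ m)) ≡⟨ ∑<-split (suc m₀) (suc n ℕ.∸ suc m₀) _ ⟩
        ∑< (suc m₀) (λ m → binom n m * ∑ (vecs (fins p) m) (Ψ m)) + ∑< (suc n ℕ.∸ suc m₀)
            (λ i → binom n (suc m₀ ℕ.+ i) * ∑ (vecs (fins p) (suc m₀ ℕ.+ i)) (Ψ (suc m₀ ℕ.+ i)))
          ≡⟨ cong₂ _+_ (∑<-cong (suc m₀) low) (∑<-≡0 (suc n ℕ.∸ suc m₀) λ i _ → trans
              (cong (binom n (suc m₀ ℕ.+ i) *_) (∑-≡0 (vecs (fins p) (suc m₀ ℕ.+ i)) λ w → trans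
              (cong (_* _) (le-no (suc m₀ ℕ.+ i) (ℕP.m≤m+n (suc m₀) i)))
              (ℚP.*-zeroˡ (inv (ff (suc m₀ ℕ.+ i)) ^ 3 * fact n ^ 3 * F³ (Vec.map suc w))))) (ℚP.*-zeroʳ (binom n (suc m₀ ℕ.+ i)))) ⟩
        ∑< (suc m₀) (λ m → fact n ^ 3 * T m) + 0ℚ ≡⟨ trans (ℚP.+-identityʳ _) (∑<-*ˡ (suc m₀) (fact n ^ 3) T) ⟩
        fact n ^ 3 * ∑< (suc m₀) T ∎
        where
        open ≡-Reasoning
        le : ℕ → ℚ
        le m with m ℕP.≤? m₀
        ... | yes _ = 1ℚ
        ... | no _ = 0ℚ
        le-no : ∀ m → m₀ ℕ.< m → le m ≡ 0ℚ
        le-no m q with m ℕP.≤? m₀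
        ... | yes q′ = ⊥-elim (ℕP.<-irrefl refl (ℕP.<-≤-trans q q′))
        ... | no _ = refl
        le-yes : ∀ m → m ℕ.≤ m₀ → le m ≡ 1ℚ
        le-yes m q with m ℕP.≤? m₀
        ... | yes _ = refl
        ... | no nq = ⊥-elim (nq q)
        Ψ : ∀ m → Vec (Fin p) m → ℚ
        Ψ m w = le m * (inv (ff m) ^ 3 * fact n ^ 3 * F³ (Vec.map suc w))
        le-big : ∀ χ → big zero χ ≡ le (proj₁ (strip χ))
        le-big χ with n ℕP.≤? count zero χ ℕ.+ m₀ | proj₁ (strip χ) ℕP.≤? m₀
        ... | yes _ | yes _ = refl
        ... | no _ | no _ = refl
        ... | yes a | no b = ⊥-elim (b (ℕP.+-cancelˡ-≤ (count zero χ) _ _ (subst (ℕ._≤ count zero χ ℕ.+ m₀) (sym (strip-count χ)) a)))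
        ... | no a | yes b = ⊥-elim (a (subst (ℕ._≤ count zero χ ℕ.+ m₀) (strip-count χ) (ℕP.+-monoʳ-≤ (count zero χ) b)))
        pt : ∀ χ → big zero χ * F³ χ ≡ Ψ (proj₁ (strip χ)) (proj₂ (strip χ))
        pt χ with proj₁ (strip χ) ℕP.≤? n
        ... | no q = ⊥-elim (q (ℕP.≤-trans (ℕP.m≤n+m _ (count zero χ)) (ℕP.≤-reflexive (strip-count χ))))
        ... | yes q = cong₂ _*_ (le-big χ) (cancel-≡ (^>0 3 d>0) (begin
            d ^ 3 * F³ χ ≡⟨ (solve 2 (λ d f → d :* (d :* (d :* con 1ℚ)) :* (f :* f :* f) := (d :* f) :* (d :* f) :* (d :* f)) refl d (F n χ)) ⟩
            (d * F n χ) * (d * F n χ) * (d * F n χ) ≡⟨ cong (λ t → t * t * t) (trans (F-strip χ) (cong (_* g) ff-n)) ⟩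
            (fact n * g) * (fact n * g) * (fact n * g) ≡⟨ (solve 2 (λ g x → (x :* g) :* (x :* g) :* (x :* g) := con 1ℚ :*
                (con 1ℚ :* (con 1ℚ :* con 1ℚ)) :* (x :* (x :* (x :* con 1ℚ)) :* (g :* g :* g))) refl g (fact n)) ⟩
            1ℚ ^ 3 * (fact n ^ 3 * F³ (Vec.map suc (proj₂ (strip χ)))) ≡⟨ cong
                (λ t → t ^ 3 * (fact n ^ 3 * F³ (Vec.map suc (proj₂ (strip χ))))) (sym (inv-r d>0)) ⟩
            (d * inv d) ^ 3 * (fact n ^ 3 * F³ (Vec.map suc (proj₂ (strip χ)))) ≡⟨
                (solve 4 (λ d i x g → (d :* i) :* ((d :* i) :* ((d :* i) :* con 1ℚ)) :* (x :* g) := d :* (d :* (d :* con 1ℚ)) :*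
                (i :* (i :* (i :* con 1ℚ)) :* x :* g)) refl d (inv d) (fact n ^ 3) (F³ (Vec.map suc (proj₂ (strip χ))))) ⟩
            d ^ 3 * (inv d ^ 3 * fact n ^ 3 * F³ (Vec.map suc (proj₂ (strip χ)))) ∎))
          where
          d g : ℚ
          d = ff (proj₁ (strip χ))
          g = F (proj₁ (strip χ)) (Vec.map suc (proj₂ (strip χ)))
          d>0 : 0ℚ < d
          d>0 = ff>0 (proj₁ (strip χ)) q
        low : ∀ m → m ℕ.< suc m₀ → binom n m * ∑ (vecs (fins p) m) (Ψ m) ≡ fact n ^ 3 * T m
        low m (s≤s q) = cancel-≡ (0<* (0<* (fact>0 m) (fact>0 l)) (0<* d>0 d>0)) (begin
          (fact m * fact l) * (d * d) * (binom n m * ∑ (vecs (fins p) m) (Ψ m))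
            ≡⟨ cong (λ t → (fact m * fact l) * (d * d) * (binom n m * t))
                (trans (∑-cong (vecs (fins p) m) λ w → trans (cong (_* _) (le-yes m q)) (ℚP.*-identityˡ _))
                (trans (∑-*ˡ (vecs (fins p) m) (inv d ^ 3 * fact n ^ 3) _)
                (cong (inv d ^ 3 * fact n ^ 3 *_) (sym (∑-vecs-map (fins p) suc m F³))))) ⟩
          (fact m * fact l) * (d * d) * (binom n m * (inv d ^ 3 * fact n ^ 3 * Z m))
            ≡⟨ (solve 7 (λ x g d b i q z → (x :* g) :* (d :* d) :* (b :* (i :* (i :* (i :* con 1ℚ)) :* q :* z)) := (b :* (x :* g)) :*
                ((d :* i) :* (d :* i) :* i) :* (q :* z)) refl (fact m) (fact l) d (binom n m) (inv d) (fact n ^ 3) (Z m)) ⟩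
          (binom n m * (fact m * fact l)) * ((d * inv d) * (d * inv d) * inv d) * (fact n ^ 3 * Z m)
            ≡⟨ cong₂ (λ a b → a * (b * b * inv d) * (fact n ^ 3 * Z m)) (trans (cong (λ t → binom t m * (fact m * fact l)) (sym ml))
                (trans (binom-fact m l) (trans (cong fact ml) (sym (ff-fact m l ml))))) (inv-r d>0) ⟩
          (d * fact l) * (1ℚ * 1ℚ * inv d) * (fact n ^ 3 * Z m) ≡⟨ (solve 5
              (λ d g i q z → (d :* g) :* (con 1ℚ :* con 1ℚ :* i) :* (q :* z) := (d :* i) :* (g :* (q :* z))) refl d (fact l) (inv d)
              (fact n ^ 3) (Z m)) ⟩
          (d * inv d) * (fact l * (fact n ^ 3 * Z m)) ≡⟨ cong (_* (fact l * (fact n ^ 3 * Z m)))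
              (trans (inv-r d>0) (sym (inv-r (den>0 m mn)))) ⟩
          (fact m * (d * d) * inv (fact m * (d * d))) * (fact l * (fact n ^ 3 * Z m)) ≡⟨
              (solve 6 (λ x d i g q z → (x :* (d :* d) :* i) :* (g :* (q :* z)) := (x :* g) :* (d :* d) :* (q :* (z :* i))) refl (fact m) d
              (inv (fact m * (d * d))) (fact l) (fact n ^ 3) (Z m)) ⟩
          (fact m * fact l) * (d * d) * (fact n ^ 3 * T m) ∎)
          where
          mn : m ℕ.≤ n
          mn = ℕP.≤-trans q m₀≤n
          l : ℕ
          l = n ℕ.∸ m
          ml : m ℕ.+ l ≡ n
          ml = ℕP.m+[n∸m]≡n mn
          d : ℚ
          d = ff m
          d>0 : 0ℚ < d
          d>0 = ff>0 m mn

      -- A translation, under which F is invariant, moves each of the n possible dominant values to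
      -- 0; hence the factor n.
      ∑F³-split : nQ ^ n * ι (s n) ≡ nQ * (fact n ^ 3 * ∑< (suc m₀) T) + ∑ (vecs gs n) (λ χ → dense χ * F³ χ)
      ∑F³-split = begin
        nQ ^ n * ι (s n) ≡⟨ sym ∑F³ ⟩
        ∑ (vecs gs n) F³ ≡⟨ ∑-cong (vecs gs n) (λ χ → trans (solve 2 (λ b f → f := b :* f :+ (con 1ℚ :- b) :* f) refl (∑ gs (λ r → big r χ))
            (F³ χ)) (cong (_+ dense χ * F³ χ) (sym (∑-*ʳ gs (F³ χ) _)))) ⟩
        ∑ (vecs gs n) (λ χ → ∑ gs (λ r → big r χ * F³ χ) + dense χ * F³ χ) ≡⟨ trans (∑-+ (vecs gs n) _ _)
            (cong (_+ D) (∑-swap (vecs gs n) gs _)) ⟩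
        ∑ gs (λ r → ∑ (vecs gs n) (λ χ → big r χ * F³ χ)) + D
          ≡⟨ cong (_+ D) (trans (∑-cong gs λ r → trans (sym (∑-translateV r n _))
              (trans (∑-cong (vecs gs n) λ χ → cong₂ (λ a b → a * (b * b * b)) (big-cong r zero (Vec.map (r ⊞_) χ) χ (count-translate r χ))
              (F-translate h n-odd r χ)) sparse-part))
               (trans (∑-fins-const n _) (cong (_* (fact n ^ 3 * ∑< (suc m₀) T)) (sym nQ-ι)))) ⟩
        nQ * (fact n ^ 3 * ∑< (suc m₀) T) + D ∎
        where
        open ≡-Reasoning
        D : ℚ
        D = ∑ (vecs gs n) (λ χ → dense χ * F³ χ)

  -- Operators with phases

  prodV : ∀ {A : Set} {m} → Vec A m → (A → ℚ) → ℚ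
  prodV [] q = 1ℚ
  prodV (x ∷ xs) q = q x * prodV xs q

  prodV-~ : ∀ {A : Set} {m} (q : A → ℚ) {u v : Vec A m} → u ~ v → prodV u q ≡ prodV v q
  prodV-~ q ~refl = refl
  prodV-~ q (~cons x e) = cong (q x *_) (prodV-~ q e)
  prodV-~ q (~swap x y {u}) = (solve 3 (λ a b c → a :* (b :* c) := b :* (a :* c)) refl (q x) (q y) (prodV u q))
  prodV-~ q (~trans e e′) = trans (prodV-~ q e) (prodV-~ q e′)

  counts-~ : ∀ {k m} (u v : Vec (Fin k) m) → (∀ a → count a u ≡ count a v) → u ~ v
  counts-~ [] [] h = ~refl
  counts-~ (x ∷ u) v h with count-extract x v (subst (0 ℕ.<_) (h x) (subst (λ t → 0 ℕ.< t ℕ.+ count x u) (sym (eqℕ-refl x)) (s≤s z≤n)))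
  ... | w , e = ~trans (~cons x (counts-~ u w λ a → ℕP.+-cancelˡ-≡ (eqℕ a x) _ _ (trans (h a) (count-~ a e)))) (~sym e)

  ∑-sumV : ∀ {k} m (g : Fin k → Vec (Fin k) (suc m) → ℚ) → (∀ j → Symm (g j)) →
    ∑ (vecs (fins k) (suc m)) (λ x → sumV x (λ j → g j x)) ≡ ι (suc m) * ∑ (fins k) (λ j → ∑ (vecs (fins k) m) (λ w → g j (j ∷ w)))
  ∑-sumV {k} m g sg = trans (∑-vecs (fins k) m _) (trans (∑-cong (fins k) λ j → ∑-+ (vecs (fins k) m) _ _) (trans (∑-+ (fins k) _ _)
     (trans (cong (H +_) (rest m g sg)) (solve 2 (λ H k → H :+ k :* H := (con 1ℚ :+ k) :* H) refl H (ι m)))))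
    where
    open ≡-Reasoning
    H : ℚ
    H = ∑ (fins k) (λ j → ∑ (vecs (fins k) m) (λ w → g j (j ∷ w)))
    rest : ∀ m (g : Fin k → Vec (Fin k) (suc m) → ℚ) → (∀ j → Symm (g j)) →
      ∑ (fins k) (λ a → ∑ (vecs (fins k) m) (λ x → sumV x (λ j → g j (a ∷ x)))) ≡ ι m * ∑ (fins k)
          (λ j → ∑ (vecs (fins k) m) (λ w → g j (j ∷ w)))
    rest zero g sg = trans (∑-≡0 (fins k) λ a → ℚP.+-identityʳ 0ℚ) (sym (ℚP.*-zeroˡ
        (∑ (fins k) (λ j → ∑ (vecs (fins k) 0) (λ w → g j (j ∷ w))))))
    rest (suc m) g sg = begin
      ∑ (fins k) (λ a → ∑ (vecs (fins k) (suc m)) (λ x → sumV x (λ j → g j (a ∷ x))))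
        ≡⟨ ∑-cong (fins k) (λ a → ∑-sumV m (λ j x → g j (a ∷ x)) (λ j q → sg j (~cons a q))) ⟩
      ∑ (fins k) (λ a → ι (suc m) * ∑ (fins k) (λ j → ∑ (vecs (fins k) m) (λ w → g j (a ∷ j ∷ w)))) ≡⟨ ∑-*ˡ (fins k) (ι (suc m)) _ ⟩
      ι (suc m) * ∑ (fins k) (λ a → ∑ (fins k) (λ j → ∑ (vecs (fins k) m) (λ w → g j (a ∷ j ∷ w))))
        ≡⟨ cong (ι (suc m) *_) (trans (∑-swap (fins k) (fins k) _) (∑-cong (fins k) λ j → trans
            (∑-cong (fins k) λ a → ∑-cong (vecs (fins k) m) λ w → sg j (~swap a j)) (sym (∑-vecs (fins k) m _)))) ⟩
      ι (suc m) * ∑ (fins k) (λ j → ∑ (vecs (fins k) (suc m)) (λ w → g j (j ∷ w))) ∎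

  injw-~ : ∀ {k m} {u v : Vec (Fin k) m} → u ~ v → injw u ≡ injw v
  injw-~ ~refl = refl
  injw-~ (~cons x e) = cong₂ (λ a b → (1ℚ - ι a) * b) (count-~ x e) (injw-~ e)
  injw-~ (~swap x y {u}) with x FinP.≟ y
  ... | yes refl = refl
  ... | no ne = trans (cong (λ t → (1ℚ - ι (t ℕ.+ count x u)) * ((1ℚ - ι (count y u)) * injw u)) (eqℕ-≢ ne)) (trans
     (solve 3 (λ a b i → (con 1ℚ :- a) :* ((con 1ℚ :- b) :* i) := (con 1ℚ :- b) :* ((con 1ℚ :- a) :* i)) refl (ι (count x u)) (ι (count y u))
         (injw u))
     (cong (λ t → (1ℚ - ι (t ℕ.+ count y u)) * ((1ℚ - ι (count x u)) * injw u)) (sym (eqℕ-≢ (ne ∘ sym)))))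
  injw-~ (~trans e e′) = trans (injw-~ e) (injw-~ e′)

  module Operators (p : ℕ) (q : Fin (suc p) → ℚ) (t : Vec (Fin (suc p)) (suc p)) where
    open Group p
    open Moments p using (V)
    open Sparse p using (ff; nQ>0; nQ≥0; ι≤nQ; ff≥0)
    open Fourier p
    open Trace p using (y; y-0; y-≈; y-kill)

    Periodic : (ℕ → ℚ) → Set
    Periodic f = ∀ i a → f (i ℕ.+ a ℕ.* n) ≡ f i

    Killed : (ℕ → ℚ) → Set
    Killed f = ∀ k → ¬ (n ∣ k) → ∀ i → ∑< n (λ j → f (i ℕ.+ k ℕ.* j)) ≡ 0ℚ

    Op : (G → ℕ) → (ℕ → ℚ) → ℕ → ℚ
    Op E f i = ∑ gs (λ r → q r * f (i ℕ.+ E r))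

    Op-cong : ∀ E {f g} → (∀ i → f i ≡ g i) → ∀ i → Op E f i ≡ Op E g i
    Op-cong E e i = ∑-cong gs λ r → cong (q r *_) (e (i ℕ.+ E r))

    private
      +-swap : ∀ a b c → a ℕ.+ b ℕ.+ c ≡ a ℕ.+ c ℕ.+ b
      +-swap a b c = trans (ℕP.+-assoc a b c) (trans (cong (a ℕ.+_) (ℕP.+-comm b c)) (sym (ℕP.+-assoc a c b)))

    Op-comm : ∀ E E′ f i → Op E (Op E′ f) i ≡ Op E′ (Op E f) i
    Op-comm E E′ f i = trans (∑-cong gs λ r → sym (∑-*ˡ gs (q r) _)) (trans (∑-swap gs gs _) (∑-cong gs λ s → trans (∑-cong gs λ r →
      trans (solve 3 (λ a b x → a :* (b :* x) := b :* (a :* x)) refl (q r) (q s) (f (i ℕ.+ E r ℕ.+ E′ s)))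
          (cong (λ z → q s * (q r * f z)) (+-swap i (E r) (E′ s)))) (∑-*ˡ gs (q s) _)))

    Op-periodic : ∀ E {f} → Periodic f → Periodic (Op E f)
    Op-periodic E {f} pf i a = ∑-cong gs λ r → cong (q r *_) (trans (cong f (+-swap i (a ℕ.* n) (E r))) (pf (i ℕ.+ E r) a))

    Op-killed : ∀ E {f} → Killed f → Killed (Op E f)
    Op-killed E {f} kf k nk i = trans (sym (∑<-swap gs n _)) (∑-≡0 gs λ r → trans (∑<-*ˡ n (q r) _)
        (trans (cong (q r *_) (trans (∑<-cong n λ j _ → cong f (+-swap i (k ℕ.* j) (E r))) (kf k nk (i ℕ.+ E r)))) (ℚP.*-zeroʳ (q r))))

    ⟨_,_⟩ : (ℕ → ℚ) → (ℕ → ℚ) → ℚ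
    ⟨ f , g ⟩ = ∑< n (λ i → f i * g i)

    N : (ℕ → ℚ) → ℚ
    N f = ⟨ f , f ⟩

    ⟨⟩-cong : ∀ {f f′ g g′} → (∀ i → f i ≡ f′ i) → (∀ i → g i ≡ g′ i) → ⟨ f , g ⟩ ≡ ⟨ f′ , g′ ⟩
    ⟨⟩-cong e e′ = ∑<-cong n λ i _ → cong₂ _*_ (e i) (e′ i)

    N≥0 : ∀ f → 0ℚ ≤ N f
    N≥0 f = ∑<≥0 n λ i → sq≥0 (f i)

    shift : ∀ {f} → Periodic f → ∀ c → ∑< n (λ i → f (i ℕ.+ c)) ≡ ∑< n f
    shift {f} pf c = ∑<-shift n f (λ j → trans (cong (λ z → f (j ℕ.+ z)) (sym (ℕP.+-identityʳ n))) (pf j 1)) c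

    -- p · E r is -E r modulo n, so this is invariance of the sum over a period under translation by
    -- E r.
    adjoint : ∀ E {f g} → Periodic f → Periodic g → ⟨ Op (λ r → p ℕ.* E r) f , g ⟩ ≡ ⟨ f , Op E g ⟩
    adjoint E {f} {g} pf pg = begin
      ∑< n (λ i → ∑ gs (λ r → q r * f (i ℕ.+ p ℕ.* E r)) * g i)
        ≡⟨ trans (∑<-cong n λ i _ → sym (∑-*ʳ gs (g i) _)) (sym (∑<-swap gs n _)) ⟩
      ∑ gs (λ r → ∑< n (λ i → q r * f (i ℕ.+ p ℕ.* E r) * g i)) ≡⟨ ∑-cong gs
          (λ r → trans (sym (shift (per r) (E r))) (∑<-cong n λ i _ → pt r i)) ⟩
      ∑ gs (λ r → ∑< n (λ i → f i * (q r * g (i ℕ.+ E r)))) ≡⟨ trans (∑<-swap gs n _) (∑<-cong n λ i _ → ∑-*ˡ gs (f i) _) ⟩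
      ⟨ f , Op E g ⟩ ∎
      where
      open ≡-Reasoning
      per : ∀ r → Periodic (λ i → q r * f (i ℕ.+ p ℕ.* E r) * g i)
      per r i a = cong₂ (λ u v → q r * u * v) (trans (cong f (+-swap i (a ℕ.* n) (p ℕ.* E r))) (pf (i ℕ.+ p ℕ.* E r) a)) (pg i a)
      pt : ∀ r i → q r * f (i ℕ.+ E r ℕ.+ p ℕ.* E r) * g (i ℕ.+ E r) ≡ f i * (q r * g (i ℕ.+ E r))
      pt r i = trans (cong (λ z → q r * z * g (i ℕ.+ E r)) (trans (cong f
          (solveℕ 3 (λ i e p → i ∔ e ∔ p ⨯ e ≐ i ∔ e ⨯ (conℕ 1 ∔ p)) refl i (E r) p)) (pf i (E r))))
        (solve 3 (λ a b c → a :* b :* c := b :* (a :* c)) refl (q r) (f i) (g (i ℕ.+ E r)))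

    -- The character r at the point x, with a free phase for each r; averaging over the phases later
    -- separates characters by their entry counts.
    exps : G → G → ℕ
    exps x r = toℕ (lookup t r) ℕ.+ toℕ r ℕ.* toℕ x

    L L* U : G → (ℕ → ℚ) → ℕ → ℚ
    L x = Op (exps x)
    L* x = Op (λ r → p ℕ.* exps x r)
    U x f = L* x (L x f)

    -- All operators are combinations of translations and commute, so both adjoints can be moved
    -- across the inner product.
    U-inner : ∀ a b {v} → Periodic v → ⟨ U a v , U b v ⟩ ≡ N (L a (L b v))
    U-inner a b {v} pv = begin
      ⟨ L* a (L a v) , L* b (L b v) ⟩ ≡⟨ adjoint (exps a) (Op-periodic (exps a) pv)
          (Op-periodic (λ r → p ℕ.* exps b r) (Op-periodic (exps b) pv)) ⟩
      ⟨ L a v , L a (L* b (L b v)) ⟩ ≡⟨ ⟨⟩-cong {f = L a v} {f′ = L a v} {g = L a (L* b (L b v))} {g′ = L* b (L a (L b v))} (λ i → refl)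
          (λ i → Op-comm (exps a) (λ r → p ℕ.* exps b r) (L b v) i) ⟩
      ⟨ L a v , L* b (L a (L b v)) ⟩ ≡⟨ ∑<-cong n (λ i _ → ℚP.*-comm (L a v i) (L* b (L a (L b v)) i)) ⟩
      ⟨ L* b (L a (L b v)) , L a v ⟩ ≡⟨ adjoint (exps b) (Op-periodic (exps a) (Op-periodic (exps b) pv)) (Op-periodic (exps a) pv) ⟩
      ⟨ L a (L b v) , L b (L a v) ⟩ ≡⟨ ⟨⟩-cong {f = L a (L b v)} {f′ = L a (L b v)} {g = L b (L a v)} {g′ = L a (L b v)} (λ i → refl)
          (λ i → Op-comm (exps b) (exps a) v i) ⟩
      N (L a (L b v)) ∎
      where open ≡-Reasoning

    -- The squared norm of U a v - U b v is nonnegative: the analogue of 2ab ≤ a² + b² for the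
    -- commuting positive operators L*L.
    pair-inequality : ∀ a b {v} → Periodic v → (ℤ.+ 2 / 1) * N (L a (L b v)) ≤ N (L a (L a v)) + N (L b (L b v))
    pair-inequality a b {v} pv = ≤-by (∑<≥0 n λ i → sq≥0 (U a v i - U b v i)) (begin
      N (L a (L a v)) + N (L b (L b v)) ≡⟨ cong₂ _+_ (sym (U-inner a a pv)) (sym (U-inner b b pv)) ⟩
      ⟨ U a v , U a v ⟩ + ⟨ U b v , U b v ⟩ ≡⟨ trans (sym (∑<-+ n _ _)) (trans
          (∑<-cong n λ i _ → (solve 2 (λ x z → x :* x :+ z :* z := con (ℤ.+ 2 / 1) :* (x :* z) :+ (x :- z) :* (x :- z)) refl (U a v i)
          (U b v i))) (∑<-+ n _ _)) ⟩
      ∑< n (λ i → (ℤ.+ 2 / 1) * (U a v i * U b v i)) + D ≡⟨ cong (_+ D) (trans (∑<-*ˡ n (ℤ.+ 2 / 1) _)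
          (cong ((ℤ.+ 2 / 1) *_) (U-inner a b pv))) ⟩
      (ℤ.+ 2 / 1) * N (L a (L b v)) + D ∎)
      where
      open ≡-Reasoning
      D : ℚ
      D = ∑< n (λ i → (U a v i - U b v i) * (U a v i - U b v i))

    Q : ℚ
    Q = ∑ gs (λ r → q r * q r)

    ∑-killed : ∀ {v} → Periodic v → Killed v → ∀ r s i → ∑ gs (λ x → v (i ℕ.+ (toℕ r ℕ.+ p ℕ.* toℕ s) ℕ.* toℕ x)) ≡ δ r s * (nQ * v i)
    ∑-killed {v} pv kv r s i with r FinP.≟ s
    ... | yes refl = trans (∑-cong gs λ x → trans (cong v (solveℕ 4 (λ i r p x → i ∔ (r ∔ p ⨯ r) ⨯ x ≐ i ∔ (r ⨯ x) ⨯ (conℕ 1 ∔ p)) refl i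
        (toℕ r) p (toℕ x))) (pv i (toℕ r ℕ.* toℕ x)))
        (trans (∑-fins-const n (v i)) (trans (cong (_* v i) (sym nQ-ι)) (sym
            (trans (cong (_* (nQ * v i)) (δ-refl r)) (ℚP.*-identityˡ (nQ * v i))))))
    ... | no ne = trans (∑-fins-toℕ n (λ j → v (i ℕ.+ (toℕ r ℕ.+ p ℕ.* toℕ s) ℕ.* j)))
        (trans (kv (toℕ r ℕ.+ p ℕ.* toℕ s) (λ d → ne (div-yes d)) i) (sym (trans (cong (_* (nQ * v i)) (δ-≢ ne)) (ℚP.*-zeroˡ (nQ * v i)))))
      where
      div-yes : n ∣ toℕ r ℕ.+ p ℕ.* toℕ s → r ≡ s
      div-yes (divides d e) = FinP.toℕ-injective (trans (sym (toℕ% r)) (trans (sym (DM.[m+kn]%n≡m%n (toℕ r) (toℕ s) n))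
          (trans (cong (_% n) (trans (solveℕ 3 (λ t c p → t ∔ c ⨯ (conℕ 1 ∔ p) ≐ c ∔ (t ∔ p ⨯ c)) refl (toℕ r) (toℕ s) p)
              (cong (toℕ s ℕ.+_) e)))
            (trans (DM.[m+kn]%n≡m%n (toℕ s) d n) (toℕ% s)))))

    -- On killed functions the sum over x keeps only the diagonal r = s, where the phases cancel.
    -- The sum of all L*L thus acts as the scalar nQ, whatever t is.
    ∑-U : ∀ {v} → Periodic v → Killed v → ∀ i → ∑ gs (λ x → U x v i) ≡ nQ * Q * v i
    ∑-U {v} pv kv i = begin
      ∑ gs (λ x → ∑ gs (λ s → q s * ∑ gs (λ r → q r * v (i ℕ.+ p ℕ.* exps x s ℕ.+ exps x r))))
        ≡⟨ trans (∑-cong gs λ x → ∑-cong gs λ s → sym (∑-*ˡ gs (q s) _)) (trans (∑-swap gs gs _) (∑-cong gs λ s → ∑-swap gs gs _)) ⟩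
      ∑ gs (λ s → ∑ gs (λ r → ∑ gs (λ x → q s * (q r * v (i ℕ.+ p ℕ.* exps x s ℕ.+ exps x r)))))
        ≡⟨ ∑-cong gs (λ s → ∑-cong gs λ r → trans (∑-*ˡ gs (q s) _) (cong (q s *_)
            (trans (∑-*ˡ gs (q r) _) (cong (q r *_) (trans (∑-cong gs λ x → cong v
            (re (toℕ x) (toℕ r) (toℕ s) (toℕ (lookup t r)) (toℕ (lookup t s)))) (∑-killed pv kv r s (off s r))))))) ⟩
      ∑ gs (λ s → ∑ gs (λ r → q s * (q r * (δ r s * (nQ * v (off s r))))))
        ≡⟨ ∑-cong gs (λ s → trans (∑-cong gs λ r → trans (solve 4 (λ a b d m → a :* (b :* (d :* m)) := d :* (a :* (b :* m))) refl (q s) (q r)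
            (δ r s) (nQ * v (off s r))) (cong (_* (q s * (q r * (nQ * v (off s r))))) (δ-comm r s)))
            (∑-δ s (λ r → q s * (q r * (nQ * v (off s r)))))) ⟩
      ∑ gs (λ s → q s * (q s * (nQ * v (off s s))))
        ≡⟨ ∑-cong gs (λ s → trans (cong (λ z → q s * (q s * (nQ * z))) (trans
            (cong v (solveℕ 3 (λ i p t → i ∔ p ⨯ t ∔ t ≐ i ∔ t ⨯ (conℕ 1 ∔ p)) refl i p (toℕ (lookup t s)))) (pv i (toℕ (lookup t s)))))
            (solve 3 (λ a n v → a :* (a :* (n :* v)) := (n :* v) :* (a :* a)) refl (q s) (nQ) (v i))) ⟩
      ∑ gs (λ s → (nQ * v i) * (q s * q s)) ≡⟨ trans (∑-*ˡ gs (nQ * v i) _)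
          (solve 3 (λ n v Q → n :* v :* Q := n :* Q :* v) refl (nQ) (v i) Q) ⟩
      nQ * Q * v i ∎
      where
      open ≡-Reasoning
      off : G → G → ℕ
      off s r = i ℕ.+ p ℕ.* toℕ (lookup t s) ℕ.+ toℕ (lookup t r)
      re : ∀ x r s a b → i ℕ.+ p ℕ.* (b ℕ.+ s ℕ.* x) ℕ.+ (a ℕ.+ r ℕ.* x) ≡ i ℕ.+ p ℕ.* b ℕ.+ a ℕ.+ (r ℕ.+ p ℕ.* s) ℕ.* x
      re x r s a b = solveℕ 7 (λ i p x r s a b → i ∔ p ⨯ (b ∔ s ⨯ x) ∔ (a ∔ r ⨯ x) ≐ i ∔ p ⨯ b ∔ a ∔ (r ∔ p ⨯ s) ⨯ x) refl i p x r s a b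

    ∑-N : ∀ {v} → Periodic v → Killed v → ∑ gs (λ x → N (L x v)) ≡ nQ * Q * N v
    ∑-N {v} pv kv = begin
      ∑ gs (λ x → N (L x v)) ≡⟨ ∑-cong gs (λ x → trans (sym (adjoint (exps x) (Op-periodic (exps x) pv) pv))
          (∑<-cong n λ i _ → ℚP.*-comm (U x v i) (v i))) ⟩
      ∑ gs (λ x → ∑< n (λ i → v i * U x v i)) ≡⟨ trans (∑<-swap gs n _) (∑<-cong n λ i _ → trans (∑-*ˡ gs (v i) _)
          (trans (cong (v i *_) (∑-U pv kv i)) (solve 2 (λ v c → v :* (c :* v) := c :* (v :* v)) refl (v i) (nQ * Q)))) ⟩
      ∑< n (λ i → nQ * Q * (v i * v i)) ≡⟨ ∑<-*ˡ n (nQ * Q) _ ⟩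
      nQ * Q * N v ∎
      where open ≡-Reasoning

    Ls : ∀ {m} → Vec G m → ℕ → ℚ
    Ls [] = y
    Ls (a ∷ x) = L a (Ls x)

    y-periodic : Periodic y
    y-periodic i a = y-≈ 0 a (ℕP.+-identityʳ _)

    Ls-periodic : ∀ {m} (x : Vec G m) → Periodic (Ls x)
    Ls-periodic [] = y-periodic
    Ls-periodic (a ∷ x) = Op-periodic (exps a) (Ls-periodic x)

    Ls-killed : ∀ {m} (x : Vec G m) → Killed (Ls x)
    Ls-killed [] = y-kill
    Ls-killed (a ∷ x) = Op-killed (exps a) {Ls x} (Ls-killed x)

    Ls-~ : ∀ {m} {u v : Vec G m} → u ~ v → ∀ i → Ls u i ≡ Ls v i
    Ls-~ ~refl i = refl
    Ls-~ (~cons x e) i = Op-cong (exps x) (Ls-~ e) i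
    Ls-~ (~swap x z {u}) i = Op-comm (exps x) (exps z) (Ls u) i
    Ls-~ (~trans e e′) i = trans (Ls-~ e i) (Ls-~ e′ i)

    NLs-symm : ∀ {m} {u v : Vec G m} → u ~ v → N (Ls u) ≡ N (Ls v)
    NLs-symm {u = u} {v = v} e = ⟨⟩-cong {f = Ls u} {f′ = Ls v} {g = Ls u} {g′ = Ls v} (Ls-~ e) (Ls-~ e)

    ∑-inj : ∀ {m} (x : Vec G m) → ∑ gs (λ j → injw (j ∷ x)) ≡ (nQ - ι m) * injw x
    ∑-inj {m} x = trans (∑-*ʳ gs (injw x) _) (cong (_* injw x) (trans (∑-− gs _ _)
        (cong₂ _-_ (trans (∑-fins-const n 1ℚ) (trans (ℚP.*-identityʳ (ι n)) (sym nQ-ι)))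
      (trans (∑-cong gs λ j → sym (ℚP.*-identityʳ (ι (count j x)))) (trans (∑-count x (λ _ → 1ℚ)) (sumV-1 x))))))

    -- The elementary symmetric functions of the commuting operators L*L, up to a factor m!.
    Sym : ℕ → ℚ
    Sym m = ∑ (vecs gs m) (λ x → injw x * N (Ls x))

    -- The companion of `Sym` in which one of the m distinct operators is applied twice.
    Diag : ℕ → ℚ
    Diag m = ∑ (vecs gs m) (λ x → sumV x (λ j → injw x * N (L j (Ls x))))

    -- One more operator L*L, summed over all j, is the scalar nQ; the index j is either new or
    -- repeats an entry of x.
    Sym-Diag : ∀ m → nQ * Q * Sym m ≡ Sym (suc m) + Diag m
    Sym-Diag m = sym (begin
      Sym (suc m) + Diag m ≡⟨ cong₂ _+_ (trans (∑-vecs gs m _) (∑-swap gs (vecs gs m) _)) (∑-cong (vecs gs m) λ x → sym (∑-count x _)) ⟩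
      ∑ (vecs gs m) (λ x → ∑ gs (λ j → (1ℚ - ι (count j x)) * injw x * N (L j (Ls x)))) + ∑ (vecs gs m)
          (λ x → ∑ gs (λ j → ι (count j x) * (injw x * N (L j (Ls x)))))
        ≡⟨ trans (sym (∑-+ (vecs gs m) _ _)) (∑-cong (vecs gs m) λ x → trans (sym (∑-+ gs _ _))
            (trans (∑-cong gs λ j → (solve 3 (λ c i v → (con 1ℚ :- c) :* i :* v :+ c :* (i :* v) := i :* v) refl (ι (count j x)) (injw x)
            (N (L j (Ls x))))) (trans (∑-*ˡ gs (injw x) _)
              (trans (cong (injw x *_) (∑-N (Ls-periodic x) (Ls-killed x)))
                  (solve 3 (λ i c v → i :* (c :* v) := c :* (i :* v)) refl (injw x) (nQ * Q) (N (Ls x))))))) ⟩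
      ∑ (vecs gs m) (λ x → nQ * Q * (injw x * N (Ls x))) ≡⟨ ∑-*ˡ (vecs gs m) (nQ * Q) _ ⟩
      nQ * Q * Sym m ∎)
      where open ≡-Reasoning

    -- `pair-inequality` trades two distinct indices for a repeated one. The index that disappears
    -- had n - (m + 1) possible values.
    Diag-bound : ∀ m → ι (suc m) * Sym (2 ℕ.+ m) ≤ (nQ - ι (suc m)) * Diag (suc m)
    Diag-bound m = cancel-≤ {c = ℤ.+ 2 / 1} (ℚP.positive⁻¹ (ℤ.+ 2 / 1)) (begin
      (ℤ.+ 2 / 1) * (ι (suc m) * Sym (2 ℕ.+ m)) ≡⟨ cong (λ z → (ℤ.+ 2 / 1) * (ι (suc m) * z))
          (trans (∑-vecs gs (suc m) _) (∑-cong gs λ a → ∑-vecs gs m _)) ⟩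
      (ℤ.+ 2 / 1) * (ι (suc m) * ∑ gs (λ a → ∑ gs (λ b → ∑ (vecs gs m) (λ w → injw (a ∷ b ∷ w) * N (L a (L b (Ls w)))))))
        ≡⟨ trans (solve 2 (λ k s → con (ℤ.+ 2 / 1) :* (k :* s) := k :* (con (ℤ.+ 2 / 1) :* s)) refl (ι (suc m))
            (∑ gs (λ a → ∑ gs (λ b → ∑ (vecs gs m) (λ w → injw (a ∷ b ∷ w) * N (L a (L b (Ls w))))))))
             (cong (ι (suc m) *_) (trans (sym (∑-*ˡ gs (ℤ.+ 2 / 1) _)) (∑-cong gs λ a → trans (sym (∑-*ˡ gs (ℤ.+ 2 / 1) _))
                 (∑-cong gs λ b → sym (∑-*ˡ (vecs gs m) (ℤ.+ 2 / 1) _))))) ⟩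
      ι (suc m) * ∑ gs (λ a → ∑ gs (λ b → ∑ (vecs gs m) (λ w → (ℤ.+ 2 / 1) * (injw (a ∷ b ∷ w) * N (L a (L b (Ls w)))))))
        ≤⟨ *-mono (ι≥0 (suc m)) (∑-mono gs λ a → ∑-mono gs λ b → ∑-mono (vecs gs m) λ w → ℚP.≤-trans
            (ℚP.≤-reflexive (solve 2 (λ i v → con (ℤ.+ 2 / 1) :* (i :* v) := i :* (con (ℤ.+ 2 / 1) :* v)) refl (injw (a ∷ b ∷ w))
            (N (L a (L b (Ls w))))))
             (ℚP.≤-trans (*-mono (injw≥0 (a ∷ b ∷ w)) (pair-inequality a b (Ls-periodic w)))
                 (ℚP.≤-reflexive (ℚP.*-distribˡ-+ (injw (a ∷ b ∷ w)) (N (L a (L a (Ls w)))) (N (L b (L b (Ls w)))))))) ⟩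
      ι (suc m) * ∑ gs (λ a → ∑ gs (λ b → ∑ (vecs gs m) (λ w → H a b w + injw (a ∷ b ∷ w) * N (L b (L b (Ls w))))))
        ≡⟨ cong (ι (suc m) *_) (trans (∑-cong gs λ a → trans (∑-cong gs λ b → ∑-+ (vecs gs m) (H a b)
            (λ w → injw (a ∷ b ∷ w) * N (L b (L b (Ls w))))) (∑-+ gs (λ b → ∑ (vecs gs m) (H a b))
            (λ b → ∑ (vecs gs m) (λ w → injw (a ∷ b ∷ w) * N (L b (L b (Ls w)))))))
            (trans (∑-+ gs _ _) (cong (∑ gs (λ a → ∑ gs (λ b → ∑ (vecs gs m) (H a b))) +_)
             (trans (∑-swap gs gs _) (∑-cong gs λ b → ∑-cong gs λ a → ∑-cong (vecs gs m) λ w → cong (_* N (L b (L b (Ls w))))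
                 (injw-~ (~swap a b {w}))))))) ⟩
      ι (suc m) * (∑ gs (λ a → ∑ gs (λ b → ∑ (vecs gs m) (H a b))) + ∑ gs (λ a → ∑ gs (λ b → ∑ (vecs gs m) (H a b))))
        ≡⟨ cong (λ z → ι (suc m) * (z + z)) (trans (∑-cong gs inner) (∑-*ˡ gs (nQ - ι (suc m)) _)) ⟩
      ι (suc m) * ((nQ - ι (suc m)) * W + (nQ - ι (suc m)) * W) ≡⟨ (solve 3
          (λ k c W → k :* (c :* W :+ c :* W) := con (ℤ.+ 2 / 1) :* (c :* (k :* W))) refl (ι (suc m)) (nQ - ι (suc m)) W) ⟩
      (ℤ.+ 2 / 1) * ((nQ - ι (suc m)) * (ι (suc m) * W))
        ≡⟨ cong (λ z → (ℤ.+ 2 / 1) * ((nQ - ι (suc m)) * z)) (sym (∑-sumV m (λ j x → injw x * N (L j (Ls x)))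
            (λ j e → cong₂ _*_ (injw-~ e) (NLs-symm (~cons j e))))) ⟩
      (ℤ.+ 2 / 1) * ((nQ - ι (suc m)) * Diag (suc m)) ∎)
      where
      open ℚP.≤-Reasoning
      H : G → G → Vec G m → ℚ
      H a b w = injw (a ∷ b ∷ w) * N (L a (L a (Ls w)))
      W : ℚ
      W = ∑ gs (λ j → ∑ (vecs gs m) (λ w → injw (j ∷ w) * N (L j (L j (Ls w)))))
      inner : ∀ a → ∑ gs (λ b → ∑ (vecs gs m) (H a b)) ≡ (nQ - ι (suc m)) * ∑ (vecs gs m) (λ w → injw (a ∷ w) * N (L a (L a (Ls w))))
      inner a = trans (∑-swap gs (vecs gs m) _) (trans (∑-cong (vecs gs m) λ w → trans
          (∑-cong gs λ b → cong (_* N (L a (L a (Ls w)))) (injw-~ (~swap a b {w}))) (trans (∑-*ʳ gs (N (L a (L a (Ls w)))) _)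
        (trans (cong (_* N (L a (L a (Ls w)))) (∑-inj (a ∷ w))) (ℚP.*-assoc (nQ - ι (suc m)) (injw (a ∷ w)) _))))
            (∑-*ˡ (vecs gs m) (nQ - ι (suc m)) _))

    -- For length k, n is split as (n - k) + k; `Diag-bound` estimates the second part, and Sym +
    -- Diag recombines to nQ times the previous Sym. Each further index thus costs at most Q for
    -- each of its free values, as if all the operators were equal.
    Sym-step : ∀ m → m ℕ.< n → Sym (suc m) ≤ (nQ - ι m) * (Q * Sym m)
    Sym-step zero l = ℚP.≤-reflexive (trans (solve 1 (λ s → s := s :+ con 0ℚ) refl (Sym 1))
        (trans (sym (Sym-Diag 0)) (solve 3 (λ n Q s → n :* Q :* s := (n :- con 0ℚ) :* (Q :* s)) refl (nQ) Q (Sym 0))))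
    Sym-step (suc m) l = cancel-≤ nQ>0 (begin
      nQ * Sym (2 ℕ.+ m) ≡⟨ (solve 3 (λ n k s → n :* s := (n :- k) :* s :+ k :* s) refl (nQ) (ι (suc m)) (Sym (2 ℕ.+ m))) ⟩
      (nQ - ι (suc m)) * Sym (2 ℕ.+ m) + ι (suc m) * Sym (2 ℕ.+ m) ≤⟨ ℚP.+-monoʳ-≤ ((nQ - ι (suc m)) * Sym (2 ℕ.+ m)) (Diag-bound m) ⟩
      (nQ - ι (suc m)) * Sym (2 ℕ.+ m) + (nQ - ι (suc m)) * Diag (suc m) ≡⟨ trans
          (sym (ℚP.*-distribˡ-+ (nQ - ι (suc m)) (Sym (2 ℕ.+ m)) (Diag (suc m)))) (cong ((nQ - ι (suc m)) *_) (sym (Sym-Diag (suc m)))) ⟩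
      (nQ - ι (suc m)) * (nQ * Q * Sym (suc m)) ≡⟨ (solve 4 (λ c n Q s → c :* (n :* Q :* s) := n :* (c :* (Q :* s))) refl (nQ - ι (suc m))
          (nQ) Q (Sym (suc m))) ⟩
      nQ * ((nQ - ι (suc m)) * (Q * Sym (suc m))) ∎)
      where open ℚP.≤-Reasoning

    Q≥0 : 0ℚ ≤ Q
    Q≥0 = ∑≥0 gs λ r → sq≥0 (q r)

    Sym-bound : ∀ m → m ℕ.≤ n → Sym m ≤ ff m * Q ^ m * N y
    Sym-bound zero l = ℚP.≤-reflexive (solve 1 (λ x → con 1ℚ :* x :+ con 0ℚ := con 1ℚ :* con 1ℚ :* x) refl (N y))
    Sym-bound (suc m) l = begin
      Sym (suc m) ≤⟨ Sym-step m l ⟩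
      (nQ - ι m) * (Q * Sym m) ≤⟨ *-mono (≤-diff (ι≤nQ (ℕP.<⇒≤ l))) (*-mono Q≥0 (Sym-bound m (ℕP.<⇒≤ l))) ⟩
      (nQ - ι m) * (Q * (ff m * Q ^ m * N y)) ≡⟨ (solve 5 (λ c Q f x v → c :* (Q :* (f :* x :* v)) := f :* c :* (Q :* x) :* v) refl (nQ - ι m)
          Q (ff m) (Q ^ m) (N y)) ⟩
      ff (suc m) * Q ^ suc m * N y ∎
      where open ℚP.≤-Reasoning

    phase : ∀ {m} → Vec G m → ℕ
    phase [] = 0
    phase (a ∷ f) = toℕ (lookup t a) ℕ.+ phase f

    Ls-expand : ∀ {m} (x : Vec G m) i → Ls x i ≡ ∑ (vecs gs m) (λ f → prodV f q * y (i ℕ.+ phase f ℕ.+ dot f (nat x)))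
    Ls-expand [] i = trans (cong y (sym (trans (ℕP.+-identityʳ _) (ℕP.+-identityʳ i))))
        (solve 1 (λ z → z := con 1ℚ :* z :+ con 0ℚ) refl (y (i ℕ.+ 0 ℕ.+ 0)))
    Ls-expand {suc m} (a ∷ x) i = begin
      ∑ gs (λ r → q r * Ls x (i ℕ.+ exps a r)) ≡⟨ ∑-cong gs (λ r → trans (cong (q r *_) (Ls-expand x (i ℕ.+ exps a r)))
          (trans (sym (∑-*ˡ (vecs gs m) (q r) _)) (∑-cong (vecs gs m) λ f →
         trans (sym (ℚP.*-assoc (q r) (prodV f q) _)) (cong (λ z → q r * prodV f q * y z)
             (solveℕ 6 (λ i t r a s d → i ∔ (t ∔ r ⨯ a) ∔ s ∔ d ≐ i ∔ (t ∔ s) ∔ (r ⨯ a ∔ d)) refl i (toℕ (lookup t r)) (toℕ r) (toℕ a)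
             (phase f) (dot f (nat x))))))) ⟩
      ∑ gs (λ r → ∑ (vecs gs m) (λ f → q r * prodV f q * y (i ℕ.+ phase (r ∷ f) ℕ.+ dot (r ∷ f) (nat (a ∷ x))))) ≡⟨ sym (∑-vecs gs m _) ⟩
      ∑ (vecs gs (suc m)) (λ f → prodV f q * y (i ℕ.+ phase f ℕ.+ dot f (nat (a ∷ x)))) ∎
      where open ≡-Reasoning

    -- Summing over π turns the expansion of the product of the operators into Fourier coefficients.
    ∑-Ls : ∀ {m} i → ∑ (vecs gs m) (λ x → injw x * Ls x i) ≡ ∑ (vecs gs m) (λ f → prodV f q * (F m f * y (i ℕ.+ phase f)))
    ∑-Ls {m} i = begin
      ∑ (vecs gs m) (λ x → injw x * Ls x i) ≡⟨ ∑-cong (vecs gs m) (λ x → trans (cong (injw x *_) (Ls-expand x i))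
          (sym (∑-*ˡ (vecs gs m) (injw x) _))) ⟩
      ∑ (vecs gs m) (λ x → ∑ (vecs gs m) (λ f → injw x * (prodV f q * y (i ℕ.+ phase f ℕ.+ dot f (nat x))))) ≡⟨ ∑-swap (vecs gs m) (vecs gs m)
          _ ⟩
      ∑ (vecs gs m) (λ f → ∑ (vecs gs m) (λ x → injw x * (prodV f q * y (i ℕ.+ phase f ℕ.+ dot f (nat x)))))
        ≡⟨ ∑-cong (vecs gs m) (λ f → trans (∑-cong (vecs gs m) λ x → trans
            (solve 3 (λ a b c → a :* (b :* c) := b :* (a :* c)) refl (injw x) (prodV f q) (y (i ℕ.+ phase f ℕ.+ dot f (nat x))))
            (cong (λ z → prodV f q * (injw x * y (i ℕ.+ phase f ℕ.+ z))) (sym (ℕP.*-identityˡ (dot f (nat x))))))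
             (trans (∑-*ˡ (vecs gs m) (prodV f q) _) (cong (prodV f q *_) (F-fourier 1 faithful-1 m f (i ℕ.+ phase f))))) ⟩
      ∑ (vecs gs m) (λ f → prodV f q * (F m f * y (i ℕ.+ phase f))) ∎
      where open ≡-Reasoning

  -- Sums over characters by entry counts

  prodF : ∀ k → (Fin k → ℚ) → ℚ
  prodF zero g = 1ℚ
  prodF (suc k) g = g zero * prodF k (g ∘ suc)

  prodF-cong : ∀ k {g h : Fin k → ℚ} → (∀ i → g i ≡ h i) → prodF k g ≡ prodF k h
  prodF-cong zero e = refl
  prodF-cong (suc k) e = cong₂ _*_ (e zero) (prodF-cong k (e ∘ suc))

  prodF-* : ∀ k (g h : Fin k → ℚ) → prodF k (λ i → g i * h i) ≡ prodF k g * prodF k h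
  prodF-* zero g h = refl
  prodF-* (suc k) g h = trans (cong (g zero * h zero *_) (prodF-* k (g ∘ suc) (h ∘ suc)))
      (solve 4 (λ a b c d → a :* b :* (c :* d) := (a :* c) :* (b :* d)) refl (g zero) (h zero) (prodF k (g ∘ suc)) (prodF k (h ∘ suc)))

  prodF>0 : ∀ k {g : Fin k → ℚ} → (∀ i → 0ℚ < g i) → 0ℚ < prodF k g
  prodF>0 zero h = 0<1
  prodF>0 (suc k) h = 0<* (h zero) (prodF>0 k (h ∘ suc))

  prodF-1 : ∀ k → prodF k (λ _ → 1ℚ) ≡ 1ℚ
  prodF-1 zero = refl
  prodF-1 (suc k) = trans (ℚP.*-identityˡ (prodF k (λ _ → 1ℚ))) (prodF-1 k)

  prodF-δ : ∀ {k} (a : Fin k) (q : Fin k → ℚ) → prodF k (λ r → q r ^ eqℕ r a) ≡ q a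
  prodF-δ {suc k} zero q = trans (cong (q zero * 1ℚ *_) (trans (prodF-cong k λ r → refl) (prodF-1 k)))
      (solve 1 (λ x → x :* con 1ℚ :* con 1ℚ := x) refl (q zero))
  prodF-δ {suc k} (suc a) q = trans (ℚP.*-identityˡ _) (prodF-δ a (q ∘ suc))

  prodV-count : ∀ {k m} (f : Vec (Fin k) m) (q : Fin k → ℚ) → prodV f q ≡ prodF k (λ r → q r ^ count r f)
  prodV-count {k} [] q = sym (prodF-1 k)
  prodV-count {k} (a ∷ f) q = sym (trans (prodF-cong k λ r → ^-+ (q r) (eqℕ r a) (count r f))
      (trans (prodF-* k _ _) (cong₂ _*_ (prodF-δ a q) (sym (prodV-count f q)))))

  same : ℕ → ℕ → ℚ
  same a b with a ℕP.≟ b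
  ... | yes _ = 1ℚ
  ... | no _ = 0ℚ

  same-refl : ∀ a → same a a ≡ 1ℚ
  same-refl a with a ℕP.≟ a
  ... | yes _ = refl
  ... | no ne = ⊥-elim (ne refl)

  same-≢ : ∀ {a b} → a ≢ b → same a b ≡ 0ℚ
  same-≢ {a} {b} ne with a ℕP.≟ b
  ... | yes e = ⊥-elim (ne e)
  ... | no _ = refl

  sames : ∀ k → (Fin k → ℕ) → (Fin k → ℕ) → ℚ
  sames k a b = prodF k (λ r → same (a r) (b r))

  sames-yes : ∀ k {a b : Fin k → ℕ} → (∀ r → a r ≡ b r) → sames k a b ≡ 1ℚ
  sames-yes k {a} {b} e = trans (prodF-cong k λ r → trans (cong (same (a r)) (sym (e r))) (same-refl (a r))) (prodF-1 k)

  prodF-0 : ∀ {k} (g : Fin k → ℚ) r → g r ≡ 0ℚ → prodF k g ≡ 0ℚ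
  prodF-0 {suc k} g zero e = trans (cong (_* prodF k (g ∘ suc)) e) (ℚP.*-zeroˡ (prodF k (g ∘ suc)))
  prodF-0 {suc k} g (suc r) e = trans (cong (g zero *_) (prodF-0 (g ∘ suc) r e)) (ℚP.*-zeroʳ (g zero))

  sames-no : ∀ k {a b : Fin k → ℕ} r → a r ≢ b r → sames k a b ≡ 0ℚ
  sames-no k {a} {b} r ne = prodF-0 (λ r → same (a r) (b r)) r (same-≢ ne)

  sumF : ∀ k → (Fin k → ℕ) → ℕ
  sumF zero a = 0
  sumF (suc k) a = a zero ℕ.+ sumF k (a ∘ suc)

  sumF-+ : ∀ k (a b : Fin k → ℕ) → sumF k (λ r → a r ℕ.+ b r) ≡ sumF k a ℕ.+ sumF k b
  sumF-+ zero a b = refl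
  sumF-+ (suc k) a b = trans (cong (a zero ℕ.+ b zero ℕ.+_) (sumF-+ k (a ∘ suc) (b ∘ suc)))
    (solveℕ 4 (λ a b c d → a ∔ b ∔ (c ∔ d) ≐ a ∔ c ∔ (b ∔ d)) refl (a zero) (b zero) (sumF k (a ∘ suc)) (sumF k (b ∘ suc)))

  sumF-0 : ∀ k → sumF k (λ _ → 0) ≡ 0
  sumF-0 zero = refl
  sumF-0 (suc k) = sumF-0 k

  sumF-eqℕ : ∀ {k} (a : Fin k) → sumF k (λ r → eqℕ r a) ≡ 1
  sumF-eqℕ {suc k} zero = cong suc (sumF-0 k)
  sumF-eqℕ {suc k} (suc a) = sumF-eqℕ a

  sumF-count : ∀ {k m} (f : Vec (Fin k) m) → sumF k (λ r → count r f) ≡ m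
  sumF-count {k} [] = sumF-0 k
  sumF-count {k} (a ∷ f) = trans (sumF-+ k (λ r → eqℕ r a) (λ r → count r f)) (cong₂ ℕ._+_ (sumF-eqℕ a) (sumF-count f))

  ∑<-single : ∀ n (f : ℕ → ℚ) j → j ℕ.< n → (∀ i → i ≢ j → f i ≡ 0ℚ) → ∑< n f ≡ f j
  ∑<-single (suc n) f j (s≤s l) h with j ℕP.≟ n
  ... | yes refl = trans (cong (_+ f n) (∑<-≡0 n λ i i<n → h i (ℕP.<⇒≢ i<n))) (ℚP.+-identityˡ (f n))
  ... | no ne = trans (cong₂ _+_ (∑<-single n f j (ℕP.≤∧≢⇒< l ne) h) (h n (ne ∘ sym))) (ℚP.+-identityʳ (f j))

  ∑<-rev : ∀ n (f : ℕ → ℚ) → ∑< (suc n) (λ i → f (n ℕ.∸ i)) ≡ ∑< (suc n) f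
  ∑<-rev zero f = refl
  ∑<-rev (suc n) f = trans (∑<-left (suc n) _) (trans (cong (f (suc n) +_) (∑<-rev n f)) (ℚP.+-comm (f (suc n)) (∑< (suc n) f)))

  ∑-strip′ : ∀ {k} N (g : ℕ → ℚ) (Ψ : ∀ m → Vec (Fin k) m → ℚ) →
    ∑ (vecs (fins (suc k)) N) (λ v → g (count zero v) * Ψ (proj₁ (strip v)) (proj₂ (strip v))) ≡ ∑< (suc N)
        (λ m → binom N m * (g (N ℕ.∸ m) * ∑ (vecs (fins k) m) (Ψ m)))
  ∑-strip′ {k} N g Ψ = trans (∑-cong (vecs (fins (suc k)) N) λ v → cong (λ t → g t * Ψ (proj₁ (strip v)) (proj₂ (strip v)))
      (trans (sym (ℕP.m+n∸n≡m (count zero v) (proj₁ (strip v)))) (cong (ℕ._∸ proj₁ (strip v)) (strip-count v))))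
    (trans (∑-strip N (λ m w → g (N ℕ.∸ m) * Ψ m w)) (∑<-cong (suc N) λ m _ → cong (binom N m *_)
        (∑-*ˡ (vecs (fins k) m) (g (N ℕ.∸ m)) (Ψ m))))

  multinomial : ∀ k N (a : Fin k → ℕ) → sumF k a ≡ N → ∑ (vecs (fins k) N) (λ f → sames k (λ r → count r f) a) * prodF k (λ r → fact (a r)) ≡
      fact N
  multinomial zero zero a refl = refl
  multinomial (suc k) N a refl = begin
    ∑ (vecs (fins (suc k)) N) (λ f → same (count zero f) a₀ * sames k (λ r → count (suc r) f) (a ∘ suc)) * (fact a₀ * P)
      ≡⟨ cong (_* (fact a₀ * P)) (trans (∑-cong (vecs (fins (suc k)) N) λ f → cong (same (count zero f) a₀ *_)
          (prodF-cong k λ r → cong (λ t → same t (a (suc r))) (strip-count-suc f r)))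
           (∑-strip′ N (λ c → same c a₀) (λ m w → sames k (λ r → count r w) (a ∘ suc)))) ⟩
    ∑< (suc N) (λ m → binom N m * (same (N ℕ.∸ m) a₀ * M m)) * (fact a₀ * P) ≡⟨ cong (_* (fact a₀ * P))
        (trans (∑<-cong (suc N) λ m l → trans (solve 3 (λ b s x → b :* (s :* x) := s :* (b :* x)) refl (binom N m) (same (N ℕ.∸ m) a₀) (M m))
        (cong (_* (binom N m * M m)) (same-eq m (ℕP.≤-pred l))))
         (trans (∑<-single (suc N) (λ m → same m m₁ * (binom N m * M m)) m₁ (s≤s (ℕP.m≤n+m m₁ a₀))
             (λ i ne → trans (cong (_* (binom N i * M i)) (same-≢ ne)) (ℚP.*-zeroˡ (binom N i * M i))))
             (trans (cong (_* (binom N m₁ * M m₁)) (same-refl m₁)) (ℚP.*-identityˡ (binom N m₁ * M m₁))))) ⟩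
    binom N m₁ * M m₁ * (fact a₀ * P) ≡⟨ (solve 4 (λ b x f P → b :* x :* (f :* P) := b :* ((x :* P) :* f)) refl (binom N m₁) (M m₁) (fact a₀)
        P) ⟩
    binom N m₁ * ((M m₁ * P) * fact a₀) ≡⟨ cong₂ (λ s t → binom s m₁ * (t * fact a₀)) (ℕP.+-comm a₀ m₁) (multinomial k m₁ (a ∘ suc) refl) ⟩
    binom (m₁ ℕ.+ a₀) m₁ * (fact m₁ * fact a₀) ≡⟨ trans (binom-fact m₁ a₀) (cong fact (ℕP.+-comm m₁ a₀)) ⟩
    fact N ∎
    where
    open ≡-Reasoning
    a₀ m₁ : ℕ
    a₀ = a zero
    m₁ = sumF k (a ∘ suc)
    P : ℚ
    P = prodF k (λ r → fact (a (suc r)))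
    M : ℕ → ℚ
    M m = ∑ (vecs (fins k) m) (λ w → sames k (λ r → count r w) (a ∘ suc))
    same-eq : ∀ m → m ℕ.≤ a₀ ℕ.+ m₁ → same (a₀ ℕ.+ m₁ ℕ.∸ m) a₀ ≡ same m m₁
    same-eq m l with m ℕP.≟ m₁
    ... | yes refl = trans (cong (λ t → same t a₀) (ℕP.m+n∸n≡m a₀ m₁)) (same-refl a₀)
    ... | no ne = same-≢ λ e → ne (ℕP.+-cancelˡ-≡ a₀ m m₁ (trans (cong (ℕ._+ m) (sym e)) (ℕP.m∸n+n≡m l)))

  ∑-empty : ∀ N (f : Vec (Fin 0) (suc N) → ℚ) → ∑ (vecs (fins 0) (suc N)) f ≡ 0ℚ
  ∑-empty N f = trans (∑-vecs (fins 0) N f) (∑-fins0 _)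

  -- Both sides compare coefficients of x^N in (Σ g(a) x^a / a!)^k.
  egf-bound : ∀ k N (g : ℕ → ℚ) x E → (∀ a → 0ℚ ≤ g a) → 0ℚ ≤ x → 0ℚ ≤ E → (∀ M → ∑< (suc M) (λ a → g a * x ^ a * inv (fact a)) ≤ E) →
    ∑ (vecs (fins k) N) (λ f → prodF k (λ r → g (count r f))) * x ^ N ≤ fact N * E ^ k
  egf-bound zero zero g x E g≥0 x≥0 E≥0 h = ℚP.≤-refl
  egf-bound zero (suc N) g x E g≥0 x≥0 E≥0 h = ℚP.≤-trans (ℚP.≤-reflexive
      (trans (cong (_* x ^ suc N) (∑-empty N _)) (ℚP.*-zeroˡ (x ^ suc N)))) (0≤* (fact≥0 (suc N)) 0≤1)
  egf-bound (suc k) N g x E g≥0 x≥0 E≥0 h = begin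
    ∑ (vecs (fins (suc k)) N) (λ f → g (count zero f) * prodF k (λ r → g (count (suc r) f))) * x ^ N
      ≡⟨ cong (_* x ^ N) (trans (∑-cong (vecs (fins (suc k)) N) λ f → cong (g (count zero f) *_)
          (prodF-cong k λ r → cong g (strip-count-suc f r))) (∑-strip′ N g (λ m w → prodF k (λ r → g (count r w))))) ⟩
    ∑< (suc N) (λ m → binom N m * (g (N ℕ.∸ m) * G m)) * x ^ N ≡⟨ sym (∑<-*ʳ (suc N) (x ^ N) _) ⟩
    ∑< (suc N) (λ m → binom N m * (g (N ℕ.∸ m) * G m) * x ^ N) ≤⟨ ∑<-mono (suc N) (λ m l → term m (ℕP.≤-pred l)) ⟩
    ∑< (suc N) (λ m → fact N * E ^ k * e (N ℕ.∸ m)) ≡⟨ trans (∑<-*ˡ (suc N) (fact N * E ^ k) _) (cong (fact N * E ^ k *_) (∑<-rev N e)) ⟩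
    fact N * E ^ k * ∑< (suc N) e ≤⟨ *-mono (0≤* (fact≥0 N) (^≥0 k E≥0)) (h N) ⟩
    fact N * E ^ k * E ≡⟨ (solve 3 (λ f a E → f :* a :* E := f :* (E :* a)) refl (fact N) (E ^ k) E) ⟩
    fact N * E ^ suc k ∎
    where
    open ℚP.≤-Reasoning
    G e : ℕ → ℚ
    G m = ∑ (vecs (fins k) m) (λ w → prodF k (λ r → g (count r w)))
    e a = g a * x ^ a * inv (fact a)
    binom≥0 : ∀ N m → 0ℚ ≤ binom N m
    binom≥0 N zero = 0≤1
    binom≥0 zero (suc m) = ℚP.≤-refl
    binom≥0 (suc N) (suc m) = 0≤+ (binom≥0 N m) (binom≥0 N (suc m))
    term : ∀ m → m ℕ.≤ N → binom N m * (g (N ℕ.∸ m) * G m) * x ^ N ≤ fact N * E ^ k * e (N ℕ.∸ m)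
    term m l = begin
      binom N m * (g a * G m) * x ^ N ≡⟨ cong (binom N m * (g a * G m) *_) (trans (cong (x ^_) (sym ml)) (^-+ x m a)) ⟩
      binom N m * (g a * G m) * (x ^ m * x ^ a) ≡⟨ (solve 5 (λ b g G u v → b :* (g :* G) :* (u :* v) := (b :* (g :* v)) :* (G :* u)) refl
          (binom N m) (g a) (G m) (x ^ m) (x ^ a)) ⟩
      (binom N m * (g a * x ^ a)) * (G m * x ^ m) ≤⟨ *-mono (0≤* (binom≥0 N m) (0≤* (g≥0 a) (^≥0 a x≥0)))
          (egf-bound k m g x E g≥0 x≥0 E≥0 h) ⟩
      (binom N m * (g a * x ^ a)) * (fact m * E ^ k) ≡⟨ (solve 4 (λ b w f q → (b :* w) :* (f :* q) := (b :* (f :* con 1ℚ)) :* q :* w) refl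
          (binom N m) (g a * x ^ a) (fact m) (E ^ k)) ⟩
      (binom N m * (fact m * 1ℚ)) * E ^ k * (g a * x ^ a) ≡⟨ cong (λ t → (binom N m * (fact m * t)) * E ^ k * (g a * x ^ a))
          (sym (inv-r (fact>0 a))) ⟩
      (binom N m * (fact m * (fact a * inv (fact a)))) * E ^ k * (g a * x ^ a) ≡⟨
          (solve 6 (λ b w f h i q → (b :* (f :* (h :* i))) :* q :* w := (b :* (f :* h)) :* q :* (w :* i)) refl (binom N m) (g a * x ^ a)
          (fact m) (fact a) (inv (fact a)) (E ^ k)) ⟩
      (binom N m * (fact m * fact a)) * E ^ k * (g a * x ^ a * inv (fact a)) ≡⟨ cong (λ t → t * E ^ k * e a)
          (trans (cong (λ t → binom t m * (fact m * fact a)) (sym ml)) (trans (binom-fact m a) (cong fact ml))) ⟩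
      fact N * E ^ k * e a ∎
      where
      a : ℕ
      a = N ℕ.∸ m
      ml : m ℕ.+ a ≡ N
      ml = ℕP.m+[n∸m]≡n l

  -- Extraction of a Fourier coefficient by averaging over phases

  ∑-vecs-1 : ∀ {A : Set} (xs : List A) m → ∑ (vecs xs m) (λ _ → 1ℚ) ≡ ι (length xs) ^ m
  ∑-vecs-1 xs zero = refl
  ∑-vecs-1 xs (suc m) = trans (∑-vecs xs m _) (trans (∑-cong xs λ _ → ∑-vecs-1 xs m) (∑-const xs (ι (length xs) ^ m)))

  module DenseBound (p : ℕ) (q : Fin (suc p) → ℚ) where
    open Group p
    open Sparse p using (ff; nQ>0; nQ≥0; ff≥0)
    open Fourier p
    open Trace p using (y; y-0)
    open Identity p using (ff-n)
    module O (t : Vec G n) = Operators p q t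

    dot-tab-+ : ∀ {k} (t : Vec G k) c (a b : Fin k → ℕ) → dot t (Vec.tabulate (λ r → c ℕ.* a r ℕ.+ b r)) ≡ c ℕ.* dot t (Vec.tabulate a) ℕ.+
        dot t (Vec.tabulate b)
    dot-tab-+ [] c a b = sym (trans (ℕP.+-identityʳ _) (ℕP.*-zeroʳ c))
    dot-tab-+ (x ∷ t) c a b = trans (cong (toℕ x ℕ.* (c ℕ.* a zero ℕ.+ b zero) ℕ.+_) (dot-tab-+ t c (a ∘ suc) (b ∘ suc)))
      (solveℕ 6 (λ x c a b d e → x ⨯ (c ⨯ a ∔ b) ∔ (c ⨯ d ∔ e) ≐ c ⨯ (x ⨯ a ∔ d) ∔ (x ⨯ b ∔ e)) refl (toℕ x) c (a zero) (b zero)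
          (dot t (Vec.tabulate (a ∘ suc))) (dot t (Vec.tabulate (b ∘ suc))))

    dot-tab-0 : ∀ {k} (t : Vec G k) → dot t (Vec.tabulate (λ _ → 0)) ≡ 0
    dot-tab-0 [] = refl
    dot-tab-0 (x ∷ t) = cong₂ ℕ._+_ (ℕP.*-zeroʳ (toℕ x)) (dot-tab-0 t)

    dot-tab-eq : ∀ {k} (t : Vec G k) a (c : Fin k → ℕ) → dot t (Vec.tabulate (λ r → eqℕ r a ℕ.+ c r)) ≡ toℕ (lookup t a) ℕ.+ dot t
        (Vec.tabulate c)
    dot-tab-eq (x ∷ t) zero c = solveℕ 3 (λ x c d → x ⨯ (conℕ 1 ∔ c) ∔ d ≐ x ∔ (x ⨯ c ∔ d)) refl (toℕ x) (c zero)
        (dot t (Vec.tabulate (c ∘ suc)))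
    dot-tab-eq (x ∷ t) (suc a) c = trans (cong (toℕ x ℕ.* c zero ℕ.+_) (dot-tab-eq t a (c ∘ suc)))
        (solveℕ 3 (λ u v w → u ∔ (v ∔ w) ≐ v ∔ (u ∔ w)) refl (toℕ x ℕ.* c zero) (toℕ (lookup t a)) (dot t (Vec.tabulate (c ∘ suc))))

    phase-dot : ∀ t {m} (f : Vec G m) → O.phase t f ≡ dot t (Vec.tabulate (λ r → count r f))
    phase-dot t [] = sym (dot-tab-0 t)
    phase-dot t (a ∷ f) = trans (cong (toℕ (lookup t a) ℕ.+_) (phase-dot t f)) (sym (dot-tab-eq t a (λ r → count r f)))

    div-yes : ∀ {v} → n ∣ v → div v ≡ 1ℚ
    div-yes {v} d with n ∣? v
    ... | yes _ = refl
    ... | no nd = ⊥-elim (nd d)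

    div-no : ∀ {v} → ¬ (n ∣ v) → div v ≡ 0ℚ
    div-no {v} nd with n ∣? v
    ... | yes d = ⊥-elim (nd d)
    ... | no _ = refl

    divs-tab : ∀ {k} (v : Fin k → ℕ) → divs (Vec.tabulate v) ≡ prodF k (λ r → div (v r))
    divs-tab {zero} v = refl
    divs-tab {suc k} v = cong (div (v zero) *_) (divs-tab (v ∘ suc))

    Dense₁ : Vec G n → Set
    Dense₁ χ = ∀ r → count r χ ℕ.< n

    count≤ : ∀ {m} r (f : Vec G m) → count r f ℕ.≤ m
    count≤ r [] = z≤n
    count≤ r (x ∷ f) with r FinP.≟ x
    ... | yes refl = subst (λ t → t ℕ.+ count r f ℕ.≤ _) (sym (eqℕ-refl r)) (s≤s (count≤ r f))
    ... | no ne = subst (λ t → t ℕ.+ count r f ℕ.≤ _) (sym (eqℕ-≢ ne)) (ℕP.m≤n⇒m≤1+n (count≤ r f))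

    mod-eq : ∀ a b → n ∣ p ℕ.* a ℕ.+ b → b % n ≡ a % n
    mod-eq a b (divides d e) = trans (sym (DM.[m+kn]%n≡m%n b a n)) (trans
        (cong (_% n) (trans (solveℕ 3 (λ b a p → b ∔ a ⨯ (conℕ 1 ∔ p) ≐ a ∔ (p ⨯ a ∔ b)) refl b a p) (cong (a ℕ.+_) e)))
        (DM.[m+kn]%n≡m%n a d n))

    -- Counts that agree modulo n agree, unless f is constant, which is excluded because χ is not.
    counts-eq : ∀ (χ f : Vec G n) → Dense₁ χ → (∀ r → n ∣ p ℕ.* count r χ ℕ.+ count r f) → ∀ r → count r f ≡ count r χ
    counts-eq χ@(x ∷ χ′) f dχ h r with ℕP.m≤n⇒m<n∨m≡n (count≤ r f)
    ... | inj₁ lt = trans (sym (DM.m<n⇒m%n≡m lt)) (trans (mod-eq (count r χ) (count r f) (h r)) (DM.m<n⇒m%n≡m (dχ r)))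
    ... | inj₂ e = ⊥-elim (ℕP.<-irrefl (sym (zeroχ x)) (subst (λ t → 0 ℕ.< t ℕ.+ count x χ′) (sym (eqℕ-refl x)) (s≤s z≤n)))
      where
      f0 : ∀ s → count s f % n ≡ 0
      f0 s with r FinP.≟ s
      ... | yes refl = trans (cong (_% n) e) (DM.n%n≡0 n)
      ... | no ne = cong (_% n) (ℕP.n≤0⇒n≡0 (ℕP.+-cancelˡ-≤ n (count s f) 0
          (subst₂ ℕ._≤_ (cong (ℕ._+ count s f) e) (sym (ℕP.+-identityʳ n)) (count-sum≤ ne f))))
      zeroχ : ∀ s → count s χ ≡ 0
      zeroχ s = trans (sym (DM.m<n⇒m%n≡m (dχ s))) (trans (sym (mod-eq (count s χ) (count s f) (h s))) (f0 s))

    divs-same : ∀ (χ f : Vec G n) → Dense₁ χ → divs (Vec.tabulate (λ r → p ℕ.* count r χ ℕ.+ count r f)) ≡ sames n (λ r → count r f)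
        (λ r → count r χ)
    divs-same χ f dχ with FinP.all? (λ r → count r f ℕP.≟ count r χ)
    ... | yes e = trans (divs-tab (λ r → p ℕ.* count r χ ℕ.+ count r f))
        (trans (trans (prodF-cong n λ r → div-yes (divides (count r χ) (trans (cong (p ℕ.* count r χ ℕ.+_) (e r))
        (solveℕ 2 (λ p c → p ⨯ c ∔ c ≐ c ⨯ (conℕ 1 ∔ p)) refl p (count r χ))))) (prodF-1 n)) (sym (sames-yes n e)))
    ... | no ne with FinP.all? (λ r → n ∣? (p ℕ.* count r χ ℕ.+ count r f))
    ...   | yes d = ⊥-elim (ne (counts-eq χ f dχ d))
    ...   | no nd = let (r , h) = FinP.¬∀⟶∃¬ n _ (λ r → n ∣? (p ℕ.* count r χ ℕ.+ count r f)) nd; (r′ , h′) = FinP.¬∀⟶∃¬ n _ (λ r → count r f ℕP.≟ count r χ) ne in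
        trans (divs-tab (λ r → p ℕ.* count r χ ℕ.+ count r f)) (trans (prodF-0 (λ r → div (p ℕ.* count r χ ℕ.+ count r f)) r (div-no h))
            (sym (sames-no n {λ r → count r f} {λ r → count r χ} r′ h′)))

    -- The shift by p times the phase of χ cancels that phase, so the sum over t selects from the
    -- expanded product the vectors f with the entry counts of χ.
    y′ : Vec G n → ℕ → ℚ
    y′ χ i = ∑ (vecs gs n) (λ t → ∑ (vecs gs n) (λ x → injw x * O.Ls t x (i ℕ.+ p ℕ.* O.phase t χ)))

    M : Vec G n → ℚ
    M χ = ∑ (vecs gs n) (λ f → sames n (λ r → count r f) (λ r → count r χ))

    -- The selected f are rearrangements of χ, M χ in number, and by symmetry all have the same
    -- weight and the same F. The sum over t compares counts only modulo n, whence the hypothesis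
    -- `Dense₁`.
    y′-eq : ∀ χ → Dense₁ χ → ∀ i → y′ χ i ≡ nQ ^ n * (prodV χ q * F n χ * M χ) * y i
    y′-eq χ dχ i = begin
      ∑ (vecs gs n) (λ t → ∑ (vecs gs n) (λ x → injw x * O.Ls t x (i ℕ.+ p ℕ.* O.phase t χ)))
        ≡⟨ trans (∑-cong (vecs gs n) λ t → O.∑-Ls t {n} (i ℕ.+ p ℕ.* O.phase t χ)) (∑-swap (vecs gs n) (vecs gs n) _) ⟩
      ∑ (vecs gs n) (λ f → ∑ (vecs gs n) (λ t → prodV f q * (F n f * y (i ℕ.+ p ℕ.* O.phase t χ ℕ.+ O.phase t f))))
        ≡⟨ ∑-cong (vecs gs n) (λ f → trans (∑-cong (vecs gs n) λ t → trans (sym (ℚP.*-assoc (prodV f q) (F n f) _))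
            (cong (λ z → prodV f q * F n f * y z) (re t f)))
             (trans (∑-*ˡ (vecs gs n) (prodV f q * F n f) _) (cong (prodV f q * F n f *_)
                 (trans (∑-orthogonal (Vec.tabulate (λ r → p ℕ.* count r χ ℕ.+ count r f)) i)
                 (cong (λ z → nQ ^ n * z * y i) (divs-same χ f dχ)))))) ⟩
      ∑ (vecs gs n) (λ f → prodV f q * F n f * (nQ ^ n * sm f * y i)) ≡⟨ ∑-cong (vecs gs n) pt ⟩
      ∑ (vecs gs n) (λ f → nQ ^ n * (prodV χ q * F n χ) * y i * sm f) ≡⟨ ∑-*ˡ (vecs gs n) (nQ ^ n * (prodV χ q * F n χ) * y i) sm ⟩
      nQ ^ n * (prodV χ q * F n χ) * y i * M χ ≡⟨ (solve 4 (λ a b y m → a :* b :* y :* m := a :* (b :* m) :* y) refl (nQ ^ n)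
          (prodV χ q * F n χ) (y i) (M χ)) ⟩
      nQ ^ n * (prodV χ q * F n χ * M χ) * y i ∎
      where
      open ≡-Reasoning
      sm : Vec G n → ℚ
      sm f = sames n (λ r → count r f) (λ r → count r χ)
      re : ∀ t f → i ℕ.+ p ℕ.* O.phase t χ ℕ.+ O.phase t f ≡ i ℕ.+ dot t (Vec.tabulate (λ r → p ℕ.* count r χ ℕ.+ count r f))
      re t f = trans (ℕP.+-assoc i _ _) (cong (i ℕ.+_) (trans (cong₂ (λ a b → p ℕ.* a ℕ.+ b) (phase-dot t χ) (phase-dot t f))
          (sym (dot-tab-+ t p (λ r → count r χ) (λ r → count r f)))))
      pt : ∀ f → prodV f q * F n f * (nQ ^ n * sm f * y i) ≡ nQ ^ n * (prodV χ q * F n χ) * y i * sm f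
      pt f with FinP.all? (λ r → count r f ℕP.≟ count r χ)
      ... | yes e = trans (cong₂ (λ a b → a * b * (nQ ^ n * sm f * y i)) (prodV-~ q (counts-~ f χ e)) (F-symm n (counts-~ f χ e)))
          (solve 5 (λ a b c s y → a :* b :* (c :* s :* y) := c :* (a :* b) :* y :* s) refl (prodV χ q) (F n χ) (nQ ^ n) (sm f) (y i))
      ... | no ne = let (r , h) = FinP.¬∀⟶∃¬ n _ (λ r → count r f ℕP.≟ count r χ) ne in
          trans (cong (λ s → prodV f q * F n f * (nQ ^ n * s * y i)) (sames-no n {λ r → count r f} {λ r → count r χ} r h))
              (trans (solve 4 (λ a c y b → a :* (c :* con 0ℚ :* y) := b :* con 0ℚ) refl (prodV f q * F n f) (nQ ^ n) (y i)
              (nQ ^ n * (prodV χ q * F n χ) * y i)) (cong (nQ ^ n * (prodV χ q * F n χ) * y i *_)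
              (sym (sames-no n {λ r → count r f} {λ r → count r χ} r h))))

    Q : ℚ
    Q = ∑ gs (λ r → q r * q r)

    Ny : ℚ
    Ny = ∑< n (λ i → y i * y i)

    Ny>0 : 0ℚ < Ny
    Ny>0 = subst (0ℚ <_) (sym (∑<-left p _)) (0<+ (subst (0ℚ <_) (cong (λ z → z * z) (sym y-0)) 0<1) (∑<≥0 p λ i → sq≥0 (y (suc i))))

    ∑-injw : ∀ m → ∑ (vecs gs m) injw ≡ ff m
    ∑-injw zero = refl
    ∑-injw (suc m) = trans (∑-vecs gs m injw) (trans (∑-swap gs (vecs gs m) _)
        (trans (∑-cong (vecs gs m) λ x → O.∑-inj (Vec.replicate n zero) x)
        (trans (∑-*ˡ (vecs gs m) (nQ - ι m) injw) (trans (cong ((nQ - ι m) *_) (∑-injw m)) (ℚP.*-comm (nQ - ι m) (ff m))))))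

    len-gs : ι (length gs) ≡ nQ
    len-gs = trans (trans (sym (ℚP.*-identityʳ _)) (sym (∑-const gs 1ℚ)))
        (trans (∑-fins-const n 1ℚ) (trans (ℚP.*-identityʳ (ι n)) (sym nQ-ι)))

    ∑-1 : ∑ (vecs gs n) (λ _ → 1ℚ) ≡ nQ ^ n
    ∑-1 = trans (∑-vecs-1 gs n) (cong (_^ n) len-gs)

    -- Cauchy-Schwarz over t and then over x with the weight `injw`. The shift by the phase of χ
    -- does not change norms, and `Sym-bound` holds for each t.
    N-y′ : ∀ χ → ∑< n (λ i → y′ χ i * y′ χ i) ≤ nQ ^ n * (nQ ^ n * (ff n * (ff n * Q ^ n * Ny)))
    N-y′ χ = begin
      ∑< n (λ i → y′ χ i * y′ χ i) ≤⟨ ∑<-mono n (λ i _ → pointwise i) ⟩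
      ∑< n (λ i → nQ ^ n * ∑ (vecs gs n) (λ t → ff n * ∑ (vecs gs n) (λ x → injw x * (h t x i * h t x i))))
        ≡⟨ trans (∑<-*ˡ n (nQ ^ n) _) (cong (nQ ^ n *_) (trans (sym (∑<-swap (vecs gs n) n _))
            (∑-cong (vecs gs n) λ t → trans (∑<-*ˡ n (ff n) _) (cong (ff n *_)
            (trans (sym (∑<-swap (vecs gs n) n _)) (∑-cong (vecs gs n) λ x →
             trans (∑<-*ˡ n (injw x) _) (cong (injw x *_) (O.shift t {λ i → O.Ls t x i * O.Ls t x i}
                 (λ i a → cong₂ _*_ (O.Ls-periodic t x i a) (O.Ls-periodic t x i a)) (p ℕ.* O.phase t χ))))))))) ⟩
      nQ ^ n * ∑ (vecs gs n) (λ t → ff n * O.Sym t n) ≤⟨ *-mono (^≥0 n nQ≥0)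
          (∑-mono (vecs gs n) λ t → *-mono (ff≥0 n ℕP.≤-refl) (O.Sym-bound t n ℕP.≤-refl)) ⟩
      nQ ^ n * ∑ (vecs gs n) (λ t → ff n * (ff n * Q ^ n * Ny)) ≡⟨ cong (nQ ^ n *_)
          (trans (∑-cong (vecs gs n) λ t → sym (ℚP.*-identityˡ _)) (trans (∑-*ʳ (vecs gs n) (ff n * (ff n * Q ^ n * Ny)) (λ _ → 1ℚ))
          (cong (_* (ff n * (ff n * Q ^ n * Ny))) ∑-1))) ⟩
      nQ ^ n * (nQ ^ n * (ff n * (ff n * Q ^ n * Ny))) ∎
      where
      open ℚP.≤-Reasoning
      h : Vec G n → Vec G n → ℕ → ℚ
      h t x i = O.Ls t x (i ℕ.+ p ℕ.* O.phase t χ)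
      g : Vec G n → ℕ → ℚ
      g t i = ∑ (vecs gs n) (λ x → injw x * h t x i)
      pointwise : ∀ i → y′ χ i * y′ χ i ≤ nQ ^ n * ∑ (vecs gs n) (λ t → ff n * ∑ (vecs gs n) (λ x → injw x * (h t x i * h t x i)))
      pointwise i = begin
        y′ χ i * y′ χ i ≡⟨ cong (λ z → z * z) (∑-cong (vecs gs n) λ t → sym (ℚP.*-identityˡ (g t i))) ⟩
        ∑ (vecs gs n) (λ t → 1ℚ * g t i) * ∑ (vecs gs n) (λ t → 1ℚ * g t i) ≤⟨ ∑-cauchy (vecs gs n) (λ _ → 1ℚ) (λ t → g t i) (λ _ → 0≤1) ⟩
        ∑ (vecs gs n) (λ _ → 1ℚ) * ∑ (vecs gs n) (λ t → 1ℚ * (g t i * g t i)) ≡⟨ cong₂ _*_ ∑-1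
            (∑-cong (vecs gs n) λ t → ℚP.*-identityˡ (g t i * g t i)) ⟩
        nQ ^ n * ∑ (vecs gs n) (λ t → g t i * g t i) ≤⟨ *-mono (^≥0 n nQ≥0)
            (∑-mono (vecs gs n) λ t → ℚP.≤-trans (∑-cauchy (vecs gs n) injw (λ x → h t x i) injw≥0)
            (ℚP.≤-reflexive (cong (_* ∑ (vecs gs n) (λ x → injw x * (h t x i * h t x i))) (∑-injw n)))) ⟩
        nQ ^ n * ∑ (vecs gs n) (λ t → ff n * ∑ (vecs gs n) (λ x → injw x * (h t x i * h t x i))) ∎

    -- R is a rational upper bound for √Q. As `y′ χ` is a multiple of `y`, the norm of `y` cancels
    -- in `N-y′` and leaves a bound for |F χ| M χ times the product of weights; M χ is n! over the
    -- product of the factorials of the counts.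
    F-dense : ∀ χ R → Dense₁ χ → (∀ r → 0ℚ ≤ q r) → 0ℚ ≤ R → Q ≤ R * R → prodV χ q * ∣ F n χ ∣ ≤ R ^ n * prodF n (λ r → fact (count r χ))
    F-dense χ R dχ q≥0 R≥0 QR = cancel-≤ (fact>0 n) (begin
      fact n * (prodV χ q * ∣ F n χ ∣) ≡⟨ cong (_* (prodV χ q * ∣ F n χ ∣)) (sym mult) ⟩
      M χ * P * (prodV χ q * ∣ F n χ ∣) ≡⟨ (solve 4 (λ m P v f → m :* P :* (v :* f) := (v :* f :* m) :* P) refl (M χ) P (prodV χ q)
          (∣ F n χ ∣)) ⟩
      (prodV χ q * ∣ F n χ ∣ * M χ) * P ≤⟨ *-monoʳ (ℚP.<⇒≤ P>0) main ⟩
      fact n * R ^ n * P ≡⟨ ℚP.*-assoc (fact n) (R ^ n) P ⟩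
      fact n * (R ^ n * P) ∎)
      where
      open ℚP.≤-Reasoning
      P a : ℚ
      P = prodF n (λ r → fact (count r χ))
      P>0 : 0ℚ < P
      P>0 = prodF>0 n λ r → fact>0 (count r χ)
      mult : M χ * P ≡ fact n
      mult = multinomial n n (λ r → count r χ) (sumF-count χ)
      a = prodV χ q * F n χ * M χ
      prodV≥0 : ∀ {m} (v : Vec G m) → 0ℚ ≤ prodV v q
      prodV≥0 [] = 0≤1
      prodV≥0 (x ∷ v) = 0≤* (q≥0 x) (prodV≥0 v)
      M≥0 : 0ℚ ≤ M χ
      M≥0 = ∑≥0 (vecs gs n) λ f → go n (λ r → count r f) (λ r → count r χ)
        where
        go : ∀ k a b → 0ℚ ≤ sames k a b
        go zero a b = 0≤1
        go (suc k) a b = 0≤* (s≥0 (a zero) (b zero)) (go k (a ∘ suc) (b ∘ suc))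
          where
          s≥0 : ∀ a b → 0ℚ ≤ same a b
          s≥0 a b with a ℕP.≟ b
          ... | yes _ = 0≤1
          ... | no _ = ℚP.≤-refl
      a² : a * a ≤ (fact n * R ^ n) * (fact n * R ^ n)
      a² = cancel-≤ (0<* (0<* (^>0 n nQ>0) (^>0 n nQ>0)) Ny>0) (begin
        nQ ^ n * nQ ^ n * Ny * (a * a) ≡⟨ trans (solve 3 (λ c v a → c :* c :* v :* (a :* a) := (c :* a) :* (c :* a) :* v) refl (nQ ^ n) (Ny)
            a) (sym (∑<-*ˡ n ((nQ ^ n * a) * (nQ ^ n * a)) _)) ⟩
        ∑< n (λ i → (nQ ^ n * a) * (nQ ^ n * a) * (y i * y i)) ≡⟨ ∑<-cong n
            (λ i _ → trans (solve 2 (λ c y → c :* c :* (y :* y) := (c :* y) :* (c :* y)) refl (nQ ^ n * a) (y i))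
            (cong (λ z → z * z) (sym (y′-eq χ dχ i)))) ⟩
        ∑< n (λ i → y′ χ i * y′ χ i) ≤⟨ N-y′ χ ⟩
        nQ ^ n * (nQ ^ n * (ff n * (ff n * Q ^ n * Ny))) ≤⟨ *-mono (^≥0 n nQ≥0)
            (*-mono (^≥0 n nQ≥0) (*-mono (ff≥0 n ℕP.≤-refl) (*-monoʳ (ℚP.<⇒≤ Ny>0)
            (*-mono (ff≥0 n ℕP.≤-refl) (^-mono n (∑≥0 gs λ r → sq≥0 (q r)) QR))))) ⟩
        nQ ^ n * (nQ ^ n * (ff n * (ff n * (R * R) ^ n * Ny))) ≡⟨ trans (cong₂ (λ s t → nQ ^ n * (nQ ^ n * (s * (s * t * Ny)))) ff-n
            (^-* R R n)) (solve 4 (λ c f r v → c :* (c :* (f :* (f :* (r :* r) :* v))) := c :* c :* v :* ((f :* r) :* (f :* r))) refl (nQ ^ n)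
            (fact n) (R ^ n) (Ny)) ⟩
        nQ ^ n * nQ ^ n * Ny * ((fact n * R ^ n) * (fact n * R ^ n)) ∎)
      main : prodV χ q * ∣ F n χ ∣ * M χ ≤ fact n * R ^ n
      main = ℚP.≤-trans (ℚP.≤-reflexive (sym (trans (∣∣-* (prodV χ q * F n χ) (M χ))
          (cong₂ _*_ (∣∣-*-nonNegˡ (F n χ) (prodV≥0 χ)) (ℚP.0≤p⇒∣p∣≡p M≥0)))))
        (∣∣≤-sq (0≤* (fact≥0 n) (^≥0 n R≥0)) a²)

  -- Numerical bounds for factorials and square roots

  bernoulli⁻ : ∀ x k → 0ℚ ≤ x → x ≤ 1ℚ → 1ℚ - ι k * x ≤ (1ℚ - x) ^ k
  bernoulli⁻ x zero p q = ℚP.≤-reflexive (solve 1 (λ x → con 1ℚ :- con 0ℚ :* x := con 1ℚ) refl x)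
  bernoulli⁻ x (suc k) p q = ℚP.≤-trans (≤-by (0≤* (ι≥0 k) (sq≥0 x))
     (solve 2 (λ x k → (con 1ℚ :- x) :* (con 1ℚ :- k :* x) := (con 1ℚ :- (con 1ℚ :+ k) :* x) :+ k :* (x :* x)) refl x (ι k)))
     (*-mono (≤-diff q) (bernoulli⁻ x k p q))

  -- The two monotone sequences converging to e.
  euler : ℕ → ℚ
  euler m = 1ℚ + inv (ι (suc m))

  euler≥1 : ∀ m → 1ℚ ≤ euler m
  euler≥1 m = ≤-by (inv≥0 (ι>0 m)) refl

  euler≥0 : ∀ m → 0ℚ ≤ euler m
  euler≥0 m = ℚP.≤-trans 0≤1 (euler≥1 m)

  eulerLower eulerUpper : ℕ → ℚ
  eulerLower m = euler m ^ suc m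
  eulerUpper m = euler m ^ suc (suc m)

  private
    i₁ : ∀ m → ι (suc m) * inv (ι (suc m)) ≡ 1ℚ
    i₁ m = inv-r (ι>0 m)

    clear : ∀ {x y} m → ι (suc m) * (ι (suc (suc m)) * x) ≡ ι (suc m) * (ι (suc (suc m)) * y) → x ≡ y
    clear m e = cancel-≡ (ι>0 (suc m)) (cancel-≡ (ι>0 m) e)

  -- `euler (suc m)` is `euler m` times 1 - 1/(m + 2)², and Bernoulli bounds the power of this
  -- factor from below.
  eulerLower-suc : ∀ m → eulerLower m ≤ eulerLower (suc m)
  eulerLower-suc m = begin
    euler m ^ suc m ≡⟨ (solve 1 (λ z → z := z :* con 1ℚ) refl (euler m ^ suc m)) ⟩
    euler m ^ suc m * 1ℚ ≡⟨ cong (euler m ^ suc m *_) (sym one) ⟩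
    euler m ^ suc m * (euler m * (1ℚ - ι (2 ℕ.+ m) * (j * j))) ≡⟨ (solve 3 (λ z euler w → z :* (euler :* w) := (euler :* z) :* w) refl
        (euler m ^ suc m) (euler m) (1ℚ - ι (2 ℕ.+ m) * (j * j))) ⟩
    euler m ^ (2 ℕ.+ m) * (1ℚ - ι (2 ℕ.+ m) * (j * j)) ≤⟨ *-mono (^≥0 (2 ℕ.+ m) (euler≥0 m)) (bernoulli⁻ (j * j) (2 ℕ.+ m) (sq≥0 j) j²≤1) ⟩
    euler m ^ (2 ℕ.+ m) * (1ℚ - j * j) ^ (2 ℕ.+ m) ≡⟨ trans (sym (^-* (euler m) (1ℚ - j * j) (2 ℕ.+ m))) (cong (_^ (2 ℕ.+ m)) step) ⟩
    euler (suc m) ^ (2 ℕ.+ m) ∎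
    where
    open ℚP.≤-Reasoning
    i j : ℚ
    i = inv (ι (suc m))
    j = inv (ι (2 ℕ.+ m))
    j≤1 : j ≤ 1ℚ
    j≤1 = cancel-≤ (ι>0 (suc m)) (ℚP.≤-trans (ℚP.≤-reflexive (i₁ (suc m)))
        (ℚP.≤-trans (ι≥1 {2 ℕ.+ m} (s≤s z≤n)) (ℚP.≤-reflexive (sym (ℚP.*-identityʳ (ι (2 ℕ.+ m)))))))
    j²≤1 : j * j ≤ 1ℚ
    j²≤1 = *-mono₂ (inv≥0 (ι>0 (suc m))) 0≤1 j≤1 j≤1
    one : euler m * (1ℚ - ι (2 ℕ.+ m) * (j * j)) ≡ 1ℚ
    one = clear m (trans (solve 3 (λ k i j → (con 1ℚ :+ k) :* ((con 1ℚ :+ (con 1ℚ :+ k)) :*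
        ((con 1ℚ :+ i) :* (con 1ℚ :- (con 1ℚ :+ (con 1ℚ :+ k)) :* (j :* j)))) := ((con 1ℚ :+ k) :+ (con 1ℚ :+ k) :* i) :*
        ((con 1ℚ :+ (con 1ℚ :+ k)) :- ((con 1ℚ :+ (con 1ℚ :+ k)) :* j) :* ((con 1ℚ :+ (con 1ℚ :+ k)) :* j))) refl (ι m) i j)
      (trans (cong₂ (λ a b → (ι (suc m) + a) * (ι (2 ℕ.+ m) - b * b)) (i₁ m) (i₁ (suc m)))
          (solve 1 (λ k → ((con 1ℚ :+ k) :+ con 1ℚ) :* ((con 1ℚ :+ (con 1ℚ :+ k)) :- con 1ℚ :* con 1ℚ) := (con 1ℚ :+ k) :*
          ((con 1ℚ :+ (con 1ℚ :+ k)) :* con 1ℚ)) refl (ι m))))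
    step : euler m * (1ℚ - j * j) ≡ euler (suc m)
    step = clear m (cancel-≡ (ι>0 (suc m)) (trans (solve 3 (λ k i j → (con 1ℚ :+ (con 1ℚ :+ k)) :*
        ((con 1ℚ :+ k) :* ((con 1ℚ :+ (con 1ℚ :+ k)) :* ((con 1ℚ :+ i) :* (con 1ℚ :- j :* j)))) := ((con 1ℚ :+ k) :+ (con 1ℚ :+ k) :* i) :*
        ((con 1ℚ :+ (con 1ℚ :+ k)) :* (con 1ℚ :+ (con 1ℚ :+ k)) :- ((con 1ℚ :+ (con 1ℚ :+ k)) :* j) :* ((con 1ℚ :+ (con 1ℚ :+ k)) :* j))) refl
        (ι m) i j)
      (trans (cong₂ (λ a b → (ι (suc m) + a) * (ι (2 ℕ.+ m) * ι (2 ℕ.+ m) - b * b)) (i₁ m) (i₁ (suc m)))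
        (trans (solve 1 (λ k → ((con 1ℚ :+ k) :+ con 1ℚ) :* ((con 1ℚ :+ (con 1ℚ :+ k)) :* (con 1ℚ :+ (con 1ℚ :+ k)) :- con 1ℚ :* con 1ℚ) :=
            (con 1ℚ :+ (con 1ℚ :+ k)) :* ((con 1ℚ :+ k) :* ((con 1ℚ :+ (con 1ℚ :+ k)) :+ con 1ℚ))) refl (ι m))
          (trans (cong (λ b → ι (2 ℕ.+ m) * (ι (suc m) * (ι (2 ℕ.+ m) + b))) (sym (i₁ (suc m))))
              (solve 2 (λ k j → (con 1ℚ :+ (con 1ℚ :+ k)) :* ((con 1ℚ :+ k) :* ((con 1ℚ :+ (con 1ℚ :+ k)) :+ (con 1ℚ :+ (con 1ℚ :+ k)) :* j))
              := (con 1ℚ :+ (con 1ℚ :+ k)) :* ((con 1ℚ :+ k) :* ((con 1ℚ :+ (con 1ℚ :+ k)) :* (con 1ℚ :+ j)))) refl (ι m) j))))))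

  -- `euler m` is `euler (suc m)` times 1 + w with w = 1/((m + 1)(m + 3)), and Bernoulli shows that
  -- the power of 1 + w outweighs the additional factor `euler (suc m)`.
  eulerUpper-suc : ∀ m → eulerUpper (suc m) ≤ eulerUpper m
  eulerUpper-suc m = begin
    euler (suc m) * euler (suc m) ^ (2 ℕ.+ m) ≤⟨ *-monoʳ (^≥0 (2 ℕ.+ m) (euler≥0 (suc m))) r≤ ⟩
    (1ℚ + ι (2 ℕ.+ m) * w) * euler (suc m) ^ (2 ℕ.+ m) ≤⟨ *-monoʳ (^≥0 (2 ℕ.+ m) (euler≥0 (suc m))) (bernoulli w (2 ℕ.+ m) w≥0) ⟩
    (1ℚ + w) ^ (2 ℕ.+ m) * euler (suc m) ^ (2 ℕ.+ m) ≡⟨ trans (sym (^-* (1ℚ + w) (euler (suc m)) (2 ℕ.+ m))) (cong (_^ (2 ℕ.+ m)) step) ⟩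
    euler m ^ (2 ℕ.+ m) ∎
    where
    open ℚP.≤-Reasoning
    i j l w : ℚ
    i = inv (ι (suc m))
    j = inv (ι (2 ℕ.+ m))
    l = inv (ι (3 ℕ.+ m))
    w = i * l
    w≥0 : 0ℚ ≤ w
    w≥0 = 0≤* (inv≥0 (ι>0 m)) (inv≥0 (ι>0 (2 ℕ.+ m)))
    r≤ : euler (suc m) ≤ 1ℚ + ι (2 ℕ.+ m) * w
    r≤ = ℚP.+-monoʳ-≤ 1ℚ (cancel-≤ (0<* (0<* (ι>0 m) (ι>0 (2 ℕ.+ m))) (ι>0 (suc m))) (≤-by 0≤1 (trans
      (solve 5 (λ a b c i l → (a :* c :* b) :* (b :* (i :* l)) := (a :* i) :* (c :* l) :* (b :* b)) refl (ι (suc m)) (ι (2 ℕ.+ m))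
          (ι (3 ℕ.+ m)) i l) (trans (cong₂ (λ s t → s * t * (ι (2 ℕ.+ m) * ι (2 ℕ.+ m))) (i₁ m) (i₁ (2 ℕ.+ m)))
        (trans (solve 1 (λ k → con 1ℚ :* con 1ℚ :* ((con 1ℚ :+ (con 1ℚ :+ k)) :* (con 1ℚ :+ (con 1ℚ :+ k))) := (con 1ℚ :+ k) :*
            (con 1ℚ :+ (con 1ℚ :+ (con 1ℚ :+ k))) :* con 1ℚ :+ con 1ℚ) refl (ι m))
            (trans (cong (λ t → ι (suc m) * ι (3 ℕ.+ m) * t + 1ℚ) (sym (i₁ (suc m))))
            (solve 4 (λ a b c j → a :* c :* (b :* j) :+ con 1ℚ := (a :* c :* b) :* j :+ con 1ℚ) refl (ι (suc m)) (ι (2 ℕ.+ m)) (ι (3 ℕ.+ m))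
            j)))))))
    step : (1ℚ + w) * euler (suc m) ≡ euler m
    step = clear m (cancel-≡ (ι>0 (2 ℕ.+ m)) (trans (solve 6 (λ a b c i j l → c :* (a :* (b :* ((con 1ℚ :+ i :* l) :* (con 1ℚ :+ j)))) :=
        (a :* c :+ (a :* i) :* (c :* l)) :* (b :+ b :* j)) refl (ι (suc m)) (ι (2 ℕ.+ m)) (ι (3 ℕ.+ m)) i j l)
      (trans (cong₂ (λ s t → (ι (suc m) * ι (3 ℕ.+ m) + s) * (ι (2 ℕ.+ m) + t)) (trans (cong₂ _*_ (i₁ m) (i₁ (2 ℕ.+ m))) refl) (i₁ (suc m)))
        (trans (solve 1 (λ k → ((con 1ℚ :+ k) :* (con 1ℚ :+ (con 1ℚ :+ (con 1ℚ :+ k))) :+ con 1ℚ) :* ((con 1ℚ :+ (con 1ℚ :+ k)) :+ con 1ℚ) :=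
            (con 1ℚ :+ (con 1ℚ :+ (con 1ℚ :+ k))) :* ((con 1ℚ :+ (con 1ℚ :+ k)) :* ((con 1ℚ :+ k) :+ con 1ℚ))) refl (ι m))
          (trans (cong (λ t → ι (3 ℕ.+ m) * (ι (2 ℕ.+ m) * (ι (suc m) + t))) (sym (i₁ m)))
              (solve 4 (λ a b c i → c :* (b :* (a :+ a :* i)) := c :* (a :* (b :* (con 1ℚ :+ i)))) refl (ι (suc m)) (ι (2 ℕ.+ m))
              (ι (3 ℕ.+ m)) i))))))

  chain-up : ∀ (f : ℕ → ℚ) → (∀ m → f m ≤ f (suc m)) → ∀ {a b} → a ℕ.≤ b → f a ≤ f b
  chain-up f h {a} le = go (ℕP.≤⇒≤′ le)
    where
    go : ∀ {b} → a ℕ.≤′ b → f a ≤ f b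
    go ℕ.≤′-refl = ℚP.≤-refl
    go (ℕ.≤′-step {n = b} l) = ℚP.≤-trans (go l) (h b)

  chain-down : ∀ (f : ℕ → ℚ) → (∀ m → f (suc m) ≤ f m) → ∀ {a b} → a ℕ.≤ b → f b ≤ f a
  chain-down f h {a} le = go (ℕP.≤⇒≤′ le)
    where
    go : ∀ {b} → a ℕ.≤′ b → f b ≤ f a
    go ℕ.≤′-refl = ℚP.≤-refl
    go (ℕ.≤′-step {n = b} l) = ℚP.≤-trans (h b) (go l)

  euler-mul : ∀ m → ι (suc m) * euler m ≡ ι (2 ℕ.+ m)
  euler-mul m = trans (solve 2 (λ k i → k :* (con 1ℚ :+ i) := k :+ k :* i) refl (ι (suc m)) (inv (ι (suc m))))
      (trans (cong (ι (suc m) +_) (i₁ m)) (ℚP.+-comm (ι (suc m)) 1ℚ))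

  module Stirling (p : ℕ) where

    -- A rational substitute for e. It lies above every `eulerLower m` and below every
    -- `eulerUpper m` with m ≤ p, so lower and upper bounds for factorials share one base and its
    -- powers cancel exactly.
    b : ℚ
    b = eulerLower p

    b≥1 : 1ℚ ≤ b
    b≥1 = ^≥1 (suc p) (euler≥1 p)

    b≥0 : 0ℚ ≤ b
    b≥0 = ℚP.≤-trans 0≤1 b≥1

    b≤eulerUpper : ∀ m → m ℕ.≤ p → b ≤ eulerUpper m
    b≤eulerUpper m le = ℚP.≤-trans (ℚP.≤-trans (ℚP.≤-reflexive (sym (ℚP.*-identityˡ b))) (*-monoʳ b≥0 (euler≥1 p)))
        (chain-down eulerUpper eulerUpper-suc le)

    b≤4 : b ≤ ℤ.+ 4 / 1
    b≤4 = b≤eulerUpper 0 z≤n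

    fact-lower : ∀ a → a ℕ.≤ suc p → ι a ^ a ≤ fact a * b ^ a
    fact-lower zero le = ℚP.≤-refl
    fact-lower (suc zero) le = ℚP.≤-trans b≥1 (ℚP.≤-reflexive (solve 1 (λ b → b := (con 1ℚ :+ con 0ℚ) :* con 1ℚ :* (b :* con 1ℚ)) refl b))
    fact-lower (suc (suc m)) (s≤s le) = begin
      ι (2 ℕ.+ m) * ι (2 ℕ.+ m) ^ suc m ≡⟨ cong (λ t → ι (2 ℕ.+ m) * t) (trans (cong (_^ suc m) (sym (euler-mul m)))
          (^-* (ι (suc m)) (euler m) (suc m))) ⟩
      ι (2 ℕ.+ m) * (ι (suc m) ^ suc m * eulerLower m) ≤⟨ *-mono (ι≥0 (2 ℕ.+ m))
          (*-mono₂ (^≥0 (suc m) (ι≥0 (suc m))) b≥0 (fact-lower (suc m) (ℕP.m≤n⇒m≤1+n le))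
          (chain-up eulerLower eulerLower-suc (ℕP.≤-trans (ℕP.n≤1+n m) le))) ⟩
      ι (2 ℕ.+ m) * (fact (suc m) * b ^ suc m * b) ≡⟨ (solve 4 (λ k f x b → k :* (f :* x :* b) := k :* f :* (b :* x)) refl (ι (2 ℕ.+ m))
          (fact (suc m)) (b ^ suc m) b) ⟩
      fact (2 ℕ.+ m) * b ^ (2 ℕ.+ m) ∎
      where open ℚP.≤-Reasoning

    fact-upper : ∀ m → m ℕ.≤ p → fact (suc m) * b ^ suc m ≤ b * ι (suc m) ^ (2 ℕ.+ m)
    fact-upper zero le = ℚP.≤-reflexive (solve 1 (λ b → (con 1ℚ :+ con 0ℚ) :* con 1ℚ :* (b :* con 1ℚ) := b :*
        ((con 1ℚ :+ con 0ℚ) :* ((con 1ℚ :+ con 0ℚ) :* con 1ℚ))) refl b)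
    fact-upper (suc m) le = begin
      ι (2 ℕ.+ m) * fact (suc m) * (b * b ^ suc m) ≡⟨ (solve 4 (λ k f x b → k :* f :* (b :* x) := k :* b :* (f :* x)) refl (ι (2 ℕ.+ m))
          (fact (suc m)) (b ^ suc m) b) ⟩
      ι (2 ℕ.+ m) * b * (fact (suc m) * b ^ suc m) ≤⟨ *-mono (0≤* (ι≥0 (2 ℕ.+ m)) b≥0) (fact-upper m (ℕP.<⇒≤ le)) ⟩
      ι (2 ℕ.+ m) * b * (b * ι (suc m) ^ (2 ℕ.+ m)) ≡⟨ (solve 3 (λ k x b → k :* b :* (b :* x) := b :* (k :* (x :* b))) refl (ι (2 ℕ.+ m))
          (ι (suc m) ^ (2 ℕ.+ m)) b) ⟩
      b * (ι (2 ℕ.+ m) * (ι (suc m) ^ (2 ℕ.+ m) * b)) ≤⟨ *-mono b≥0 (*-mono (ι≥0 (2 ℕ.+ m))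
          (*-mono (^≥0 (2 ℕ.+ m) (ι≥0 (suc m))) (b≤eulerUpper m (ℕP.<⇒≤ le)))) ⟩
      b * (ι (2 ℕ.+ m) * (ι (suc m) ^ (2 ℕ.+ m) * euler m ^ (2 ℕ.+ m))) ≡⟨ cong (λ t → b * (ι (2 ℕ.+ m) * t))
          (trans (sym (^-* (ι (suc m)) (euler m) (2 ℕ.+ m))) (cong (_^ (2 ℕ.+ m)) (euler-mul m))) ⟩
      b * ι (2 ℕ.+ m) ^ (3 ℕ.+ m) ∎
      where open ℚP.≤-Reasoning

  -- Square root rounded up, so that `sq-lower` holds without loss and only `sq-upper` carries the
  -- rounding error.
  isq : ℕ → ℕ
  isq zero = 0
  isq (suc N) with isq N ℕ.* isq N ℕP.≤? N
  ... | yes _ = suc (isq N)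
  ... | no _ = isq N

  isq-≥ : ∀ N → N ℕ.≤ isq N ℕ.* isq N
  isq-≥ zero = z≤n
  isq-≥ (suc N) with isq N ℕ.* isq N ℕP.≤? N
  ... | no h = ℕP.≰⇒> h
  ... | yes _ = s≤s (ℕP.≤-trans (isq-≥ N) (ℕP.≤-trans (ℕP.*-monoʳ-≤ (isq N) (ℕP.n≤1+n (isq N))) (ℕP.m≤n+m _ (isq N))))

  isq-least : ∀ N k → N ℕ.≤ k ℕ.* k → isq N ℕ.≤ k
  isq-least zero k h = z≤n
  isq-least (suc N) k h with isq N ℕ.* isq N ℕP.≤? N
  ... | no _ = isq-least N k (ℕP.<⇒≤ h)
  ... | yes q = ℕP.≰⇒> λ k≤ → ℕP.<-irrefl refl (ℕP.≤-trans h (ℕP.≤-trans (ℕP.*-mono-≤ k≤ k≤) q))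

  isq-≤ : ∀ N → isq N ℕ.* isq N ℕ.≤ N ℕ.+ 2 ℕ.* isq N
  isq-≤ N with isq N in eq
  ... | zero = z≤n
  ... | suc k with N ℕP.≤? k ℕ.* k
  ...   | yes h = ⊥-elim (ℕP.<-irrefl refl (subst (ℕ._≤ k) eq (isq-least N k h)))
  ...   | no h = ℕP.≤-trans (ℕP.≤-reflexive (solveℕ 1 (λ k → (conℕ 1 ∔ k) ⨯ (conℕ 1 ∔ k) ≐ (conℕ 1 ∔ k ⨯ k) ∔ conℕ 2 ⨯ k) refl k))
      (ℕP.+-mono-≤ (ℕP.≰⇒> h) (ℕP.*-monoʳ-≤ 2 (ℕP.n≤1+n k)))

  -- Rational approximations to square roots from above, of relative precision 1/20000.
  module Roots (d : ℕ) (d-large : (ℤ.+ 30000 / 1) ≤ ι d) where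

    d>0 : 0ℚ < ι d
    d>0 = ℚP.<-≤-trans (ℚP.positive⁻¹ (ℤ.+ 30000 / 1)) d-large

    κ : ℚ
    κ = ℤ.+ 10001 / 10000

    w : ℕ → ℕ
    w a = isq (a ℕ.* (d ℕ.* d))

    sq : ℕ → ℚ
    sq a = ι (w a) * inv (ι d)

    sq≥0′ : ∀ a → 0ℚ ≤ sq a
    sq≥0′ a = 0≤* (ι≥0 (w a)) (inv≥0 d>0)

    private
      d² : ∀ x → (ι d * ι d) * (x * inv (ι d) * (x * inv (ι d))) ≡ x * x
      d² x = trans (solve 3 (λ d i x → (d :* d) :* (x :* i :* (x :* i)) := (d :* i) :* (d :* i) :* (x :* x)) refl (ι d) (inv (ι d)) x)
          (trans (cong (λ t → t * t * (x * x)) (inv-r d>0)) (solve 1 (λ x → con 1ℚ :* con 1ℚ :* (x :* x) := x :* x) refl x))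

    sq-lower : ∀ a → ι a ≤ sq a * sq a
    sq-lower a = cancel-≤ (0<* d>0 d>0) (ℚP.≤-trans (ℚP.≤-reflexive (trans (ℚP.*-comm (ι d * ι d) (ι a))
        (sym (trans (ι-* a (d ℕ.* d)) (cong (ι a *_) (ι-* d d))))))
      (ℚP.≤-trans (ι-mono (isq-≥ (a ℕ.* (d ℕ.* d)))) (ℚP.≤-reflexive (trans (ι-* (w a) (w a)) (sym (d² (ι (w a))))))))

    sq-upper : ∀ a → sq a * sq a ≤ ι a * κ
    sq-upper a = cancel-≤ (0<* d>0 d>0) (begin
      (ι d * ι d) * (sq a * sq a) ≡⟨ trans (d² (ι (w a))) (sym (ι-* (w a) (w a))) ⟩
      ι (w a ℕ.* w a) ≤⟨ ι-mono (isq-≤ (a ℕ.* (d ℕ.* d))) ⟩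
      ι (a ℕ.* (d ℕ.* d) ℕ.+ 2 ℕ.* w a) ≤⟨ ι-mono (ℕP.+-monoʳ-≤ (a ℕ.* (d ℕ.* d)) (ℕP.*-monoʳ-≤ 2 w≤)) ⟩
      ι (a ℕ.* (d ℕ.* d) ℕ.+ 2 ℕ.* (a ℕ.* d)) ≡⟨ trans (ι-+ (a ℕ.* (d ℕ.* d)) _)
          (cong₂ _+_ (trans (ι-* a (d ℕ.* d)) (cong (ι a *_) (ι-* d d))) (trans (ι-* 2 (a ℕ.* d)) (cong (ι 2 *_) (ι-* a d)))) ⟩
      -- Rounding costs a relative error of at most 2/d ≤ 1/15000, within the allowance κ.
      ι a * (ι d * ι d) + ι 2 * (ι a * ι d) ≤⟨ ≤-by (0≤* (0≤* (ι≥0 a) (ℚP.<⇒≤ d>0))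
          (0≤+ (0≤* (nonneg {ℤ.+ 1 / 15000}) (≤-diff d-large)) (0≤* (nonneg {ℤ.+ 1 / 30000}) (ι≥0 d))))
          (solve 2 (λ a d → (d :* d) :* (a :* con (ℤ.+ 10001 / 10000)) := (a :* (d :* d) :+ con (ℤ.+ 2 / 1) :* (a :* d)) :+ a :* d :*
              (con (ℤ.+ 1 / 15000) :* (d :- con (ℤ.+ 30000 / 1)) :+ con (ℤ.+ 1 / 30000) :* d)) refl (ι a) (ι d)) ⟩
      (ι d * ι d) * (ι a * κ) ∎)
      where
      open ℚP.≤-Reasoning
      w≤ : w a ℕ.≤ a ℕ.* d
      w≤ = isq-least (a ℕ.* (d ℕ.* d)) (a ℕ.* d) (ℕP.≤-trans (le a) (ℕP.≤-reflexive
          (solveℕ 2 (λ a d → a ⨯ (a ⨯ (d ⨯ d)) ≐ a ⨯ d ⨯ (a ⨯ d)) refl a d)))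
        where
        le : ∀ a → a ℕ.* (d ℕ.* d) ℕ.≤ a ℕ.* (a ℕ.* (d ℕ.* d))
        le zero = z≤n
        le (suc a) = ℕP.m≤m+n _ _

    sq-2 : ∀ m → sq (suc m) ≤ (ℤ.+ 2 / 1) * ι (suc m)
    sq-2 m = sq-≤ (0≤* (nonneg {ℤ.+ 2 / 1}) (ι≥0 (suc m))) (ℚP.≤-trans (sq-upper (suc m))
        (≤-by (0≤* (ι≥0 (suc m)) (0≤+ (nonneg {ℤ.+ 29999 / 10000}) (0≤* (nonneg {ℤ.+ 4 / 1}) (ι≥0 m))))
       (solve 1 (λ k → con (ℤ.+ 2 / 1) :* (con 1ℚ :+ k) :* (con (ℤ.+ 2 / 1) :* (con 1ℚ :+ k)) := (con 1ℚ :+ k) :* con (ℤ.+ 10001 / 10000) :+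
           (con 1ℚ :+ k) :* (con (ℤ.+ 29999 / 10000) :+ con (ℤ.+ 4 / 1) :* k)) refl (ι m))))

    sq>0 : ∀ m → 0ℚ < sq (suc m)
    sq>0 m = ≤≢⇒< (sq≥0′ (suc m)) λ e → ℚP.<-irrefl refl (ℚP.<-≤-trans (ι>0 m)
        (ℚP.≤-trans (sq-lower (suc m)) (ℚP.≤-reflexive (trans (cong (λ t → t * t) (sym e)) refl))))

  -- The remaining characters

  geometricρ : ∀ M → ∑< M (λ i → (ℤ.+ 1999 / 2000) ^ i) ≤ ℤ.+ 2000 / 1
  geometricρ M = ≤-by (0≤* (nonneg {ℤ.+ 2000 / 1}) (^≥0 M (nonneg {ℤ.+ 1999 / 2000}))) (sym (eq M))
    where
    eq : ∀ M → ∑< M (λ i → (ℤ.+ 1999 / 2000) ^ i) + (ℤ.+ 2000 / 1) * (ℤ.+ 1999 / 2000) ^ M ≡ ℤ.+ 2000 / 1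
    eq zero = refl
    eq (suc M) = trans (solve 2 (λ s x → (s :+ x) :+ con (ℤ.+ 2000 / 1) :* (con (ℤ.+ 1999 / 2000) :* x) := s :+ con (ℤ.+ 2000 / 1) :* x) refl
        (∑< M (λ i → (ℤ.+ 1999 / 2000) ^ i)) ((ℤ.+ 1999 / 2000) ^ M)) (eq M)

  -- Each factor m + 1 is at most 2000 (2001/2000)^m by Bernoulli; 2000³ is the constant, and
  -- (2001/2000)³ · 499/500 is still at most 1999/2000.
  cubic-geometric : ∀ m → ι (suc m) * ι (suc m) * ι (suc m) * (ℤ.+ 499 / 500) ^ m ≤ (ℤ.+ 8000000000 / 1) * (ℤ.+ 1999 / 2000) ^ m
  cubic-geometric m = begin
    A * A * A * θ ^ m ≤⟨ *-monoʳ (^≥0 m (nonneg {θ})) (*-mono₂ (0≤* A≥0 A≥0) B≥0 (*-mono₂ A≥0 B≥0 A≤ A≤) A≤) ⟩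
    (ℤ.+ 2000 / 1) * u * ((ℤ.+ 2000 / 1) * u) * ((ℤ.+ 2000 / 1) * u) * θ ^ m ≡⟨
        (solve 2 (λ u v → con (ℤ.+ 2000 / 1) :* u :* (con (ℤ.+ 2000 / 1) :* u) :* (con (ℤ.+ 2000 / 1) :* u) :* v := con (ℤ.+ 8000000000 / 1)
        :* (u :* u :* u :* v)) refl u (θ ^ m)) ⟩
    (ℤ.+ 8000000000 / 1) * (u * u * u * θ ^ m) ≡⟨ cong ((ℤ.+ 8000000000 / 1) *_)
        (trans (cong (_* θ ^ m) (trans (cong (_* u) (sym (^-* μ μ m))) (sym (^-* (μ * μ) μ m)))) (sym (^-* (μ * μ * μ) θ m))) ⟩
    (ℤ.+ 8000000000 / 1) * (μ * μ * μ * θ) ^ m ≤⟨ *-mono {c = ℤ.+ 8000000000 / 1} nonneg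
        (^-mono m (nonneg {μ * μ * μ * θ}) (diff-≤ {μ * μ * μ * θ} {ℤ.+ 1999 / 2000} nonneg)) ⟩
    (ℤ.+ 8000000000 / 1) * (ℤ.+ 1999 / 2000) ^ m ∎
    where
    open ℚP.≤-Reasoning
    A θ μ u : ℚ
    A = ι (suc m)
    θ = ℤ.+ 499 / 500
    μ = ℤ.+ 2001 / 2000
    u = μ ^ m
    A≥0 = ι≥0 (suc m)
    B≥0 : 0ℚ ≤ (ℤ.+ 2000 / 1) * u
    B≥0 = 0≤* (nonneg {ℤ.+ 2000 / 1}) (^≥0 m (nonneg {μ}))
    A≤ : A ≤ (ℤ.+ 2000 / 1) * u
    A≤ = ℚP.≤-trans (≤-by (nonneg {ℤ.+ 1999 / 1}) (solve 1 (λ k → con (ℤ.+ 2000 / 1) :* (con 1ℚ :+ k :* con (ℤ.+ 1 / 2000)) := (con 1ℚ :+ k)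
        :+ con (ℤ.+ 1999 / 1)) refl (ι m))) (*-mono {c = ℤ.+ 2000 / 1} nonneg (bernoulli (ℤ.+ 1 / 2000) m nonneg))

  onlyIf : ∀ {A : Set} → Dec A → ℚ → ℚ
  onlyIf (yes _) u = u
  onlyIf (no _) u = 0ℚ

  onlyIf≥0 : ∀ {A : Set} (A? : Dec A) {u} → 0ℚ ≤ u → 0ℚ ≤ onlyIf A? u
  onlyIf≥0 (yes _) u≥0 = u≥0
  onlyIf≥0 (no _) u≥0 = ℚP.≤-refl

  onlyIf-yes : ∀ {A : Set} (A? : Dec A) {u} → A → onlyIf A? u ≡ u
  onlyIf-yes (yes _) a = refl
  onlyIf-yes (no ¬a) a = ⊥-elim (¬a a)

  onlyIf-term : ∀ {A : Set} (A? : Dec A) {u y j B} → (A → u * y * j ≤ B) → 0ℚ ≤ B → onlyIf A? u * y * j ≤ B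
  onlyIf-term (yes a) bound B≥0 = bound a
  onlyIf-term (no _) {y = y} {j} bound B≥0 = ℚP.≤-trans (ℚP.≤-reflexive (solve 2 (λ y j → con 0ℚ :* y :* j := con 0ℚ) refl y j)) B≥0

  -- The bound that sq n must exceed for the sum E below to be at most 1 + 1/1000.
  C₀ : ℚ
  C₀ = ℤ.+ 768000000000000000 / 1

  module DenseSum (p d : ℕ) (d-large : (ℤ.+ 30000 / 1) ≤ ι d) (n-large : C₀ ≤ Roots.sq d d-large (suc p)) where
    open Group p using (n; G; gs; F)
    open Roots d d-large
    open Stirling p
    open Sparse p using (nQ≥0)
    open Identity p using (F³)

    -- x is η e²/√n with b for e and σ for √n, and η is the source of the exponential gain. It has
    -- to satisfy 0.99 η² κ ≤ θ², so that the series decays up to the cut 99n/100, and κ⁵ E ≤ η ρ,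
    -- so that ρ^n is left after all losses.
    η θ ρ σ x R E : ℚ
    η = ℤ.+ 401 / 400
    θ = ℤ.+ 499 / 500
    ρ = ℤ.+ 1999 / 2000
    σ = sq n
    x = η * (b * b) * inv σ
    R = σ * κ
    E = ℤ.+ 1001 / 1000

    σ>0 : 0ℚ < σ
    σ>0 = sq>0 p

    σ≥0 : 0ℚ ≤ σ
    σ≥0 = ℚP.<⇒≤ σ>0

    x>0 : 0ℚ < x
    x>0 = 0<* (0<* (ℚP.positive⁻¹ η) (0<* b>0 b>0)) (inv>0 σ>0)
      where
      b>0 = ℚP.<-≤-trans 0<1 b≥1

    n≤σ² : ι n ≤ σ * σ
    n≤σ² = sq-lower n

    active : ℕ → Set
    active a = 100 ℕ.* a ℕ.≤ 99 ℕ.* n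

    -- `h a` is the factor of the bound for |F| due to a value occurring a times, with weight about
    -- √a. `g` cuts off its cube beyond 99n/100, where η would let the terms grow.
    h g : ℕ → ℚ
    h a = fact a * inv (sq a ^ a)
    g a = onlyIf (100 ℕ.* a ℕP.≤? 99 ℕ.* n) (h a * h a * h a)

    sq^>0 : ∀ a → 0ℚ < sq a ^ a
    sq^>0 zero = 0<1
    sq^>0 (suc a) = ^>0 (suc a) (sq>0 a)

    h≥0 : ∀ a → 0ℚ ≤ h a
    h≥0 a = 0≤* (fact≥0 a) (inv≥0 (sq^>0 a))

    g≥0 : ∀ a → 0ℚ ≤ g a
    g≥0 a = onlyIf≥0 (100 ℕ.* a ℕP.≤? 99 ℕ.* n) (0≤* (0≤* (h≥0 a) (h≥0 a)) (h≥0 a))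

    g-active : ∀ a → active a → g a ≡ h a * h a * h a
    g-active a = onlyIf-yes (100 ℕ.* a ℕP.≤? 99 ℕ.* n)

    term : ℕ → ℚ
    term a = g a * x ^ a * inv (fact a)

    active→≤ : ∀ m → active (suc m) → m ℕ.≤ p
    active→≤ m q = ℕP.≤-pred (ℕP.*-cancelˡ-≤ 100 (ℕP.≤-trans q (ℕP.*-monoˡ-≤ n (ℕP.n≤1+n 99))))

    -- `fact-upper` turns (a! b^a)² into (b a^(a+1))². The powers a^(2a) cancel against sq a^(3a) up
    -- to one power of sq a, leaving b² a² z^a with z = η sq a/σ ≤ θ. One factor z is spent on 1/σ,
    -- the others give θ^m.
    term-active : ∀ m → active (suc m) → h (suc m) * h (suc m) * h (suc m) * x ^ suc m * inv (fact (suc m)) ≤ (ℤ.+ 384000000000 / 1) * inv σ *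
        ρ ^ m
    term-active m q = begin
      h a * h a * h a * x ^ a * inv Fa ≡⟨ (solve 4 (λ f i y j → f :* i :* (f :* i) :* (f :* i) :* y :* j := (f :* j) :* (f :* f :* y) :*
          (i :* i :* i)) refl (Fa) (Si) (x ^ a) (inv Fa)) ⟩
      (Fa * inv Fa) * (Fa * Fa * x ^ a) * (Si * Si * Si) ≡⟨ cong₂ (λ u v → u * (Fa * Fa * v) * (Si * Si * Si)) (inv-r (fact>0 a)) xa ⟩
      1ℚ * (Fa * Fa * (η ^ a * (b ^ a * b ^ a) * inv σ ^ a)) * (Si * Si * Si)
        ≡⟨ (solve 5 (λ f e c s i → con 1ℚ :* (f :* f :* (e :* (c :* c) :* s)) :* (i :* i :* i) := ((f :* c) :* (f :* c)) :*
            (e :* s :* (i :* i :* i))) refl (Fa) (η ^ a) (b ^ a) (inv σ ^ a) (Si)) ⟩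
      ((Fa * b ^ a) * (Fa * b ^ a)) * (η ^ a * inv σ ^ a * (Si * Si * Si))
        ≤⟨ *-monoʳ (0≤* es≥0 (0≤* (0≤* Si≥0 Si≥0) Si≥0)) (*-mono₂ Fb≥0 bA≥0 (fact-upper m (active→≤ m q)) (fact-upper m (active→≤ m q))) ⟩
      ((b * (A * A ^ a)) * (b * (A * A ^ a))) * (η ^ a * inv σ ^ a * (Si * Si * Si))
        ≡⟨ (solve 5 (λ b A y w i → ((b :* (A :* y)) :* (b :* (A :* y))) :* (w :* (i :* i :* i)) :=
            (b :* b :* (A :* A) :* (w :* (i :* i :* i))) :* (y :* y)) refl b A (A ^ a) (η ^ a * inv σ ^ a) (Si)) ⟩
      (b * b * (A * A) * (η ^ a * inv σ ^ a * (Si * Si * Si))) * (A ^ a * A ^ a)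
        ≤⟨ *-mono (0≤* (0≤* (0≤* b≥0 b≥0) (sq≥0 A)) (0≤* es≥0 (0≤* (0≤* Si≥0 Si≥0) Si≥0))) (*-mono₂ (^≥0 a A≥0) (0≤* S≥0 S≥0) A≤S² A≤S²) ⟩
      (b * b * (A * A) * (η ^ a * inv σ ^ a * (Si * Si * Si))) * ((S * S) * (S * S))
        ≡⟨ (solve 5 (λ b A w i S → (b :* b :* (A :* A) :* (w :* (i :* i :* i))) :* ((S :* S) :* (S :* S)) := b :* b :* (A :* A) :* (w :* S) :*
            ((S :* i) :* (S :* i) :* (S :* i))) refl b A (η ^ a * inv σ ^ a) (Si) S) ⟩
      b * b * (A * A) * (η ^ a * inv σ ^ a * S) * ((S * Si) * (S * Si) * (S * Si)) ≡⟨ cong₂ (λ u v → b * b * (A * A) * u * (v * v * v)) za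
          (inv-r (sq^>0 a)) ⟩
      b * b * (A * A) * z ^ a * (1ℚ * 1ℚ * 1ℚ) ≡⟨ (solve 4 (λ b A u z → b :* b :* (A :* A) :* (z :* u) :* (con 1ℚ :* con 1ℚ :* con 1ℚ) :=
          (b :* b) :* (A :* A :* (z :* u))) refl b A (z ^ m) z) ⟩
      (b * b) * (A * A * (z * z ^ m)) ≤⟨ *-mono₂ (0≤* b≥0 b≥0) (0≤* (0≤* A≥0 A≥0) (0≤* 3Ai≥0 (^≥0 m (nonneg {θ}))))
          (*-mono₂ b≥0 (nonneg {ℤ.+ 4 / 1}) b≤4 b≤4)
           (*-mono (0≤* A≥0 A≥0) (*-mono₂ z≥0 (^≥0 m (nonneg {θ})) z≤3A (^-mono m z≥0 z≤θ))) ⟩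
      ((ℤ.+ 4 / 1) * (ℤ.+ 4 / 1)) * (A * A * ((ℤ.+ 3 / 1) * A * inv σ * θ ^ m)) ≡⟨
          (solve 3 (λ A i t → (con (ℤ.+ 4 / 1) :* con (ℤ.+ 4 / 1)) :* (A :* A :* (con (ℤ.+ 3 / 1) :* A :* i :* t)) := con (ℤ.+ 48 / 1) :* i :*
          (A :* A :* A :* t)) refl A (inv σ) (θ ^ m)) ⟩
      (ℤ.+ 48 / 1) * inv σ * (A * A * A * θ ^ m) ≤⟨ *-mono (0≤* (nonneg {ℤ.+ 48 / 1}) iσ≥0) (cubic-geometric m) ⟩
      (ℤ.+ 48 / 1) * inv σ * ((ℤ.+ 8000000000 / 1) * ρ ^ m) ≡⟨ (solve 2 (λ i t → con (ℤ.+ 48 / 1) :* i :* (con (ℤ.+ 8000000000 / 1) :* t) :=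
          con (ℤ.+ 384000000000 / 1) :* i :* t) refl (inv σ) (ρ ^ m)) ⟩
      (ℤ.+ 384000000000 / 1) * inv σ * ρ ^ m ∎
      where
      open ℚP.≤-Reasoning
      a : ℕ
      a = suc m
      A Fa S Si z : ℚ
      A = ι a
      Fa = fact a
      S = sq a ^ a
      Si = inv S
      z = η * sq a * inv σ
      A≥0 = ι≥0 a
      S≥0 = ℚP.<⇒≤ (sq^>0 a)
      Si≥0 = inv≥0 (sq^>0 a)
      iσ≥0 : 0ℚ ≤ inv σ
      iσ≥0 = inv≥0 σ>0
      es≥0 : 0ℚ ≤ η ^ a * inv σ ^ a
      es≥0 = 0≤* (^≥0 a (nonneg {η})) (^≥0 a iσ≥0)
      Fb≥0 : 0ℚ ≤ Fa * b ^ a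
      Fb≥0 = 0≤* (fact≥0 a) (^≥0 a b≥0)
      bA≥0 : 0ℚ ≤ b * (A * A ^ a)
      bA≥0 = 0≤* b≥0 (0≤* A≥0 (^≥0 a A≥0))
      z≥0 : 0ℚ ≤ z
      z≥0 = 0≤* (0≤* (nonneg {η}) (sq≥0′ a)) iσ≥0
      3Ai≥0 : 0ℚ ≤ (ℤ.+ 3 / 1) * A * inv σ
      3Ai≥0 = 0≤* (0≤* (nonneg {ℤ.+ 3 / 1}) A≥0) iσ≥0
      xa : x ^ a ≡ η ^ a * (b ^ a * b ^ a) * inv σ ^ a
      xa = trans (^-* (η * (b * b)) (inv σ) a) (cong (_* inv σ ^ a) (trans (^-* η (b * b) a) (cong (η ^ a *_) (^-* b b a))))
      za : η ^ a * inv σ ^ a * S ≡ z ^ a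
      za = trans (solve 3 (λ e s S → e :* s :* S := e :* S :* s) refl (η ^ a) (inv σ ^ a) S)
          (sym (trans (^-* (η * sq a) (inv σ) a) (cong (_* inv σ ^ a) (^-* η (sq a) a))))
      A≤S² : A ^ a ≤ S * S
      A≤S² = ℚP.≤-trans (^-mono a A≥0 (sq-lower a)) (ℚP.≤-reflexive (^-* (sq a) (sq a) a))
      z≤3A : z ≤ (ℤ.+ 3 / 1) * A * inv σ
      z≤3A = *-monoʳ iσ≥0 (ℚP.≤-trans (*-mono {c = η} nonneg (sq-2 m)) (≤-by (0≤* (nonneg {ℤ.+ 199 / 200}) A≥0)
          (solve 1 (λ A → con (ℤ.+ 3 / 1) :* A := con (ℤ.+ 401 / 400) :* (con (ℤ.+ 2 / 1) :* A) :+ con (ℤ.+ 199 / 200) :* A) refl A)))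
      A≤99 : A ≤ (ℤ.+ 99 / 100) * (σ * σ)
      A≤99 = cancel-≤ {c = ℤ.+ 100 / 1} (ℚP.positive⁻¹ (ℤ.+ 100 / 1)) (ℚP.≤-trans (ℚP.≤-reflexive (sym (ι-* 100 a)))
          (ℚP.≤-trans (ι-mono q) (ℚP.≤-trans (ℚP.≤-reflexive (ι-* 99 n))
        (ℚP.≤-trans (*-mono {c = ι 99} (ι≥0 99) n≤σ²) (ℚP.≤-reflexive (solve 1
            (λ s → con (ℤ.+ 99 / 1) :* s := con (ℤ.+ 100 / 1) :* (con (ℤ.+ 99 / 100) :* s)) refl (σ * σ)))))))
      z≤θ : z ≤ θ
      z≤θ = sq-≤ (nonneg {θ}) (begin
        η * sq a * inv σ * (η * sq a * inv σ) ≡⟨ (solve 2 (λ s i → con (ℤ.+ 401 / 400) :* s :* i :* (con (ℤ.+ 401 / 400) :* s :* i) := con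
            (ℤ.+ 401 / 400) :* con (ℤ.+ 401 / 400) :* (i :* i) :* (s :* s)) refl (sq a) (inv σ)) ⟩
        η * η * (inv σ * inv σ) * (sq a * sq a) ≤⟨ *-mono (0≤* (nonneg {η * η}) (sq≥0 (inv σ)))
            (ℚP.≤-trans (sq-upper a) (*-monoʳ (nonneg {κ}) A≤99)) ⟩
        η * η * (inv σ * inv σ) * ((ℤ.+ 99 / 100) * (σ * σ) * κ) ≡⟨ (solve 2
            (λ i s → con (ℤ.+ 401 / 400) :* con (ℤ.+ 401 / 400) :* (i :* i) :* (con (ℤ.+ 99 / 100) :* (s :* s) :* con (ℤ.+ 10001 / 10000)) :=
            (con (ℤ.+ 401 / 400) :* con (ℤ.+ 401 / 400) :* con (ℤ.+ 99 / 100) :* con (ℤ.+ 10001 / 10000)) :* ((s :* i) :* (s :* i))) refl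
            (inv σ) (σ)) ⟩
        (η * η * (ℤ.+ 99 / 100) * κ) * ((σ * inv σ) * (σ * inv σ)) ≡⟨ cong (λ t → (η * η * (ℤ.+ 99 / 100) * κ) * (t * t)) (inv-r σ>0) ⟩
        (η * η * (ℤ.+ 99 / 100) * κ) * (1ℚ * 1ℚ) ≤⟨ diff-≤ {(η * η * (ℤ.+ 99 / 100) * κ) * (1ℚ * 1ℚ)} {θ * θ} nonneg ⟩
        θ * θ ∎)

    term-bound : ∀ m → term (suc m) ≤ (ℤ.+ 384000000000 / 1) * inv σ * ρ ^ m
    term-bound m = onlyIf-term (100 ℕ.* suc m ℕP.≤? 99 ℕ.* n) (term-active m)
      (0≤* (0≤* (nonneg {ℤ.+ 384000000000 / 1}) (inv≥0 σ>0)) (^≥0 m (nonneg {ρ})))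

    E-bound : ∀ M → ∑< (suc M) term ≤ E
    E-bound M = begin
      ∑< (suc M) term ≡⟨ ∑<-left M term ⟩
      term 0 + ∑< M (term ∘ suc) ≤⟨ ℚP.+-mono-≤ (ℚP.≤-reflexive (trans (cong (λ t → t * 1ℚ * inv 1ℚ) (g-active 0 z≤n)) refl))
          (∑<-mono M λ i _ → term-bound i) ⟩
      1ℚ + ∑< M (λ i → (ℤ.+ 384000000000 / 1) * inv σ * ρ ^ i) ≡⟨ cong (1ℚ +_) (∑<-*ˡ M ((ℤ.+ 384000000000 / 1) * inv σ) _) ⟩
      1ℚ + (ℤ.+ 384000000000 / 1) * inv σ * ∑< M (λ i → ρ ^ i) ≤⟨ ℚP.+-monoʳ-≤ 1ℚ
          (*-mono (0≤* (nonneg {ℤ.+ 384000000000 / 1}) (inv≥0 σ>0)) (geometricρ M)) ⟩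
      -- 384000000000 · 2000 is C₀/1000, which is the origin of C₀; the first factor is 4² · 3 ·
      -- 2000³.
      1ℚ + (ℤ.+ 384000000000 / 1) * inv σ * (ℤ.+ 2000 / 1) ≡⟨ (solve 1 (λ i → con 1ℚ :+ con (ℤ.+ 384000000000 / 1) :* i :* con (ℤ.+ 2000 / 1)
          := con 1ℚ :+ con (ℤ.+ 1 / 1000) :* (con (ℤ.+ 768000000000000000 / 1) :* i)) refl (inv σ)) ⟩
      1ℚ + (ℤ.+ 1 / 1000) * (C₀ * inv σ) ≤⟨ ℚP.+-monoʳ-≤ 1ℚ (*-mono {c = ℤ.+ 1 / 1000} nonneg
          (ℚP.≤-trans (*-monoʳ (inv≥0 σ>0) n-large) (ℚP.≤-reflexive (inv-r σ>0)))) ⟩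
      1ℚ + (ℤ.+ 1 / 1000) * 1ℚ ≡⟨ refl ⟩
      E ∎
      where open ℚP.≤-Reasoning

    Active : Vec G n → Set
    Active χ = ∀ r → active (count r χ)

    prodF-cube : ∀ (f : G → ℚ) → prodF n f * prodF n f * prodF n f ≡ prodF n (λ r → f r * f r * f r)
    prodF-cube f = sym (trans (prodF-* n (λ r → f r * f r) f) (cong (_* prodF n f) (prodF-* n f f)))

    -- The weights are adapted to χ itself, q_r = `sq (count r χ)`. Then Q is at most κ n, which is
    -- at most R².
    F-active : ∀ χ → Active χ → ∣ F n χ ∣ ≤ R ^ n * prodF n (λ r → h (count r χ))
    F-active χ ac = cancel-≤ {c = prodV χ q} V>0 (ℚP.≤-trans (DenseBound.F-dense p q χ R dense₁ (λ r → sq≥0′ (count r χ))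
        (0≤* σ≥0 (nonneg {κ})) QR) (ℚP.≤-reflexive (begin
      R ^ n * prodF n (λ r → fact (count r χ)) ≡⟨ cong (R ^ n *_) (prodF-cong n λ r → trans
          (trans (sym (ℚP.*-identityʳ (fact (count r χ)))) (cong (fact (count r χ) *_) (sym (inv-r (sq^>0 (count r χ))))))
           (solve 3 (λ f s i → f :* (s :* i) := s :* (f :* i)) refl (fact (count r χ)) (sq (count r χ) ^ count r χ)
               (inv (sq (count r χ) ^ count r χ)))) ⟩
      R ^ n * prodF n (λ r → sq (count r χ) ^ count r χ * h (count r χ)) ≡⟨ cong (R ^ n *_)
          (trans (prodF-* n (λ r → sq (count r χ) ^ count r χ) (λ r → h (count r χ)))
          (cong (_* prodF n (λ r → h (count r χ))) (sym (prodV-count χ q)))) ⟩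
      R ^ n * (prodV χ q * prodF n (λ r → h (count r χ))) ≡⟨ (solve 3 (λ a v P → a :* (v :* P) := v :* (a :* P)) refl (R ^ n) (prodV χ q)
          (prodF n (λ r → h (count r χ)))) ⟩
      prodV χ q * (R ^ n * prodF n (λ r → h (count r χ))) ∎)))
      where
      open ≡-Reasoning
      q : G → ℚ
      q r = sq (count r χ)
      V>0 : 0ℚ < prodV χ q
      V>0 = subst (0ℚ <_) (sym (prodV-count χ q)) (prodF>0 n λ r → sq^>0 (count r χ))
      dense₁ : ∀ r → count r χ ℕ.< n
      dense₁ r = ℕP.*-cancelˡ-< 100 (count r χ) n (ℕP.≤-<-trans (ac r) (ℕP.*-monoˡ-< n (ℕP.≤-refl {100})))
      QR : ∑ gs (λ r → q r * q r) ≤ R * R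
      QR = ℚP.≤-trans (∑-mono gs λ r → sq-upper (count r χ)) (ℚP.≤-trans
          (ℚP.≤-reflexive (trans (∑-count χ (λ _ → κ)) (trans (sumV-κ χ) (ℚP.*-comm (ι n) κ))))
        (ℚP.≤-trans (*-mono {c = κ} nonneg n≤σ²) (≤-by (0≤* (sq≥0 σ) (nonneg {κ * (ℤ.+ 1 / 10000)}))
            (solve 1 (λ s → s :* con (ℤ.+ 10001 / 10000) :* (s :* con (ℤ.+ 10001 / 10000)) := con (ℤ.+ 10001 / 10000) :* (s :* s) :+ s :* s :*
            (con (ℤ.+ 10001 / 10000) :* con (ℤ.+ 1 / 10000))) refl (σ)))))
        where
        sumV-κ : ∀ {m} (v : Vec G m) → sumV v (λ _ → κ) ≡ ι m * κ
        sumV-κ [] = refl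
        sumV-κ {suc m} (x ∷ v) = trans (cong (κ +_) (sumV-κ v)) (solve 2 (λ k κ → κ :+ k :* κ := (con 1ℚ :+ k) :* κ) refl (ι m) κ)

    -- R³/x is about n²/(η b²), and n^n ≤ n! b^n, used twice, turns its n-th power into n!² η^(-n).
    R-bound : ∀ {G₀} → G₀ * x ^ n ≤ fact n * E ^ n → (R ^ n) * (R ^ n) * (R ^ n) * G₀ ≤ fact n * fact n * fact n * ρ ^ n
    R-bound {G₀} hG = cancel-≤ (0<* (^>0 n x>0) (^>0 n bb>0)) (begin
      x ^ n * (b * b) ^ n * (R ^ n * R ^ n * R ^ n * G₀) ≡⟨ (solve 4 (λ u v r G₀ → u :* v :* (r :* r :* r :* G₀) := (v :* (r :* r :* r)) :*
          (G₀ :* u)) refl (x ^ n) ((b * b) ^ n) (R ^ n) G₀) ⟩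
      ((b * b) ^ n * (R ^ n * R ^ n * R ^ n)) * (G₀ * x ^ n) ≤⟨ *-mono (0≤* (ℚP.<⇒≤ (^>0 n bb>0)) (0≤* (0≤* R^≥0 R^≥0) R^≥0)) hG ⟩
      ((b * b) ^ n * (R ^ n * R ^ n * R ^ n)) * (fact n * E ^ n) ≡⟨ trans
          (solve 4 (λ v r f e → (v :* (r :* r :* r)) :* (f :* e) := f :* (v :* (r :* r :* r) :* e)) refl ((b * b) ^ n) (R ^ n) (fact n)
          (E ^ n)) (cong (fact n *_) pows) ⟩
      fact n * ((b * b) * (R * R * R) * E) ^ n ≤⟨ *-mono (fact≥0 n) (^-mono n (0≤* (0≤* (sq≥0 b) (0≤* (0≤* R≥0 R≥0) R≥0)) (nonneg {E})) key) ⟩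
      fact n * (x * ρ * (ι n * ι n)) ^ n ≡⟨ cong (fact n *_) (trans (^-* (x * ρ) (ι n * ι n) n) (cong₂ _*_ (^-* x ρ n) (^-* (ι n) (ι n) n))) ⟩
      fact n * (x ^ n * ρ ^ n * (ι n ^ n * ι n ^ n)) ≤⟨ *-mono (fact≥0 n)
          (*-mono (0≤* (ℚP.<⇒≤ (^>0 n x>0)) (^≥0 n (nonneg {ρ}))) (*-mono₂ (^≥0 n (ι≥0 n)) (0≤* (fact≥0 n) (^≥0 n b≥0))
          (fact-lower n ℕP.≤-refl) (fact-lower n ℕP.≤-refl))) ⟩
      fact n * (x ^ n * ρ ^ n * (fact n * b ^ n * (fact n * b ^ n))) ≡⟨ trans
          (solve 4 (λ f u w c → f :* (u :* w :* (f :* c :* (f :* c))) := u :* (c :* c) :* (f :* f :* f :* w)) refl (fact n) (x ^ n) (ρ ^ n)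
          (b ^ n)) (cong (λ t → x ^ n * t * (fact n * fact n * fact n * ρ ^ n)) (sym (^-* b b n))) ⟩
      x ^ n * (b * b) ^ n * (fact n * fact n * fact n * ρ ^ n) ∎)
      where
      open ℚP.≤-Reasoning
      bb>0 : 0ℚ < b * b
      bb>0 = 0<* (ℚP.<-≤-trans 0<1 b≥1) (ℚP.<-≤-trans 0<1 b≥1)
      R≥0 : 0ℚ ≤ R
      R≥0 = 0≤* σ≥0 (nonneg {κ})
      R^≥0 : 0ℚ ≤ R ^ n
      R^≥0 = ^≥0 n R≥0
      pows : (b * b) ^ n * (R ^ n * R ^ n * R ^ n) * E ^ n ≡ ((b * b) * (R * R * R) * E) ^ n
      pows = sym (trans (^-* ((b * b) * (R * R * R)) E n) (cong (_* E ^ n)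
          (trans (^-* (b * b) (R * R * R) n) (cong ((b * b) ^ n *_) (trans (^-* (R * R) R n) (cong (_* R ^ n) (^-* R R n)))))))
      -- All losses are collected in the numerical inequality κ⁵ E ≤ η ρ; two of the five factors κ
      -- come from bounding σ⁴ by n².
      key : (b * b) * (R * R * R) * E ≤ x * ρ * (ι n * ι n)
      key = cancel-≤ σ>0 (begin
        σ * ((b * b) * (R * R * R) * E) ≡⟨ (solve 2 (λ s b → s :* ((b :* b) :*
            (s :* con (ℤ.+ 10001 / 10000) :* (s :* con (ℤ.+ 10001 / 10000)) :* (s :* con (ℤ.+ 10001 / 10000))) :* con (ℤ.+ 1001 / 1000)) :=
            (b :* b) :* (con (ℤ.+ 10001 / 10000) :* con (ℤ.+ 10001 / 10000) :* con (ℤ.+ 10001 / 10000) :* con (ℤ.+ 1001 / 1000)) :*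
            ((s :* s) :* (s :* s))) refl (σ) b) ⟩
        (b * b) * (κ * κ * κ * E) * ((σ * σ) * (σ * σ)) ≤⟨ *-mono (0≤* (sq≥0 b) (nonneg {κ * κ * κ * E}))
            (*-mono₂ (sq≥0 σ) (0≤* (ι≥0 n) (nonneg {κ})) (sq-upper n) (sq-upper n)) ⟩
        (b * b) * (κ * κ * κ * E) * ((ι n * κ) * (ι n * κ)) ≡⟨ (solve 2 (λ b k → (b :* b) :*
            (con (ℤ.+ 10001 / 10000) :* con (ℤ.+ 10001 / 10000) :* con (ℤ.+ 10001 / 10000) :* con (ℤ.+ 1001 / 1000)) :*
            ((k :* con (ℤ.+ 10001 / 10000)) :* (k :* con (ℤ.+ 10001 / 10000))) := (b :* b) :* (k :* k) :*
            (con (ℤ.+ 10001 / 10000) :* con (ℤ.+ 10001 / 10000) :* con (ℤ.+ 10001 / 10000) :* con (ℤ.+ 1001 / 1000) :*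
            (con (ℤ.+ 10001 / 10000) :* con (ℤ.+ 10001 / 10000)))) refl b (ι n)) ⟩
        (b * b) * (ι n * ι n) * (κ * κ * κ * E * (κ * κ)) ≤⟨ *-mono (0≤* (sq≥0 b) (sq≥0 (ι n)))
            (diff-≤ {κ * κ * κ * E * (κ * κ)} {η * ρ} nonneg) ⟩
        (b * b) * (ι n * ι n) * (η * ρ) ≡⟨ trans (solve 2 (λ b k → (b :* b) :* (k :* k) :* (con (ℤ.+ 401 / 400) :* con (ℤ.+ 1999 / 2000)) :=
            con 1ℚ :* (con (ℤ.+ 401 / 400) :* (b :* b) :* con (ℤ.+ 1999 / 2000) :* (k :* k))) refl b (ι n))
            (cong (_* (η * (b * b) * ρ * (ι n * ι n))) (sym (inv-r σ>0))) ⟩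
        σ * inv σ * (η * (b * b) * ρ * (ι n * ι n)) ≡⟨ (solve 4 (λ s i b k → s :* i :*
            (con (ℤ.+ 401 / 400) :* (b :* b) :* con (ℤ.+ 1999 / 2000) :* (k :* k)) := s :*
            (con (ℤ.+ 401 / 400) :* (b :* b) :* i :* con (ℤ.+ 1999 / 2000) :* (k :* k))) refl (σ) (inv σ) b (ι n)) ⟩
        σ * (x * ρ * (ι n * ι n)) ∎)

    dense-sum : (w : Vec G n → ℚ) → (∀ χ → (w χ ≡ 1ℚ × Active χ) ⊎ (w χ ≡ 0ℚ)) → ∣ ∑ (vecs gs n) (λ χ → w χ * F³ χ) ∣ ≤ fact n * fact n * fact
        n * ρ ^ n
    dense-sum w hw = begin
      ∣ ∑ (vecs gs n) (λ χ → w χ * F³ χ) ∣ ≤⟨ ∑-abs (vecs gs n) _ ⟩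
      ∑ (vecs gs n) (λ χ → ∣ w χ * F³ χ ∣) ≤⟨ ∑-mono (vecs gs n) pt ⟩
      ∑ (vecs gs n) (λ χ → R ^ n * R ^ n * R ^ n * P χ) ≡⟨ ∑-*ˡ (vecs gs n) (R ^ n * R ^ n * R ^ n) P ⟩
      R ^ n * R ^ n * R ^ n * ∑ (vecs gs n) P ≤⟨ R-bound (egf-bound n n g x E g≥0 (ℚP.<⇒≤ x>0) (nonneg {E}) E-bound) ⟩
      fact n * fact n * fact n * ρ ^ n ∎
      where
      open ℚP.≤-Reasoning
      P : Vec G n → ℚ
      P χ = prodF n (λ r → g (count r χ))
      R^≥0 : 0ℚ ≤ R ^ n
      R^≥0 = ^≥0 n (0≤* σ≥0 (nonneg {κ}))
      prod≥0 : ∀ k (f : Fin k → ℚ) → (∀ r → 0ℚ ≤ f r) → 0ℚ ≤ prodF k f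
      prod≥0 zero f h = 0≤1
      prod≥0 (suc k) f h = 0≤* (h zero) (prod≥0 k (f ∘ suc) (h ∘ suc))
      pt : ∀ χ → ∣ w χ * F³ χ ∣ ≤ R ^ n * R ^ n * R ^ n * P χ
      pt χ = pt′ (hw χ)
        where
        pt′ : (w χ ≡ 1ℚ × Active χ) ⊎ (w χ ≡ 0ℚ) → ∣ w χ * F³ χ ∣ ≤ R ^ n * R ^ n * R ^ n * P χ
        H : ℚ
        H = prodF n (λ r → h (count r χ))
        a≥0 : 0ℚ ≤ ∣ F n χ ∣
        a≥0 = ℚP.0≤∣p∣ (F n χ)
        c≥0 : 0ℚ ≤ R ^ n * H
        c≥0 = 0≤* R^≥0 (prod≥0 n _ λ r → h≥0 (count r χ))
        pt′ (inj₂ e) = ℚP.≤-trans (ℚP.≤-reflexive (cong ∣_∣ (trans (cong (_* F³ χ) e) (ℚP.*-zeroˡ (F³ χ)))))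
            (0≤* (0≤* (0≤* R^≥0 R^≥0) R^≥0) (prod≥0 n _ λ r → g≥0 (count r χ)))
        pt′ (inj₁ (e , ac)) = begin
          ∣ w χ * F³ χ ∣ ≡⟨ trans (cong ∣_∣ (trans (cong (_* F³ χ) e) (ℚP.*-identityˡ (F³ χ))))
              (trans (∣∣-* (F n χ * F n χ) (F n χ)) (cong (_* ∣ F n χ ∣) (∣∣-* (F n χ) (F n χ)))) ⟩
          ∣ F n χ ∣ * ∣ F n χ ∣ * ∣ F n χ ∣ ≤⟨ *-mono₂ (0≤* a≥0 a≥0) c≥0 (*-mono₂ a≥0 c≥0 (F-active χ ac) (F-active χ ac)) (F-active χ ac) ⟩
          (R ^ n * H) * (R ^ n * H) * (R ^ n * H) ≡⟨ (solve 2 (λ r H → (r :* H) :* (r :* H) :* (r :* H) := r :* r :* r :* (H :* H :* H)) refl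
              (R ^ n) H) ⟩
          R ^ n * R ^ n * R ^ n * (H * H * H) ≡⟨ cong (R ^ n * R ^ n * R ^ n *_)
              (trans (prodF-cube (λ r → h (count r χ))) (prodF-cong n λ r → sym (g-active (count r χ) (ac r)))) ⟩
          R ^ n * R ^ n * R ^ n * P χ ∎

  -- Assembly of the sparse and dense estimates

  fact-! : ∀ k → ι (k !) ≡ fact k
  fact-! zero = refl
  fact-! (suc k) = trans (ι-* (suc k) (k !)) (cong (ι (suc k) *_) (fact-! k))

  -- r + r = 0 gives n ∣ 2r, and n r - h · 2r = r because n = 2h + 1.
  odd⇒Odd : ∀ p h → suc p ≡ suc (2 ℕ.* h) → Odd p
  odd⇒Odd p h eq r e = go (toℕ r) refl
    where
    open Group p
    go : ∀ k → toℕ r ≡ k → r ≡ zero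
    go zero er = FinP.toℕ-injective er
    go (suc j) er = ⊥-elim (ℕP.<-irrefl refl (ℕP.≤-<-trans (∣P.∣⇒≤ d) (subst (ℕ._< suc p) er (FinP.toℕ<n r))))
      where
      2r : n ∣ 2 ℕ.* suc j
      2r = subst (λ t → n ∣ 2 ℕ.* t) er (∣P.m%n≡0⇒n∣m _ n (trans (cong (λ t → (toℕ r ℕ.+ t) % n) (ℕP.+-identityʳ (toℕ r)))
          (trans (sym (toℕ-⊞ r r)) (cong toℕ e))))
      d : n ∣ suc j
      d = ∣P.∣m+n∣m⇒∣n {m = h ℕ.* (2 ℕ.* suc j)} (subst (n ∣_) (trans (cong (ℕ._* suc j) eq)
          (solveℕ 2 (λ h j → (conℕ 1 ∔ conℕ 2 ⨯ h) ⨯ j ≐ h ⨯ (conℕ 2 ⨯ j) ∔ j) refl h (suc j))) (∣P.m∣m*n (suc j))) (∣P.∣n⇒∣m*n h 2r)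

  -- The difference times n · n!³ is exactly the dense sum, and the factor n ≥ 1 is dropped. Since
  -- m₀ is the integer part of n/100, n ≤ 100(m₀ + 1), which puts every count of a dense χ below the
  -- cut 99n/100.
  ratio-split : ∀ p d (d-large : (ℤ.+ 30000 / 1) ≤ ι d) → C₀ ≤ Roots.sq d d-large (suc p) → ∀ h → suc p ≡ suc (2 ℕ.* h) →
    ∣ ratio (suc p) - ∑< (suc (suc p ℕ./ 100)) (Sparse.T p) ∣ ≤ (ℤ.+ 1999 / 2000) ^ suc p
  ratio-split p d d-large n-large h n-odd = cancel-≤ f³>0 (begin
    f³ * ∣ ratio n - ΣT ∣ ≡⟨ sym (∣∣-*-nonNegˡ (ratio n - ΣT) (ℚP.<⇒≤ f³>0)) ⟩
    ∣ f³ * (ratio n - ΣT) ∣ ≤⟨ ℚP.≤-trans (ℚP.≤-reflexive (sym (ℚP.*-identityˡ _))) (*-monoʳ (ℚP.0≤∣p∣ (f³ * (ratio n - ΣT))) nQ≥1) ⟩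
    nQ * ∣ f³ * (ratio n - ΣT) ∣ ≡⟨ trans (sym (∣∣-*-nonNegˡ (f³ * (ratio n - ΣT)) nQ≥0)) (cong ∣_∣ eq) ⟩
    ∣ D ∣ ≤⟨ DenseSum.dense-sum p d d-large n-large dense cases ⟩
    f³ * (ℤ.+ 1999 / 2000) ^ n ∎)
    where
    open ℚP.≤-Reasoning
    open Group p
    open Sparse p using (nQ≥0; nQ>0; ι≤nQ; T)
    open Identity p
    m₀ : ℕ
    m₀ = n ℕ./ 100
    small : m₀ ℕ.+ m₀ ℕ.< n
    small = go m₀ (ℕP.≤-trans (ℕP.≤-reflexive (ℕP.*-comm 100 m₀)) (DM.m/n*n≤m n 100))
      where
      go : ∀ q → 100 ℕ.* q ℕ.≤ n → q ℕ.+ q ℕ.< n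
      go zero _ = s≤s z≤n
      go (suc q) le = ℕP.<-≤-trans (ℕP.≤-trans (ℕP.m≤m+n (suc (suc q ℕ.+ suc q)) (97 ℕ.+ 98 ℕ.* q))
          (ℕP.≤-reflexive (solveℕ 1 (λ q → (conℕ 1 ∔ ((conℕ 1 ∔ q) ∔ (conℕ 1 ∔ q))) ∔ (conℕ 97 ∔ conℕ 98 ⨯ q) ≐ conℕ 100 ⨯ (conℕ 1 ∔ q)) refl
          q))) le
    open Split h n-odd m₀ small
    ΣT D f³ : ℚ
    ΣT = ∑< (suc m₀) T
    D = ∑ (vecs gs n) (λ χ → dense χ * F³ χ)
    f³ = fact n * fact n * fact n
    f³>0 : 0ℚ < f³
    f³>0 = 0<* (0<* (fact>0 n) (fact>0 n)) (fact>0 n)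
    nQ≥1 : 1ℚ ≤ nQ
    nQ≥1 = ι≤nQ {1} (s≤s z≤n)
    cases : ∀ χ → (dense χ ≡ 1ℚ × (∀ r → 100 ℕ.* count r χ ℕ.≤ 99 ℕ.* n)) ⊎ (dense χ ≡ 0ℚ)
    cases χ = Sum.map (λ (e , dχ) → e , λ r → ℕP.+-cancelʳ-≤ n _ _ (ℕP.≤-trans (ℕP.+-monoʳ-≤ (100 ℕ.* count r χ) n<)
        (ℕP.≤-trans (ℕP.≤-reflexive (re (count r χ))) (ℕP.≤-trans (ℕP.*-monoʳ-≤ 100 (dχ r))
        (ℕP.≤-reflexive (solveℕ 1 (λ n → conℕ 100 ⨯ n ≐ conℕ 99 ⨯ n ∔ n) refl n)))))) (λ e → e) (dense-cases χ)
      where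
      n< : n ℕ.≤ 100 ℕ.* suc m₀
      n< = ℕP.≤-trans (ℕP.≤-reflexive (DM.m≡m%n+[m/n]*n n 100)) (ℕP.≤-trans (ℕP.+-monoˡ-≤ (m₀ ℕ.* 100) (ℕP.<⇒≤ (m%n<n n 100)))
          (ℕP.≤-reflexive (ℕP.*-comm (suc m₀) 100)))
      re : ∀ c → 100 ℕ.* c ℕ.+ 100 ℕ.* suc m₀ ≡ 100 ℕ.* suc (c ℕ.+ m₀)
      re c = solveℕ 2 (λ c m → conℕ 100 ⨯ c ∔ conℕ 100 ⨯ (conℕ 1 ∔ m) ≐ conℕ 100 ⨯ (conℕ 1 ∔ (c ∔ m))) refl c m₀
    ratio-eq : f³ * ratio n ≡ nQ ^ p * ι (s n)
    ratio-eq = trans (cong (_* ratio n) (sym (trans (ι-^ (n !) 3) (trans (cong (_^ 3) (fact-! n))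
        (solve 1 (λ f → f :* (f :* (f :* con 1ℚ)) := f :* f :* f) refl (fact n))))))
      (trans (/-* (ℤ.+ (s n ℕ.* n ℕ.^ p)) ((n !) ℕ.^ 3) {{ℕP.m^n≢0 (n !) 3 {{n ℕP.!≢0}}}})
          (trans (sym (ι-/1 (s n ℕ.* n ℕ.^ p))) (trans (ι-* (s n) (n ℕ.^ p))
          (trans (cong (ι (s n) *_) (trans (ι-^ n p) (cong (_^ p) (sym nQ-ι)))) (ℚP.*-comm (ι (s n)) (nQ ^ p))))))
    eq : nQ * (f³ * (ratio n - ΣT)) ≡ D
    eq = begin-equality
      nQ * (f³ * (ratio n - ΣT)) ≡⟨ (solve 4 (λ c f r t → c :* (f :* (r :- t)) := c :* (f :* r) :- c :* (f :* t)) refl (nQ) (f³) (ratio n)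
          (ΣT)) ⟩
      nQ * (f³ * ratio n) - nQ * (f³ * ΣT) ≡⟨ cong (λ u → nQ * u - nQ * (f³ * ΣT)) ratio-eq ⟩
      nQ * (nQ ^ p * ι (s n)) - nQ * (f³ * ΣT) ≡⟨ cong (λ u → u - nQ * (f³ * ΣT)) (trans (sym (ℚP.*-assoc nQ (nQ ^ p) (ι (s n)))) ∑F³-split) ⟩
      (nQ * (fact n ^ 3 * ΣT) + D) - nQ * (f³ * ΣT) ≡⟨ (solve 4 (λ c f t D → (c :* (f :* (f :* (f :* con 1ℚ)) :* t) :+ D) :- c :*
          (f :* f :* f :* t) := D) refl (nQ) (fact n) (ΣT) D) ⟩
      D ∎

  -- Abstracting over the witnesses keeps the type checker from evaluating ι at the huge numbers found by archimedes.
  combine : ∀ {ε γ} → 0ℚ < γ → (γ + γ) + (γ + γ) ≡ ε →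
    ∃[ N ] (∀ p m → N ℕ.≤ p → N ℕ.≤ m → Odd p → ∣ ∑< (suc (suc p ℕ./ 100)) (Sparse.T p) - expPartial m ∣ ≤ γ) →
    ∃[ N ] (∀ a → N ℕ.≤ a → 1ℚ * (ℤ.+ 1999 / 2000) ^ a ≤ γ) →
    ∃[ d ] (ℤ.+ 30000 / 1) ≤ ι d → ∃[ N ] C₀ * C₀ ≤ ι N →
    ∃[ N ] ((n m : ℕ) → N ℕ.≤ n → N ℕ.≤ m → n ℕ.% 2 ≡ 1 → ∣ ratio n - expPartial m ∣ < ε)
  combine {ε} {γ} γ>0 4γ (N₁ , sparse) (N₂ , pow) (d , d-large) (N₃ , big) = N , bound
    where
    N : ℕ
    N = suc (N₁ ℕ.+ (N₂ ℕ.+ N₃))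
    bound : (n m : ℕ) → N ℕ.≤ n → N ℕ.≤ m → n ℕ.% 2 ≡ 1 → ∣ ratio n - expPartial m ∣ < ε
    bound (suc p) m (s≤s Np) Nm odd = ℚP.≤-<-trans (begin
      ∣ ratio n - expPartial m ∣ ≡⟨ cong ∣_∣ (solve 3 (λ a b c → a :- c := (a :- b) :+ (b :- c)) refl (ratio n)
          (∑< (suc (n ℕ./ 100)) (Sparse.T p)) (expPartial m)) ⟩
      ∣ (ratio n - ∑< (suc (n ℕ./ 100)) (Sparse.T p)) + (∑< (suc (n ℕ./ 100)) (Sparse.T p) - expPartial m) ∣
        ≤⟨ ℚP.≤-trans (ℚP.∣p+q∣≤∣p∣+∣q∣ (ratio n - ∑< (suc (n ℕ./ 100)) (Sparse.T p)) (∑< (suc (n ℕ./ 100)) (Sparse.T p) - expPartial m))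
            (ℚP.+-mono-≤ b₁ b₂) ⟩
      γ + γ ∎) (subst₂ _<_ refl 4γ
        (subst (_< (γ + γ) + (γ + γ)) (ℚP.+-identityʳ (γ + γ)) (ℚP.+-monoʳ-< (γ + γ) (0<+ γ>0 (ℚP.<⇒≤ γ>0)))))
      where
      open ℚP.≤-Reasoning
      n : ℕ
      n = suc p
      h : ℕ
      h = n ℕ./ 2
      n-odd : n ≡ suc (2 ℕ.* h)
      n-odd = trans (DM.m≡m%n+[m/n]*n n 2) (cong₂ ℕ._+_ odd (ℕP.*-comm h 2))
      large : C₀ ≤ Roots.sq d (d-large) n
      large = sq-≤ (Roots.sq≥0′ d (d-large) n) (ℚP.≤-trans (big) (ℚP.≤-trans
          (ι-mono (ℕP.≤-trans (ℕP.m≤n+m (N₃) (N₂)) (ℕP.≤-trans (ℕP.m≤n+m _ (N₁)) (ℕP.≤-trans Np (ℕP.n≤1+n p)))))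
          (Roots.sq-lower d (d-large) n)))
      b₁ : ∣ ratio n - ∑< (suc (n ℕ./ 100)) (Sparse.T p) ∣ ≤ γ
      b₁ = ℚP.≤-trans (ratio-split p d (d-large) large h n-odd) (ℚP.≤-trans (ℚP.≤-reflexive (sym (ℚP.*-identityˡ ((ℤ.+ 1999 / 2000) ^ n))))
        (pow n (ℕP.≤-trans (ℕP.m≤m+n (N₂) (N₃)) (ℕP.≤-trans (ℕP.m≤n+m _ (N₁)) (ℕP.≤-trans Np (ℕP.n≤1+n p))))))
      b₂ : ∣ ∑< (suc (n ℕ./ 100)) (Sparse.T p) - expPartial m ∣ ≤ γ
      b₂ = sparse p m (ℕP.≤-trans (ℕP.m≤m+n (N₁) _) Np) (ℕP.≤-trans (ℕP.m≤m+n (N₁) _) (ℕP.≤-trans (ℕP.n≤1+n _) Nm)) (odd⇒Odd p h n-odd)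

  theorem : (ε : ℚ) → 0ℚ < ε → ∃[ N ] ((n m : ℕ) → N ℕ.≤ n → N ℕ.≤ m → n ℕ.% 2 ≡ 1 → ∣ ratio n - expPartial m ∣ < ε)
  theorem ε ε>0 = combine γ>0 (solve 1 (λ ε → (con (ℤ.+ 1 / 4) :* ε :+ con (ℤ.+ 1 / 4) :* ε) :+ (con (ℤ.+ 1 / 4) :* ε :+ con (ℤ.+ 1 / 4) :* ε)
      := ε) refl ε) (sparse-limit γ γ>0)
    (pow-small {ℤ.+ 1999 / 2000} {ℤ.+ 1 / 2000} (nonneg {ℤ.+ 1999 / 2000}) (ℚP.positive⁻¹ (ℤ.+ 1 / 2000)) (diff-≤ nonneg) 1ℚ γ γ>0)
    (archimedes (ℤ.+ 30000 / 1)) (archimedes (C₀ * C₀))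
    where
    γ : ℚ
    -- Two errors of at most ε/4 leave room for the strict inequality.
    γ = (ℤ.+ 1 / 4) * ε
    γ>0 : 0ℚ < γ
    γ>0 = 0<* (ℚP.positive⁻¹ (ℤ.+ 1 / 4)) ε>0

open import Defs
open import Data.Nat using (ℕ; _≤_; _%_)
open import Data.Product using (∃-syntax)
open import Data.Rational using (ℚ; 0ℚ; _<_; _-_; ∣_∣)
open import Relation.Binary.PropositionalEquality using (_≡_)

theorem1p2 : (ε : ℚ) → 0ℚ < ε →
    ∃[ N ] ((n m : ℕ) → N ≤ n → N ≤ m → n % 2 ≡ 1 →
    ∣ ratio n - expPartial m ∣ < ε)
theorem1p2 = Proof.theorem
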